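{- Put $\alpha=1.230175$ and $\beta=\frac{\log 3}{\log 2}-1$, so that $(1+\beta)/2\approx0.792481$. For a suitable choice of its parameters, the space-improved algorithm (described in the context) computes $\Vert n\Vert$ for all $n\le N$ in time $O(N^{\alpha})$ using $O(N^{(1+\beta)/2}\log\log N)$ bits of storage.
   Context: For a positive integer $n$, the complexity $\Vert n\Vert$ is the least number of $1$'s needed to express $n$ using only $+$, $\times$ and parentheses. Time is the number of elementary operations (arithmetic operations and comparisons on integers, reads and writes of array entries). The algorithm computes the values $\Vert n\Vert$, $n\le N$, successively in increasing order; they need not all be stored simultaneously, and values no longer needed are discarded. The function $E$: $E(0)=1$, $E(1)=1$, and for $j\ge1$: $E(3j)=3^j$, $E(3j+1)=4\cdot3^{j-1}$, $E(3j-1)=2\cdot3^{j-1}$. For $n\ge2$ the number $\mathrm{kMax}=\mathrm{kMax}(n)$ is obtained as follows: put $T=\Vert n-1\Vert$, $t=\lfloor T/2\rfloor$; while $E(t)+E(T-t)<n$, replace $t$ by $t-1$; when the loop stops put $\mathrm{kMax}=E(t)$. Time-improved algorithm (used as a subroutine), with input $M$. An array $\mathrm{Compl}[1..M]$ is initialized with all entries equal to $\lfloor 3\log M/\log 2\rfloor+1$, except $\mathrm{Compl}[1]=1$. For $n=2,\dots,M$ in increasing order: replace $\mathrm{Compl}[n]$ by $\min(\mathrm{Compl}[n],\mathrm{Compl}[n-1]+1)$; compute $\mathrm{kMax}(n)$; for $6\le m\le\mathrm{kMax}(n)$ replace $\mathrm{Compl}[n]$ by $\min(\mathrm{Compl}[n],\mathrm{Compl}[m]+\mathrm{Compl}[n-m])$;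 for $2\le k\le\min(n,\lfloor M/n\rfloor)$ replace $\mathrm{Compl}[kn]$ by $\min(\mathrm{Compl}[kn],\mathrm{Compl}[k]+\mathrm{Compl}[n])$. Space-improved algorithm. Parameters: positive integers $N,H,\ell$ and $L=2\ell$ satisfying $$\mathrm{kMax}(n)<\ell\ (\text{for all } n\le N),\quad N\le \ell H,\quad \ell\mid H,\quad \ell\mid N,\quad H\ge\sqrt{LN};$$ if needed, $N$ may be increased a little so that these conditions can be met. A fixed block $B_0$ stores $\Vert n\Vert$ for $1\le n\le H$ and is computed with the time-improved algorithm. Running blocks $B_j$ ($j\ge1$), each of length $L$, store $\Vert n\Vert$ for $H_j-L<n\le H_j$. When a running block $B_j$ is initialized, one sets $H_j=H$ and copies its entries from $B_0$. At the start $B_1$ is initialized. Main loop: while $H_1<N$, set $h=\min(H_1+\ell,N)$ and, for $j=\lceil h/H\rceil-1,\dots,2,1$ in descending order: put $\mathrm{newH}=\ell\lceil h/(j\ell)\rceil$; if $B_j$ is not initialized and $\mathrm{newH}>H$, initialize it; then if $H_j<\mathrm{newH}$, shift $B_j$ (increase $H_j$ by $\ell$, copy the upper half of the old block into the lower half of the new one, and set the $\ell$ new entries to an upper bound of order $\log N$ for the complexities) and compute its new entries as follows. (i) Products: for all integers $2\le a\le b$ with $H_j-\ell<ab\le H_j$, read $\Vert a\Vert$ from $B_0$, read $\Vert b\Vert$ from $B_0$ if $\lfloor H_j/a\rfloor\le H$ and from $B_{aj}$ otherwise, and replace the entry for $ab$ by $\Vert a\Vert+\Vert b\Vert$ if this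 is smaller. (ii) Sums: for each $n$ with $H_j-\ell<n\le H_j$ in ascending order, replace the entry for $n$ by $\Vert n-1\Vert+1$ if this is smaller; compute $\mathrm{kMax}(n)$; for each $6\le k\le\mathrm{kMax}(n)$, read $\Vert k\Vert$ from $B_0$ and $\Vert n-k\Vert$ from $B_j$ and replace the entry for $n$ by $\Vert k\Vert+\Vert n-k\Vert$ if this is smaller. -}

module Defs where

open import Data.Bool.Base using (Bool; true; false; if_then_else_; _∧_)
open import Data.Fin using (Fin; #_)
open import Data.List.Base using (List; []; _∷_; _∷ʳ_; map; upTo)
open import Data.List.Relation.Unary.All using (All)
open import Data.Maybe.Base using (Maybe; just; nothing; _>>=_)
open import Data.Nat.Base
open import Data.Nat.DivMod using (_/_; _%_)
open import Data.Nat.Divisibility using (_∣_)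
open import Data.Product.Base using (_×_; _,_; proj₁; ∃; uncurry)
open import Data.Vec.Base using (Vec; lookup; replicate; _[_]≔_)
open import Relation.Binary.PropositionalEquality using (_≡_)

------------------------------------------------------------------------
-- Integer complexity

infixl 6 _⊞_
infixl 7 _⊠_

data Formula : Set where
  𝟙       : Formula
  _⊞_ _⊠_ : Formula → Formula → Formula

value : Formula → ℕ
value 𝟙       = 1
value (f ⊞ g) = value f + value g
value (f ⊠ g) = value f * value g

ones : Formula → ℕ
ones 𝟙       = 1
ones (f ⊞ g) = ones f + ones g
ones (f ⊠ g) = ones f + ones g

-- ‖ n ‖≡ c  states that c is the complexity of n.

‖_‖≡_ : ℕ → ℕ → Set
‖ n ‖≡ c = ∃ (λ f → value f ≡ n × ones f ≡ c)
         × (∀ f → value f ≡ n → c ≤ ones f)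

------------------------------------------------------------------------
-- E and kMax

-- In the last clause of byRemainder the index is 3j−1 = 3(j−1)+2, so its quotient by 3
-- is already j−1.

byRemainder : ℕ → ℕ → ℕ
byRemainder zero    0 = 1
byRemainder zero    1 = 1
byRemainder (suc j) 0 = 3 ^ suc j
byRemainder (suc j) 1 = 4 * 3 ^ j
byRemainder j       _ = 2 * 3 ^ j

E : ℕ → ℕ
E i = byRemainder (i / 3) (i % 3)

-- kMax n T is kMax(n) when T = ‖n−1‖.  In that case the search stops by
-- itself at the latest at t = 0, because E(T) is the largest integer of
-- complexity T, so E 0 + E T ≥ n.

search : ℕ → ℕ → ℕ → ℕ
search n T zero    = zero
search n T (suc t) =
  if E (suc t) + E (T ∸ suc t) <ᵇ n then search n T t else suc t

kMax : ℕ → ℕ → ℕ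
kMax n T = E (search n T (T / 2))

------------------------------------------------------------------------
-- Parameters of the space-improved algorithm

record Admissible (N H ℓ : ℕ) : Set where
  field
    N-positive : 1 ≤ N
    H-positive : 1 ≤ H
    ℓ-positive : 1 ≤ ℓ
    kMax<ℓ     : ∀ n T → 2 ≤ n → n ≤ N → ‖ n ∸ 1 ‖≡ T → kMax n T < ℓ
    N≤ℓH       : N ≤ ℓ * H
    ℓ∣H        : ℓ ∣ H
    ℓ∣N        : ℓ ∣ N
    LN≤H²      : (2 * ℓ) * N ≤ H * H

------------------------------------------------------------------------
-- A register machine with arrays

-- Arrays come in two families, each indexed by natural numbers: block j is
-- the block B_j, and top 0 is the array whose j-th entry is H_j.  The
-- entries of an array are numbered from 1.

data Family : Set where
  block top : Family

_==_ : Family → Family → Bool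
block == block = true
top   == top   = true
_     == _     = false

#registers : ℕ
#registers = 25

Register : Set
Register = Fin #registers

-- Every register and every entry of the family top has wordSize bits;
-- every entry of a block has entrySize bits.

record Machine : Set where
  field
    wordSize  : ℕ
    entrySize : ℕ

  width : Family → ℕ
  width block = entrySize
  width top   = wordSize

infix  10 !_
infix  9 _[_][_]
infixl 7 _⊗_ _⊘_
infixl 6 _⊕_ _⊖_
infix  5 _≼_ _≺_ _≐_
infix  4 _≔_ _[_][_]≔_
infixr 3 _⨟_

-- ⊖ is truncated subtraction and ⊘ is the quotient rounded down.

data Expr : Set where
  lit             : ℕ → Expr
  !_              : Register → Expr
  _[_][_]         : Family → Expr → Expr → Expr
  _⊕_ _⊖_ _⊗_ _⊘_ : Expr → Expr → Expr

data Test : Set where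
  _≼_ _≺_ _≐_ : Expr → Expr → Test

data Program : Set where
  skip      : Program
  _≔_       : Register → Expr → Program
  _[_][_]≔_ : Family → Expr → Expr → Expr → Program
  allocate  : Family → Expr → Expr → Program
  emit      : Expr → Expr → Program
  _⨟_       : Program → Program → Program
  branch    : Test → Program → Program → Program
  while     : Test → Program → Program

-- cell f j i is nothing when the entry has not been written yet; size f j is
-- 0 when the array has not been allocated; allocated is the total number of
-- bits in the allocated arrays; emitted is the list of results in the order
-- in which they were produced.

record State : Set where
  constructor mkState
  field
    registers : Vec ℕ #registers
    cell      : Family → ℕ → ℕ → Maybe ℕ
    size      : Family → ℕ → ℕ
    allocated : ℕ
    emitted   : List (ℕ × ℕ)

open State public

initial : State
initial = mkState (replicate #registers 0) (λ _ _ _ → nothing) (λ _ _ → 0) 0 []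

setRegister : Register → ℕ → State → State
setRegister r v σ = record σ { registers = registers σ [ r ]≔ v }

setCell : Family → ℕ → ℕ → ℕ → State → State
setCell f j i v σ = record σ { cell = λ f′ j′ i′ →
  if f == f′ ∧ (j ≡ᵇ j′) ∧ (i ≡ᵇ i′) then just v else cell σ f′ j′ i′ }

newArray : Machine → Family → ℕ → ℕ → State → State
newArray m f j len σ = record σ
  { size      = λ f′ j′ → if f == f′ ∧ (j ≡ᵇ j′) then len else size σ f′ j′
  ; allocated = allocated σ + len * Machine.width m f
  }

addResult : ℕ → ℕ → State → State
addResult n c σ = record σ { emitted = emitted σ ∷ʳ (n , c) }

-- Arrays are never deallocated, so the storage in use never decreases and
-- its value at the end of a run is its maximum during the run.

storage : Machine → State → ℕ
storage m σ = #registers * Machine.wordSize m + allocated σ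

quotient : ℕ → ℕ → Maybe ℕ
quotient a zero    = nothing
quotient a (suc b) = just (a / suc b)

eval : State → Expr → Maybe ℕ
eval σ (lit a)       = just a
eval σ (! r)         = just (lookup (registers σ) r)
eval σ (f [ d ][ e ]) = eval σ d >>= λ j → eval σ e >>= λ i → cell σ f j i
eval σ (d ⊕ e)       = eval σ d >>= λ a → eval σ e >>= λ b → just (a + b)
eval σ (d ⊖ e)       = eval σ d >>= λ a → eval σ e >>= λ b → just (a ∸ b)
eval σ (d ⊗ e)       = eval σ d >>= λ a → eval σ e >>= λ b → just (a * b)
eval σ (d ⊘ e)       = eval σ d >>= λ a → eval σ e >>= λ b → quotient a b

test : State → Test → Maybe Bool
test σ (d ≼ e) = eval σ d >>= λ a → eval σ e >>= λ b → just (a ≤ᵇ b)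
test σ (d ≺ e) = eval σ d >>= λ a → eval σ e >>= λ b → just (a <ᵇ b)
test σ (d ≐ e) = eval σ d >>= λ a → eval σ e >>= λ b → just (a ≡ᵇ b)

-- The cost counts every node, including literals and register accesses.

cost : Expr → ℕ
cost (lit _)        = 1
cost (! _)          = 1
cost (_ [ d ][ e ]) = 1 + cost d + cost e
cost (d ⊕ e)        = 1 + cost d + cost e
cost (d ⊖ e)        = 1 + cost d + cost e
cost (d ⊗ e)        = 1 + cost d + cost e
cost (d ⊘ e)        = 1 + cost d + cost e

costᵗ : Test → ℕ
costᵗ (d ≼ e) = 1 + cost d + cost e
costᵗ (d ≺ e) = 1 + cost d + cost e
costᵗ (d ≐ e) = 1 + cost d + cost e

-- m ⊢⟨ p , σ ⟩⇓⟨ σ′ , t ⟩  states that p, started in σ, terminates in σ′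
-- after t elementary operations.  There is no such σ′ if the run reads an
-- unwritten entry, writes outside an array, divides by zero, allocates an
-- array twice, or stores an integer that is too large for its place.

data _⊢⟨_,_⟩⇓⟨_,_⟩ (m : Machine) : Program → State → State → ℕ → Set where

  run-skip : ∀ {σ} →
    m ⊢⟨ skip , σ ⟩⇓⟨ σ , 1 ⟩

  run-≔ : ∀ {σ r e v} →
    eval σ e ≡ just v → v < 2 ^ Machine.wordSize m →
    m ⊢⟨ r ≔ e , σ ⟩⇓⟨ setRegister r v σ , 1 + cost e ⟩

  run-[]≔ : ∀ {σ f c d e j i v} →
    eval σ c ≡ just j → eval σ d ≡ just i → eval σ e ≡ just v →
    1 ≤ i → i ≤ size σ f j → v < 2 ^ Machine.width m f →
    m ⊢⟨ f [ c ][ d ]≔ e , σ ⟩⇓⟨ setCell f j i v σ , 1 + cost c + cost d + cost e ⟩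

  run-allocate : ∀ {σ f d e j len} →
    eval σ d ≡ just j → eval σ e ≡ just len → size σ f j ≡ 0 →
    m ⊢⟨ allocate f d e , σ ⟩⇓⟨ newArray m f j len σ , 1 + cost d + cost e ⟩

  run-emit : ∀ {σ d e n c} →
    eval σ d ≡ just n → eval σ e ≡ just c →
    m ⊢⟨ emit d e , σ ⟩⇓⟨ addResult n c σ , 1 + cost d + cost e ⟩

  run-⨟ : ∀ {σ σ′ σ″ p q t u} →
    m ⊢⟨ p , σ ⟩⇓⟨ σ′ , t ⟩ → m ⊢⟨ q , σ′ ⟩⇓⟨ σ″ , u ⟩ →
    m ⊢⟨ p ⨟ q , σ ⟩⇓⟨ σ″ , t + u ⟩

  run-branch-true : ∀ {σ σ′ b p q t} →
    test σ b ≡ just true → m ⊢⟨ p , σ ⟩⇓⟨ σ′ , t ⟩ →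
    m ⊢⟨ branch b p q , σ ⟩⇓⟨ σ′ , costᵗ b + t ⟩

  run-branch-false : ∀ {σ σ′ b p q t} →
    test σ b ≡ just false → m ⊢⟨ q , σ ⟩⇓⟨ σ′ , t ⟩ →
    m ⊢⟨ branch b p q , σ ⟩⇓⟨ σ′ , costᵗ b + t ⟩

  run-while-true : ∀ {σ σ′ σ″ b p t u} →
    test σ b ≡ just true →
    m ⊢⟨ p , σ ⟩⇓⟨ σ′ , t ⟩ → m ⊢⟨ while b p , σ′ ⟩⇓⟨ σ″ , u ⟩ →
    m ⊢⟨ while b p , σ ⟩⇓⟨ σ″ , costᵗ b + t + u ⟩

  run-while-false : ∀ {σ b p} →
    test σ b ≡ just false →
    m ⊢⟨ while b p , σ ⟩⇓⟨ σ , costᵗ b ⟩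

------------------------------------------------------------------------
-- The space-improved algorithm

module Registers where
  N H ℓ L M n T t u e₁ e₂ s κ k v i bound h j newH Hⱼ a b q y : Register
  N     = # 0
  H     = # 1
  ℓ     = # 2
  L     = # 3
  M     = # 4
  n     = # 5
  T     = # 6
  t     = # 7
  u     = # 8
  e₁    = # 9
  e₂    = # 10
  s     = # 11
  κ     = # 12
  k     = # 13
  v     = # 14
  i     = # 15
  bound = # 16
  h     = # 17
  j     = # 18
  newH  = # 19
  Hⱼ    = # 20
  a     = # 21
  b     = # 22
  q     = # 23
  y     = # 24

open Registers

ceilDiv : Expr → Expr → Expr
ceilDiv d e = (d ⊕ e ⊖ lit 1) ⊘ e

when : Test → Program → Program
when c p = branch c p skip

forUp : Register → Expr → Expr → Program → Program
forUp x from to p = x ≔ from ⨟ while (! x ≼ to) (p ⨟ x ≔ ! x ⊕ lit 1)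

forDown : Register → Expr → Expr → Program → Program
forDown x from to p = x ≔ from ⨟ while (to ≼ ! x) (p ⨟ x ≔ ! x ⊖ lit 1)

-- Replace an entry by the value of an expression if that is smaller.

lower : Expr → Expr → Expr → Program
lower c d e = v ≔ e ⨟ when (! v ≺ block [ c ][ d ]) (block [ c ][ d ]≔ ! v)

-- bound := ⌊3 log x / log 2⌋ + 1, since ⌊3 log x / log 2⌋ = ⌊log₂ x³⌋.

computeBound : Register → Program
computeBound x =
  y ≔ ! x ⊗ ! x ⊗ ! x ⨟
  bound ≔ lit 1 ⨟
  while (lit 2 ≼ ! y)
    ( y ≔ ! y ⊘ lit 2 ⨟
      bound ≔ ! bound ⊕ lit 1 )

-- dst := E(src), from E(x) = 3 E(x−3) for x ≥ 5, E(0) = 1 and E(x) = x for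
-- 1 ≤ x ≤ 4.

computeE : Register → Register → Program
computeE dst src =
  s ≔ ! src ⨟
  dst ≔ lit 1 ⨟
  while (lit 5 ≼ ! s)
    ( s ≔ ! s ⊖ lit 3 ⨟
      dst ≔ lit 3 ⊗ ! dst ) ⨟
  when (lit 1 ≼ ! s)
    ( dst ≔ ! dst ⊗ ! s )

computeSummands : Program
computeSummands = u ≔ ! T ⊖ ! t ⨟ computeE e₁ t ⨟ computeE e₂ u

-- κ := kMax(n), provided that T holds ‖n−1‖.

computeKMax : Program
computeKMax =
  t ≔ ! T ⊘ lit 2 ⨟
  computeSummands ⨟
  while (! e₁ ⊕ ! e₂ ≺ ! n)
    ( t ≔ ! t ⊖ lit 1 ⨟
      computeSummands ) ⨟
  κ ≔ ! e₁

-- The time-improved algorithm with input M; its array Compl is the block B₀.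

timeImproved : Program
timeImproved =
  allocate block (lit 0) (! M) ⨟
  computeBound M ⨟
  forUp i (lit 1) (! M)
    ( block [ lit 0 ][ ! i ]≔ ! bound ) ⨟
  block [ lit 0 ][ lit 1 ]≔ lit 1 ⨟
  emit (lit 1) (block [ lit 0 ][ lit 1 ]) ⨟
  forUp n (lit 2) (! M)
    ( lower (lit 0) (! n) (block [ lit 0 ][ ! n ⊖ lit 1 ] ⊕ lit 1) ⨟
      T ≔ block [ lit 0 ][ ! n ⊖ lit 1 ] ⨟
      computeKMax ⨟
      forUp k (lit 6) (! κ)
        ( lower (lit 0) (! n)
            (block [ lit 0 ][ ! k ] ⊕ block [ lit 0 ][ ! n ⊖ ! k ]) ) ⨟
      emit (! n) (block [ lit 0 ][ ! n ]) ⨟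
      q ≔ ! M ⊘ ! n ⨟
      when (! n ≺ ! q) (q ≔ ! n) ⨟
      forUp k (lit 2) (! q)
        ( lower (lit 0) (! k ⊗ ! n)
            (block [ lit 0 ][ ! k ] ⊕ block [ lit 0 ][ ! n ]) ) )

-- H_x; the value 0 means that B_x is not initialized.

topOf : Expr → Expr
topOf x = top [ lit 0 ][ x ]

-- The running block B_x holds ‖m‖ in its entry number m − (H_x − L).

position : Expr → Expr → Expr
position x m = ! L ⊕ m ⊖ topOf x

initialize : Program
initialize =
  allocate block (! j) (! L) ⨟
  top [ lit 0 ][ ! j ]≔ ! H ⨟
  forUp i (lit 1) (! L)
    ( block [ ! j ][ ! i ]≔ block [ lit 0 ][ ! H ⊖ ! L ⊕ ! i ] )

shift : Program
shift =
  top [ lit 0 ][ ! j ]≔ topOf (! j) ⊕ ! ℓ ⨟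
  forUp i (lit 1) (! ℓ)
    ( block [ ! j ][ ! i ]≔ block [ ! j ][ ! ℓ ⊕ ! i ] ) ⨟
  computeBound N ⨟
  forUp i (! ℓ ⊕ lit 1) (! L)
    ( block [ ! j ][ ! i ]≔ ! bound )

-- The pairs a ≤ b with H_j − ℓ < ab ≤ H_j are enumerated by
-- 2 ≤ a, a² ≤ H_j and max(a, ⌊(H_j − ℓ)/a⌋ + 1) ≤ b ≤ ⌊H_j/a⌋.

products : Program
products =
  a ≔ lit 2 ⨟
  while (! a ⊗ ! a ≼ ! Hⱼ)
    ( q ≔ ! Hⱼ ⊘ ! a ⨟
      b ≔ (! Hⱼ ⊖ ! ℓ) ⊘ ! a ⊕ lit 1 ⨟
      when (! b ≺ ! a) (b ≔ ! a) ⨟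
      while (! b ≼ ! q)
        ( branch (! q ≼ ! H)
            ( y ≔ block [ lit 0 ][ ! b ] )
            ( y ≔ block [ ! a ⊗ ! j ][ position (! a ⊗ ! j) (! b) ] ) ⨟
          lower (! j) (position (! j) (! a ⊗ ! b)) (block [ lit 0 ][ ! a ] ⊕ ! y) ⨟
          b ≔ ! b ⊕ lit 1 ) ⨟
      a ≔ ! a ⊕ lit 1 )

-- The entries of B_1 are final once their sums have been treated, and the
-- integers in B_1 beyond H are met in increasing order; they are reported
-- at that moment.

sums : Program
sums =
  forUp n (! Hⱼ ⊖ ! ℓ ⊕ lit 1) (! Hⱼ)
    ( i ≔ position (! j) (! n) ⨟
      T ≔ block [ ! j ][ ! i ⊖ lit 1 ] ⨟
      lower (! j) (! i) (! T ⊕ lit 1) ⨟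
      computeKMax ⨟
      forUp k (lit 6) (! κ)
        ( lower (! j) (! i) (block [ lit 0 ][ ! k ] ⊕ block [ ! j ][ ! i ⊖ ! k ]) ) ⨟
      when (! j ≐ lit 1)
        ( emit (! n) (block [ ! j ][ ! i ]) ) )

mainLoop : Program
mainLoop =
  while (topOf (lit 1) ≺ ! N)
    ( h ≔ topOf (lit 1) ⊕ ! ℓ ⨟
      when (! N ≺ ! h) (h ≔ ! N) ⨟
      forDown j (ceilDiv (! h) (! H) ⊖ lit 1) (lit 1)
        ( newH ≔ ! ℓ ⊗ ceilDiv (! h) (! j ⊗ ! ℓ) ⨟
          when (topOf (! j) ≐ lit 0)
            ( when (! H ≺ ! newH) initialize ) ⨟
          when (lit 1 ≼ topOf (! j))
            ( when (topOf (! j) ≺ ! newH)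
                ( shift ⨟
                  Hⱼ ≔ topOf (! j) ⨟
                  products ⨟
                  sums ) ) ) )

-- The indices j occurring in the main loop are less than ⌈N/H⌉, and B_1
-- always exists, so there is room for all the H_j in ⌈N/H⌉ entries.

spaceImproved : (N₀ H₀ ℓ₀ : ℕ) → Program
spaceImproved N₀ H₀ ℓ₀ =
  N ≔ lit N₀ ⨟
  H ≔ lit H₀ ⨟
  ℓ ≔ lit ℓ₀ ⨟
  L ≔ lit 2 ⊗ ! ℓ ⨟
  M ≔ ! H ⨟
  timeImproved ⨟
  allocate top (lit 0) (ceilDiv (! N) (! H)) ⨟
  forUp i (lit 1) (ceilDiv (! N) (! H))
    ( top [ lit 0 ][ ! i ]≔ lit 0 ) ⨟
  j ≔ lit 1 ⨟
  initialize ⨟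
  mainLoop

-- The emitted results are (1 , ‖1‖), (2 , ‖2‖), …, (K , ‖K‖), in this order,
-- for some K ≥ N.

ComputesComplexities : ℕ → List (ℕ × ℕ) → Set
ComputesComplexities N rs =
    ∃ (λ K → N ≤ K × map proj₁ rs ≡ map suc (upTo K))
  × All (uncurry ‖_‖≡_) rs

------------------------------------------------------------------------
-- Powers with real exponents

-- A real number θ ≥ 0 is represented by its upper cut: θ p q means θ ≤ p/q,
-- for q ≥ 1.

Exponent : Set₁
Exponent = ℕ → ℕ → Set

α : Exponent
α p q = q * 1230175 ≤ p * 1000000

-- log 3 / log 2 − 1 ≤ p/q  ⇔  q log 3 ≤ (p + q) log 2

β : Exponent
β p q = 3 ^ q ≤ 2 ^ (p + q)

-- (1 + θ)/2 ≤ p/q  ⇔  θ ≤ (2p − q)/q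

[1+_]/2 : Exponent → Exponent
[1+ θ ]/2 p q = q ≤ 2 * p × θ (2 * p ∸ q) q

-- x ≤ c N^θ, for N ≥ 1: this says x ≤ c N^(p/q) for all rationals p/q ≥ θ,
-- which is the same since N^θ is the infimum of these N^(p/q).

_≤[_·_↑_] : ℕ → ℕ → ℕ → Exponent → Set
x ≤[ c · N ↑ θ ] = ∀ p q → 1 ≤ q → θ p q → x ^ q ≤ c ^ q * N ^ p

{-# OPTIONS --safe #-}

-- If n = a + b with a ≤ b and ‖a‖ + ‖b‖ ≤ ‖n−1‖, then a ≤ kMax(n), because m ≤ E(‖m‖); this
-- and the products make the minimum computed for n equal to ‖n‖.
--
-- Time.  Since n kMax(n) ≤ 2 E(‖n−1‖), which is about 3^(‖n−1‖/3), the sum of the kMax(n) is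
-- controlled by the averages of 3^(‖n‖/3).  Dividing n with remainder by 2 or by 3, as
-- prescribed by n mod 36, bounds the sum over each residue class mod 36 and n ≤ N by sums over
-- classes and m ≤ N/2 or m ≤ N/3.  An explicit approximate eigenvector of this system shows
-- that the sums are O(N^(20/9)), so that the sum of the kMax(n) is O(N^(11/9)).  As
-- 11/9 < 1.230175, all logarithmic factors are harmless.  In the main loop H_j is the maximum
-- of H and ℓ⌈h/(jℓ)⌉, and the cost of an update of B_j is the increase of a potential that
-- depends on H_j only; the final potentials are summed over j ≤ N/H with H_j ≤ 2N/j.
--
-- Storage.  From ‖n‖ ≤ 3 log₂ n one gets kMax(n) ≤ 2 (3/2)^k for n − 1 < 2^(k+1), so ℓ may be
-- of order (3/2)^k and H of order 3^(k/2), which is N^((1+β)/2) for N of order 2^k.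

module Submission where

open import Defs
open import Data.Bool.Base as Bool using (Bool; _∧_; _∨_; false; if_then_else_; true)
open import Data.Fin.Base using (Fin; suc; toℕ; zero)
open import Data.Fin.Properties using (toℕ-injective)
open import Data.List.Base as List using (List; []; _∷_; _∷ʳ_; concatMap; filter; foldr; upTo)
open import Data.List.Membership.Propositional using (_∈_; lose)
open import Data.List.Membership.Propositional.Properties using (∈-concatMap⁺; ∈-filter⁺; ∈-filter⁻; ∈-upTo⁺)
open import Data.List.Properties using (map-++; upTo-∷ʳ)
open import Data.List.Relation.Unary.All using (All; []; _∷_)
open import Data.List.Relation.Unary.All.Properties using (∷ʳ⁺)
open import Data.List.Relation.Unary.Any using (here; there)
open import Data.Maybe.Base using (Maybe; _>>=_; just; nothing)
open import Data.Maybe.Properties using (just-injective)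
open import Data.Nat.Base
open import Data.Nat.DivMod
open import Data.Nat.Divisibility using (divides)
open import Data.Nat.Logarithm
open import Data.Nat.Properties
open import Data.Nat.Tactic.RingSolver using (solve-∀)
open import Data.Product.Base
open import Data.Sum.Base using (_⊎_; inj₁; inj₂)
open import Data.Vec.Base as Vec using (Vec; _[_]≔_)
open import Data.Vec.Properties using (lookup∘tabulate)
open import Function.Base using (_∘_; case_of_)
open import Relation.Binary.PropositionalEquality
open import Relation.Nullary using (Dec; contradiction; no; yes; ¬_)
open import Relation.Nullary.Decidable using (_×-dec_; _⊎-dec_; from-yes; map′)

open ≤-Reasoning

-- A class mod 36 divided by 2 or 3 becomes a class mod 18 or 12, which is a union of classes mod
-- 36; so the system of inequalities closes up. Real powers are avoided: a bound g/q is carried as a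
-- pair of integers and compared with K^(20/9) through ninth powers. The obstacle in summing the
-- potentials is that the H_j have very different sizes. Therefore the sum of the kMax(n) over n ≤ X
-- is bounded linearly in X, uniformly for all X up to 2N; with H_j ≤ 2N/j only a harmonic sum
-- remains, at the price of a logarithm. The descending order of j is what makes the products
-- possible: when B_j is updated, every B_(aj) with a ≥ 2 has already been moved for the same h, and
-- then it contains the cofactor. The factor log log N in the storage comes from the block entries,
-- which are O(log N). Only the registers and the roughly N/H numbers H_j need words of O(log N)
-- bits, and k N/H is still dominated by 3^(k/2). Correctness, time and absence of overflow are
-- proved together, since a run that stores too large an integer does not exist.

m+n≤o⇒n≤o∸m : ∀ m {n o} → m + n ≤ o → n ≤ o ∸ m
m+n≤o⇒n≤o∸m m {n} {o} le = m+n≤o⇒m≤o∸n n (subst (_≤ o) (+-comm m n) le)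

^-distribʳ-* : ∀ k m n → (m * n) ^ k ≡ m ^ k * n ^ k
^-distribʳ-* zero    m n = refl
^-distribʳ-* (suc k) m n = trans (cong (m * n *_) (^-distribʳ-* k m n)) (lem m n (m ^ k) (n ^ k))
  where
  lem : ∀ a b c d → a * b * (c * d) ≡ a * c * (b * d)
  lem = solve-∀

-- Complexity as a function

unary : ℕ → Formula
unary zero          = 𝟙
unary (suc zero)    = 𝟙
unary (suc (suc n)) = 𝟙 ⊞ unary (suc n)

value-unary : ∀ {n} → 1 ≤ n → value (unary n) ≡ n
value-unary {suc zero}    _ = refl
value-unary {suc (suc n)} _ = cong suc (value-unary (s≤s z≤n))

1≤value : ∀ f → 1 ≤ value f
1≤value 𝟙       = ≤-refl
1≤value (f ⊞ g) = ≤-trans (1≤value f) (m≤m+n _ _)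
1≤value (f ⊠ g) = *-mono-≤ (1≤value f) (1≤value g)

1≤ones : ∀ f → 1 ≤ ones f
1≤ones 𝟙       = ≤-refl
1≤ones (f ⊞ g) = ≤-trans (1≤ones f) (m≤m+n _ _)
1≤ones (f ⊠ g) = ≤-trans (1≤ones f) (m≤m+n _ _)

cheaper : Formula → Formula → Formula
cheaper f g with ones f ≤? ones g
... | yes _ = f
... | no  _ = g

cheapest : Formula → List Formula → Formula
cheapest = foldr cheaper

cheapest-∈ : ∀ f fs → cheapest f fs ≡ f ⊎ cheapest f fs ∈ fs
cheapest-∈ f []       = inj₁ refl
cheapest-∈ f (g ∷ fs) with ones g ≤? ones (cheapest f fs)
... | yes _ = inj₂ (here refl)
... | no  _ with cheapest-∈ f fs
...   | inj₁ eq = inj₁ eq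
...   | inj₂ ∈fs = inj₂ (there ∈fs)

cheapest-≤ : ∀ f fs → ones (cheapest f fs) ≤ ones f
cheapest-≤ f []       = ≤-refl
cheapest-≤ f (g ∷ fs) with ones g ≤? ones (cheapest f fs)
... | yes p = ≤-trans p (cheapest-≤ f fs)
... | no  _ = cheapest-≤ f fs

cheapest-≤-∈ : ∀ f {g} fs → g ∈ fs → ones (cheapest f fs) ≤ ones g
cheapest-≤-∈ f (g ∷ fs) g∈ with ones g ≤? ones (cheapest f fs) | g∈
... | yes _ | here refl = ≤-refl
... | yes p | there ∈fs = ≤-trans p (cheapest-≤-∈ f fs ∈fs)
... | no ¬p | here refl = <⇒≤ (≰⇒> ¬p)
... | no ¬p | there ∈fs = cheapest-≤-∈ f fs ∈fs

-- The summands and divisors are written suc a, which makes the quotient total.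

splittings : (ℕ → Formula) → ℕ → List Formula
splittings F n = concatMap
  (λ a → F (suc a) ⊞ F (n ∸ suc a) ∷ F (suc a) ⊠ F (n / suc a) ∷ []) (upTo n)

-- `d` limits the depth of the recursion, and `best d n` is optimal for n ≤ d. Splittings whose
-- value is not n, from an inexact quotient or an empty remainder, are removed by the filter, so
-- nothing has to be assumed about them.
best : ℕ → ℕ → Formula
best zero    n = unary n
best (suc d) n = cheapest (unary n) (filter (λ f → value f ≟ n) (splittings (best d) n))

value-best : ∀ d {n} → 1 ≤ n → value (best d n) ≡ n
value-best zero        1≤n = value-unary 1≤n
value-best (suc d) {n} 1≤n
  with cheapest-∈ (unary n) (filter (λ f → value f ≟ n) (splittings (best d) n))
... | inj₁ eq  = trans (cong value eq) (value-unary 1≤n)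
... | inj₂ ∈fs = proj₂ (∈-filter⁻ (λ f → value f ≟ n) {xs = splittings (best d) n} ∈fs)

best-candidate : ∀ d {n a f} → a < n → value f ≡ n →
  f ∈ (best d (suc a) ⊞ best d (n ∸ suc a) ∷ best d (suc a) ⊠ best d (n / suc a) ∷ []) →
  ones (best (suc d) n) ≤ ones f
best-candidate d {n} {a} a<n eq f∈ = cheapest-≤-∈ (unary n) _
  (∈-filter⁺ (λ f → value f ≟ n)
    (∈-concatMap⁺ (λ b → best d (suc b) ⊞ best d (n ∸ suc b) ∷ best d (suc b) ⊠ best d (n / suc b) ∷ [])
      (lose (∈-upTo⁺ a<n) f∈)) eq)

-- Both parts of a sum are smaller than its value, so `d` drops. Multiplication by 1 does not lower
-- the value; there the recursion keeps `d` and passes to the subformula.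
best-optimal : ∀ d g → value g ≤ d → ones (best d (value g)) ≤ ones g
best-optimal zero g v≤0 = contradiction (≤-trans (1≤value g) v≤0) (λ ())
best-optimal (suc d) 𝟙 _ = cheapest-≤ 𝟙 (filter (λ f → value f ≟ 1) (splittings (best d) 1))
best-optimal (suc d) (g ⊞ h) v≤d with value g in eg | 1≤value g
... | suc a | _ = begin
  ones (best (suc d) (suc a + value h)) ≤⟨ best-candidate d (m≤m+n (suc a) _) valid (here refl) ⟩
  ones (best d (suc a)) + ones (best d (suc a + value h ∸ suc a))
    ≡⟨ cong₂ (λ x y → ones (best d x) + ones (best d y)) (sym eg) (m+n∸m≡n (suc a) _) ⟩
  ones (best d (value g)) + ones (best d (value h))
    ≤⟨ +-mono-≤ (best-optimal d g (s≤s⁻¹ (≤-trans lt₁ v≤d))) (best-optimal d h (s≤s⁻¹ (≤-trans lt₂ v≤d))) ⟩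
  ones g + ones h ∎
  where
  lt₁ : suc (value g) ≤ suc a + value h
  lt₁ = begin suc (value g) ≡⟨ cong suc eg ⟩ suc (suc a) ≡⟨ +-comm 1 (suc a) ⟩ suc a + 1 ≤⟨ +-monoʳ-≤ (suc a) (1≤value h) ⟩ suc a + value h ∎
  lt₂ : suc (value h) ≤ suc a + value h
  lt₂ = s≤s (m≤n+m _ a)
  valid : value (best d (suc a)) + value (best d (suc a + value h ∸ suc a)) ≡ suc a + value h
  valid = cong₂ _+_ (value-best d (s≤s z≤n))
    (trans (cong (value ∘ best d) (m+n∸m≡n (suc a) (value h))) (value-best d (1≤value h)))
best-optimal (suc d) (g ⊠ h) v≤d with value g in eg | value h in eh | 1≤value g | 1≤value h
... | suc zero | b | _ | _ = begin
  ones (best (suc d) (b + 0)) ≡⟨ cong (ones ∘ best (suc d)) (trans (+-identityʳ b) (sym eh)) ⟩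
  ones (best (suc d) (value h)) ≤⟨ best-optimal (suc d) h (≤-trans (≤-reflexive (trans eh (sym (+-identityʳ b)))) v≤d) ⟩
  ones h ≤⟨ m≤n+m _ _ ⟩
  ones g + ones h ∎
... | suc (suc a) | suc zero | _ | _ = begin
  ones (best (suc d) (suc (suc a) * 1)) ≡⟨ cong (ones ∘ best (suc d)) (trans (*-identityʳ (suc (suc a))) (sym eg)) ⟩
  ones (best (suc d) (value g)) ≤⟨ best-optimal (suc d) g (≤-trans (≤-reflexive (trans eg (sym (*-identityʳ (suc (suc a)))))) v≤d) ⟩
  ones g ≤⟨ m≤m+n _ _ ⟩
  ones g + ones h ∎
... | suc (suc a) | suc (suc b) | _ | _ = begin
  ones (best (suc d) (A * B)) ≤⟨ best-candidate d A≤ valid (there (here refl)) ⟩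
  ones (best d A) + ones (best d (A * B / A))
    ≡⟨ cong₂ (λ x y → ones (best d x) + ones (best d y)) (sym eg) (trans quot (sym eh)) ⟩
  ones (best d (value g)) + ones (best d (value h))
    ≤⟨ +-mono-≤ (best-optimal d g (subst (_≤ d) (sym eg) (s≤s⁻¹ (≤-trans A< v≤d))))
                (best-optimal d h (subst (_≤ d) (sym eh) (s≤s⁻¹ (≤-trans B< v≤d)))) ⟩
  ones g + ones h ∎
  where
  A B : ℕ
  A = suc (suc a)
  B = suc (suc b)
  quot : A * B / A ≡ B
  quot = trans (cong (_/ A) (*-comm A B)) (m*n/n≡m B A)
  A< : A < A * B
  A< = m<m*n A B (s≤s (s≤s z≤n))
  B< : B < A * B
  B< = subst (B <_) (*-comm B A) (m<m*n B A (s≤s (s≤s z≤n)))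
  A≤ : A ≤ A * B
  A≤ = <⇒≤ A<
  valid : value (best d A) * value (best d (A * B / A)) ≡ A * B
  valid = cong₂ _*_ (value-best d {A} (s≤s z≤n)) (trans (cong (value ∘ best d) quot) (value-best d {B} (s≤s z≤n)))

opaque
  -- Sealed, so that no later conversion runs the exhaustive search; the few numerical values
  -- required are computed inside the block.
  comp : ℕ → ℕ
  comp n = ones (best n n)

  comp-best : ∀ n → comp n ≡ ones (best n n)
  comp-best n = refl

  comp-correct : ∀ {n} → 1 ≤ n → ‖ n ‖≡ comp n
  comp-correct {n} 1≤n = (best n n , value-best n 1≤n , refl) , λ { f refl → best-optimal n f ≤-refl }

  comp≤ones : ∀ f → comp (value f) ≤ ones f
  comp≤ones f = best-optimal (value f) f ≤-refl

  1≤comp : ∀ n → 1 ≤ comp n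
  1≤comp n = 1≤ones (best n n)

  comp-0 : comp 0 ≡ 1
  comp-0 = refl

  comp-1 : comp 1 ≡ 1
  comp-1 = refl

  a≤comp : ∀ {a} → a < 6 → a ≤ comp a
  a≤comp = from-yes (allUpTo? (λ a → a ≤? comp a) 6)

comp-unique : ∀ {n c} → 1 ≤ n → ‖ n ‖≡ c → c ≡ comp n
comp-unique {n} 1≤n ((f , refl , refl) , min) with comp-correct 1≤n
... | (g , eq , eq′) , _ = ≤-antisym (subst (ones f ≤_) eq′ (min g eq)) (comp≤ones f)

comp-+ : ∀ {a b} → 1 ≤ a → 1 ≤ b → comp (a + b) ≤ comp a + comp b
comp-+ {a} {b} 1≤a 1≤b = subst₂ _≤_
  (cong comp (cong₂ _+_ (value-best a 1≤a) (value-best b 1≤b)))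
  (cong₂ _+_ (sym (comp-best a)) (sym (comp-best b))) (comp≤ones (best a a ⊞ best b b))

comp-* : ∀ {a b} → 1 ≤ a → 1 ≤ b → comp (a * b) ≤ comp a + comp b
comp-* {a} {b} 1≤a 1≤b = subst₂ _≤_
  (cong comp (cong₂ _*_ (value-best a 1≤a) (value-best b 1≤b)))
  (cong₂ _+_ (sym (comp-best a)) (sym (comp-best b))) (comp≤ones (best a a ⊠ best b b))

comp-suc : ∀ {n} → 1 ≤ n → comp (suc n) ≤ suc (comp n)
comp-suc {n} 1≤n = subst (λ c → comp (suc n) ≤ c + comp n) comp-1 (comp-+ {1} {n} (s≤s z≤n) 1≤n)

comp≤n : ∀ {n} → 1 ≤ n → comp n ≤ n
comp≤n {suc zero}    _ = ≤-reflexive comp-1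
comp≤n {suc (suc n)} _ = ≤-trans (comp-suc (s≤s z≤n)) (s≤s (comp≤n (s≤s z≤n)))

Summands Factors : ℕ → Set
Summands n = ∃₂ λ a b → 1 ≤ a × 1 ≤ b × a + b ≡ n × comp a + comp b ≤ comp n
Factors  n = ∃₂ λ a b → 2 ≤ a × 2 ≤ b × a * b ≡ n × comp a + comp b ≤ comp n

-- Reads off the outermost operation of an optimal formula. A factor 1 cannot occur, since the other
-- factor would be a cheaper formula of the same value.
comp-split : ∀ {n} → 2 ≤ n → Summands n ⊎ Factors n
comp-split {n} 2≤n with best n n | value-best n {n} (<⇒≤ 2≤n) | comp-best n
... | 𝟙     | refl | _ = contradiction 2≤n λ { (s≤s ()) }
... | f ⊞ g | vn | cn = inj₁ (value f , value g , 1≤value f , 1≤value g , vn ,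
  ≤-trans (+-mono-≤ (comp≤ones f) (comp≤ones g)) (≤-reflexive (sym cn)))
... | f ⊠ g | vn | cn with value f in vf | value g in vg | 1≤value f | 1≤value g
...   | suc zero    | b | _ | _ = contradiction (comp≤ones g) (<⇒≱ lt)
  where
  lt : ones g < comp (value g)
  lt = begin-strict
    ones g <⟨ m<n+m (ones g) (1≤ones f) ⟩
    ones f + ones g ≡⟨ sym cn ⟩
    comp n ≡⟨ cong comp (trans (sym vn) (trans (+-identityʳ b) (sym vg))) ⟩
    comp (value g) ∎
...   | suc (suc a) | suc zero | _ | _ = contradiction (comp≤ones f) (<⇒≱ lt)
  where
  lt : ones f < comp (value f)
  lt = begin-strict
    ones f <⟨ m<m+n (ones f) (1≤ones g) ⟩
    ones f + ones g ≡⟨ sym cn ⟩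
    comp n ≡⟨ cong comp (trans (sym vn) (trans (*-identityʳ (suc (suc a))) (sym vf))) ⟩
    comp (value f) ∎
...   | suc (suc a) | suc (suc b) | _ | _ = inj₂ (suc (suc a) , suc (suc b) , s≤s (s≤s z≤n) , s≤s (s≤s z≤n) , vn ,
  (begin
    comp (suc (suc a)) + comp (suc (suc b)) ≡⟨ cong₂ (λ x y → comp x + comp y) (sym vf) (sym vg) ⟩
    comp (value f) + comp (value g) ≤⟨ +-mono-≤ (comp≤ones f) (comp≤ones g) ⟩
    ones f + ones g ≡⟨ cn ⟨
    comp n ∎))

-- The function E

3+/3 : ∀ i → (3 + i) / 3 ≡ suc (i / 3)
3+/3 i = m/n≡1+[m∸n]/n {3 + i} {3} (m≤m+n 3 i)

3+%3 : ∀ i → (3 + i) % 3 ≡ i % 3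
3+%3 i = trans (cong (_% 3) (+-comm 3 i)) ([m+n]%n≡m%n i 3)

byRemainder-suc : ∀ j r → byRemainder (2 + j) r ≡ 3 * byRemainder (suc j) r
byRemainder-suc j 0             = refl
byRemainder-suc j 1             = lem (3 ^ j)
  where
  lem : ∀ x → 4 * (3 * x) ≡ 3 * (4 * x)
  lem = solve-∀
byRemainder-suc j (suc (suc _)) = lem (3 ^ j)
  where
  lem : ∀ x → 2 * (3 * (3 * x)) ≡ 3 * (2 * (3 * x))
  lem = solve-∀

-- The rule E(x + 3) = 3 E(x) is stated from x = 2 on because it fails at x = 1, where E(4) = 4 and
-- E(1) = 1.
E-3+ : ∀ i → E (5 + i) ≡ 3 * E (2 + i)
E-3+ 0 = refl
E-3+ (suc i) rewrite 3+/3 (3 + i) | 3+%3 (3 + i) | 3+/3 i = byRemainder-suc (i / 3) ((3 + i) % 3)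

E-3* : ∀ j → E (3 * j) ≡ 3 ^ j
E-3* 0 = refl
E-3* 1 = refl
E-3* (suc (suc j)) = begin-equality
  E (3 * (2 + j))     ≡⟨ cong E (lem j) ⟩
  E (5 + (1 + 3 * j)) ≡⟨ E-3+ (1 + 3 * j) ⟩
  3 * E (3 + 3 * j)   ≡⟨ cong (λ x → 3 * E x) (sym (*-suc 3 j)) ⟩
  3 * E (3 * suc j)   ≡⟨ cong (3 *_) (E-3* (suc j)) ⟩
  3 ^ (2 + j)         ∎
  where
  lem : ∀ j → 3 * (2 + j) ≡ 5 + (1 + 3 * j)
  lem = solve-∀

E-suc : ∀ i → E i ≤ E (suc i)
E-suc 0 = from-yes (1 ≤? 1)
E-suc 1 = from-yes (1 ≤? 2)
E-suc 2 = from-yes (2 ≤? 3)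
E-suc 3 = from-yes (3 ≤? 4)
E-suc 4 = from-yes (4 ≤? 6)
E-suc (suc (suc (suc k@(suc (suc i))))) = begin
  E (5 + i)     ≡⟨ E-3+ i ⟩
  3 * E (2 + i) ≤⟨ *-monoʳ-≤ 3 (E-suc k) ⟩
  3 * E (3 + i) ≡⟨ E-3+ (suc i) ⟨
  E (6 + i)     ∎

E-mono : ∀ {i j} → i ≤ j → E i ≤ E j
E-mono {i} {zero} z≤n = ≤-refl
E-mono {i} {suc j} i≤1+j with m≤n⇒m<n∨m≡n i≤1+j
... | inj₁ i<1+j = ≤-trans (E-mono (s≤s⁻¹ i<1+j)) (E-suc j)
... | inj₂ refl  = ≤-refl

1≤E : ∀ i → 1 ≤ E i
1≤E i = E-mono {0} {i} z≤n

-- Reducing each argument by 3 as long as the tripling rule applies ends below 5, so 25 pairs remain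
-- as base cases, to be settled by evaluation.
module _ (P : ℕ → ℕ → ℕ → Set)
  (small  : ∀ {i} → i < 5 → ∀ {j} → j < 5 → P (E i) (E j) (E (i + j)))
  (scaleˡ : ∀ {x y z} → P x y z → P (3 * x) y (3 * z))
  (scaleʳ : ∀ {x y z} → P x y z → P x (3 * y) (3 * z)) where

  private
    E-inductionʳ : ∀ i → i < 5 → ∀ j → P (E i) (E j) (E (i + j))
    E-inductionʳ i i<5 (suc (suc (suc k@(suc (suc j))))) = subst₂ (P (E i)) (sym (E-3+ j))
      (trans (sym (E-3+ (i + j))) (cong E (lem₅ i j)))
      (scaleʳ (subst (P (E i) (E (2 + j)) ∘ E) (lem₂ i j) (E-inductionʳ i i<5 k)))
      where
      lem₅ : ∀ i j → 5 + (i + j) ≡ i + (5 + j)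
      lem₅ = solve-∀
      lem₂ : ∀ i j → i + (2 + j) ≡ 2 + (i + j)
      lem₂ = solve-∀
    E-inductionʳ i i<5 0 = small i<5 (from-yes (0 <? 5))
    E-inductionʳ i i<5 1 = small i<5 (from-yes (1 <? 5))
    E-inductionʳ i i<5 2 = small i<5 (from-yes (2 <? 5))
    E-inductionʳ i i<5 3 = small i<5 (from-yes (3 <? 5))
    E-inductionʳ i i<5 4 = small i<5 (from-yes (4 <? 5))

  E-induction : ∀ i j → P (E i) (E j) (E (i + j))
  E-induction (suc (suc (suc k@(suc (suc i))))) j = subst₂ (λ x z → P x (E j) z)
    (sym (E-3+ i)) (sym (E-3+ (i + j))) (scaleˡ (E-induction k j))
  E-induction 0 = E-inductionʳ 0 (from-yes (0 <? 5))
  E-induction 1 = E-inductionʳ 1 (from-yes (1 <? 5))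
  E-induction 2 = E-inductionʳ 2 (from-yes (2 <? 5))
  E-induction 3 = E-inductionʳ 3 (from-yes (3 <? 5))
  E-induction 4 = E-inductionʳ 4 (from-yes (4 <? 5))

E-* : ∀ i j → E i * E j ≤ E (i + j)
E-* = E-induction (λ x y z → x * y ≤ z)
  (λ i<5 j<5 → from-yes (allUpTo? (λ i → allUpTo? (λ j → E i * E j ≤? E (i + j)) 5) 5) i<5 j<5)
  (λ {x} {y} {z} le → ≤-trans (≤-reflexive (*-assoc 3 x y)) (*-monoʳ-≤ 3 le))
  (λ {x} {y} {z} le → ≤-trans (≤-reflexive (lem x y)) (*-monoʳ-≤ 3 le))
  where
  lem : ∀ x y → x * (3 * y) ≡ 3 * (x * y)
  lem = solve-∀

-- E i + E j ≤ E (i + j) fails when i = 0, where E j < 1 + E j.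

1+E≤ : ∀ {j} → 1 ≤ j → 1 + E j ≤ E (1 + j)
1+E≤ {1} _ = from-yes (2 ≤? 2)
1+E≤ {2} _ = from-yes (3 ≤? 3)
1+E≤ {3} _ = from-yes (4 ≤? 4)
1+E≤ {4} _ = from-yes (5 ≤? 6)
1+E≤ {suc (suc (suc k@(suc (suc j))))} _ = begin
  1 + E (5 + j)       ≡⟨ cong suc (E-3+ j) ⟩
  1 + 3 * E (2 + j)   ≤⟨ +-monoˡ-≤ (3 * E (2 + j)) (from-yes (1 ≤? 3)) ⟩
  3 + 3 * E (2 + j)   ≡⟨ *-suc 3 (E (2 + j)) ⟨
  3 * (1 + E (2 + j)) ≤⟨ *-monoʳ-≤ 3 (1+E≤ {k} (s≤s z≤n)) ⟩
  3 * E (3 + j)       ≡⟨ E-3+ (suc j) ⟨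
  E (6 + j)           ∎

-- If both values are at least 2, their sum is at most their product and `E-*` applies; otherwise
-- one of them is 1.
E-+ : ∀ {i j} → 1 ≤ i → 1 ≤ j → E i + E j ≤ E (i + j)
E-+ {i} {j} 1≤i 1≤j with 2 ≤? E i | 2 ≤? E j
... | yes 2≤Ei | yes 2≤Ej = ≤-trans (lem 2≤Ei 2≤Ej) (E-* i j)
  where
  lem : ∀ {x y} → 2 ≤ x → 2 ≤ y → x + y ≤ x * y
  lem {suc (suc x)} {suc (suc y)} _ _ = ≤-trans (m≤m+n _ (x * y + x + y)) (≤-reflexive (eq x y))
    where
    eq : ∀ x y → suc (suc x) + suc (suc y) + (x * y + x + y) ≡ suc (suc x) * suc (suc y)
    eq = solve-∀
  lem {suc zero} (s≤s ()) _
  lem {suc (suc _)} {suc zero} _ (s≤s ())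
... | no 2≰Ei | _ = ≤-trans (+-monoˡ-≤ (E j) (s≤s⁻¹ (≰⇒> 2≰Ei))) (≤-trans (1+E≤ 1≤j) (E-mono (+-monoˡ-≤ j 1≤i)))
... | yes _ | no 2≰Ej = begin
  E i + E j ≤⟨ +-monoʳ-≤ (E i) (s≤s⁻¹ (≰⇒> 2≰Ej)) ⟩
  E i + 1   ≡⟨ +-comm (E i) 1 ⟩
  1 + E i   ≤⟨ 1+E≤ 1≤i ⟩
  E (1 + i) ≤⟨ E-mono (+-monoˡ-≤ i 1≤j) ⟩
  E (j + i) ≡⟨ cong E (+-comm j i) ⟩
  E (i + j) ∎

value≤E : ∀ f → value f ≤ E (ones f)
value≤E 𝟙       = ≤-refl
value≤E (f ⊞ g) = ≤-trans (+-mono-≤ (value≤E f) (value≤E g)) (E-+ (1≤ones f) (1≤ones g))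
value≤E (f ⊠ g) = ≤-trans (*-mono-≤ (value≤E f) (value≤E g)) (E-* (ones f) (ones g))

n≤E[comp] : ∀ {n} → 1 ≤ n → n ≤ E (comp n)
n≤E[comp] {n} 1≤n = subst₂ (λ m c → m ≤ E c) (value-best n 1≤n) (sym (comp-best n)) (value≤E (best n n))

-- kMax

search-≤ : ∀ n T t → search n T t ≤ t
search-≤ n T zero = z≤n
search-≤ n T (suc t) with E (suc t) + E (T ∸ suc t) <ᵇ n
... | true  = m≤n⇒m≤1+n (search-≤ n T t)
... | false = ≤-refl

search-stops : ∀ n T t → search n T t ≡ 0 ⊎ n ≤ E (search n T t) + E (T ∸ search n T t)
search-stops n T zero = inj₁ refl
search-stops n T (suc t) with E (suc t) + E (T ∸ suc t) <ᵇ n in eq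
... | true  = search-stops n T t
... | false = inj₂ (≮⇒≥ λ lt → subst Bool.T eq (<⇒<ᵇ lt))

search-maximal : ∀ n T t {x} → x ≤ t → n ≤ E x + E (T ∸ x) → x ≤ search n T t
search-maximal n T zero    x≤0 _ = x≤0
search-maximal n T (suc t) {x} x≤1+t n≤ with E (suc t) + E (T ∸ suc t) <ᵇ n in eq
... | false = x≤1+t
... | true with m≤n⇒m<n∨m≡n x≤1+t
...   | inj₁ x<1+t = search-maximal n T t (s≤s⁻¹ x<1+t) n≤
...   | inj₂ refl  = contradiction n≤ (<⇒≱ (<ᵇ⇒< _ _ (subst Bool.T (sym eq) _)))

m/2+m/2≤m : ∀ m → m / 2 + m / 2 ≤ m
m/2+m/2≤m m = subst (_≤ m) (lem (m / 2)) (m/n*n≤m m 2)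
  where
  lem : ∀ x → x * 2 ≡ x + x
  lem = solve-∀

m+m≤n⇒m≤n/2 : ∀ {m n} → m + m ≤ n → m ≤ n / 2
m+m≤n⇒m≤n/2 {m} {n} le = subst (_≤ n / 2) (m*n/n≡m m 2) (/-monoˡ-≤ 2 (subst (_≤ n) (lem m) le))
  where
  lem : ∀ x → x + x ≡ x * 2
  lem = solve-∀

-- The smaller summand need not be the cheaper one. The search is tested at the smaller of the two
-- complexities, which is at most T/2; if that one belongs to b, then a ≤ b ≤ E(‖b‖) still gives the
-- claim.
summand≤kMax : ∀ {n a b} T → 1 ≤ a → a ≤ b → a + b ≡ n → comp a + comp b ≤ T → a ≤ kMax n T
summand≤kMax {n} {a} {b} T 1≤a a≤b a+b≡n c≤T with comp a ≤? comp b
... | yes ca≤cb = ≤-trans (n≤E[comp] 1≤a) (E-mono (search-maximal n T (T / 2) {comp a}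
  (m+m≤n⇒m≤n/2 {comp a} (≤-trans (+-monoʳ-≤ (comp a) ca≤cb) c≤T))
  (begin
    n ≡⟨ a+b≡n ⟨
    a + b ≤⟨ +-mono-≤ (n≤E[comp] 1≤a) (≤-trans (n≤E[comp] (≤-trans 1≤a a≤b)) (E-mono (m+n≤o⇒n≤o∸m (comp a) c≤T))) ⟩
    E (comp a) + E (T ∸ comp a) ∎)))
... | no ca≰cb = ≤-trans a≤b (≤-trans (n≤E[comp] (≤-trans 1≤a a≤b)) (E-mono (search-maximal n T (T / 2) {comp b}
  (m+m≤n⇒m≤n/2 {comp b} (≤-trans (+-monoˡ-≤ (comp b) (<⇒≤ (≰⇒> ca≰cb))) c≤T))
  (begin
    n ≡⟨ a+b≡n ⟨
    a + b ≡⟨ +-comm a b ⟩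
    b + a ≤⟨ +-mono-≤ (n≤E[comp] (≤-trans 1≤a a≤b)) (≤-trans (n≤E[comp] 1≤a) (E-mono (m+n≤o⇒n≤o∸m (comp b) (subst (_≤ T) (+-comm (comp a) (comp b)) c≤T)))) ⟩
    E (comp b) + E (T ∸ comp b) ∎))))

-- Removing 2, 3, 4 or 5 from n is no better than removing 1 that many times.

small-summand : ∀ {a b} → 1 ≤ a → a < 6 → 1 ≤ b → suc (comp (pred a + b)) ≤ comp a + comp b
small-summand {a} {b} 1≤a a<6 1≤b = ≤-trans (lem a 1≤a) (+-monoˡ-≤ (comp b) (a≤comp a<6))
  where
  lem : ∀ a → 1 ≤ a → suc (comp (pred a + b)) ≤ a + comp b
  lem (suc zero)    _ = ≤-refl
  lem (suc (suc a)) _ = s≤s (≤-trans (comp-suc (≤-trans 1≤b (m≤n+m b a))) (lem (suc a) (s≤s z≤n)))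

-- `x` stands for the entry left by the algorithm. A sum that the algorithm does not examine either
-- costs more than ‖n-1‖ or has a summand below 6; in both cases adding 1 to n-1 is no worse.
comp-characterised : ∀ {n x} → 2 ≤ n → comp n ≤ x → x ≤ suc (comp (n ∸ 1)) →
  (∀ a b → 2 ≤ a → a ≤ b → a * b ≡ n → x ≤ comp a + comp b) →
  (∀ k → 6 ≤ k → k ≤ kMax n (comp (n ∸ 1)) → x ≤ comp k + comp (n ∸ k)) →
  x ≡ comp n
comp-characterised {n} {x} 2≤n c≤x x≤1+ x≤products x≤sums = ≤-antisym x≤c c≤x
  where
  T : ℕ
  T = comp (n ∸ 1)
  sums′ : ∀ a b → 1 ≤ a → a ≤ b → a + b ≡ n → x ≤ comp a + comp b
  sums′ a b 1≤a a≤b a+b≡n with a <? 6 | comp a + comp b ≤? T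
  ... | yes a<6 | _ = ≤-trans x≤1+ (≤-trans (≤-reflexive (cong (suc ∘ comp) (trans (cong (_∸ 1) (sym a+b≡n)) (lem 1≤a))))
    (small-summand 1≤a a<6 (≤-trans 1≤a a≤b)))
    where
    lem : ∀ {a} → 1 ≤ a → a + b ∸ 1 ≡ pred a + b
    lem {suc _} _ = refl
  ... | no a≮6 | yes c≤T = subst (λ y → x ≤ comp a + comp y) (trans (cong (_∸ a) (sym a+b≡n)) (m+n∸m≡n a b))
    (x≤sums a (≮⇒≥ a≮6) (summand≤kMax T 1≤a a≤b a+b≡n c≤T))
  ... | no _ | no c≰T = ≤-trans x≤1+ (≰⇒> c≰T)
  x≤c : x ≤ comp n
  x≤c with comp-split 2≤n
  ... | inj₁ (a , b , 1≤a , 1≤b , eq , le) with ≤-total a b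
  ...   | inj₁ a≤b = ≤-trans (sums′ a b 1≤a a≤b eq) le
  ...   | inj₂ b≤a = ≤-trans (sums′ b a 1≤b b≤a (trans (+-comm b a) eq)) (≤-trans (≤-reflexive (+-comm (comp b) (comp a))) le)
  x≤c | inj₂ (a , b , 2≤a , 2≤b , eq , le) with ≤-total a b
  ...   | inj₁ a≤b = ≤-trans (x≤products a b 2≤a a≤b eq) le
  ...   | inj₂ b≤a = ≤-trans (x≤products b a 2≤b b≤a (trans (*-comm b a) eq)) (≤-trans (≤-reflexive (+-comm (comp b) (comp a))) le)

-- Complexity, kMax and binary logarithms

-- Horner's scheme in base 2: after the leading digit, each doubling costs 2 and each nonzero digit
-- 1. The integer 1 is excluded because its complexity is 1 and not 0.
comp≤3log : ∀ k {n} → 2 ≤ n → n < 2 ^ suc k → comp n ≤ 3 * k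
comp≤3log zero    2≤n n<2 = contradiction 2≤n (<⇒≱ n<2)
comp≤3log (suc k) {n} 2≤n n< with n <? 4
... | yes n<4 = ≤-trans (comp≤n (<⇒≤ 2≤n)) (≤-trans (s≤s⁻¹ n<4) (m≤m*n 3 (suc k)))
... | no n≮4 = begin
  comp n ≡⟨ cong comp (m≡m%n+[m/n]*n n 2) ⟩
  comp (n % 2 + n / 2 * 2) ≤⟨ step (m%n<n n 2) ⟩
  3 + comp (n / 2) ≤⟨ +-monoʳ-≤ 3 (comp≤3log k 2≤n/2 (m<n*o⇒m/o<n (subst (n <_) (*-comm 2 (2 ^ suc k)) n<))) ⟩
  3 + 3 * k ≡⟨ *-suc 3 k ⟨
  3 * suc k ∎
  where
  2≤n/2 : 2 ≤ n / 2
  2≤n/2 = /-monoˡ-≤ 2 (≮⇒≥ n≮4)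
  1≤n/2 : 1 ≤ n / 2
  1≤n/2 = <⇒≤ 2≤n/2
  double : comp (n / 2 * 2) ≤ 2 + comp (n / 2)
  double = ≤-trans (comp-* 1≤n/2 (s≤s z≤n)) (≤-trans (+-monoʳ-≤ _ (comp≤n (s≤s z≤n))) (≤-reflexive (+-comm (comp (n / 2)) 2)))
  step : ∀ {r} → r < 2 → comp (r + n / 2 * 2) ≤ 3 + comp (n / 2)
  step {zero}        _ = m≤n⇒m≤1+n double
  step {suc zero}    _ = ≤-trans (comp-suc (*-mono-≤ 1≤n/2 (s≤s (z≤n {1})))) (s≤s double)
  step {suc (suc _)} (s≤s (s≤s ()))

floor-log : ∀ n → 1 ≤ n → ∃ λ k → 2 ^ k ≤ n × n < 2 ^ suc k
floor-log 1 _ = 0 , from-yes (1 ≤? 1) , from-yes (1 <? 2)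
floor-log (suc (suc n)) _ with floor-log (suc n) (s≤s z≤n)
... | k , lo , hi with suc (suc n) <? 2 ^ suc k
...   | yes lt = k , m≤n⇒m≤1+n lo , lt
...   | no ≮  = suc k , ≮⇒≥ ≮ , ≤-trans (s≤s hi) (+-mono-≤ (m^n>0 2 (suc k)) (≤-reflexive (sym (+-identityʳ _))))

E[comp]≤3^ : ∀ {k n} → 1 ≤ n → n < 2 ^ suc k → E (comp n) ≤ 3 ^ k
E[comp]≤3^ {k} {1} _ _ = subst (λ c → E c ≤ 3 ^ k) (sym comp-1) (m^n>0 3 k)
E[comp]≤3^ {k} {suc (suc n)} _ n< = ≤-trans (E-mono (comp≤3log k (s≤s (s≤s z≤n)) n<)) (≤-reflexive (E-3* k))

E[comp]≤n² : ∀ {n} → 1 ≤ n → E (comp n) ≤ n * n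
E[comp]≤n² {n} 1≤n with floor-log n 1≤n
... | k , lo , hi = begin
  E (comp n)    ≤⟨ E[comp]≤3^ {k} 1≤n hi ⟩
  3 ^ k         ≤⟨ ^-monoˡ-≤ k (from-yes (3 ≤? 4)) ⟩
  (2 * 2) ^ k   ≡⟨ ^-distribʳ-* k 2 2 ⟩
  2 ^ k * 2 ^ k ≤⟨ *-mono-≤ lo lo ⟩
  n * n         ∎

search+search≤ : ∀ n T → search n T (T / 2) + search n T (T / 2) ≤ T
search+search≤ n T = ≤-trans (+-mono-≤ (search-≤ n T (T / 2)) (search-≤ n T (T / 2))) (m/2+m/2≤m T)

kMax² : ∀ n T → kMax n T * kMax n T ≤ E T
kMax² n T = ≤-trans (E-* s s) (E-mono (search+search≤ n T))
  where
  s : ℕ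
  s = search n T (T / 2)

-- By `kMax²`, kMax(n)² ≤ E(‖n-1‖) ≤ (n-1)². Hence the loops over k read only entries of positive
-- integers below n.
kMax<n : ∀ {n} → 2 ≤ n → kMax n (comp (n ∸ 1)) < n
kMax<n {suc n} (s≤s 1≤n) = s≤s (≮⇒≥ λ n<κ → <⇒≱ (*-mono-< n<κ n<κ) (≤-trans (kMax² (suc n) (comp n)) (E[comp]≤n² 1≤n)))

-- At the stopping point s one has s ≤ T - s, hence n ≤ 2 E(T - s), and E(s) E(T - s) ≤ E(T). The
-- stop at 0 is separate because `search` ends there without a test.
kMax*n≤ : ∀ {n} T → n ≤ suc (E T) → kMax n T * n ≤ 2 * E T
kMax*n≤ {n} T n≤ = lem (search-stops n T (T / 2))
  where
  s : ℕ
  s = search n T (T / 2)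
  s≤T∸s : s ≤ T ∸ s
  s≤T∸s = m+n≤o⇒n≤o∸m s (search+search≤ n T)
  s≤T : s ≤ T
  s≤T = ≤-trans (m≤m+n s s) (search+search≤ n T)
  lem : s ≡ 0 ⊎ n ≤ E s + E (T ∸ s) → E s * n ≤ 2 * E T
  lem (inj₁ s≡0) = begin
    E s * n     ≡⟨ cong (λ t → E t * n) s≡0 ⟩
    n + 0       ≡⟨ +-identityʳ n ⟩
    n           ≤⟨ n≤ ⟩
    1 + E T     ≤⟨ +-mono-≤ (1≤E T) (m≤m+n (E T) 0) ⟩
    2 * E T     ∎
  lem (inj₂ n≤′) = begin
    E s * n                   ≤⟨ *-monoʳ-≤ (E s) (≤-trans n≤′ (+-monoˡ-≤ _ (E-mono s≤T∸s))) ⟩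
    E s * (E (T ∸ s) + E (T ∸ s)) ≡⟨ eq (E s) (E (T ∸ s)) ⟩
    2 * (E s * E (T ∸ s))     ≤⟨ *-monoʳ-≤ 2 (E-* s (T ∸ s)) ⟩
    2 * E (s + (T ∸ s))       ≡⟨ cong (λ t → 2 * E t) (m+[n∸m]≡n s≤T) ⟩
    2 * E T                   ∎
    where
    eq : ∀ x y → x * (y + y) ≡ 2 * (x * y)
    eq = solve-∀

-- kMax(n) with T = ‖n−1‖; the value at 0 is arbitrary.

κ : ℕ → ℕ
κ zero    = 0
κ (suc n) = kMax (suc n) (comp n)

κ*n≤ : ∀ n → κ (suc n) * suc n ≤ 2 * E (comp n)
κ*n≤ zero    = kMax*n≤ (comp 0) (s≤s z≤n)
κ*n≤ (suc n) = kMax*n≤ (comp (suc n)) (s≤s (n≤E[comp] (s≤s z≤n)))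

-- With 2^k ≤ n-1 < 2^(k+1) the product κ(n) n is at most 2 · 3^k. Passing from k to K multiplies
-- the left side by 2^(K-k) and the right side by 3^(K-k).
κ-bound : ∀ {n} K → 2 ≤ n → n ≤ 2 ^ suc K → κ n * 2 ^ K ≤ 2 * 3 ^ K
κ-bound {suc n} K (s≤s 1≤n) n≤ with floor-log n 1≤n
... | k , lo , hi = begin
  κ (suc n) * 2 ^ K ≡⟨ cong (λ x → κ (suc n) * 2 ^ x) (m+[n∸m]≡n k≤K) ⟨
  κ (suc n) * 2 ^ (k + (K ∸ k)) ≡⟨ cong (κ (suc n) *_) (^-distribˡ-+-* 2 k (K ∸ k)) ⟩
  κ (suc n) * (2 ^ k * 2 ^ (K ∸ k)) ≡⟨ *-assoc (κ (suc n)) (2 ^ k) (2 ^ (K ∸ k)) ⟨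
  κ (suc n) * 2 ^ k * 2 ^ (K ∸ k) ≤⟨ *-mono-≤ (*-monoʳ-≤ (κ (suc n)) (m≤n⇒m≤1+n lo)) (^-monoˡ-≤ (K ∸ k) (from-yes (2 ≤? 3))) ⟩
  κ (suc n) * suc n * 3 ^ (K ∸ k) ≤⟨ *-monoˡ-≤ (3 ^ (K ∸ k)) (≤-trans (κ*n≤ n) (*-monoʳ-≤ 2 (E[comp]≤3^ {k} 1≤n hi))) ⟩
  2 * 3 ^ k * 3 ^ (K ∸ k) ≡⟨ *-assoc 2 (3 ^ k) (3 ^ (K ∸ k)) ⟩
  2 * (3 ^ k * 3 ^ (K ∸ k)) ≡⟨ cong (2 *_) (^-distribˡ-+-* 3 k (K ∸ k)) ⟨
  2 * 3 ^ (k + (K ∸ k)) ≡⟨ cong (λ x → 2 * 3 ^ x) (m+[n∸m]≡n k≤K) ⟩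
  2 * 3 ^ K ∎
  where
  k≤K : k ≤ K
  k≤K = ≮⇒≥ λ K<k → <⇒≱ (s≤s (≤-trans (^-monoʳ-≤ 2 K<k) lo)) n≤

-- Finite sums

Σ< : ℕ → (ℕ → ℕ) → ℕ
Σ< zero    f = 0
Σ< (suc n) f = Σ< n f + f n

Σ<-mono : ∀ n {f g} → (∀ i → i < n → f i ≤ g i) → Σ< n f ≤ Σ< n g
Σ<-mono zero    _   = z≤n
Σ<-mono (suc n) f≤g = +-mono-≤ (Σ<-mono n (λ i i<n → f≤g i (m≤n⇒m≤1+n i<n))) (f≤g n ≤-refl)

Σ<-cong : ∀ n {f g} → (∀ i → f i ≡ g i) → Σ< n f ≡ Σ< n g
Σ<-cong zero    _   = refl
Σ<-cong (suc n) f≡g = cong₂ _+_ (Σ<-cong n f≡g) (f≡g n)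

Σ<-monoˡ : ∀ {m n} f → m ≤ n → Σ< m f ≤ Σ< n f
Σ<-monoˡ {m} {zero}  f z≤n = ≤-refl
Σ<-monoˡ {m} {suc n} f m≤ with m≤n⇒m<n∨m≡n m≤
... | inj₁ m<    = ≤-trans (Σ<-monoˡ f (s≤s⁻¹ m<)) (m≤m+n _ _)
... | inj₂ refl = ≤-refl

Σ<-+ : ∀ n f g → Σ< n (λ i → f i + g i) ≡ Σ< n f + Σ< n g
Σ<-+ zero    f g = refl
Σ<-+ (suc n) f g = trans (cong (_+ (f n + g n)) (Σ<-+ n f g)) (lem (Σ< n f) (Σ< n g) (f n) (g n))
  where
  lem : ∀ a b c d → a + b + (c + d) ≡ a + c + (b + d)
  lem = solve-∀

Σ<-* : ∀ c n f → c * Σ< n f ≡ Σ< n (λ i → c * f i)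
Σ<-* c zero    f = *-zeroʳ c
Σ<-* c (suc n) f = trans (*-distribˡ-+ c (Σ< n f) (f n)) (cong (_+ c * f n) (Σ<-* c n f))

Σ<-const : ∀ n c → Σ< n (λ _ → c) ≡ n * c
Σ<-const zero    c = refl
Σ<-const (suc n) c = trans (+-comm _ c) (cong (c +_) (Σ<-const n c))

Σ<-append : ∀ m n f → Σ< (m + n) f ≡ Σ< m f + Σ< n (λ i → f (m + i))
Σ<-append m zero    f = trans (cong (λ k → Σ< k f) (+-identityʳ m)) (sym (+-identityʳ _))
Σ<-append m (suc n) f = begin-equality
  Σ< (m + suc n) f                                  ≡⟨ cong (λ k → Σ< k f) (+-suc m n) ⟩
  Σ< (m + n) f + f (m + n)                          ≡⟨ cong (_+ f (m + n)) (Σ<-append m n f) ⟩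
  Σ< m f + Σ< n (λ i → f (m + i)) + f (m + n)       ≡⟨ +-assoc (Σ< m f) _ _ ⟩
  Σ< m f + (Σ< n (λ i → f (m + i)) + f (m + n))     ∎

Σ<-head : ∀ n f → Σ< (suc n) f ≡ f 0 + Σ< n (f ∘ suc)
Σ<-head n f = Σ<-append 1 n f

Σ<-classes : ∀ a n f → Σ< (a * n) f ≡ Σ< a (λ i → Σ< n (λ k → f (a * k + i)))
Σ<-classes a zero    f = trans (cong (λ k → Σ< k f) (*-zeroʳ a)) (sym (trans (Σ<-const a 0) (*-zeroʳ a)))
Σ<-classes a (suc n) f = begin-equality
  Σ< (a * suc n) f                                ≡⟨ cong (λ k → Σ< k f) (trans (*-suc a n) (+-comm a (a * n))) ⟩
  Σ< (a * n + a) f                                ≡⟨ Σ<-append (a * n) a f ⟩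
  Σ< (a * n) f + Σ< a (λ i → f (a * n + i))       ≡⟨ cong (_+ Σ< a (λ i → f (a * n + i))) (Σ<-classes a n f) ⟩
  Σ< a (λ i → Σ< n (λ k → f (a * k + i))) + Σ< a (λ i → f (a * n + i)) ≡⟨ Σ<-+ a _ _ ⟨
  Σ< a (λ i → Σ< (suc n) (λ k → f (a * k + i)))   ∎

1≤^ : ∀ {x} n → 1 ≤ x → 1 ≤ x ^ n
1≤^ {x} n 1≤x = m^n>0 x {{>-nonZero 1≤x}} n

-- The average of 3^(‖n‖/3)

-- root / unit exceeds the cube root of 3, and θ c is unit · 3^(c/3), rounded up.

opaque
  unit root : ℕ
  unit = 10000
  root = 14423

  1≤unit : 1 ≤ unit
  1≤unit = from-yes (1 ≤? 10000)

θ : ℕ → ℕ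
θ 0                   = 10000
θ 1                   = 14423
θ 2                   = 20801
θ (suc (suc (suc c))) = 3 * θ c

opaque
  unfolding unit root

  θ-suc : ∀ c → unit * θ (suc c) ≤ root * θ c
  θ-suc 0 = ≤-refl
  θ-suc 1 = from-yes (10000 * 20801 ≤? 14423 * 14423)
  θ-suc 2 = from-yes (10000 * 30000 ≤? 14423 * 20801)
  θ-suc (suc (suc (suc c))) = begin
    unit * (3 * θ (suc c)) ≡⟨ lem (θ (suc c)) unit ⟩
    3 * (unit * θ (suc c)) ≤⟨ *-monoʳ-≤ 3 (θ-suc c) ⟩
    3 * (root * θ c)       ≡⟨ lem (θ c) root ⟨
    root * (3 * θ c)       ∎
    where
    lem : ∀ x d → d * (3 * x) ≡ 3 * (d * x)
    lem = solve-∀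

θ-+ : ∀ d c → unit ^ d * θ (d + c) ≤ root ^ d * θ c
θ-+ zero    c = ≤-refl
θ-+ (suc d) c = begin
  unit * unit ^ d * θ (suc (d + c))   ≡⟨ lem₁ (unit ^ d) (θ (suc (d + c))) unit ⟩
  unit ^ d * (unit * θ (suc (d + c))) ≤⟨ *-monoʳ-≤ (unit ^ d) (θ-suc (d + c)) ⟩
  unit ^ d * (root * θ (d + c))       ≡⟨ lem₂ (unit ^ d) (θ (d + c)) root ⟩
  root * (unit ^ d * θ (d + c))       ≤⟨ *-monoʳ-≤ root (θ-+ d c) ⟩
  root * (root ^ d * θ c)             ≡⟨ *-assoc root (root ^ d) (θ c) ⟨
  root * root ^ d * θ c               ∎
  where
  lem₁ : ∀ p x k → k * p * x ≡ p * (k * x)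
  lem₁ = solve-∀
  lem₂ : ∀ p x k → p * (k * x) ≡ k * (p * x)
  lem₂ = solve-∀

θ-mono-suc : ∀ c → θ c ≤ θ (suc c)
θ-mono-suc 0 = from-yes (10000 ≤? 14423)
θ-mono-suc 1 = from-yes (14423 ≤? 20801)
θ-mono-suc 2 = from-yes (20801 ≤? 30000)
θ-mono-suc (suc (suc (suc c))) = *-monoʳ-≤ 3 (θ-mono-suc c)

θ-mono : ∀ {c d} → c ≤ d → θ c ≤ θ d
θ-mono {c} {zero}  z≤n = ≤-refl
θ-mono {c} {suc d} c≤ with m≤n⇒m<n∨m≡n c≤
... | inj₁ c<   = ≤-trans (θ-mono (s≤s⁻¹ c<)) (θ-mono-suc d)
... | inj₂ refl = ≤-refl

opaque
  unfolding unit

  E≤θ : ∀ c → unit * E c ≤ θ c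
  E≤θ 0 = from-yes (10000 ≤? 10000)
  E≤θ 1 = from-yes (10000 ≤? 14423)
  E≤θ 2 = from-yes (20000 ≤? 20801)
  E≤θ 3 = from-yes (30000 ≤? 30000)
  E≤θ 4 = from-yes (40000 ≤? 43269)
  E≤θ (suc (suc (suc k@(suc (suc i))))) = begin
    unit * E (5 + i)       ≡⟨ cong (10000 *_) (E-3+ i) ⟩
    unit * (3 * E (2 + i)) ≡⟨ lem 10000 (E (2 + i)) ⟩
    3 * (unit * E (2 + i)) ≤⟨ *-monoʳ-≤ 3 (E≤θ k) ⟩
    3 * θ (2 + i)           ∎
    where
    lem : ∀ d x → d * (3 * x) ≡ 3 * (d * x)
    lem = solve-∀

-- For n ≡ v (mod 36) write n = a m + r with a = divisor v ∈ {2, 3} and 0 ≤ r < a;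
-- then ‖n‖ ≤ ‖m‖ + a + r.  The weights are an approximate eigenvector of the resulting
-- transfer operator on the classes mod 36, for the growth exponent 20/9.

divisors-1 : List ℕ
divisors-1 =
  1 ∷ 1 ∷ 1 ∷ 2 ∷ 1 ∷ 1 ∷ 1 ∷ 1 ∷ 1 ∷ 2 ∷ 2 ∷ 2 ∷ 1 ∷ 1 ∷ 1 ∷ 2 ∷ 1 ∷ 1 ∷
  2 ∷ 2 ∷ 1 ∷ 2 ∷ 1 ∷ 1 ∷ 1 ∷ 1 ∷ 1 ∷ 2 ∷ 1 ∷ 1 ∷ 2 ∷ 2 ∷ 1 ∷ 2 ∷ 1 ∷ 1 ∷ []

weights : List ℕ
weights =
  2164 ∷ 3121 ∷ 3121 ∷ 3121 ∷ 3032 ∷ 4374 ∷ 3121 ∷ 4502 ∷ 3712 ∷ 2791 ∷ 4026 ∷ 5806 ∷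
  2845 ∷ 4103 ∷ 4103 ∷ 4103 ∷ 3748 ∷ 5405 ∷ 2644 ∷ 3814 ∷ 3617 ∷ 3814 ∷ 5216 ∷ 7523 ∷
  3200 ∷ 4615 ∷ 4615 ∷ 3363 ∷ 4010 ∷ 5784 ∷ 4265 ∷ 6151 ∷ 4807 ∷ 6151 ∷ 6933 ∷ 10000 ∷ []

entry : List ℕ → ℕ → ℕ
entry []       _       = 0
entry (x ∷ xs) zero    = x
entry (x ∷ xs) (suc i) = entry xs i

-- The table holds the divisors minus 1, so that `divisor v` is visibly nonzero.
divisor : ℕ → ℕ
divisor v = suc (entry divisors-1 (v % 36))

-- Classes are normally represented by 36 to 71. A representative below 36 has one further member,
-- namely itself, and the extra 1 in its weight pays for that term.
weight : ℕ → ℕ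
weight v = entry weights (v % 36) + (if v <ᵇ 36 then 1 else 0)

-- ratio a ≥ 10⁴ a^(−20/9)

ratio : ℕ → ℕ
ratio 2 = 2144
ratio _ = 872

-- If n ≡ v mod 36 and n = a m + r, then m is determined mod 36/a, so it lies in one of the a
-- classes `v / a + 36 / a * i` mod 36. The field `weights≤` is the eigenvector inequality for this
-- step: `root ^ (a + v % a)` pays for the a + r additional ones, and `ratio a` for the shrinking of
-- K^(20/9) when K is divided by a.
record Contracts (v a : ℕ) .{{_ : NonZero a}} : Set where
  constructor contraction
  field
    weights≤ : root ^ (a + v % a) * (ratio a * Σ< a (λ i → weight (v / a + 36 / a * i)))
             ≤ unit ^ (a + v % a) * (unit * weight v)
    ratio≥   : unit ^ 9 ≤ ratio a ^ 9 * a ^ 20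
    a∣36     : a * (36 / a) ≡ 36
    1<a      : 1 < a
    a≤3      : a ≤ 3
    1≤weight : 1 ≤ weight v

contracts? : ∀ v a .{{_ : NonZero a}} → Dec (Contracts v a)
contracts? v a = map′ (λ (p , q , r , s , t , u) → contraction p q r s t u) (λ (contraction p q r s t u) → p , q , r , s , t , u)
  ((_ ≤? _) ×-dec (_ ≤? _) ×-dec (_ ≟ _) ×-dec (_ <? _) ×-dec (_ ≤? _) ×-dec (_ ≤? _))

opaque
  unfolding unit root

  contracts : ∀ {v} → v < 36 → Contracts (v + 36) (divisor (v + 36))
  contracts = from-yes (allUpTo? (λ v → contracts? (v + 36) (divisor (v + 36))) 36)

weight-small : ∀ {v} → v < 36 → weight v ≡ weight (v + 36) + 1
weight-small = from-yes (allUpTo? (λ v → weight v ≟ weight (v + 36) + 1) 36)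

-- 143 = 36 · 2 + 35 + 36 is the largest integer in a class sum of three terms with representative
-- below 72, and 3 is the number of terms. This covers the sums where the recursion ends.
K₀-spec : ∃ λ K → 1 ≤ K × (∀ {n} → 1 ≤ n → n ≤ 143 → 3 * θ (comp n) ≤ K)
K₀-spec = bound 143 , ≤-trans (1≤θ 143) (m≤n*m (θ 143) 3) , λ 1≤n n≤ → *-monoʳ-≤ 3 (θ-mono (≤-trans (comp≤n 1≤n) n≤))
  where
  bound : ℕ → ℕ
  bound n = 3 * θ n
  1≤θ : ∀ c → 1 ≤ θ c
  1≤θ c = ≤-trans (from-yes (1 ≤? 10000)) (θ-mono {0} {c} z≤n)

opaque
  K₀ : ℕ
  K₀ = proj₁ K₀-spec

  1≤K₀ : 1 ≤ K₀
  1≤K₀ = proj₁ (proj₂ K₀-spec)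

  3θ[comp]≤K₀ : ∀ {n} → 1 ≤ n → n ≤ 143 → 3 * θ (comp n) ≤ K₀
  3θ[comp]≤K₀ = proj₂ (proj₂ K₀-spec)

θ[comp]≤K₀ : ∀ {n} → 1 ≤ n → n ≤ 143 → θ (comp n) ≤ K₀
θ[comp]≤K₀ {n} 1≤n n≤ = ≤-trans (m≤n*m (θ (comp n)) 3) (3θ[comp]≤K₀ 1≤n n≤)

-- Sums over residue classes mod 36

classSum : ℕ → ℕ → ℕ
classSum v K = Σ< (suc K) (λ k → θ (comp (36 * k + v)))

-- Passing to v + 36 makes all members at least 36, so that division by 2 or 3 leaves positive
-- quotients. Only the first term is treated apart.
classSum-shift : ∀ v K → classSum v K ≤ θ (comp v) + classSum (v + 36) K
classSum-shift v K = begin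
  classSum v K ≡⟨ Σ<-head K _ ⟩
  θ (comp v) + Σ< K (λ k → θ (comp (36 * suc k + v))) ≤⟨ +-monoʳ-≤ (θ (comp v)) (Σ<-monoˡ _ (n≤1+n K)) ⟩
  θ (comp v) + Σ< (suc K) (λ k → θ (comp (36 * suc k + v))) ≡⟨ cong (θ (comp v) +_) (Σ<-cong (suc K) (λ k → cong (θ ∘ comp) (lem k v))) ⟩
  θ (comp v) + classSum (v + 36) K ∎
  where
  lem : ∀ k v → 36 * suc k + v ≡ 36 * k + (v + 36)
  lem = solve-∀

comp-divide : ∀ a m r → 1 ≤ a → 1 ≤ m → comp (a * m + r) ≤ a + r + comp m
comp-divide a m zero    1≤a 1≤m = begin
  comp (a * m + 0)  ≡⟨ cong comp (+-identityʳ (a * m)) ⟩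
  comp (a * m)      ≤⟨ comp-* 1≤a 1≤m ⟩
  comp a + comp m   ≤⟨ +-monoˡ-≤ (comp m) (comp≤n 1≤a) ⟩
  a + comp m        ≡⟨ cong (_+ comp m) (+-identityʳ a) ⟨
  a + 0 + comp m    ∎
comp-divide a m (suc r) 1≤a 1≤m = begin
  comp (a * m + suc r)   ≡⟨ cong comp (+-suc (a * m) r) ⟩
  comp (suc (a * m + r)) ≤⟨ comp-suc (≤-trans (*-mono-≤ 1≤a 1≤m) (m≤m+n _ r)) ⟩
  suc (comp (a * m + r)) ≤⟨ s≤s (comp-divide a m r 1≤a 1≤m) ⟩
  suc (a + r + comp m)   ≡⟨ cong (_+ comp m) (+-suc a r) ⟨
  a + suc r + comp m     ∎

Σ<-suc≤ : ∀ K a .{{_ : NonZero a}} f → Σ< (suc K) f ≤ Σ< (a * suc (K / a)) f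
Σ<-suc≤ K a f = Σ<-monoˡ f (begin
  suc K                         ≡⟨ cong suc (m≡m%n+[m/n]*n K a) ⟩
  suc (K % a) + K / a * a       ≤⟨ +-monoˡ-≤ (K / a * a) (m%n<n K a) ⟩
  suc (K / a) * a               ≡⟨ *-comm (suc (K / a)) a ⟩
  a * suc (K / a)               ∎)

-- The index is written as a k + i. By `digits`, the quotient of 36 (a k + i) + v by a is the k-th
-- member of the i-th child class, with k ≤ K / a.
classSum-step : ∀ v K a .{{_ : NonZero a}} → 36 ≤ v → a ≤ 3 → a * (36 / a) ≡ 36 →
  unit ^ (a + v % a) * classSum v K ≤ root ^ (a + v % a) * Σ< a (λ i → classSum (v / a + 36 / a * i) (K / a))
classSum-step v K a 36≤v a≤3 a∣36 = begin
  D * classSum v K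
    ≤⟨ *-monoʳ-≤ D (Σ<-suc≤ K a _) ⟩
  D * Σ< (a * suc (K / a)) (λ k → θ (comp (36 * k + v)))
    ≡⟨ cong (D *_) (Σ<-classes a (suc (K / a)) _) ⟩
  D * Σ< a (λ i → Σ< (suc (K / a)) (λ k → θ (comp (36 * (a * k + i) + v))))
    ≡⟨ Σ<-* D a _ ⟩
  Σ< a (λ i → D * Σ< (suc (K / a)) (λ k → θ (comp (36 * (a * k + i) + v))))
    ≤⟨ Σ<-mono a (λ i i<a → class i) ⟩
  Σ< a (λ i → root ^ d * classSum (v / a + 36 / a * i) (K / a))
    ≡⟨ Σ<-* (root ^ d) a _ ⟨
  root ^ d * Σ< a (λ i → classSum (v / a + 36 / a * i) (K / a)) ∎
  where
  d D : ℕ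
  d = a + v % a
  D = unit ^ d
  1≤v/a : 1 ≤ v / a
  1≤v/a = m≥n⇒m/n>0 {v} {a} (≤-trans a≤3 (≤-trans (from-yes (3 ≤? 36)) 36≤v))
  digits : ∀ i k → 36 * (a * k + i) + v ≡ a * (36 * k + (v / a + 36 / a * i)) + v % a
  digits i k = begin-equality
    36 * (a * k + i) + v
      ≡⟨ cong₂ (λ x y → x * (a * k + i) + y) (sym a∣36) (m≡m%n+[m/n]*n v a) ⟩
    a * (36 / a) * (a * k + i) + (v % a + v / a * a)
      ≡⟨ lem a (36 / a) k i (v % a) (v / a) ⟩
    a * (a * (36 / a) * k + (v / a + 36 / a * i)) + v % a
      ≡⟨ cong (λ x → a * (x * k + (v / a + 36 / a * i)) + v % a) a∣36 ⟩
    a * (36 * k + (v / a + 36 / a * i)) + v % a ∎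
    where
    lem : ∀ a q k i r u → a * q * (a * k + i) + (r + u * a) ≡ a * (a * q * k + (u + q * i)) + r
    lem = solve-∀
  class : ∀ i → D * Σ< (suc (K / a)) (λ k → θ (comp (36 * (a * k + i) + v)))
                ≤ root ^ d * classSum (v / a + 36 / a * i) (K / a)
  class i = begin
    D * Σ< (suc (K / a)) (λ k → θ (comp (36 * (a * k + i) + v)))
      ≡⟨ Σ<-* D (suc (K / a)) _ ⟩
    Σ< (suc (K / a)) (λ k → D * θ (comp (36 * (a * k + i) + v)))
      ≤⟨ Σ<-mono (suc (K / a)) (λ k _ → ≤-trans
           (*-monoʳ-≤ D (θ-mono (subst (λ n → comp n ≤ d + comp (m k)) (sym (digits i k))
             (comp-divide a (m k) (v % a) (>-nonZero⁻¹ a) (≤-trans 1≤v/a (≤-trans (m≤m+n _ _) (m≤n+m _ (36 * k))))))))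
           (θ-+ d (comp (m k)))) ⟩
    Σ< (suc (K / a)) (λ k → root ^ d * θ (comp (m k)))
      ≡⟨ Σ<-* (root ^ d) (suc (K / a)) _ ⟨
    root ^ d * classSum (v / a + 36 / a * i) (K / a) ∎
    where
    m : ℕ → ℕ
    m k = 36 * k + (v / a + 36 / a * i)

^9-cancel-≤ : ∀ {x y} → x ^ 9 ≤ y ^ 9 → x ≤ y
^9-cancel-≤ le = ≮⇒≥ λ y<x → <⇒≱ (^-monoˡ-< 9 y<x) le

-- The hypothesis says that g / q ≥ K₀ K^(20/9).

Bound : ℕ → ℕ → ℕ → ℕ → Set
Bound v K q g = (q * K₀) ^ 9 * K ^ 20 ≤ g ^ 9 → q * classSum v K ≤ weight v * g

q*K₀≤g : ∀ {K} q g → 1 ≤ K → (q * K₀) ^ 9 * K ^ 20 ≤ g ^ 9 → q * K₀ ≤ g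
q*K₀≤g {K} q g 1≤K hyp = ^9-cancel-≤ (≤-trans (m≤m*n _ (K ^ 20) {{>-nonZero (1≤^ 20 1≤K)}}) hyp)

classSum-base : ∀ v K q g → 1 ≤ K → K < 3 → v < 36 → 1 ≤ weight (v + 36) → Bound (v + 36) K q g
classSum-base v K q g 1≤K K<3 v<36 1≤w hyp = begin
  q * classSum (v + 36) K ≤⟨ *-monoʳ-≤ q (*-cancelˡ-≤ 3 thrice) ⟩
  q * K₀                  ≤⟨ q*K₀≤g q g 1≤K hyp ⟩
  g                       ≤⟨ m≤n*m g (weight (v + 36)) {{>-nonZero 1≤w}} ⟩
  weight (v + 36) * g     ∎
  where
  pos : ∀ k → 1 ≤ 36 * k + (v + 36)
  pos k = ≤-trans (≤-trans (s≤s z≤n) (m≤n+m 36 v)) (m≤n+m _ (36 * k))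
  small : ∀ {k} → k < 3 → 36 * k + (v + 36) ≤ 143
  small k<3 = +-mono-≤ (*-monoʳ-≤ 36 (s≤s⁻¹ k<3)) (+-monoˡ-≤ 36 (s≤s⁻¹ v<36))
  thrice : 3 * classSum (v + 36) K ≤ 3 * K₀
  thrice = begin
    3 * classSum (v + 36) K ≤⟨ *-monoʳ-≤ 3 (Σ<-monoˡ {suc K} {3} _ K<3) ⟩
    3 * classSum (v + 36) 2 ≡⟨ Σ<-* 3 3 (λ k → θ (comp (36 * k + (v + 36)))) ⟩
    Σ< 3 (λ k → 3 * θ (comp (36 * k + (v + 36)))) ≤⟨ Σ<-mono 3 (λ k k<3 → 3θ[comp]≤K₀ (pos k) (small k<3)) ⟩
    Σ< 3 (λ _ → K₀)         ≡⟨ Σ<-const 3 K₀ ⟩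
    3 * K₀                  ∎

-- g / q is multiplied by p / unit ≥ a^(-20/9), which matches the passage from K to K / a.
scale-hypothesis : ∀ q g K p a .{{_ : NonZero a}} → unit ^ 9 ≤ p ^ 9 * a ^ 20 →
  (q * K₀) ^ 9 * K ^ 20 ≤ g ^ 9 → (q * unit * K₀) ^ 9 * (K / a) ^ 20 ≤ (g * p) ^ 9
scale-hypothesis q g K p a ratio≥ hyp = begin
  (q * unit * K₀) ^ 9 * (K / a) ^ 20
    ≡⟨ cong (λ x → x ^ 9 * (K / a) ^ 20) (lem q unit K₀) ⟩
  (q * K₀ * unit) ^ 9 * (K / a) ^ 20
    ≡⟨ cong (_* (K / a) ^ 20) (^-distribʳ-* 9 (q * K₀) unit) ⟩
  (q * K₀) ^ 9 * unit ^ 9 * (K / a) ^ 20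
    ≤⟨ *-monoˡ-≤ ((K / a) ^ 20) (*-monoʳ-≤ ((q * K₀) ^ 9) ratio≥) ⟩
  (q * K₀) ^ 9 * (p ^ 9 * a ^ 20) * (K / a) ^ 20
    ≡⟨ lem′ ((q * K₀) ^ 9) (p ^ 9) (a ^ 20) ((K / a) ^ 20) ⟩
  (q * K₀) ^ 9 * ((K / a) ^ 20 * a ^ 20) * p ^ 9
    ≡⟨ cong (λ x → (q * K₀) ^ 9 * x * p ^ 9) (^-distribʳ-* 20 (K / a) a) ⟨
  (q * K₀) ^ 9 * (K / a * a) ^ 20 * p ^ 9
    ≤⟨ *-monoˡ-≤ (p ^ 9) (*-monoʳ-≤ ((q * K₀) ^ 9) (^-monoˡ-≤ 20 (m/n*n≤m K a))) ⟩
  (q * K₀) ^ 9 * K ^ 20 * p ^ 9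
    ≤⟨ *-monoˡ-≤ (p ^ 9) hyp ⟩
  g ^ 9 * p ^ 9
    ≡⟨ ^-distribʳ-* 9 g p ⟨
  (g * p) ^ 9 ∎
  where
  lem : ∀ x y z → x * y * z ≡ x * z * y
  lem = solve-∀
  lem′ : ∀ x y z w → x * (y * z) * w ≡ x * (w * z) * y
  lem′ = solve-∀

-- A child class with representative below 36 is shifted; its first term is at most K₀ ≤ g / q and
-- is absorbed by the extra 1 in its weight.
classSum-child : ∀ u K q g → 1 ≤ u → u < 72 → 1 ≤ K → (∀ v → v < 36 → Bound (v + 36) K q g) → Bound u K q g
classSum-child u K q g 1≤u u<72 1≤K bound hyp with u <? 36
... | no u≮36 = subst (λ x → q * classSum x K ≤ weight x * g) (m∸n+n≡m (≮⇒≥ u≮36))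
  (bound (u ∸ 36) (+-cancelʳ-< 36 (u ∸ 36) 36 (subst (_< 72) (sym (m∸n+n≡m (≮⇒≥ u≮36))) u<72)) hyp)
... | yes u<36 = begin
  q * classSum u K
    ≤⟨ *-monoʳ-≤ q (≤-trans (classSum-shift u K) (+-monoˡ-≤ _ (θ[comp]≤K₀ 1≤u (≤-trans (<⇒≤ u<36) (from-yes (36 ≤? 143)))))) ⟩
  q * (K₀ + classSum (u + 36) K)
    ≡⟨ *-distribˡ-+ q K₀ _ ⟩
  q * K₀ + q * classSum (u + 36) K
    ≤⟨ +-mono-≤ (q*K₀≤g q g 1≤K hyp) (bound u u<36 hyp) ⟩
  g + weight (u + 36) * g
    ≡⟨ cong (_* g) (+-comm 1 (weight (u + 36))) ⟩
  (weight (u + 36) + 1) * g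
    ≡⟨ cong (_* g) (weight-small u<36) ⟨
  weight u * g ∎

-- The transfer step with denominators cleared: `q * unit` and `g * p` are the data with which the
-- children are estimated.
classSum-combine : ∀ v K q g a .{{_ : NonZero a}} p → 36 ≤ v → a ≤ 3 → a * (36 / a) ≡ 36 →
  root ^ (a + v % a) * (p * Σ< a (λ i → weight (v / a + 36 / a * i))) ≤ unit ^ (a + v % a) * (unit * weight v) →
  (∀ i → i < a → q * unit * classSum (v / a + 36 / a * i) (K / a) ≤ weight (v / a + 36 / a * i) * (g * p)) →
  q * classSum v K ≤ weight v * g
classSum-combine v K q g a p 36≤v a≤3 a∣36 contr child =
  *-cancelˡ-≤ (unit ^ d * unit) {{>-nonZero (*-mono-≤ (1≤^ d 1≤unit) 1≤unit)}} (begin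
  unit ^ d * unit * (q * classSum v K)
    ≡⟨ lem₁ (unit ^ d) unit q (classSum v K) ⟩
  q * unit * (unit ^ d * classSum v K)
    ≤⟨ *-monoʳ-≤ (q * unit) (classSum-step v K a 36≤v a≤3 a∣36) ⟩
  q * unit * (root ^ d * Σ< a (λ i → classSum (u i) (K / a)))
    ≡⟨ lem₂ (q * unit) (root ^ d) _ ⟩
  root ^ d * (q * unit * Σ< a (λ i → classSum (u i) (K / a)))
    ≡⟨ cong (root ^ d *_) (Σ<-* (q * unit) a _) ⟩
  root ^ d * Σ< a (λ i → q * unit * classSum (u i) (K / a))
    ≤⟨ *-monoʳ-≤ (root ^ d) (Σ<-mono a child) ⟩
  root ^ d * Σ< a (λ i → weight (u i) * (g * p))
    ≡⟨ cong (root ^ d *_) (trans (Σ<-cong a (λ i → *-comm (weight (u i)) (g * p))) (sym (Σ<-* (g * p) a _))) ⟩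
  root ^ d * (g * p * Σ< a (λ i → weight (u i)))
    ≡⟨ lem₃ (root ^ d) g p (Σ< a (λ i → weight (u i))) ⟩
  root ^ d * (p * Σ< a (λ i → weight (u i))) * g
    ≤⟨ *-monoˡ-≤ g contr ⟩
  unit ^ d * (unit * weight v) * g
    ≡⟨ lem₄ (unit ^ d) unit (weight v) g ⟩
  unit ^ d * unit * (weight v * g) ∎)
  where
  d : ℕ
  d = a + v % a
  u : ℕ → ℕ
  u i = v / a + 36 / a * i
  lem₁ : ∀ x y z w → x * y * (z * w) ≡ z * y * (x * w)
  lem₁ = solve-∀
  lem₂ : ∀ x y z → x * (y * z) ≡ y * (x * z)
  lem₂ = solve-∀
  lem₃ : ∀ x y z w → x * (y * z * w) ≡ x * (z * w) * y
  lem₃ = solve-∀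
  lem₄ : ∀ x y z w → x * (y * z) * w ≡ x * y * (z * w)
  lem₄ = solve-∀

classSum-step-bound : ∀ v a .{{_ : NonZero a}} K q g → v < 36 → 3 ≤ K → Contracts (v + 36) a →
  (∀ v′ → v′ < 36 → Bound (v′ + 36) (K / a) (q * unit) (g * ratio a)) → Bound (v + 36) K q g
classSum-step-bound v a K q g v<36 3≤K (contraction contr ratio≥ a∣36 1<a a≤3 _) bound hyp =
  classSum-combine (v + 36) K q g a (ratio a) (m≤n+m 36 v) a≤3 a∣36 contr
    (λ i i<a → classSum-child (u i) (K / a) (q * unit) (g * ratio a) (1≤u i) (u<72 i i<a)
      (m≥n⇒m/n>0 {K} {a} (≤-trans a≤3 3≤K)) bound (scale-hypothesis q g K (ratio a) a ratio≥ hyp))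
  where
  u : ℕ → ℕ
  u i = (v + 36) / a + 36 / a * i
  1≤u : ∀ i → 1 ≤ u i
  1≤u i = ≤-trans (m≥n⇒m/n>0 {v + 36} {a} (≤-trans a≤3 (≤-trans (from-yes (3 ≤? 36)) (m≤n+m 36 v)))) (m≤m+n _ _)
  -- As a ≥ 2, the quotient of v + 36 ≤ 71 is at most 35, and 36 / a * i is at most 36; so the
  -- children stay within the range that `classSum-child` handles.
  u<72 : ∀ i → i < a → u i < 72
  u<72 i i<a = +-mono-≤ {suc ((v + 36) / a)} {36} {36 / a * i} {36}
    (m<n*o⇒m/o<n {v + 36} {36} {a} (≤-trans (+-monoˡ-< 36 v<36) (*-monoʳ-≤ 36 1<a)))
    (≤-trans (*-monoʳ-≤ (36 / a) (<⇒≤ i<a)) (≤-reflexive (trans (*-comm (36 / a) a) a∣36)))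

-- Induction on a bound `h` for K, since K / a < K. The recursion ends at K < 3, because a ≤ 3 keeps
-- K / a positive as long as K ≥ 3.
classSum-bound : ∀ h v K q g → K ≤ h → 1 ≤ K → v < 36 → Bound (v + 36) K q g
classSum-bound zero    v K q g K≤0 1≤K _ = contradiction (≤-trans 1≤K K≤0) (λ ())
classSum-bound (suc h) v K q g K≤ 1≤K v<36 = by-cases (divisor (v + 36)) (K <? 3) (contracts v<36)
  where
  -- The divisor is generalized to a variable, so that the table behind it is not unfolded.
  by-cases : ∀ a .{{_ : NonZero a}} → Dec (K < 3) → Contracts (v + 36) a → Bound (v + 36) K q g
  by-cases a (yes K<3) c = classSum-base v K q g 1≤K K<3 v<36 (Contracts.1≤weight c)
  by-cases a (no K≮3)  c = classSum-step-bound v a K q g v<36 (≮⇒≥ K≮3) c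
    (λ v′ v′<36 → classSum-bound h v′ (K / a) (q * unit) (g * ratio a)
      (s≤s⁻¹ (≤-trans (m/n<m K a {{>-nonZero 1≤K}} (Contracts.1<a c)) K≤))
      (m≥n⇒m/n>0 {K} {a} (≤-trans (Contracts.a≤3 c) (≮⇒≥ K≮3))) v′<36)

Σ<-weighted : ∀ c q g f w → (∀ v → v < c → q * f v ≤ w v * g) → q * Σ< c f ≤ Σ< c w * g
Σ<-weighted c q g f w le = begin
  q * Σ< c f              ≡⟨ Σ<-* q c f ⟩
  Σ< c (λ v → q * f v)    ≤⟨ Σ<-mono c le ⟩
  Σ< c (λ v → w v * g)    ≡⟨ Σ<-cong c (λ v → *-comm (w v) g) ⟩
  Σ< c (λ v → g * w v)    ≡⟨ Σ<-* g c w ⟨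
  g * Σ< c w              ≡⟨ *-comm g (Σ< c w) ⟩
  Σ< c w * g              ∎

-- The number of classes is a variable here, and the total weight is opaque below, so that
-- neither is ever evaluated in unary.

θ-average-classes : ∀ c → c ≡ 36 → ∀ X q g → 1 ≤ X → (q * K₀) ^ 9 * X ^ 20 ≤ g ^ 9 →
  q * Σ< (suc X) (θ ∘ comp) ≤ Σ< c (λ v → suc (weight (v + 36))) * g
θ-average-classes c c≡36 X q g 1≤X hyp = begin
  q * Σ< (suc X) (θ ∘ comp)              ≤⟨ *-monoʳ-≤ q (Σ<-monoˡ _ (m≤n*m (suc X) c {{subst NonZero (sym c≡36) _}})) ⟩
  q * Σ< (c * suc X) (θ ∘ comp)          ≡⟨ cong (q *_) (Σ<-classes c (suc X) (θ ∘ comp)) ⟩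
  q * Σ< c (λ v → Σ< (suc X) (λ k → θ (comp (c * k + v))))
    ≤⟨ Σ<-weighted c q g _ (λ v → suc (weight (v + 36))) (λ v v<c → subst (λ a → q * Σ< (suc X) (λ k → θ (comp (a * k + v))) ≤ suc (weight (v + 36)) * g) (sym c≡36) (class v (subst (v <_) c≡36 v<c))) ⟩
  Σ< c (λ v → suc (weight (v + 36))) * g ∎
  where
  θ≤K₀ : ∀ {v} → v < 36 → θ (comp v) ≤ K₀
  θ≤K₀ {zero}  _  = subst (λ c → θ c ≤ K₀) (trans comp-1 (sym comp-0)) (θ[comp]≤K₀ {1} ≤-refl (from-yes (1 ≤? 143)))
  θ≤K₀ {suc v} v< = θ[comp]≤K₀ (s≤s z≤n) (≤-trans (<⇒≤ v<) (from-yes (36 ≤? 143)))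
  class : ∀ v → v < 36 → q * classSum v X ≤ suc (weight (v + 36)) * g
  class v v<36 = begin
    q * classSum v X                   ≤⟨ *-monoʳ-≤ q (≤-trans (classSum-shift v X) (+-monoˡ-≤ _ (θ≤K₀ v<36))) ⟩
    q * (K₀ + classSum (v + 36) X)     ≡⟨ *-distribˡ-+ q K₀ _ ⟩
    q * K₀ + q * classSum (v + 36) X   ≤⟨ +-mono-≤ (^9-cancel-≤ (≤-trans (m≤m*n _ (X ^ 20) {{>-nonZero (1≤^ 20 1≤X)}}) hyp))
                                            (classSum-bound X v X q g ≤-refl 1≤X v<36 hyp) ⟩
    g + weight (v + 36) * g            ∎

θ-average-∃ : ∀ c → c ≡ 36 → ∃ λ W → ∀ X q g → 1 ≤ X → (q * K₀) ^ 9 * X ^ 20 ≤ g ^ 9 →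
  q * Σ< (suc X) (θ ∘ comp) ≤ W * g
θ-average-∃ c c≡36 = Σ< c (λ v → suc (weight (v + 36))) , θ-average-classes c c≡36

opaque
  totalWeight : ℕ
  totalWeight = proj₁ (θ-average-∃ 36 refl)

  θ-average : ∀ X q g → 1 ≤ X → (q * K₀) ^ 9 * X ^ 20 ≤ g ^ 9 → q * Σ< (suc X) (θ ∘ comp) ≤ totalWeight * g
  θ-average = proj₂ (θ-average-∃ 36 refl)

-- Sums of kMax

-- For 2^i ≤ n < 2^(i+1) the factor n in `κ*n≤` is replaced by 2^i. The average is taken up to Z =
-- 2^(i+1) with g = h Z²; since Z^(20/9) ≤ Z² Y^(2/9), it suffices that h ≥ K₀ Y^(11/9). Keeping Y
-- fixed while i varies makes the bound linear in 2^i, as needed for the sum over all H_j.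
κ-dyadic : ∀ i Y h → 2 ^ suc i ≤ Y → K₀ ^ 9 * Y ^ 11 ≤ h ^ 9 →
  Y * Σ< (2 ^ i) (λ r → κ (2 ^ i + r)) ≤ 16 * totalWeight * h * 2 ^ i
κ-dyadic i Y h Z≤Y hyp = *-cancelˡ-≤ (unit * z) {{>-nonZero (*-mono-≤ 1≤unit (m^n>0 2 i))}} (begin
  unit * z * (Y * Σ< z (λ r → κ (z + r)))         ≡⟨ lem₁ unit z Y _ ⟩
  Y * (unit * (z * Σ< z (λ r → κ (z + r))))       ≤⟨ *-monoʳ-≤ Y (*-monoʳ-≤ unit weighted) ⟩
  Y * (unit * (2 * Σ< (suc Z) (E ∘ comp)))        ≡⟨ cong (Y *_) (lem₂ unit 2 _) ⟩
  Y * (2 * (unit * Σ< (suc Z) (E ∘ comp)))        ≡⟨ cong (λ x → Y * (2 * x)) (Σ<-* unit (suc Z) _) ⟩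
  Y * (2 * Σ< (suc Z) (λ n → unit * E (comp n)))  ≤⟨ *-monoʳ-≤ Y (*-monoʳ-≤ 2 (Σ<-mono (suc Z) (λ n _ → E≤θ (comp n)))) ⟩
  Y * (2 * Σ< (suc Z) (θ ∘ comp))                  ≡⟨ lem₂ Y 2 _ ⟩
  2 * (Y * Σ< (suc Z) (θ ∘ comp))                  ≤⟨ *-monoʳ-≤ 2 (θ-average Z Y (h * (Z * Z)) (m^n>0 2 (suc i)) hyp′) ⟩
  2 * (totalWeight * (h * (2 * z * (2 * z))))      ≡⟨ lem₃ totalWeight h z ⟩
  z * (8 * totalWeight * h * z)                    ≤⟨ *-monoʳ-≤ z (*-monoˡ-≤ z (*-monoˡ-≤ h (*-monoˡ-≤ totalWeight (from-yes (8 ≤? 16))))) ⟩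
  z * (16 * totalWeight * h * z)                   ≤⟨ *-monoˡ-≤ (16 * totalWeight * h * z) (m≤n*m z unit {{>-nonZero 1≤unit}}) ⟩
  unit * z * (16 * totalWeight * h * z)           ∎)
  where
  z Z : ℕ
  z = 2 ^ i
  Z = 2 ^ suc i
  lem₁ : ∀ a z y s → a * z * (y * s) ≡ y * (a * (z * s))
  lem₁ = solve-∀
  lem₂ : ∀ a b c → a * (b * c) ≡ b * (a * c)
  lem₂ = solve-∀
  lem₃ : ∀ w h z → 2 * (w * (h * (2 * z * (2 * z)))) ≡ z * (8 * w * h * z)
  lem₃ = solve-∀
  weighted : z * Σ< z (λ r → κ (z + r)) ≤ 2 * Σ< (suc Z) (E ∘ comp)
  weighted = begin
    z * Σ< z (λ r → κ (z + r))        ≡⟨ Σ<-* z z _ ⟩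
    Σ< z (λ r → z * κ (z + r))        ≤⟨ Σ<-mono z (λ r _ → pointwise r) ⟩
    Σ< z (λ r → 2 * E (comp (z + r ∸ 1))) ≤⟨ m≤n+m _ _ ⟩
    Σ< z (λ n → 2 * E (comp (n ∸ 1))) + Σ< z (λ r → 2 * E (comp (z + r ∸ 1))) ≡⟨ Σ<-append z z _ ⟨
    Σ< (z + z) (λ n → 2 * E (comp (n ∸ 1))) ≤⟨ Σ<-monoˡ {z + z} {suc (z + z)} _ (n≤1+n _) ⟩
    Σ< (suc (z + z)) (λ n → 2 * E (comp (n ∸ 1))) ≡⟨ Σ<-head (z + z) _ ⟩
    2 * E (comp 0) + Σ< (z + z) (λ n → 2 * E (comp n)) ≤⟨ +-monoˡ-≤ _ (≤-trans (*-monoʳ-≤ 2 (E-mono comp0≤)) (≤-reflexive refl)) ⟩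
    2 * E (comp (z + z)) + Σ< (z + z) (λ n → 2 * E (comp n)) ≡⟨ +-comm (2 * E (comp (z + z))) _ ⟩
    Σ< (suc (z + z)) (λ n → 2 * E (comp n)) ≡⟨ cong (λ x → Σ< (suc x) (λ n → 2 * E (comp n))) (cong (z +_) (+-identityʳ z)) ⟨
    Σ< (suc Z) (λ n → 2 * E (comp n)) ≡⟨ Σ<-* 2 (suc Z) _ ⟨
    2 * Σ< (suc Z) (E ∘ comp)         ∎
    where
    comp0≤ : comp 0 ≤ comp (z + z)
    comp0≤ = subst (_≤ comp (z + z)) (sym comp-0) (1≤comp (z + z))
    pointwise : ∀ r → z * κ (z + r) ≤ 2 * E (comp (z + r ∸ 1))
    pointwise r with z | m^n>0 2 i
    ... | suc y | _ = ≤-trans (*-monoˡ-≤ (κ (suc y + r)) (m≤m+n (suc y) r))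
      (≤-trans (≤-reflexive (*-comm (suc y + r) (κ (suc y + r)))) (κ*n≤ (y + r)))
  hyp′ : (Y * K₀) ^ 9 * Z ^ 20 ≤ (h * (Z * Z)) ^ 9
  hyp′ = begin
    (Y * K₀) ^ 9 * Z ^ 20                ≡⟨ cong (λ x → (Y * K₀) ^ 9 * x) (^-distribˡ-+-* Z 18 2) ⟩
    (Y * K₀) ^ 9 * (Z ^ 18 * Z ^ 2)      ≤⟨ *-monoʳ-≤ ((Y * K₀) ^ 9) (*-monoʳ-≤ (Z ^ 18) (^-monoˡ-≤ 2 Z≤Y)) ⟩
    (Y * K₀) ^ 9 * (Z ^ 18 * Y ^ 2)      ≡⟨ cong (_* (Z ^ 18 * Y ^ 2)) (^-distribʳ-* 9 Y K₀) ⟩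
    Y ^ 9 * K₀ ^ 9 * (Z ^ 18 * Y ^ 2)    ≡⟨ lem (Y ^ 9) (K₀ ^ 9) (Z ^ 18) (Y ^ 2) ⟩
    K₀ ^ 9 * (Y ^ 9 * Y ^ 2) * Z ^ 18    ≡⟨ cong₂ (λ x y → K₀ ^ 9 * x * y) (sym (^-distribˡ-+-* Y 9 2)) (trans (sym (^-*-assoc Z 2 9)) (cong (_^ 9) (cong (Z *_) (*-identityʳ Z)))) ⟩
    K₀ ^ 9 * Y ^ 11 * (Z * Z) ^ 9        ≤⟨ *-monoˡ-≤ ((Z * Z) ^ 9) hyp ⟩
    h ^ 9 * (Z * Z) ^ 9                  ≡⟨ ^-distribʳ-* 9 h (Z * Z) ⟨
    (h * (Z * Z)) ^ 9                    ∎
    where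
    lem : ∀ a b c d → a * b * (c * d) ≡ b * (a * d) * c
    lem = solve-∀

κ-sum-2^ : ∀ m Y h → 2 ^ m ≤ Y → K₀ ^ 9 * Y ^ 11 ≤ h ^ 9 → Y * Σ< (2 ^ m) κ ≤ 16 * totalWeight * h * 2 ^ m
κ-sum-2^ zero    Y h _ _ = ≤-trans (≤-reflexive (*-zeroʳ Y)) z≤n
κ-sum-2^ (suc m) Y h le hyp = begin
  Y * Σ< (2 ^ suc m) κ ≡⟨ cong (λ x → Y * Σ< (2 ^ m + x) κ) (+-identityʳ (2 ^ m)) ⟩
  Y * Σ< (2 ^ m + 2 ^ m) κ ≡⟨ cong (Y *_) (Σ<-append (2 ^ m) (2 ^ m) κ) ⟩
  Y * (Σ< (2 ^ m) κ + Σ< (2 ^ m) (λ r → κ (2 ^ m + r))) ≡⟨ *-distribˡ-+ Y _ _ ⟩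
  Y * Σ< (2 ^ m) κ + Y * Σ< (2 ^ m) (λ r → κ (2 ^ m + r))
    ≤⟨ +-mono-≤ (κ-sum-2^ m Y h (≤-trans (m≤m+n _ _) le) hyp) (κ-dyadic m Y h le hyp) ⟩
  16 * totalWeight * h * 2 ^ m + 16 * totalWeight * h * 2 ^ m ≡⟨ lem (16 * totalWeight * h) (2 ^ m) ⟩
  16 * totalWeight * h * 2 ^ suc m ∎
  where
  lem : ∀ a b → a * b + a * b ≡ a * (2 * b)
  lem = solve-∀

U : ℕ → ℕ
U X = Σ< (suc X) κ

-- X is enlarged to a power of 2 that is at most 2X, which turns 16 into 32.
U-bound : ∀ X Y h → 1 ≤ X → 2 * X ≤ Y → K₀ ^ 9 * Y ^ 11 ≤ h ^ 9 → Y * U X ≤ 32 * totalWeight * h * X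
U-bound X Y h 1≤X 2X≤Y hyp with floor-log X 1≤X
... | k , lo , hi = begin
  Y * U X                              ≤⟨ *-monoʳ-≤ Y (Σ<-monoˡ κ hi) ⟩
  Y * Σ< (2 ^ suc k) κ                 ≤⟨ κ-sum-2^ (suc k) Y h (≤-trans (*-monoʳ-≤ 2 lo) 2X≤Y) hyp ⟩
  16 * totalWeight * h * (2 * 2 ^ k)   ≤⟨ *-monoʳ-≤ (16 * totalWeight * h) (*-monoʳ-≤ 2 lo) ⟩
  16 * totalWeight * h * (2 * X)       ≡⟨ lem totalWeight h X ⟩
  32 * totalWeight * h * X             ∎
  where
  lem : ∀ w h x → 16 * w * h * (2 * x) ≡ 32 * w * h * x
  lem = solve-∀

-- Symbolic execution

module R = Registers

Env : Set
Env = Register → ℕ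

-- Registers are compared by number, so that for concrete registers a lookup in an updated
-- environment computes; most register conditions below then hold by `refl`.
upd : Register → ℕ → Env → Env
upd r v ρ s = if toℕ r ≡ᵇ toℕ s then v else ρ s

record Memory : Set where
  constructor memory
  field
    cells : Family → ℕ → ℕ → Maybe ℕ
    sizes : Family → ℕ → ℕ
    alloc : ℕ
    out   : List (ℕ × ℕ)

open Memory

st : Env → Memory → State
st ρ s = mkState (Vec.tabulate ρ) (cells s) (sizes s) (alloc s) (out s)

tabulate-update : ∀ {n} (f : Fin n → ℕ) r v →
  Vec.tabulate f [ r ]≔ v ≡ Vec.tabulate (λ s → if toℕ r ≡ᵇ toℕ s then v else f s)
tabulate-update f zero    v = refl
tabulate-update f (suc r) v = cong (f zero Vec.∷_) (tabulate-update (f ∘ suc) r v)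

st-upd : ∀ r v ρ s → setRegister r v (st ρ s) ≡ st (upd r v ρ) s
st-upd r v ρ s = cong (λ V → mkState V (cells s) (sizes s) (alloc s) (out s)) (tabulate-update ρ r v)

put : Family → ℕ → ℕ → ℕ → Memory → Memory
put f j i v s = memory
  (λ f′ j′ i′ → if f == f′ ∧ (j ≡ᵇ j′) ∧ (i ≡ᵇ i′) then just v else cells s f′ j′ i′) (sizes s) (alloc s) (out s)

new : Machine → Family → ℕ → ℕ → Memory → Memory
new m f j len s = memory (cells s)
  (λ f′ j′ → if f == f′ ∧ (j ≡ᵇ j′) then len else sizes s f′ j′) (alloc s + len * Machine.width m f) (out s)

report : ℕ → ℕ → Memory → Memory
report n c s = memory (cells s) (sizes s) (alloc s) (out s ∷ʳ (n , c))

ev : Env → Memory → Expr → Maybe ℕ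
ev ρ s (lit a)        = just a
ev ρ s (! r)          = just (ρ r)
ev ρ s (f [ d ][ e ]) = ev ρ s d >>= λ j → ev ρ s e >>= λ i → cells s f j i
ev ρ s (d ⊕ e)        = ev ρ s d >>= λ a → ev ρ s e >>= λ b → just (a + b)
ev ρ s (d ⊖ e)        = ev ρ s d >>= λ a → ev ρ s e >>= λ b → just (a ∸ b)
ev ρ s (d ⊗ e)        = ev ρ s d >>= λ a → ev ρ s e >>= λ b → just (a * b)
ev ρ s (d ⊘ e)        = ev ρ s d >>= λ a → ev ρ s e >>= λ b → quotient a b

eval-st : ∀ ρ s e → eval (st ρ s) e ≡ ev ρ s e
eval-st ρ s (lit a) = refl
eval-st ρ s (! r)   = cong just (lookup∘tabulate ρ r)
eval-st ρ s (f [ d ][ e ]) rewrite eval-st ρ s d | eval-st ρ s e = refl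
eval-st ρ s (d ⊕ e) rewrite eval-st ρ s d | eval-st ρ s e = refl
eval-st ρ s (d ⊖ e) rewrite eval-st ρ s d | eval-st ρ s e = refl
eval-st ρ s (d ⊗ e) rewrite eval-st ρ s d | eval-st ρ s e = refl
eval-st ρ s (d ⊘ e) rewrite eval-st ρ s d | eval-st ρ s e = refl

infix 3 _⊢_⇒_

-- Wrapped in a record, so that state, expression and value can be inferred from a derivation.
record _⊢_⇒_ (σ : Env × Memory) (e : Expr) (v : ℕ) : Set where
  constructor evaluates
  field evaluation : ev (proj₁ σ) (proj₂ σ) e ≡ just v

record Tests (ρ : Env) (s : Memory) (t : Test) (b : Bool) : Set where
  constructor tests
  field outcome : test (st ρ s) t ≡ just b

open _⊢_⇒_
open Tests

ev-! : ∀ {ρ s r v} → ρ r ≡ v → (ρ , s) ⊢ ! r ⇒ v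
ev-! eq = evaluates (cong just eq)

ev-lit : ∀ {ρ s a} → (ρ , s) ⊢ lit a ⇒ a
ev-lit = evaluates refl

ev-⊕ : ∀ {ρ s d e a b} → (ρ , s) ⊢ d ⇒ a → (ρ , s) ⊢ e ⇒ b → (ρ , s) ⊢ d ⊕ e ⇒ a + b
ev-⊕ (evaluates p) (evaluates q) = evaluates (lem p q)
  where
  lem : ∀ {x y a b} → x ≡ just a → y ≡ just b → (x >>= λ a → y >>= λ b → just (a + b)) ≡ just (a + b)
  lem refl refl = refl

ev-⊖ : ∀ {ρ s d e a b} → (ρ , s) ⊢ d ⇒ a → (ρ , s) ⊢ e ⇒ b → (ρ , s) ⊢ d ⊖ e ⇒ a ∸ b
ev-⊖ (evaluates p) (evaluates q) = evaluates (lem p q)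
  where
  lem : ∀ {x y a b} → x ≡ just a → y ≡ just b → (x >>= λ a → y >>= λ b → just (a ∸ b)) ≡ just (a ∸ b)
  lem refl refl = refl

ev-⊗ : ∀ {ρ s d e a b} → (ρ , s) ⊢ d ⇒ a → (ρ , s) ⊢ e ⇒ b → (ρ , s) ⊢ d ⊗ e ⇒ a * b
ev-⊗ (evaluates p) (evaluates q) = evaluates (lem p q)
  where
  lem : ∀ {x y a b} → x ≡ just a → y ≡ just b → (x >>= λ a → y >>= λ b → just (a * b)) ≡ just (a * b)
  lem refl refl = refl

ev-⊘ : ∀ {ρ s d e a b} .{{_ : NonZero b}} → (ρ , s) ⊢ d ⇒ a → (ρ , s) ⊢ e ⇒ b → (ρ , s) ⊢ d ⊘ e ⇒ a / b
ev-⊘ (evaluates p) (evaluates q) = evaluates (lem p q)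
  where
  lem : ∀ {x y a b} .{{_ : NonZero b}} → x ≡ just a → y ≡ just b → (x >>= λ a → y >>= λ b → quotient a b) ≡ just (a / b)
  lem {b = suc _} refl refl = refl

ev-[] : ∀ {ρ s f d e j i v} → (ρ , s) ⊢ d ⇒ j → (ρ , s) ⊢ e ⇒ i → cells s f j i ≡ just v → (ρ , s) ⊢ f [ d ][ e ] ⇒ v
ev-[] {s = s} {f} (evaluates p) (evaluates q) r = evaluates (lem p q r)
  where
  lem : ∀ {x y j i v} → x ≡ just j → y ≡ just i → cells s f j i ≡ just v → (x >>= λ j → y >>= λ i → cells s f j i) ≡ just v
  lem refl refl r = r

eval-ev : ∀ {ρ s e v} → (ρ , s) ⊢ e ⇒ v → eval (st ρ s) e ≡ just v
eval-ev {ρ} {s} {e} (evaluates p) = trans (eval-st ρ s e) p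

tst : ∀ {x y : Maybe ℕ} {a b : ℕ} (f : ℕ → ℕ → Bool) → x ≡ just a → y ≡ just b → (x >>= λ a → y >>= λ b → just (f a b)) ≡ just (f a b)
tst f refl refl = refl

tst-≼ : ∀ {ρ s d e a b} → (ρ , s) ⊢ d ⇒ a → (ρ , s) ⊢ e ⇒ b → Tests ρ s (d ≼ e) (a ≤ᵇ b)
tst-≼ p q = tests (tst _≤ᵇ_ (eval-ev p) (eval-ev q))

tst-≺ : ∀ {ρ s d e a b} → (ρ , s) ⊢ d ⇒ a → (ρ , s) ⊢ e ⇒ b → Tests ρ s (d ≺ e) (a <ᵇ b)
tst-≺ p q = tests (tst _<ᵇ_ (eval-ev p) (eval-ev q))

tst-≐ : ∀ {ρ s d e a b} → (ρ , s) ⊢ d ⇒ a → (ρ , s) ⊢ e ⇒ b → Tests ρ s (d ≐ e) (a ≡ᵇ b)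
tst-≐ p q = tests (tst _≡ᵇ_ (eval-ev p) (eval-ev q))

retest : ∀ {ρ s t b b′} → b ≡ b′ → Tests ρ s t b → Tests ρ s t b′
retest refl t = t

≡true⇒T : ∀ {b} → b ≡ true → Bool.T b
≡true⇒T refl = _

<ᵇ-true : ∀ {a b} → (a <ᵇ b) ≡ true → a < b
<ᵇ-true eq = <ᵇ⇒< _ _ (≡true⇒T eq)

<ᵇ-false : ∀ {a b} → (a <ᵇ b) ≡ false → b ≤ a
<ᵇ-false {a} {b} eq = ≮⇒≥ λ a<b → subst Bool.T eq (<⇒<ᵇ a<b)

≤ᵇ-true : ∀ {a b} → (a ≤ᵇ b) ≡ true → a ≤ b
≤ᵇ-true eq = ≤ᵇ⇒≤ _ _ (≡true⇒T eq)

≤ᵇ-false : ∀ {a b} → (a ≤ᵇ b) ≡ false → b < a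
≤ᵇ-false {a} {b} eq = ≰⇒> λ a≤b → subst Bool.T eq (≤⇒≤ᵇ a≤b)

≡ᵇ-true : ∀ {a b} → (a ≡ᵇ b) ≡ true → a ≡ b
≡ᵇ-true eq = ≡ᵇ⇒≡ _ _ (≡true⇒T eq)

≡ᵇ-false : ∀ {a b} → (a ≡ᵇ b) ≡ false → a ≢ b
≡ᵇ-false {a} {b} eq a≡b = subst Bool.T eq (≡⇒≡ᵇ a b a≡b)

≡ᵇ-refl : ∀ a → (a ≡ᵇ a) ≡ true
≡ᵇ-refl zero    = refl
≡ᵇ-refl (suc a) = ≡ᵇ-refl a

≢⇒≡ᵇ : ∀ {a b} → a ≢ b → (a ≡ᵇ b) ≡ false
≢⇒≡ᵇ {a} {b} a≢b with a ≡ᵇ b in eq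
... | true  = contradiction (≡ᵇ-true eq) a≢b
... | false = refl

≤ᵇ-true′ : ∀ {a b} → a ≤ b → (a ≤ᵇ b) ≡ true
≤ᵇ-true′ {a} {b} le with a ≤ᵇ b in eq
... | true  = refl
... | false = contradiction le (<⇒≱ (≤ᵇ-false {a} {b} eq))

<ᵇ-true′ : ∀ {a b} → a < b → (a <ᵇ b) ≡ true
<ᵇ-true′ {a} {b} lt with a <ᵇ b in eq
... | true  = refl
... | false = contradiction (<ᵇ-false eq) (<⇒≱ lt)

<ᵇ-false′ : ∀ {a b} → b ≤ a → (a <ᵇ b) ≡ false
<ᵇ-false′ {a} {b} le with a <ᵇ b in eq
... | false = refl
... | true  = contradiction (<ᵇ-true {a} {b} eq) (≤⇒≯ le)

-- Frame conditions for registers and arrays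

_∈ᵇ_ : Register → List Register → Bool
r ∈ᵇ []       = false
r ∈ᵇ (x ∷ xs) = (toℕ x ≡ᵇ toℕ r) ∨ r ∈ᵇ xs

_⊆ᵇ_ : List Register → List Register → Bool
[]       ⊆ᵇ ys = true
(x ∷ xs) ⊆ᵇ ys = x ∈ᵇ ys ∧ xs ⊆ᵇ ys

-- `rs` lists the registers that may have changed. Membership is Boolean, so that the side
-- conditions for concrete registers are closed computations.
record Frame (rs : List Register) (ρ ρ′ : Env) : Set where
  constructor frame
  field kept : ∀ r → r ∈ᵇ rs ≡ false → ρ′ r ≡ ρ r

open Frame

∈ᵇ-⊆ : ∀ r xs ys → xs ⊆ᵇ ys ≡ true → r ∈ᵇ ys ≡ false → r ∈ᵇ xs ≡ false
∈ᵇ-⊆ r []       ys _   _  = refl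
∈ᵇ-⊆ r (x ∷ xs) ys sub r∉ with toℕ x ≡ᵇ toℕ r in eq | x ∈ᵇ ys in x∈
... | true  | true  with refl ← toℕ-injective {i = x} {j = r} (≡ᵇ-true eq) with () ← trans (sym r∉) x∈
... | false | true  = ∈ᵇ-⊆ r xs ys sub r∉
... | true  | false with () ← sub
... | false | false with () ← sub

frame-refl : ∀ {rs ρ} → Frame rs ρ ρ
frame-refl = frame λ r _ → refl

frame-trans : ∀ {xs ys ρ ρ′ ρ″} → Frame ys ρ ρ′ → xs ⊆ᵇ ys ≡ true → Frame xs ρ′ ρ″ → Frame ys ρ ρ″
frame-trans {xs} {ys} fr sub fr′ = frame λ r r∉ → trans (kept fr′ r (∈ᵇ-⊆ r xs ys sub r∉)) (kept fr r r∉)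

frame-upd : ∀ {ys ρ ρ′ v} x → x ∈ᵇ ys ≡ true → Frame ys ρ ρ′ → Frame ys ρ (upd x v ρ′)
frame-upd {ys} {ρ} {ρ′} {v} x x∈ fr = frame lem
  where
  lem : ∀ r → r ∈ᵇ ys ≡ false → upd x v ρ′ r ≡ ρ r
  lem r r∉ with toℕ x ≡ᵇ toℕ r in eq
  ... | true with refl ← toℕ-injective {i = x} {j = r} (≡ᵇ-true eq) with () ← trans (sym r∉) x∈
  ... | false = kept fr r r∉

-- `A` is indexed by the integers whose bounds are stored and not by positions: entry i belongs to
-- the integer base + i. For a running block, base is H_j - L.
record Arr (s : Memory) (j base len : ℕ) (A : ℕ → ℕ) : Set where
  constructor arr
  field
    length≡ : sizes s block j ≡ len
    get     : ∀ i → 1 ≤ i → i ≤ len → cells s block j i ≡ just (A (base + i))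

open Arr

Arr-cong : ∀ {s j base len A B} → (∀ i → 1 ≤ i → i ≤ len → A (base + i) ≡ B (base + i)) → Arr s j base len A → Arr s j base len B
Arr-cong eq (arr l g) = arr l λ i lo hi → trans (g i lo hi) (cong just (eq i lo hi))

-- `out` is left free: results may be reported while block j changes, and they are tracked
-- separately.
record Only (j : ℕ) (s s′ : Memory) : Set where
  constructor only
  field
    blocks≡ : ∀ k i → k ≢ j → cells s′ block k i ≡ cells s block k i
    tops≡   : ∀ i → cells s′ top 0 i ≡ cells s top 0 i
    sizes≡  : ∀ f k → sizes s′ f k ≡ sizes s f k
    alloc≡  : alloc s′ ≡ alloc s

open Only

Only-refl : ∀ {j s} → Only j s s
Only-refl = only (λ _ _ _ → refl) (λ _ → refl) (λ _ _ → refl) refl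

Only-trans : ∀ {j s s′ s″} → Only j s s′ → Only j s′ s″ → Only j s s″
Only-trans (only b t z a) (only b′ t′ z′ a′) = only (λ k i ne → trans (b′ k i ne) (b k i ne)) (λ i → trans (t′ i) (t i))
  (λ f k → trans (z′ f k) (z f k)) (trans a′ a)

Arr-Only : ∀ {j k s s′ base len A} → k ≢ j → Only j s s′ → Arr s k base len A → Arr s′ k base len A
Arr-Only {k = k} k≢j o (arr l g) = arr (trans (sizes≡ o block k) l) λ i lo hi → trans (blocks≡ o k i k≢j) (g i lo hi)

set : ℕ → ℕ → (ℕ → ℕ) → ℕ → ℕ
set n x A m = if n ≡ᵇ m then x else A m

set-same : ∀ n x A → set n x A n ≡ x
set-same n x A rewrite ≡ᵇ-refl n = refl

set-other : ∀ {n m} x A → n ≢ m → set n x A m ≡ A m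
set-other x A n≢m rewrite ≢⇒≡ᵇ n≢m = refl

put-same : ∀ j i v s → cells (put block j i v s) block j i ≡ just v
put-same j i v s rewrite ≡ᵇ-refl j | ≡ᵇ-refl i = refl

put-other-block : ∀ {j i v s} k l → k ≢ j → cells (put block j i v s) block k l ≡ cells s block k l
put-other-block {j} k l k≢j rewrite ≢⇒≡ᵇ {j} {k} (k≢j ∘ sym) = refl

put-other-entry : ∀ {j i v s} k l → l ≢ i → cells (put block j i v s) block k l ≡ cells s block k l
put-other-entry {j} {i} k l l≢i with j ≡ᵇ k
... | false = refl
... | true rewrite ≢⇒≡ᵇ {i} {l} (l≢i ∘ sym) = refl

put-only : ∀ j i v s → Only j s (put block j i v s)
put-only j i v s = only (λ k l → put-other-block {j} {i} {v} {s} k l) (λ _ → refl) (λ _ _ → refl) refl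

Arr-put : ∀ {s j base len A} i v → Arr s j base len A → Arr (put block j i v s) j base len (set (base + i) v A)
Arr-put {s} {j} {base} {len} {A} i v (arr l g) = arr l λ k lo hi → case k ≟ i of λ where
  (yes refl) → trans (put-same j i v s) (cong just (sym (set-same (base + i) v A)))
  (no k≢i)   → trans (put-other-entry {j} {i} {v} {s} j k k≢i) (trans (g k lo hi)
    (cong just (sym (set-other v A (k≢i ∘ sym ∘ +-cancelˡ-≡ base i k)))))

lowerAt : ℕ → ℕ → (ℕ → ℕ) → ℕ → ℕ
lowerAt n x A = set n (x ⊓ A n) A

lowerAt-≤ : ∀ n x A m → lowerAt n x A m ≤ A m
lowerAt-≤ n x A m with n ≡ᵇ m in eq
... | true  = ≤-trans (m⊓n≤n x (A n)) (≤-reflexive (cong A (≡ᵇ-true eq)))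
... | false = ≤-refl

lowerAt-≤x : ∀ n x A → lowerAt n x A n ≤ x
lowerAt-≤x n x A = ≤-trans (≤-reflexive (set-same n _ A)) (m⊓n≤m x (A n))

lowerAt-≥ : ∀ {n x A c m} → (n ≡ m → c ≤ x) → c ≤ A m → c ≤ lowerAt n x A m
lowerAt-≥ {n} {x} {A} {c} {m} c≤x c≤A with n ≡ᵇ m in eq
... | true  = ⊓-glb (c≤x (≡ᵇ-true eq)) (subst (λ k → c ≤ A k) (sym (≡ᵇ-true {n} {m} eq)) c≤A)
... | false = c≤A

-- A program logic with running times

module Execution (w e : ℕ) where

  m : Machine
  m = record { wordSize = w ; entrySize = e }

  -- Total correctness with a time bound: a run exists, takes at most c operations and ends in a
  -- state satisfying Ψ. Existence includes that no illegal access and no overflow occurs.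
  record Runs (p : Program) (ρ : Env) (s : Memory) (c : ℕ) (Ψ : Env → Memory → Set) : Set where
    constructor runs
    field
      {env}  : Env
      {mem}  : Memory
      {time} : ℕ
      run    : m ⊢⟨ p , st ρ s ⟩⇓⟨ st env mem , time ⟩
      time≤  : time ≤ c
      post   : Ψ env mem

  private variable
    p q : Program
    ρ : Env
    s : Memory
    c c′ d : ℕ
    Ψ Φ : Env → Memory → Set

  weaken : c ≤ c′ → Runs p ρ s c Ψ → Runs p ρ s c′ Ψ
  weaken c≤ (runs r t≤ ψ) = runs r (≤-trans t≤ c≤) ψ

  conseq : (∀ ρ s → Φ ρ s → Ψ ρ s) → Runs p ρ s c Φ → Runs p ρ s c Ψ
  conseq imp (runs r t≤ φ) = runs r t≤ (imp _ _ φ)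

  skip-run : Ψ ρ s → 1 ≤ c → Runs skip ρ s c Ψ
  skip-run ψ 1≤c = runs run-skip 1≤c ψ

  assign : ∀ {r x v} → (ρ , s) ⊢ x ⇒ v → v < 2 ^ w → Ψ (upd r v ρ) s → Runs (r ≔ x) ρ s (1 + cost x) Ψ
  assign {ρ} {s} {r = r} {x} {v} eq v< ψ = runs
    (subst (λ σ → m ⊢⟨ r ≔ x , st ρ s ⟩⇓⟨ σ , 1 + cost x ⟩) (st-upd r v ρ s) (run-≔ (eval-ev eq) v<)) ≤-refl ψ

  infixr 2 _then_

  _then_ : Runs p ρ s c Φ → (∀ {ρ s} → Φ ρ s → Runs q ρ s d Ψ) → Runs (p ⨟ q) ρ s (c + d) Ψ
  runs r t≤ φ then k with k φ
  ... | runs r′ t′≤ ψ = runs (run-⨟ r r′) (+-mono-≤ t≤ t′≤) ψ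

  -- Unlike with `_then_`, the rest is verified in the exact environment after the assignment, so
  -- that lookups in it compute.
  assign⨟ : ∀ {r x v} → (ρ , s) ⊢ x ⇒ v → v < 2 ^ w → Runs q (upd r v ρ) s d Ψ → Runs (r ≔ x ⨟ q) ρ s (1 + cost x + d) Ψ
  assign⨟ {ρ} {s} {r = r} {x} {v} eq v< rest with assign {ρ} {s} {λ ρ′ s′ → (ρ′ ≡ upd r v ρ) × (s′ ≡ s)} {r} {x} eq v< (refl , refl)
  ... | runs r₁ t≤ (refl , refl) with rest
  ...   | runs r₂ t′≤ ψ = runs (run-⨟ r₁ r₂) (+-mono-≤ t≤ t′≤) ψ

  write : ∀ {f x y z j i v} → (ρ , s) ⊢ x ⇒ j → (ρ , s) ⊢ y ⇒ i → (ρ , s) ⊢ z ⇒ v →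
    1 ≤ i → i ≤ sizes s f j → v < 2 ^ Machine.width m f → Ψ ρ (put f j i v s) →
    Runs (f [ x ][ y ]≔ z) ρ s (1 + cost x + cost y + cost z) Ψ
  write {ρ} {s} {f = f} {x} {y} {z} ex ey ez 1≤i i≤ v< ψ =
    runs (run-[]≔ (eval-ev ex) (eval-ev ey) (eval-ev ez) 1≤i i≤ v<) ≤-refl ψ

  allocate-run : ∀ {f x y j l} → (ρ , s) ⊢ x ⇒ j → (ρ , s) ⊢ y ⇒ l → sizes s f j ≡ 0 → Ψ ρ (new m f j l s) →
    Runs (allocate f x y) ρ s (1 + cost x + cost y) Ψ
  allocate-run {ρ} {s} {f = f} {x} {y} ex ey z ψ =
    runs (run-allocate (eval-ev ex) (eval-ev ey) z) ≤-refl ψ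

  emit-run : ∀ {x y n v} → (ρ , s) ⊢ x ⇒ n → (ρ , s) ⊢ y ⇒ v → Ψ ρ (report n v s) →
    Runs (emit x y) ρ s (1 + cost x + cost y) Ψ
  emit-run {ρ} {s} {x = x} {y} ex ey ψ = runs (run-emit (eval-ev ex) (eval-ev ey)) ≤-refl ψ

  branch-run : ∀ {t b} → Tests ρ s t b → (b ≡ true → Runs p ρ s c Ψ) → (b ≡ false → Runs q ρ s c Ψ) →
    Runs (branch t p q) ρ s (costᵗ t + c) Ψ
  branch-run {t = t} {true}  eq yes′ _ with yes′ refl
  ... | runs r t≤ ψ = runs (run-branch-true (outcome eq) r) (+-monoʳ-≤ (costᵗ t) t≤) ψ
  branch-run {t = t} {false} eq _ no′ with no′ refl
  ... | runs r t≤ ψ = runs (run-branch-false (outcome eq) r) (+-monoʳ-≤ (costᵗ t) t≤) ψ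

  -- The index of the invariant bounds the number of remaining iterations, and the loop may also end
  -- before it is used up. The costs are indexed by what remains, which lets them be summed without
  -- knowing where the loop started.
  while-run : ∀ {t p} (c : ℕ → ℕ) (I : ℕ → Env → Memory → Set) →
    (∀ k ρ s → I k ρ s → (Tests ρ s t false × Ψ ρ s) ⊎ (Tests ρ s t true × ∃ λ k′ → k ≡ suc k′ × Runs p ρ s (c k′) (I k′))) →
    ∀ k {ρ s} → I k ρ s → Runs (while t p) ρ s (Σ< k (λ i → costᵗ t + c i) + costᵗ t) Ψ
  while-run {t = t} c I step k {ρ} {s} inv with step k ρ s inv
  ... | inj₁ (eq , ψ) = runs (run-while-false (outcome eq)) (m≤n+m _ _) ψ
  ... | inj₂ (eq , k′ , refl , runs r t≤ inv′) with while-run c I step k′ inv′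
  ...   | runs {time = u} r′ t′≤ ψ = runs (run-while-true (outcome eq) r r′) lem ψ
    where
    lem = begin
      costᵗ t + _ + u ≤⟨ +-mono-≤ (+-monoʳ-≤ (costᵗ t) t≤) t′≤ ⟩
      costᵗ t + c k′ + (Σ< k′ (λ i → costᵗ t + c i) + costᵗ t) ≡⟨ eq′ (costᵗ t + c k′) (Σ< k′ (λ i → costᵗ t + c i)) (costᵗ t) ⟩
      Σ< k′ (λ i → costᵗ t + c i) + (costᵗ t + c k′) + costᵗ t ∎
      where
      eq′ : ∀ a b c → a + (b + c) ≡ b + a + c
      eq′ = solve-∀

  -- The counter ends at `suc hi`, or stays at `lo` if the range is empty, and this last value must
  -- still fit into a register. The test and the increment together cost 6 + `cost to`.
  loop-up : ∀ {x to p hi} (c : ℕ → ℕ) (I : ℕ → Env → Memory → Set) → suc hi < 2 ^ w →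
    (∀ {i ρ s} → I i ρ s → ρ x ≡ i × (ρ , s) ⊢ to ⇒ hi) →
    (∀ {i ρ s} → i ≤ hi → I i ρ s → Runs p ρ s (c i) (λ ρ′ s′ → ρ′ x ≡ i × I (suc i) (upd x (suc i) ρ′) s′)) →
    ∀ n lo {ρ s} → suc hi ∸ lo ≡ n → I lo ρ s →
    Runs (while (! x ≼ to) (p ⨟ x ≔ ! x ⊕ lit 1)) ρ s (Σ< n (λ i → 6 + cost to + c (lo + i)) + (2 + cost to))
      (λ ρ′ s′ → ∃ λ i → hi < i × lo ≤ i × (lo ≤ suc hi → i ≡ suc hi) × I i ρ′ s′)
  loop-up {hi = hi} c I hi< regs body zero lo eq inv =
    runs (run-while-false (outcome (retest (<ᵇ-false″ (m∸n≡0⇒m≤n eq)) (tst-≼ (ev-! (proj₁ (regs inv))) (proj₂ (regs inv)))))) ≤-refl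
      (lo , m∸n≡0⇒m≤n eq , ≤-refl , (λ le → ≤-antisym le (m∸n≡0⇒m≤n eq)) , inv)
    where
    <ᵇ-false″ : suc hi ≤ lo → (lo ≤ᵇ hi) ≡ false
    <ᵇ-false″ le with lo ≤ᵇ hi in eq
    ... | false = refl
    ... | true  = contradiction (≤ᵇ-true {lo} {hi} eq) (<⇒≱ le)
  loop-up {x} {to} {p} {hi} c I hi< regs body (suc n) lo {ρ} {s} eq inv = weaken budget
    (conseq-while (body lo≤hi inv then λ { {ρ′} {s′} (xlo , inv′) → assign (ev-⊕ (ev-! xlo) ev-lit)
      (subst (_< 2 ^ w) (+-comm 1 lo) (≤-<-trans (s≤s lo≤hi) hi<)) (subst (λ v → I (suc lo) (upd x v ρ′) s′) (+-comm 1 lo) inv′) }))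
    where
    lo≤hi : lo ≤ hi
    lo≤hi = ≮⇒≥ λ hi<lo → case trans (sym eq) (m≤n⇒m∸n≡0 hi<lo) of λ ()
    true′ : (lo ≤ᵇ hi) ≡ true
    true′ with lo ≤ᵇ hi in eq
    ... | true  = refl
    ... | false = contradiction lo≤hi (<⇒≱ (≤ᵇ-false {lo} {hi} eq))
    Post : Env → Memory → Set
    Post ρ′ s′ = ∃ λ i → hi < i × lo ≤ i × (lo ≤ suc hi → i ≡ suc hi) × I i ρ′ s′
    conseq-while : ∀ {b} → Runs (p ⨟ x ≔ ! x ⊕ lit 1) ρ s b (I (suc lo)) →
      Runs (while (! x ≼ to) (p ⨟ x ≔ ! x ⊕ lit 1)) ρ s
        (2 + cost to + b + (Σ< n (λ i → 6 + cost to + c (suc lo + i)) + (2 + cost to))) Post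
    conseq-while (runs r t≤ inv′) with loop-up {x} {to} {p} c I hi< regs body n (suc lo)
      (suc-injective (trans (sym (+-∸-assoc 1 lo≤hi)) eq)) inv′
    ... | runs r′ t′≤ (i , hi<i , lo<i , final , inv″) =
      runs (run-while-true (outcome (retest true′ (tst-≼ (ev-! (proj₁ (regs inv))) (proj₂ (regs inv))))) r r′)
        (+-mono-≤ (+-monoʳ-≤ (2 + cost to) t≤) t′≤) (i , hi<i , <⇒≤ lo<i , (λ _ → final (s≤s lo≤hi)) , inv″)
    budget : 2 + cost to + (c lo + 4) + (Σ< n (λ i → 6 + cost to + c (suc lo + i)) + (2 + cost to))
           ≤ Σ< (suc n) (λ i → 6 + cost to + c (lo + i)) + (2 + cost to)
    budget = ≤-reflexive (begin-equality
      2 + cost to + (c lo + 4) + (Σ< n (λ i → 6 + cost to + c (suc lo + i)) + (2 + cost to))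
        ≡⟨ rearrange (cost to) (c lo) (Σ< n (λ i → 6 + cost to + c (suc lo + i))) ⟩
      6 + cost to + c lo + Σ< n (λ i → 6 + cost to + c (suc lo + i)) + (2 + cost to)
        ≡⟨ cong (_+ (2 + cost to)) (cong₂ _+_ (cong (λ k → 6 + cost to + c k) (sym (+-identityʳ lo)))
             (Σ<-cong n (λ i → cong (λ k → 6 + cost to + c k) (sym (+-suc lo i))))) ⟩
      6 + cost to + c (lo + 0) + Σ< n (λ i → 6 + cost to + c (lo + suc i)) + (2 + cost to)
        ≡⟨ cong (_+ (2 + cost to)) (Σ<-head n (λ i → 6 + cost to + c (lo + i))) ⟨
      Σ< (suc n) (λ i → 6 + cost to + c (lo + i)) + (2 + cost to) ∎)
      where
      rearrange : ∀ t c S → 2 + t + (c + 4) + (S + (2 + t)) ≡ 6 + t + c + S + (2 + t)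
      rearrange = solve-∀

  forUp-run : ∀ {x from to p lo hi} (c : ℕ → ℕ) (I : ℕ → Env → Memory → Set) →
    (ρ , s) ⊢ from ⇒ lo → lo < 2 ^ w → suc hi < 2 ^ w →
    (∀ {i ρ s} → I i ρ s → ρ x ≡ i × (ρ , s) ⊢ to ⇒ hi) →
    (∀ {i ρ s} → lo ≤ i → i ≤ hi → I i ρ s → Runs p ρ s (c i) (λ ρ′ s′ → ρ′ x ≡ i × I (suc i) (upd x (suc i) ρ′) s′)) →
    I lo (upd x lo ρ) s →
    Runs (forUp x from to p) ρ s (1 + cost from + (Σ< (suc hi ∸ lo) (λ i → 6 + cost to + c (lo + i)) + (2 + cost to)))
      (λ ρ′ s′ → ∃ λ i → hi < i × (lo ≤ suc hi → i ≡ suc hi) × I i ρ′ s′)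
  forUp-run {lo = lo} {hi} c I efrom lo< hi< regs body inv = assign⨟ efrom lo<
    (conseq (λ { _ _ (i , hi<i , _ , final , _ , inv′) → i , hi<i , final , inv′ })
      (loop-up c (λ i ρ s → lo ≤ i × I i ρ s) hi< (regs ∘ proj₂)
        (λ i≤hi (lo≤i , inv′) → conseq (λ { _ _ (eq , inv″) → eq , m≤n⇒m≤1+n lo≤i , inv″ }) (body lo≤i i≤hi inv′))
        _ lo refl (≤-refl , inv)))

  loop-down : ∀ {x p} (c : ℕ → ℕ) (I : ℕ → Env → Memory → Set) →
    (∀ {i ρ s} → I i ρ s → ρ x ≡ i) →
    (∀ {i ρ s} → I (suc i) ρ s → Runs p ρ s (c i) (λ ρ′ s′ → ρ′ x ≡ suc i × i < 2 ^ w × I i (upd x i ρ′) s′)) →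
    ∀ n {ρ s} → I n ρ s →
    Runs (while (lit 1 ≼ ! x) (p ⨟ x ≔ ! x ⊖ lit 1)) ρ s (Σ< n (λ i → 7 + c i) + 3) (I 0)
  loop-down {x} {p} c I regs body n inv = weaken (+-monoˡ-≤ 3 (≤-reflexive (Σ<-cong n λ i → cong (3 +_) (+-comm (c i) 4))))
    (while-run {p = p ⨟ x ≔ ! x ⊖ lit 1} (λ i → c i + 4) I step n inv)
    where
    step : ∀ k ρ s → I k ρ s → (Tests ρ s (lit 1 ≼ ! x) false × I 0 ρ s) ⊎
      (Tests ρ s (lit 1 ≼ ! x) true × ∃ λ k′ → k ≡ suc k′ × Runs (p ⨟ x ≔ ! x ⊖ lit 1) ρ s (c k′ + 4) (I k′))
    step zero    ρ s inv = inj₁ (tst-≼ ev-lit (ev-! (regs inv)) , inv)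
    step (suc k) ρ s inv = inj₂ (tst-≼ ev-lit (ev-! (regs inv)) , k , refl ,
      (body inv then λ { (eq , k< , inv′) → assign (ev-⊖ (ev-! eq) ev-lit) k< inv′ }))

  -- The table becomes `lowerAt` whether or not a write takes place. The new value need not be
  -- bounded by the entry size beforehand: it is written only if it is smaller than the old entry.
  lower-run : ∀ {x y z j i v base len A} → Arr s j base len A → 1 ≤ i → i ≤ len →
    (ρ , s) ⊢ z ⇒ v → (upd R.v v ρ , s) ⊢ x ⇒ j → (upd R.v v ρ , s) ⊢ y ⇒ i → v < 2 ^ w → A (base + i) < 2 ^ e →
    (∀ {s′} → Arr s′ j base len (lowerAt (base + i) v A) → Only j s s′ → out s′ ≡ out s → Ψ (upd R.v v ρ) s′) →
    Runs (lower x y z) ρ s (1 + cost z + (3 + cost x + cost y + (2 + cost x + cost y))) Ψ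
  lower-run {s} {ρ} {Ψ} {x} {y} {z} {j} {i} {v} {base} {len} {A} ar 1≤i i≤ ez ex ey v< A< k =
    assign⨟ ez v< (branch-run (tst-≺ (ev-! refl) (ev-[] ex ey (get ar i 1≤i i≤)))
      (λ lt → weaken (≤-reflexive (trans (+-comm _ 1) refl)) (write {s = s} ex ey (ev-! refl) 1≤i (subst (i ≤_) (sym (length≡ ar)) i≤)
        (<-trans (<ᵇ-true lt) A<)
        (k (Arr-cong (λ i′ _ _ → cong (λ u → set (base + i) u A (base + i′)) (sym (m≤n⇒m⊓n≡m (<⇒≤ (<ᵇ-true lt))))) (Arr-put i v ar))
           (put-only j i v s) refl)))
      (λ ge → skip-run (k (Arr-cong (λ i′ _ _ → unchanged i′ (<ᵇ-false ge)) ar) Only-refl refl) (s≤s z≤n)))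
    where
    unchanged : ∀ i′ → A (base + i) ≤ v → A (base + i′) ≡ lowerAt (base + i) v A (base + i′)
    unchanged i′ le with base + i ≡ᵇ base + i′ in eq
    ... | true  = trans (cong A (sym (≡ᵇ-true eq))) (sym (m≥n⇒m⊓n≡n le))
    ... | false = refl

-- The arithmetic subroutines

lg³ : ℕ → ℕ
lg³ x = ⌊log₂ (x * x * x) ⌋

m/2≡⌊m/2⌋ : ∀ m → m / 2 ≡ ⌊ m /2⌋
m/2≡⌊m/2⌋ zero          = refl
m/2≡⌊m/2⌋ (suc zero)    = refl
m/2≡⌊m/2⌋ (suc (suc m)) = trans (m/n≡1+[m∸n]/n {2 + m} {2} (s≤s (s≤s z≤n))) (cong suc (m/2≡⌊m/2⌋ m))

lg-half : ∀ {y} → 2 ≤ y → ⌊log₂ y ⌋ ≡ suc ⌊log₂ (y / 2) ⌋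
lg-half {y} 2≤y = begin-equality
  ⌊log₂ y ⌋                  ≡⟨ suc-pred ⌊log₂ y ⌋ {{>-nonZero 1≤lg}} ⟨
  suc (pred ⌊log₂ y ⌋)       ≡⟨ cong suc (sym (pred≡∸1 ⌊log₂ y ⌋)) ⟩
  suc (⌊log₂ y ⌋ ∸ 1)        ≡⟨ cong suc (⌊log₂⌊n/2⌋⌋≡⌊log₂n⌋∸1 y) ⟨
  suc ⌊log₂ ⌊ y /2⌋ ⌋        ≡⟨ cong (λ z → suc ⌊log₂ z ⌋) (m/2≡⌊m/2⌋ y) ⟨
  suc ⌊log₂ (y / 2) ⌋        ∎
  where
  1≤lg : 1 ≤ ⌊log₂ y ⌋
  1≤lg = ⌊log₂⌋-mono-≤ 2≤y
  pred≡∸1 : ∀ n → n ∸ 1 ≡ pred n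
  pred≡∸1 n = sym (pred[m∸n]≡m∸[1+n] n 0)

-- With 2^k ≤ m one has ‖m‖ ≤ 3k and 2^(3k) ≤ X³. The added 1 serves m = 1, where the logarithm may
-- be 0. This makes the initial entries of the arrays legitimate upper bounds.
comp≤lg³ : ∀ {X m} → 1 ≤ m → m ≤ X → comp m ≤ suc (lg³ X)
comp≤lg³ {X} {suc zero} _ _ = ≤-trans (≤-reflexive comp-1) (s≤s z≤n)
comp≤lg³ {X} {m@(suc (suc _))} 1≤m m≤X with floor-log m 1≤m
... | k , lo , hi = begin
  comp m                   ≤⟨ comp≤3log k (s≤s (s≤s z≤n)) hi ⟩
  3 * k                    ≡⟨ ⌊log₂[2^n]⌋≡n (3 * k) ⟨
  ⌊log₂ (2 ^ (3 * k)) ⌋    ≤⟨ ⌊log₂⌋-mono-≤ pow≤ ⟩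
  lg³ X                    ≤⟨ n≤1+n _ ⟩
  suc (lg³ X)              ∎
  where
  lem : ∀ x → x * (x * (x * 1)) ≡ x * x * x
  lem = solve-∀
  pow≤ : 2 ^ (3 * k) ≤ X * X * X
  pow≤ = begin
    2 ^ (3 * k)           ≡⟨ cong (2 ^_) (*-comm 3 k) ⟩
    2 ^ (k * 3)           ≡⟨ ^-*-assoc 2 k 3 ⟨
    (2 ^ k) ^ 3           ≡⟨ lem (2 ^ k) ⟩
    2 ^ k * 2 ^ k * 2 ^ k ≤⟨ *-mono-≤ (*-mono-≤ (≤-trans lo m≤X) (≤-trans lo m≤X)) (≤-trans lo m≤X) ⟩
    X * X * X             ∎

module Arithmetic (w e : ℕ) where

  open Execution w e

  computeBound-run : ∀ x {ρ s X} → ρ x ≡ X → X * X * X < 2 ^ w → suc (lg³ X) < 2 ^ w →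
    Runs (computeBound x) ρ s (11 + 11 * lg³ X)
      (λ ρ′ s′ → Frame (R.y ∷ R.bound ∷ []) ρ ρ′ × ρ′ R.bound ≡ suc (lg³ X) × s′ ≡ s)
  computeBound-run x {ρ} {s} {X} ρx X³< lg< =
    weaken (≤-reflexive cost≡)
    (assign⨟ (ev-⊗ (ev-⊗ (ev-! ρx) (ev-! ρx)) (ev-! ρx)) X³<
    (assign⨟ ev-lit (≤-<-trans (s≤s z≤n) lg<)
    (while-run (λ _ → 8) I step (lg³ X) (X * X * X , refl , refl , refl , X³< ,
      frame-upd R.bound refl (frame-upd R.y refl frame-refl) , refl))))
    where
    -- Halving y lowers its logarithm by 1 while the bound grows by 1, so the sum of the two is
    -- invariant.
    I : ℕ → Env → Memory → Set
    I k ρ′ s′ = ∃ λ y → ρ′ R.y ≡ y × k ≡ ⌊log₂ y ⌋ × ρ′ R.bound + k ≡ suc (lg³ X) × y < 2 ^ w × Frame (R.y ∷ R.bound ∷ []) ρ ρ′ × s′ ≡ s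
    cost≡ : 6 + (2 + (Σ< (lg³ X) (λ _ → 11) + 3)) ≡ 11 + 11 * lg³ X
    cost≡ = trans (cong (λ S → 6 + (2 + (S + 3))) (Σ<-const (lg³ X) 11)) (lem (lg³ X))
      where
      lem : ∀ L → 6 + (2 + (L * 11 + 3)) ≡ 11 + 11 * L
      lem = solve-∀
    step : ∀ k ρ′ s′ → I k ρ′ s′ → (Tests ρ′ s′ (lit 2 ≼ ! R.y) false ×
      (Frame (R.y ∷ R.bound ∷ []) ρ ρ′ × ρ′ R.bound ≡ suc (lg³ X) × s′ ≡ s)) ⊎ (Tests ρ′ s′ (lit 2 ≼ ! R.y) true × ∃ λ k′ → k ≡ suc k′ ×
      Runs (R.y ≔ ! R.y ⊘ lit 2 ⨟ R.bound ≔ ! R.bound ⊕ lit 1) ρ′ s′ 8 (I k′))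
    step k ρ′ s′ (y , ρy , k≡ , b+k , y< , fr , s≡) with 2 ≤ᵇ y in eq
    ... | false = inj₁ (retest eq (tst-≼ ev-lit (ev-! ρy)) , fr ,
      trans (sym (+-identityʳ _)) (subst (λ k → ρ′ R.bound + k ≡ suc (lg³ X)) (trans k≡ (small (≤ᵇ-false {2} {y} eq))) b+k) , s≡)
      where
      small : ∀ {y} → y < 2 → ⌊log₂ y ⌋ ≡ 0
      small {zero}  _ = refl
      small {suc zero} _ = refl
      small {suc (suc y)} (s≤s (s≤s ()))
    ... | true = inj₂ (retest eq (tst-≼ ev-lit (ev-! ρy)) , ⌊log₂ (y / 2) ⌋ , trans k≡ (lg-half (≤ᵇ-true {2} {y} eq)) ,
      assign⨟ (ev-⊘ (ev-! ρy) ev-lit) half<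
      (assign (ev-⊕ (ev-! refl) ev-lit) b<
        (y / 2 , refl , refl , b+k′ , half< , frame-upd R.bound refl (frame-upd R.y refl fr) , s≡)))
      where
      half< : y / 2 < 2 ^ w
      half< = ≤-<-trans (m/n≤m y 2) y<
      b+k′ : ρ′ R.bound + 1 + ⌊log₂ (y / 2) ⌋ ≡ suc (lg³ X)
      b+k′ = trans (+-assoc (ρ′ R.bound) 1 _) (trans (cong (ρ′ R.bound +_) (sym (trans k≡ (lg-half (≤ᵇ-true {2} {y} eq))))) b+k)
      b< : ρ′ R.bound + 1 < 2 ^ w
      b< = ≤-<-trans (≤-trans (m≤m+n _ _) (≤-reflexive b+k′)) lg<

  E-small : ∀ x → 1 ≤ x → x < 5 → E x ≡ x
  E-small 1 _ _ = refl
  E-small 2 _ _ = refl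
  E-small 3 _ _ = refl
  E-small 4 _ _ = refl
  E-small (suc (suc (suc (suc (suc x))))) _ (s≤s (s≤s (s≤s (s≤s (s≤s ())))))

  E-∸3 : ∀ x → 5 ≤ x → E x ≡ 3 * E (x ∸ 3)
  E-∸3 (suc (suc (suc (suc (suc x))))) _ = E-3+ x
  E-∸3 1 (s≤s ())
  E-∸3 2 (s≤s (s≤s ()))
  E-∸3 3 (s≤s (s≤s (s≤s ())))
  E-∸3 4 (s≤s (s≤s (s≤s (s≤s ()))))

  -- The product of `dst` and E(s) is invariant, because E(s) = 3 E(s - 3) for s ≥ 5. The hypotheses
  -- on `upd` say that `dst` is not the work register; for concrete registers they hold by `refl`.
  computeE-run : ∀ dst src {ρ s} →
    (∀ v ρ → upd dst v ρ dst ≡ v) → (∀ v ρ → upd R.s v ρ dst ≡ ρ dst) → (∀ v ρ → upd dst v ρ R.s ≡ ρ R.s) →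
    dst ∈ᵇ (dst ∷ R.s ∷ []) ≡ true → R.s ∈ᵇ (dst ∷ R.s ∷ []) ≡ true →
    ∀ {X} → ρ src ≡ X → X < 2 ^ w → E X < 2 ^ w →
    Runs (computeE dst src) ρ s (14 + 11 * X) (λ ρ′ s′ → Frame (dst ∷ R.s ∷ []) ρ ρ′ × ρ′ dst ≡ E X × s′ ≡ s)
  computeE-run dst src {ρ} {s} same keep keep′ d∈ s∈ {X} ρsrc X< EX< =
    weaken (≤-reflexive cost≡)
    (assign⨟ (ev-! ρsrc) X<
    (assign⨟ ev-lit 1<
    (while-run {Ψ = I′} (λ _ → 8) I step X
      (X , 1 , ≤-refl , ≤-refl , keep′ 1 (upd R.s X ρ) , same 1 (upd R.s X ρ) , *-identityˡ _ , frame-upd dst d∈ (frame-upd R.s s∈ frame-refl) , refl)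
    then final)))
    where
    1< : 1 < 2 ^ w
    1< = ≤-<-trans (1≤E X) EX<
    I : ℕ → Env → Memory → Set
    I k ρ′ s′ = ∃₂ λ x d → x ≤ k × x ≤ X × ρ′ R.s ≡ x × ρ′ dst ≡ d × d * E x ≡ E X × Frame (dst ∷ R.s ∷ []) ρ ρ′ × s′ ≡ s
    I′ : Env → Memory → Set
    I′ ρ′ s′ = ∃₂ λ x d → x < 5 × ρ′ R.s ≡ x × ρ′ dst ≡ d × d * E x ≡ E X × Frame (dst ∷ R.s ∷ []) ρ ρ′ × s′ ≡ s
    cost≡ : 2 + (2 + (Σ< X (λ _ → 11) + 3 + 7)) ≡ 14 + 11 * X
    cost≡ = trans (cong (λ S → 2 + (2 + (S + 3 + 7))) (Σ<-const X 11)) (lem X)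
      where
      lem : ∀ L → 2 + (2 + (L * 11 + 3 + 7)) ≡ 14 + 11 * L
      lem = solve-∀
    d≤ : ∀ {d x} → d * E x ≡ E X → d ≤ E X
    d≤ {d} {x} eq = ≤-trans (m≤m*n d (E x) {{>-nonZero (1≤E x)}}) (≤-reflexive eq)
    step : ∀ k ρ′ s′ → I k ρ′ s′ → (Tests ρ′ s′ (lit 5 ≼ ! R.s) false × I′ ρ′ s′) ⊎
      (Tests ρ′ s′ (lit 5 ≼ ! R.s) true × ∃ λ k′ → k ≡ suc k′ ×
      Runs (R.s ≔ ! R.s ⊖ lit 3 ⨟ dst ≔ lit 3 ⊗ ! dst) ρ′ s′ 8 (I k′))
    step k ρ′ s′ (x , d , x≤k , x≤X , ρs , ρd , d*E , fr , s≡) with 5 ≤ᵇ x in eq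
    ... | false = inj₁ (retest eq (tst-≼ ev-lit (ev-! ρs)) , x , d , ≤ᵇ-false {5} {x} eq , ρs , ρd , d*E , fr , s≡)
    step zero    ρ′ s′ (zero , _) | true with () ← eq
    step zero    ρ′ s′ (suc x , d , () , _) | true
    step (suc k) ρ′ s′ (x , d , x≤k , x≤X , ρs , ρd , d*E , fr , s≡) | true =
      inj₂ (retest eq (tst-≼ ev-lit (ev-! ρs)) , k , refl ,
      assign⨟ (ev-⊖ (ev-! ρs) ev-lit) (≤-<-trans (≤-trans (m∸n≤m x 3) x≤X) X<)
      (assign (ev-⊗ ev-lit (ev-! (trans (keep (x ∸ 3) ρ′) ρd))) (≤-<-trans (d≤ {3 * d} {x ∸ 3} eq₃) EX<)
        (x ∸ 3 , 3 * d , ≤-trans (∸-monoˡ-≤ 3 x≤k) (m∸n≤m k 2) , ≤-trans (m∸n≤m x 3) x≤X ,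
         keep′ (3 * d) (upd R.s (x ∸ 3) ρ′) , same (3 * d) (upd R.s (x ∸ 3) ρ′) , eq₃ , frame-upd dst d∈ (frame-upd R.s s∈ fr) , s≡)))
      where
      5≤x : 5 ≤ x
      5≤x = ≤ᵇ-true {5} {x} eq
      eq₃ : 3 * d * E (x ∸ 3) ≡ E X
      eq₃ = trans (lem d (E (x ∸ 3))) (trans (cong (d *_) (sym (E-∸3 x 5≤x))) d*E)
        where
        lem : ∀ d y → 3 * d * y ≡ d * (3 * y)
        lem = solve-∀
    final : ∀ {ρ′ s′} → I′ ρ′ s′ → Runs (when (lit 1 ≼ ! R.s) (dst ≔ ! dst ⊗ ! R.s)) ρ′ s′ 7
      (λ ρ′ s′ → Frame (dst ∷ R.s ∷ []) ρ ρ′ × ρ′ dst ≡ E X × s′ ≡ s)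
    final {ρ′} (x , d , x<5 , ρs , ρd , d*E , fr , s≡) = branch-run (tst-≼ ev-lit (ev-! ρs))
      (λ 1≤x → let eq = trans (cong (d *_) (sym (E-small x (≤ᵇ-true 1≤x) x<5))) d*E in
        assign (ev-⊗ {a = d} {x} (ev-! ρd) (ev-! ρs)) (subst (_< 2 ^ w) (sym eq) EX<)
        (frame-upd dst d∈ fr , trans (same (d * x) ρ′) eq , s≡))
      (λ x<1 → skip-run (fr , trans ρd (trans (sym (*-identityʳ d)) (trans (cong (d *_) (zero-case (≤ᵇ-false {1} {x} x<1))) d*E)) , s≡) (s≤s z≤n))
      where
      zero-case : ∀ {x} → x < 1 → 1 ≡ E x
      zero-case (s≤s z≤n) = refl

  summandRegs kMaxRegs : List Register
  summandRegs = R.u ∷ R.e₁ ∷ R.e₂ ∷ R.s ∷ []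
  kMaxRegs    = R.t ∷ R.κ ∷ summandRegs

  computeSummands-run : ∀ {ρ s T x} → ρ R.T ≡ T → ρ R.t ≡ x → x ≤ T → T < 2 ^ w → E T < 2 ^ w →
    Runs computeSummands ρ s (32 + 11 * T)
      (λ ρ′ s′ → Frame summandRegs ρ ρ′ × ρ′ R.e₁ ≡ E x × ρ′ R.e₂ ≡ E (T ∸ x) × s′ ≡ s)
  computeSummands-run {ρ} {s} {T} {x} ρT ρt x≤T T< ET< = weaken (≤-reflexive cost≡)
    (assign⨟ (ev-⊖ (ev-! ρT) (ev-! ρt)) (≤-<-trans (m∸n≤m T x) T<)
    (computeE-run R.e₁ R.t (λ _ _ → refl) (λ _ _ → refl) (λ _ _ → refl) refl refl ρt (≤-<-trans x≤T T<) (≤-<-trans (E-mono x≤T) ET<)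
     then λ { {ρ₁} (fr₁ , e₁≡ , refl) →
    conseq (λ { ρ₂ _ (fr₂ , e₂≡ , refl) →
      frame-trans (frame-trans (frame-upd R.u refl frame-refl) refl fr₁) refl fr₂ , trans (kept fr₂ R.e₁ refl) e₁≡ , e₂≡ , refl })
    (computeE-run R.e₂ R.u (λ _ _ → refl) (λ _ _ → refl) (λ _ _ → refl) refl refl (kept fr₁ R.u refl)
      (≤-<-trans (m∸n≤m T x) T<) (≤-<-trans (E-mono (m∸n≤m T x)) ET<)) }))
    where
    cost≡ : 4 + (14 + 11 * x + (14 + 11 * (T ∸ x))) ≡ 32 + 11 * T
    cost≡ = trans (lem x (T ∸ x)) (cong (λ y → 32 + 11 * y) (m+[n∸m]≡n x≤T))
      where
      lem : ∀ x y → 4 + (14 + 11 * x + (14 + 11 * y)) ≡ 32 + 11 * (x + y)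
      lem = solve-∀

  kMaxCost : ℕ → ℕ
  kMaxCost T = 60 * (suc T * suc T)

  kMaxCost-mono : ∀ {T T′} → T ≤ T′ → kMaxCost T ≤ kMaxCost T′
  kMaxCost-mono T≤ = *-monoʳ-≤ 60 (*-mono-≤ (s≤s T≤) (s≤s T≤))

  computeKMax-run : ∀ {ρ s n} → ρ R.n ≡ suc n → ρ R.T ≡ comp n → comp n < 2 ^ w → E (comp n) < 2 ^ w →
    Runs computeKMax ρ s (kMaxCost (comp n)) (λ ρ′ s′ → Frame kMaxRegs ρ ρ′ × ρ′ R.κ ≡ κ (suc n) × s′ ≡ s)
  computeKMax-run {ρ} {s} {n} ρn ρT T< ET< = weaken cost≤
    (assign⨟ (ev-⊘ (ev-! ρT) ev-lit) (≤-<-trans t₀≤ T<)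
    (computeSummands-run ρT refl t₀≤ T< ET<
     then λ { (fr₁ , e₁≡ , e₂≡ , refl) →
    while-run {Ψ = Found} (λ _ → 4 + (32 + 11 * T)) I step T
      (T / 2 , t₀≤ , t₀≤ , trans (kept fr₁ R.t refl) refl , e₁≡ , e₂≡ , refl ,
        frame-trans (frame-upd R.t refl frame-refl) refl fr₁ , refl)
     then λ { (fr , e₁≡ , refl) →
    assign (ev-! e₁≡) (≤-<-trans (E-mono (≤-trans (search-≤ (suc n) T (T / 2)) t₀≤)) ET<)
      (frame-upd R.κ refl fr , refl , refl) } }))
    where
    T : ℕ
    T = comp n
    t₀≤ : T / 2 ≤ T
    t₀≤ = m/n≤m T 2
    Found : Env → Memory → Set
    Found ρ′ s′ = Frame kMaxRegs ρ ρ′ × ρ′ R.e₁ ≡ E (search (suc n) T (T / 2)) × s′ ≡ s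
    I : ℕ → Env → Memory → Set
    I k ρ′ s′ = ∃ λ x → x ≤ k × x ≤ T × ρ′ R.t ≡ x × ρ′ R.e₁ ≡ E x × ρ′ R.e₂ ≡ E (T ∸ x) ×
      search (suc n) T x ≡ search (suc n) T (T / 2) × Frame kMaxRegs ρ ρ′ × s′ ≡ s
    stops : ∀ x → (E x + E (T ∸ x) <ᵇ suc n) ≡ false → search (suc n) T x ≡ x
    stops zero    _  = refl
    stops (suc x) eq = cong (λ b → if b then search (suc n) T x else suc x) eq
    continues : ∀ x → (E x + E (T ∸ x) <ᵇ suc n) ≡ true → ∃ λ y → x ≡ suc y × search (suc n) T x ≡ search (suc n) T y
    -- The program has no test for t = 0. At 0 the loop ends by itself, because E(0) + E(T) ≥ 1 + n,
    -- which is the integer being treated.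
    continues zero eq = contradiction (<ᵇ-true {E 0 + E T} {suc n} eq) (≤⇒≯ (s≤s (n≤E′ n)))
      where
      n≤E′ : ∀ n → n ≤ E (comp n)
      n≤E′ zero    = z≤n
      n≤E′ (suc n) = n≤E[comp] (s≤s z≤n)
    continues (suc x) eq = x , refl , cong (λ b → if b then search (suc n) T x else suc x) eq
    step : ∀ k ρ′ s′ → I k ρ′ s′ → (Tests ρ′ s′ (! R.e₁ ⊕ ! R.e₂ ≺ ! R.n) false × Found ρ′ s′) ⊎
      (Tests ρ′ s′ (! R.e₁ ⊕ ! R.e₂ ≺ ! R.n) true × ∃ λ k′ → k ≡ suc k′ ×
      Runs (R.t ≔ ! R.t ⊖ lit 1 ⨟ computeSummands) ρ′ s′ (4 + (32 + 11 * T)) (I k′))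
    step k ρ′ s′ (x , x≤k , x≤T , ρt , ρe₁ , ρe₂ , search≡ , fr , s≡) with E x + E (T ∸ x) <ᵇ suc n in eq
    ... | false = inj₁ (retest eq (tst-≺ (ev-⊕ (ev-! ρe₁) (ev-! ρe₂)) (ev-! (trans (kept fr R.n refl) ρn))) ,
      fr , trans ρe₁ (cong E (trans (sym (stops x eq)) search≡)) , s≡)
    ... | true with continues x eq | x≤k
    ...   | y , refl , search≡′ | s≤s {n = k′} y≤k′ = inj₂
      (retest eq (tst-≺ (ev-⊕ (ev-! ρe₁) (ev-! ρe₂)) (ev-! (trans (kept fr R.n refl) ρn))) , k′ , refl ,
      assign⨟ (ev-⊖ (ev-! ρt) ev-lit) (≤-<-trans y≤T T<)
      (conseq (λ { _ _ (fr′ , e₁≡ , e₂≡ , refl) → y , y≤k′ , y≤T , trans (kept fr′ R.t refl) refl , e₁≡ , e₂≡ ,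
          trans (sym search≡′) search≡ , frame-trans (frame-upd R.t refl fr) refl fr′ , s≡ })
        (computeSummands-run (trans (kept fr R.T refl) ρT) refl y≤T T< ET<)))
      where
      y≤T : y ≤ T
      y≤T = <⇒≤ x≤T
    cost≤ : 4 + (32 + 11 * T + (Σ< T (λ _ → 5 + (4 + (32 + 11 * T))) + 5 + 2)) ≤ kMaxCost T
    cost≤ = begin
      4 + (32 + 11 * T + (Σ< T (λ _ → 5 + (4 + (32 + 11 * T))) + 5 + 2))
        ≡⟨ cong (λ S → 4 + (32 + 11 * T + (S + 5 + 2))) (Σ<-const T (41 + 11 * T)) ⟩
      4 + (32 + 11 * T + (T * (41 + 11 * T) + 5 + 2))
        ≤⟨ m≤m+n _ (17 + 68 * T + 49 * (T * T)) ⟩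
      4 + (32 + 11 * T + (T * (41 + 11 * T) + 5 + 2)) + (17 + 68 * T + 49 * (T * T))
        ≡⟨ lem T ⟩
      60 * (suc T * suc T) ∎
      where
      lem : ∀ T → 4 + (32 + 11 * T + (T * (41 + 11 * T) + 5 + 2)) + (17 + 68 * T + 49 * (T * T)) ≡ 60 * (suc T * suc T)
      lem = solve-∀

  record Filled (j lo hi : ℕ) (V : ℕ → ℕ) (s s′ : Memory) : Set where
    field
      only-j    : Only j s s′
      inside    : ∀ k → lo ≤ k → k ≤ hi → cells s′ block j k ≡ just (V k)
      outside   : ∀ k → k < lo ⊎ hi < k → cells s′ block j k ≡ cells s block j k
      reported  : out s′ ≡ out s

  open Filled public

  -- When entry k is written, the entries from k on are still the old ones. Hence `z` may read the
  -- same block further up, as in copying its upper half onto its lower half.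
  fill-run : ∀ {from to x z j lo hi ρ s} (V : ℕ → ℕ) →
    (ρ , s) ⊢ from ⇒ lo → lo ≤ suc hi → suc hi < 2 ^ w → 1 ≤ lo → hi ≤ sizes s block j → (∀ k → lo ≤ k → k ≤ hi → V k < 2 ^ e) →
    (∀ {ρ′ s′} → Frame (R.i ∷ []) ρ ρ′ → (ρ′ , s′) ⊢ to ⇒ hi) →
    (∀ {ρ′ s′} → Frame (R.i ∷ []) ρ ρ′ → (ρ′ , s′) ⊢ x ⇒ j) →
    (∀ {k ρ′ s′} → lo ≤ k → k ≤ hi → Frame (R.i ∷ []) ρ ρ′ → ρ′ R.i ≡ k → Only j s s′ →
      (∀ l → k ≤ l → cells s′ block j l ≡ cells s block j l) → (ρ′ , s′) ⊢ z ⇒ V k) →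
    Runs (forUp R.i from to (block [ x ][ ! R.i ]≔ z)) ρ s
      (1 + cost from + ((suc hi ∸ lo) * (6 + cost to + (1 + cost x + 1 + cost z)) + (2 + cost to)))
      (λ ρ′ s′ → Frame (R.i ∷ []) ρ ρ′ × Filled j lo hi V s s′)
  fill-run {from} {to} {x} {z} {j} {lo} {hi} {ρ} {s} V efrom lo≤ hi< 1≤lo hi≤ V< eto ex ez =
    weaken (≤-reflexive (cong (λ S → 1 + cost from + (S + (2 + cost to))) (Σ<-const (suc hi ∸ lo) _)))
    (conseq (λ { _ _ (i , hi<i , final , _ , fr , f) → fr , subst (λ i → Filled j lo (pred i) V s _) (final lo≤) f })
    (forUp-run {hi = hi} (λ _ → 1 + cost x + 1 + cost z) I efrom (≤-<-trans lo≤ hi<) hi< (λ (ρi , fr , _) → ρi , eto fr) body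
      (refl , frame-upd R.i refl frame-refl , record
        { only-j = Only-refl ; inside = λ k lo≤k k≤ → contradiction (≤-trans lo≤k k≤) (<⇒≱ (pred< 1≤lo))
        ; outside = λ _ _ → refl ; reported = refl })))
    where
    pred< : ∀ {n} → 1 ≤ n → pred n < n
    pred< {suc n} _ = ≤-refl
    I : ℕ → Env → Memory → Set
    I i ρ′ s′ = ρ′ R.i ≡ i × Frame (R.i ∷ []) ρ ρ′ × Filled j lo (pred i) V s s′
    body : ∀ {i ρ′ s′} → lo ≤ i → i ≤ hi → I i ρ′ s′ → Runs (block [ x ][ ! R.i ]≔ z) ρ′ s′ (1 + cost x + 1 + cost z)
      (λ ρ″ s″ → ρ″ R.i ≡ i × I (suc i) (upd R.i (suc i) ρ″) s″)
    body {i} {ρ′} {s′} lo≤i i≤hi (ρi , fr , f) =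
      write (ex fr) (ev-! ρi) (ez lo≤i i≤hi fr ρi (only-j f) (λ l i≤l → outside f l (inj₂ (≤-trans (pred< (≤-trans 1≤lo lo≤i)) i≤l))))
        (≤-trans 1≤lo lo≤i) (≤-trans i≤hi (subst (hi ≤_) (sym (sizes≡ (only-j f) block j)) hi≤)) (V< i lo≤i i≤hi)
      (ρi , refl , frame-upd R.i refl fr , record
        { only-j   = Only-trans (only-j f) (put-only j i (V i) s′)
        ; inside   = λ k lo≤k k≤i → case k ≟ i of λ where
            (yes refl) → put-same j i (V i) s′
            (no k≢i)   → trans (put-other-entry {j} {i} {V i} {s′} j k k≢i) (inside f k lo≤k (≤-pred (subst (suc k ≤_) (sym (suc-pred i {{>-nonZero (≤-trans 1≤lo lo≤i)}})) (≤∧≢⇒< k≤i k≢i))))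
        ; outside  = λ k out → trans (put-other-entry {j} {i} {V i} {s′} j k (differs k out)) (outside f k (wider k out))
        ; reported = reported f })
      where
      differs : ∀ k → k < lo ⊎ i < k → k ≢ i
      differs k (inj₁ k<lo) refl = <⇒≱ k<lo lo≤i
      differs k (inj₂ i<k)  refl = <⇒≱ i<k ≤-refl
      wider : ∀ k → k < lo ⊎ i < k → k < lo ⊎ pred i < k
      wider k (inj₁ p) = inj₁ p
      wider k (inj₂ p) = inj₂ (≤-trans (s≤s (pred[n]≤n {i})) p)

-- Tables of upper bounds for complexities

-- Entries only decrease, and one that is an upper bound for the complexity remains so; hence an
-- exact entry never changes again.
record Better (A A′ : ℕ → ℕ) : Set where
  constructor better
  field
    lower≤ : ∀ m → A′ m ≤ A m
    sound  : ∀ m → comp m ≤ A m → comp m ≤ A′ m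

open Better

Better-refl : ∀ {A} → Better A A
Better-refl = better (λ _ → ≤-refl) (λ _ c≤ → c≤)

Better-trans : ∀ {A B C} → Better A B → Better B C → Better A C
Better-trans (better l s) (better l′ s′) = better (λ m → ≤-trans (l′ m) (l m)) (λ m → s′ m ∘ s m)

lowerAt-better : ∀ {n x A} → comp n ≤ x → Better A (lowerAt n x A)
lowerAt-better {n} {x} {A} c≤x = better (lowerAt-≤ n x A) (λ m → lowerAt-≥ {n} {x} {A} {comp m} {m} (λ { refl → c≤x }))

Better-exact : ∀ {A A′ m} → Better A A′ → A m ≡ comp m → A′ m ≡ comp m
Better-exact {m = m} b eq = ≤-antisym (≤-trans (lower≤ b m) (≤-reflexive eq)) (sound b m (≤-reflexive (sym eq)))

results : ℕ → List (ℕ × ℕ)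
results zero    = []
results (suc n) = results n ∷ʳ (suc n , comp (suc n))

module Tables (w e : ℕ) where

  open Execution w e
  open Arithmetic w e

  lowerCost : ℕ → ℕ → ℕ → ℕ
  lowerCost cx cy cz = 1 + cz + (3 + cx + cy + (2 + cx + cy))

  -- Shared by both algorithms, which differ only in the block and the positions used. `ez` has to
  -- hold for every improved table, since the loop changes the block from which it reads.
  sumsLoop-run : ∀ {x y z j i n base len A ρ s} →
    base + i ≡ suc n → 1 ≤ i → i ≤ len → 1 ≤ n → Arr s j base len A →
    ρ R.κ ≡ κ (suc n) → suc (κ (suc n)) < 2 ^ w → 6 < 2 ^ w → A (suc n) < 2 ^ e →
    (∀ k → 6 ≤ k → k ≤ κ (suc n) → comp k + comp (suc n ∸ k) < 2 ^ w) →
    (∀ {ρ′ s′ v} → Frame (R.k ∷ R.v ∷ []) ρ ρ′ → (upd R.v v ρ′ , s′) ⊢ x ⇒ j) →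
    (∀ {ρ′ s′ v} → Frame (R.k ∷ R.v ∷ []) ρ ρ′ → (upd R.v v ρ′ , s′) ⊢ y ⇒ i) →
    (∀ {k ρ′ s′ A′} → 6 ≤ k → k ≤ κ (suc n) → Frame (R.k ∷ R.v ∷ []) ρ ρ′ → ρ′ R.k ≡ k → Arr s′ j base len A′ → Better A A′ → Only j s s′ →
      (ρ′ , s′) ⊢ block [ lit 0 ][ ! R.k ] ⊕ z ⇒ comp k + comp (suc n ∸ k)) →
    Runs (forUp R.k (lit 6) (! R.κ) (lower x y (block [ lit 0 ][ ! R.k ] ⊕ z))) ρ s
      (5 + κ (suc n) * (7 + lowerCost (cost x) (cost y) (4 + cost z)))
      (λ ρ′ s′ → Frame (R.k ∷ R.v ∷ []) ρ ρ′ × Only j s s′ × out s′ ≡ out s × ∃ λ A′ → Arr s′ j base len A′ × Better A A′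
        × (∀ k → 6 ≤ k → k ≤ κ (suc n) → A′ (suc n) ≤ comp k + comp (suc n ∸ k)))
  sumsLoop-run {x} {y} {z} {j} {i} {n} {base} {len} {A} {ρ} {s} n≡ 1≤i i≤ 1≤n ar ρκ κ< 6< A< v< ex ey ez =
    weaken cost≤ (conseq (λ { _ _ (k , κ<k , _ , _ , fr , o , out≡ , A′ , ar′ , b , done) → fr , o , out≡ , A′ , ar′ , b ,
        λ k′ 6≤k′ k′≤ → done k′ 6≤k′ (≤-<-trans k′≤ κ<k) })
      (forUp-run {hi = κ (suc n)} (λ _ → lowerCost (cost x) (cost y) (4 + cost z)) I ev-lit 6< κ<
        (λ (ρk , fr , _) → ρk , ev-! (trans (kept fr R.κ refl) ρκ)) body
        (refl , frame-upd R.k refl frame-refl , Only-refl , refl , A , ar , Better-refl ,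
          λ k 6≤k k<6 → contradiction 6≤k (<⇒≱ k<6))))
    where
    I : ℕ → Env → Memory → Set
    I k ρ′ s′ = ρ′ R.k ≡ k × Frame (R.k ∷ R.v ∷ []) ρ ρ′ × Only j s s′ × out s′ ≡ out s × ∃ λ A′ → Arr s′ j base len A′ × Better A A′
        × (∀ k′ → 6 ≤ k′ → k′ < k → A′ (suc n) ≤ comp k′ + comp (suc n ∸ k′))
    body : ∀ {k ρ′ s′} → 6 ≤ k → k ≤ κ (suc n) → I k ρ′ s′ → Runs (lower x y (block [ lit 0 ][ ! R.k ] ⊕ z)) ρ′ s′
      (lowerCost (cost x) (cost y) (4 + cost z)) (λ ρ″ s″ → ρ″ R.k ≡ k × I (suc k) (upd R.k (suc k) ρ″) s″)
    body {k} {ρ′} {s′} 6≤k k≤ (ρk , fr , o , out≡ , A′ , ar′ , b , done) =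
      lower-run ar′ 1≤i i≤ (ez 6≤k k≤ fr ρk ar′ b o) (ex fr) (ey fr) (v< k 6≤k k≤)
        (subst (λ m → A′ m < 2 ^ e) (sym n≡) (≤-<-trans (lower≤ b (suc n)) A<))
        λ ar″ o″ out″ → ρk , refl , frame-upd R.k refl (frame-upd R.v refl fr) , Only-trans o o″ , trans out″ out≡ , _ , ar″ ,
          Better-trans b step , λ k′ 6≤k′ k′<1+k → case m<1+n⇒m<n∨m≡n k′<1+k of λ where
            (inj₁ k′<k) → ≤-trans (lower≤ step (suc n)) (done k′ 6≤k′ k′<k)
            (inj₂ refl) → subst (λ m → lowerAt (base + i) (comp k + comp (suc n ∸ k)) A′ m ≤ comp k + comp (suc n ∸ k)) n≡
              (lowerAt-≤x (base + i) _ A′)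
      where
      k≤n : k ≤ n
      k≤n = ≤-trans k≤ (≤-pred (kMax<n (s≤s 1≤n)))
      step : Better A′ (lowerAt (base + i) (comp k + comp (suc n ∸ k)) A′)
      step = lowerAt-better (subst (λ m → comp m ≤ comp k + comp (suc n ∸ k)) (trans (m+[n∸m]≡n (m≤n⇒m≤1+n k≤n)) (sym n≡))
        (comp-+ (≤-trans (s≤s z≤n) 6≤k) (m<n⇒0<n∸m (s≤s k≤n))))
    cost≤ : 2 + (Σ< (suc (κ (suc n)) ∸ 6) (λ _ → 7 + lowerCost (cost x) (cost y) (4 + cost z)) + 3)
          ≤ 5 + κ (suc n) * (7 + lowerCost (cost x) (cost y) (4 + cost z))
    cost≤ = begin
      2 + (Σ< (suc (κ (suc n)) ∸ 6) (λ _ → 7 + lc) + 3) ≡⟨ cong (λ S → 2 + (S + 3)) (Σ<-const (suc (κ (suc n)) ∸ 6) (7 + lc)) ⟩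
      2 + ((κ (suc n) ∸ 5) * (7 + lc) + 3)              ≤⟨ +-monoʳ-≤ 2 (+-monoˡ-≤ 3 (*-monoˡ-≤ (7 + lc) (m∸n≤m (κ (suc n)) 5))) ⟩
      2 + (κ (suc n) * (7 + lc) + 3)                    ≡⟨ cong (2 +_) (+-comm (κ (suc n) * (7 + lc)) 3) ⟩
      5 + κ (suc n) * (7 + lc)                          ∎
      where
      lc : ℕ
      lc = lowerCost (cost x) (cost y) (4 + cost z)

-- The value at divisor 0 is arbitrary.

quot : ℕ → ℕ → ℕ
quot x zero    = 0
quot x (suc n) = x / suc n

-- The time-improved algorithm

-- The cube in `fits` is formed when the initial bound is computed; `2bound<` is for sums of two
-- entries.
module TimeImproved (w e X : ℕ) (2≤X : 2 ≤ X)
  (fits : ∀ {v} → v ≤ X * X * X → v < 2 ^ w)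
  (bound< : suc (lg³ X) < 2 ^ e) (2bound< : suc (lg³ X) + suc (lg³ X) < 2 ^ w) where

  open Execution w e
  open Arithmetic w e
  open Tables w e

  Bd : ℕ
  Bd = suc (lg³ X)

  1≤X : 1 ≤ X
  1≤X = <⇒≤ 2≤X

  X*X≤ : X * X ≤ X * X * X
  X*X≤ = m≤m*n (X * X) X {{>-nonZero 1≤X}}

  X≤X*X : X ≤ X * X
  X≤X*X = m≤m*n X X {{>-nonZero 1≤X}}

  X<2^w : X < 2 ^ w
  X<2^w = fits (≤-trans X≤X*X X*X≤)

  1+X<2^w : suc X < 2 ^ w
  1+X<2^w = fits (≤-trans (≤-trans (+-monoˡ-≤ X 1≤X) (≤-trans (≤-reflexive (cong (X +_) (sym (+-identityʳ X)))) (*-monoˡ-≤ X 2≤X))) X*X≤)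

  comp≤Bd : ∀ {n} → 1 ≤ n → n ≤ X → comp n ≤ Bd
  comp≤Bd = comp≤lg³

  comp+comp< : ∀ {a b} → 1 ≤ a → a ≤ X → 1 ≤ b → b ≤ X → comp a + comp b < 2 ^ w
  comp+comp< 1≤a a≤X 1≤b b≤X = ≤-<-trans (+-mono-≤ (comp≤Bd 1≤a a≤X) (comp≤Bd 1≤b b≤X)) 2bound<

  -- The situation before n is treated. A product ab with 2 ≤ a ≤ b is entered when b is treated;
  -- since b < ab, all factorizations of n have been used when n is reached.
  record Table (n : ℕ) (A : ℕ → ℕ) : Set where
    field
      above    : ∀ m → 1 ≤ m → m ≤ X → comp m ≤ A m
      below    : ∀ m → 1 ≤ m → m ≤ X → A m ≤ Bd
      exact    : ∀ m → 1 ≤ m → m < n → A m ≡ comp m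
      factored : ∀ a b → 2 ≤ a → a ≤ b → b < n → a * b ≤ X → A (a * b) ≤ comp a + comp b

  open Table

  Table-better : ∀ {n A A′} → Better A A′ → Table n A → Table n A′
  Table-better b t = record
    { above    = λ m lo hi → sound b m (above t m lo hi)
    ; below    = λ m lo hi → ≤-trans (lower≤ b m) (below t m lo hi)
    ; exact    = λ m lo hi → Better-exact b (exact t m lo hi)
    ; factored = λ x y 2≤x x≤y y<n xy≤X → ≤-trans (lower≤ b (x * y)) (factored t x y 2≤x x≤y y<n xy≤X) }

  read : ∀ {s A m} → Arr s 0 0 X A → 1 ≤ m → m ≤ X → A m ≡ comp m → cells s block 0 m ≡ just (comp m)
  read {m = m} ar lo hi eq = trans (get ar m lo hi) (cong just eq)

  tableRegs : List Register
  tableRegs = R.y ∷ R.bound ∷ R.i ∷ R.n ∷ R.T ∷ R.k ∷ R.v ∷ R.q ∷ kMaxRegs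

  bodyCost : ℕ → ℕ
  bodyCost n = 47 + kMaxCost Bd + 26 * κ n + 28 * quot X n

  module Body (ρ₀ : Env) (ρM : ρ₀ R.M ≡ X) (s₁ : Memory) where

    Good : ℕ → ℕ → Env → Memory → Set
    Good n r ρ s = ρ R.n ≡ n × Frame tableRegs ρ₀ ρ × Only 0 s₁ s × out s ≡ results r × ∃ λ A → Arr s 0 0 X A × Table n A

    -- The conditions on `q` characterize it as the smaller of n and ⌊M/n⌋, for n the integer
    -- treated. So every a ≤ n with an ≤ M is among the factors of the loop.
    multiples-run : ∀ {n ρ s q} → 2 ≤ suc n → suc n ≤ X → Good (suc n) (suc n) ρ s → cells s block 0 (suc n) ≡ just (comp (suc n)) →
      ρ R.q ≡ q → q ≤ suc n → q ≤ X / suc n → (∀ a → a ≤ suc n → a ≤ X / suc n → a ≤ q) →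
      Runs (forUp R.k (lit 2) (! R.q) (lower (lit 0) (! R.k ⊗ ! R.n) (block [ lit 0 ][ ! R.k ] ⊕ block [ lit 0 ][ ! R.n ]))) ρ s
        (5 + 28 * (X / suc n)) (λ ρ′ s′ → ρ′ R.n ≡ suc n × Good (suc (suc n)) (suc n) (upd R.n (suc (suc n)) ρ′) s′)
    multiples-run {n} {ρ} {s} {q} 2≤n n≤X (ρn , fr₀ , o₀ , out₀ , A , ar , t) readₙ ρq q≤n q≤ max =
      weaken cost≤ (conseq (λ { _ _ (k , q<k , _ , _ , ρn , fr , o , out≡ , A′ , ar′ , b , done) →
        ρn , refl , frame-upd R.n refl (frame-trans fr₀ refl fr) , Only-trans o₀ o , trans out≡ out₀ , A′ , ar′ , final A′ b
          (λ k′ 2≤k′ k′≤q → done k′ 2≤k′ (≤-<-trans k′≤q q<k)) })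
      (forUp-run {hi = q} (λ _ → lowerCost 1 3 7) I ev-lit (≤-<-trans 2≤X X<2^w) (≤-<-trans (s≤s (≤-trans q≤n n≤X)) 1+X<2^w)
        (λ (ρk , ρn , fr , _) → ρk , ev-! (trans (kept fr R.q refl) ρq)) body
        (refl , ρn , frame-upd R.k refl frame-refl , Only-refl , refl , A , ar , Better-refl ,
          λ k 2≤k k<2 → contradiction 2≤k (<⇒≱ k<2))))
      where
      Aₙ : A (suc n) ≡ comp (suc n)
      Aₙ = just-injective (trans (sym (get ar (suc n) (s≤s z≤n) n≤X)) readₙ)
      I : ℕ → Env → Memory → Set
      I k ρ′ s′ = ρ′ R.k ≡ k × ρ′ R.n ≡ suc n × Frame (R.k ∷ R.v ∷ []) ρ ρ′ × Only 0 s s′ × out s′ ≡ out s ×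
        ∃ λ A′ → Arr s′ 0 0 X A′ × Better A A′ × (∀ k′ → 2 ≤ k′ → k′ < k → A′ (k′ * suc n) ≤ comp k′ + comp (suc n))
      exact≤ : ∀ m → 1 ≤ m → m ≤ suc n → A m ≡ comp m
      exact≤ m 1≤m m≤n with m≤n⇒m<n∨m≡n m≤n
      ... | inj₁ m<n  = exact t m 1≤m m<n
      ... | inj₂ refl = Aₙ
      body : ∀ {k ρ′ s′} → 2 ≤ k → k ≤ q → I k ρ′ s′ →
        Runs (lower (lit 0) (! R.k ⊗ ! R.n) (block [ lit 0 ][ ! R.k ] ⊕ block [ lit 0 ][ ! R.n ])) ρ′ s′ (lowerCost 1 3 7)
          (λ ρ″ s″ → ρ″ R.k ≡ k × I (suc k) (upd R.k (suc k) ρ″) s″)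
      body {k} {ρ′} {s′} 2≤k k≤q (ρk , ρn , fr , o , out≡ , A′ , ar′ , b , done) =
        lower-run ar′ (*-mono-≤ 1≤k (s≤s z≤n)) kn≤X
          (ev-⊕ (ev-[] ev-lit (ev-! ρk) (read ar′ 1≤k k≤X (Better-exact b (exact≤ k 1≤k (≤-trans k≤q q≤n)))))
                (ev-[] ev-lit (ev-! ρn) (read ar′ (s≤s z≤n) n≤X (Better-exact b Aₙ))))
          ev-lit (ev-⊗ (ev-! ρk) (ev-! ρn)) (comp+comp< 1≤k k≤X (s≤s z≤n) n≤X)
          (≤-<-trans (≤-trans (lower≤ b _) (below t _ (*-mono-≤ 1≤k (s≤s z≤n)) kn≤X)) bound<)
          λ ar″ o″ out″ → ρk , refl , ρn , frame-upd R.k refl (frame-upd R.v refl fr) , Only-trans o o″ , trans out″ out≡ , _ , ar″ ,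
            Better-trans b step , λ k′ 2≤k′ k′<1+k → case m<1+n⇒m<n∨m≡n k′<1+k of λ where
              (inj₁ k′<k) → ≤-trans (lower≤ step (k′ * suc n)) (done k′ 2≤k′ k′<k)
              (inj₂ refl) → lowerAt-≤x (k * suc n) _ A′
        where
        1≤k : 1 ≤ k
        1≤k = <⇒≤ 2≤k
        k≤X : k ≤ X
        k≤X = ≤-trans k≤q (≤-trans q≤n n≤X)
        kn≤X : k * suc n ≤ X
        kn≤X = ≤-trans (*-monoˡ-≤ (suc n) (≤-trans k≤q q≤)) (m/n*n≤m X (suc n))
        step : Better A′ (lowerAt (k * suc n) (comp k + comp (suc n)) A′)
        step = lowerAt-better (comp-* 1≤k (s≤s z≤n))
      final : ∀ A′ → Better A A′ → (∀ k → 2 ≤ k → k ≤ q → A′ (k * suc n) ≤ comp k + comp (suc n)) → Table (suc (suc n)) A′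
      final A′ b done = record
        { above    = λ m lo hi → sound b m (above t m lo hi)
        ; below    = λ m lo hi → ≤-trans (lower≤ b m) (below t m lo hi)
        ; exact    = λ m lo hi → Better-exact b (exact≤ m lo (≤-pred hi))
        ; factored = λ x y 2≤x x≤y y< xy≤X → case m<1+n⇒m<n∨m≡n y< of λ where
            (inj₁ y<n)  → ≤-trans (lower≤ b (x * y)) (factored t x y 2≤x x≤y y<n xy≤X)
            (inj₂ refl) → done x 2≤x (max x x≤y (subst (_≤ X / suc n) (m*n/n≡m x (suc n)) (/-monoˡ-≤ (suc n) xy≤X))) }
      cost≤ : 2 + (Σ< (suc q ∸ 2) (λ _ → 7 + lowerCost 1 3 7) + 3) ≤ 5 + 28 * (X / suc n)
      cost≤ = begin
        2 + (Σ< (suc q ∸ 2) (λ _ → 28) + 3) ≡⟨ cong (λ S → 2 + (S + 3)) (Σ<-const (suc q ∸ 2) 28) ⟩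
        2 + ((q ∸ 1) * 28 + 3)              ≤⟨ +-monoʳ-≤ 2 (+-monoˡ-≤ 3 (*-monoˡ-≤ 28 (≤-trans (m∸n≤m q 1) q≤))) ⟩
        2 + (X / suc n * 28 + 3)            ≡⟨ lem (X / suc n) ⟩
        5 + 28 * (X / suc n)                ∎
        where
        lem : ∀ x → 2 + (x * 28 + 3) ≡ 5 + 28 * x
        lem = solve-∀

    body : Program
    body =
      lower (lit 0) (! R.n) (block [ lit 0 ][ ! R.n ⊖ lit 1 ] ⊕ lit 1) ⨟
      R.T ≔ block [ lit 0 ][ ! R.n ⊖ lit 1 ] ⨟
      computeKMax ⨟
      forUp R.k (lit 6) (! R.κ)
        ( lower (lit 0) (! R.n) (block [ lit 0 ][ ! R.k ] ⊕ block [ lit 0 ][ ! R.n ⊖ ! R.k ]) ) ⨟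
      emit (! R.n) (block [ lit 0 ][ ! R.n ]) ⨟
      R.q ≔ ! R.M ⊘ ! R.n ⨟
      when (! R.n ≺ ! R.q) (R.q ≔ ! R.n) ⨟
      forUp R.k (lit 2) (! R.q)
        ( lower (lit 0) (! R.k ⊗ ! R.n) (block [ lit 0 ][ ! R.k ] ⊕ block [ lit 0 ][ ! R.n ]) )

    body-run : ∀ {n ρ s} → 1 ≤ n → suc n ≤ X → Good (suc n) n ρ s →
      Runs body ρ s (bodyCost (suc n)) (λ ρ′ s′ → ρ′ R.n ≡ suc n × Good (suc (suc n)) (suc n) (upd R.n (suc (suc n)) ρ′) s′)
    body-run {n} {ρ} {s} 1≤n n≤X (ρn , fr , o , out≡ , A , ar , t) = weaken cost≤
      (lower-run {Ψ = Ψ₁} ar (s≤s z≤n) n≤X (ev-⊕ (ev-[] ev-lit (ev-⊖ (ev-! ρn) ev-lit) (read ar 1≤n n≤X′ (exact t n 1≤n ≤-refl))) ev-lit)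
        ev-lit (ev-! ρn) (≤-<-trans (+-monoʳ-≤ (comp n) (1≤comp n)) (comp+comp< 1≤n n≤X′ 1≤n n≤X′)) (≤-<-trans (below t (suc n) (s≤s z≤n) n≤X) bound<)
        (λ ar₁ o₁ out₁ → ρn , frame-upd R.v refl fr , Only-trans o o₁ , trans out₁ out≡ , _ , ar₁ , Table-better step₁ t , lowerAt-≤x (suc n) _ A)
      then λ { {ρ₁} {s₂} (ρn , fr , o , out≡ , A₁ , ar₁ , t₁ , A₁≤) →
      assign⨟ (ev-[] ev-lit (ev-⊖ (ev-! ρn) ev-lit) (read ar₁ 1≤n n≤X′ (exact t₁ n 1≤n ≤-refl))) comp<
      (weaken (kMaxCost-mono (comp≤Bd 1≤n n≤X′)) (computeKMax-run ρn refl comp< E<)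
      then λ { {ρ₃} (fr₃ , ρκ , refl) →
      sumsLoop-run {z = block [ lit 0 ][ ! R.n ⊖ ! R.k ]} refl (s≤s z≤n) n≤X 1≤n ar₁ ρκ κ< (≤-<-trans (≤-trans (from-yes (6 ≤? 8)) (*-mono-≤ (*-mono-≤ 2≤X 2≤X) 2≤X)) (fits ≤-refl))
        (≤-<-trans (below t₁ (suc n) (s≤s z≤n) n≤X) bound<)
        (λ k 6≤k k≤ → comp+comp< (≤-trans (s≤s z≤n) 6≤k) (≤-trans (k≤n k≤) n≤X′) (m<n⇒0<n∸m (s≤s (k≤n k≤))) (≤-trans (m∸n≤m (suc n) k) n≤X))
        (λ fr′ → ev-lit) (λ fr′ → ev-! (trans (kept fr′ R.n refl) (trans (kept fr₃ R.n refl) ρn)))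
        (λ {k} 6≤k k≤ fr′ ρk ar′ b′ o′ → ev-⊕
          (ev-[] ev-lit (ev-! ρk) (read ar′ (≤-trans (s≤s z≤n) 6≤k) (≤-trans (k≤n k≤) n≤X′)
            (Better-exact b′ (exact t₁ k (≤-trans (s≤s z≤n) 6≤k) (s≤s (k≤n k≤))))))
          (ev-[] ev-lit (ev-⊖ (ev-! (trans (kept fr′ R.n refl) (trans (kept fr₃ R.n refl) ρn))) (ev-! ρk))
            (read ar′ (m<n⇒0<n∸m (s≤s (k≤n k≤))) (≤-trans (m∸n≤m (suc n) k) n≤X)
              (Better-exact b′ (exact t₁ (suc n ∸ k) (m<n⇒0<n∸m (s≤s (k≤n k≤))) (∸-monoʳ-< (≤-trans (s≤s z≤n) 6≤k) (≤-trans (k≤n k≤) (n≤1+n n))))))))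
      then λ { {ρ₄} {s₄} (fr₄ , o₄ , out₄ , A₂ , ar₂ , b₂ , done) →
      let A₂n : A₂ (suc n) ≡ comp (suc n)
          A₂n = comp-characterised (s≤s 1≤n) (sound b₂ (suc n) (above t₁ (suc n) (s≤s z≤n) n≤X))
                  (≤-trans (lower≤ b₂ (suc n)) (≤-trans A₁≤ (≤-reflexive (+-comm (comp n) 1))))
                  (λ x y 2≤x x≤y xy≡ → subst (λ m → A₂ m ≤ comp x + comp y) xy≡ (≤-trans (lower≤ b₂ (x * y))
                    (factored t₁ x y 2≤x x≤y (subst (y <_) xy≡ (subst (y <_) (*-comm y x) (m<m*n y x {{>-nonZero (≤-trans (<⇒≤ 2≤x) x≤y)}} 2≤x))) (subst (_≤ X) (sym xy≡) n≤X))))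
                  done
          ρ₄n : ρ₄ R.n ≡ suc n
          ρ₄n = trans (kept fr₄ R.n refl) (trans (kept fr₃ R.n refl) ρn)
          fr₅ : Frame tableRegs ρ₀ ρ₄
          fr₅ = frame-trans (frame-trans (frame-upd R.T refl fr) refl fr₃) refl fr₄
          readₙ : cells s₄ block 0 (suc n) ≡ just (comp (suc n))
          readₙ = read ar₂ (s≤s z≤n) n≤X A₂n
      in
      emit-run {Ψ = λ ρ′ s′ → ρ′ ≡ ρ₄ × s′ ≡ report (suc n) (comp (suc n)) s₄} (ev-! ρ₄n) (ev-[] ev-lit (ev-! ρ₄n) readₙ) (refl , refl)
      then λ { (refl , refl) →
      assign⨟ (ev-⊘ (ev-! (trans (kept fr₅ R.M refl) ρM)) (ev-! ρ₄n)) (≤-<-trans (m/n≤m X (suc n)) X<2^w)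
      (branch-run {c = 2} {Ψ = λ ρ′ s′ → ∃ λ q → ρ′ R.q ≡ q × q ≤ suc n × q ≤ X / suc n × (∀ x → x ≤ suc n → x ≤ X / suc n → x ≤ q) × ρ′ R.n ≡ suc n
          × Frame tableRegs ρ₀ ρ′ × s′ ≡ report (suc n) (comp (suc n)) s₄}
        (tst-≺ (ev-! ρ₄n) (ev-! refl))
        (λ n<q → assign (ev-! ρ₄n) (≤-<-trans n≤X X<2^w) (suc n , refl , ≤-refl , <⇒≤ (<ᵇ-true n<q) , (λ x x≤ _ → x≤) , ρ₄n ,
          frame-upd R.q refl (frame-upd R.q refl fr₅) , refl))
        (λ q≤n → skip-run (X / suc n , refl , <ᵇ-false q≤n , ≤-refl , (λ x _ x≤ → x≤) , ρ₄n , frame-upd R.q refl fr₅ , refl) (s≤s z≤n))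
      then λ { (q , ρq , q≤n , q≤ , max , ρ₆n , fr₆ , refl) →
      multiples-run (s≤s 1≤n) n≤X (ρ₆n , fr₆ , Only-trans o (Only-trans o₄ (only (λ _ _ _ → refl) (λ _ → refl) (λ _ _ → refl) refl)) ,
        cong (_∷ʳ (suc n , comp (suc n))) (trans out₄ out≡) , A₂ , arr (length≡ ar₂) (get ar₂) , Table-better b₂ t₁) readₙ ρq q≤n q≤ max }) } } }) })
      where
      n≤X′ : n ≤ X
      n≤X′ = <⇒≤ n≤X
      Ψ₁ : Env → Memory → Set
      Ψ₁ ρ′ s′ = ρ′ R.n ≡ suc n × Frame tableRegs ρ₀ ρ′ × Only 0 s₁ s′ × out s′ ≡ results n × ∃ λ A′ → Arr s′ 0 0 X A′ × Table (suc n) A′ × A′ (suc n) ≤ comp n + 1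
      step₁ : Better A (lowerAt (suc n) (comp n + 1) A)
      step₁ = lowerAt-better (≤-trans (comp-suc 1≤n) (≤-reflexive (+-comm 1 (comp n))))
      comp< : comp n < 2 ^ w
      comp< = ≤-<-trans (m≤m+n _ _) (comp+comp< 1≤n n≤X′ 1≤n n≤X′)
      E< : E (comp n) < 2 ^ w
      E< = fits (≤-trans (E[comp]≤n² 1≤n) (≤-trans (*-mono-≤ n≤X′ n≤X′) X*X≤))
      κ<n : κ (suc n) < suc n
      κ<n = kMax<n (s≤s 1≤n)
      κ< : suc (κ (suc n)) < 2 ^ w
      κ< = ≤-<-trans (≤-trans κ<n n≤X) X<2^w
      k≤n : ∀ {k} → k ≤ κ (suc n) → k ≤ n
      k≤n k≤ = ≤-trans k≤ (≤-pred κ<n)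
      cost≤ : 17 + (6 + (kMaxCost Bd + (5 + κ (suc n) * 26 + (5 + (4 + (5 + (5 + 28 * (X / suc n)))))))) ≤ bodyCost (suc n)
      cost≤ = ≤-reflexive (lem (kMaxCost Bd) (κ (suc n)) (X / suc n))
        where
        lem : ∀ kc k q → 17 + (6 + (kc + (5 + k * 26 + (5 + (4 + (5 + (5 + 28 * q))))))) ≡ 47 + kc + 26 * k + 28 * q
        lem = solve-∀

  timeImprovedCost : ℕ
  timeImprovedCost = 33 + 11 * lg³ X + 11 * X + Σ< (X ∸ 1) (λ i → 7 + bodyCost (2 + i))

  timeImproved-run : ∀ {ρ s} → ρ R.M ≡ X → sizes s block 0 ≡ 0 → out s ≡ [] →
    Runs timeImproved ρ s timeImprovedCost
      (λ ρ′ s′ → Frame tableRegs ρ ρ′ × Only 0 (new m block 0 X s) s′ × out s′ ≡ results X × Arr s′ 0 0 X comp)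
  timeImproved-run {ρ} {s} ρM size₀ out₀ = weaken (≤-reflexive cost≡)
    (allocate-run {Ψ = λ ρ′ s′ → ρ′ ≡ ρ × s′ ≡ s₁} ev-lit (ev-! ρM) size₀ (refl , refl)
    then λ { (refl , refl) →
    computeBound-run R.M ρM (fits ≤-refl) (≤-<-trans (m≤m+n _ _) 2bound<)
    then λ { (fr₁ , ρbound , refl) →
    fill-run (λ _ → Bd) ev-lit (s≤s z≤n) 1+X<2^w ≤-refl ≤-refl (λ _ _ _ → bound<)
      (λ fr → ev-! (trans (kept fr R.M refl) (trans (kept fr₁ R.M refl) ρM))) (λ _ → ev-lit)
      (λ _ _ fr _ _ _ → ev-! (trans (kept fr R.bound refl) ρbound))
    then λ { {ρ₂} {s₂} (fr₂ , f) →
    let ar₂ : Arr s₂ 0 0 X (λ _ → Bd)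
        ar₂ = arr (sizes≡ (only-j f) block 0) (λ i lo hi → inside f i lo hi)
        ar₃ = Arr-put 1 1 ar₂
        fr₃ : Frame tableRegs ρ ρ₂
        fr₃ = frame-trans (frame-trans frame-refl refl fr₁) refl fr₂
    in
    write {Ψ = λ ρ′ s′ → ρ′ ≡ ρ₂ × s′ ≡ put block 0 1 1 s₂} ev-lit ev-lit ev-lit ≤-refl (subst (1 ≤_) (sym (length≡ ar₂)) 1≤X) (≤-<-trans (s≤s z≤n) bound<) (refl , refl)
    then λ { (refl , refl) →
    emit-run {Ψ = λ ρ′ s′ → ρ′ ≡ ρ₂ × s′ ≡ report 1 1 (put block 0 1 1 s₂)} ev-lit (ev-[] ev-lit ev-lit refl) (refl , refl)
    then λ { (refl , refl) →
    let open Body ρ ρM s₁ in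
    conseq (λ { _ _ (n , _ , final , _ , fr , o , out≡ , A , ar , t) → let n≡ = final 2≤1+X in
        fr , o , trans out≡ (cong (results ∘ pred) n≡) ,
        Arr-cong (λ i lo hi → exact t i lo (subst (i <_) (sym n≡) (s≤s hi))) ar })
    (forUp-run {hi = X} bodyCost (λ n → Good n (pred n)) ev-lit (≤-<-trans 2≤X X<2^w) 1+X<2^w
      (λ (ρn , fr , _) → ρn , ev-! (trans (kept fr R.M refl) ρM))
      (λ { {zero} () _ _ ; {suc n} 2≤n n≤X good → body-run (≤-pred 2≤n) n≤X good })
      (refl , frame-upd R.n refl fr₃ , Only-trans (only-j f) (only (blocks≡ (put-only 0 1 1 s₂)) (λ _ → refl) (λ _ _ → refl) refl) ,
        trans (cong (_∷ʳ (1 , 1)) (trans (reported f) out₀)) (cong (λ c → (1 , c) ∷ []) (sym comp-1)) ,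
        set 1 1 (λ _ → Bd) , arr (length≡ ar₃) (get ar₃) , initialTable)) } } } } })
    where
    s₁ : Memory
    s₁ = new m block 0 X s
    2≤1+X : 2 ≤ suc X
    2≤1+X = m≤n⇒m≤1+n 2≤X
    initialTable : Table 2 (set 1 1 (λ _ → Bd))
    initialTable = record
      { above    = λ where
          zero          ()  _
          (suc zero)    _ _ → ≤-reflexive comp-1
          (suc (suc m)) _ hi → comp≤Bd (s≤s z≤n) hi
      ; below    = λ where
          zero          ()  _
          (suc zero)    _ _ → s≤s z≤n
          (suc (suc m)) _ _ → ≤-refl
      ; exact    = λ where
          zero          () _
          (suc zero)    _ _ → sym comp-1
          (suc (suc m)) _ (s≤s (s≤s ()))
      ; factored = λ a b 2≤a a≤b b<2 _ → contradiction (≤-trans 2≤a a≤b) (<⇒≱ b<2) }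
    cost≡ : 3 + (11 + 11 * lg³ X + (1 + 1 + ((suc X ∸ 1) * (6 + 1 + (1 + 1 + 1 + 1)) + (2 + 1)) + (4 + (5 +
      (1 + 1 + (Σ< (suc X ∸ 2) (λ i → 6 + 1 + bodyCost (2 + i)) + (2 + 1))))))) ≡ timeImprovedCost
    cost≡ = lem (lg³ X) X (Σ< (X ∸ 1) (λ i → 7 + bodyCost (2 + i)))
      where
      lem : ∀ l x S → 3 + (11 + 11 * l + (1 + 1 + (x * 11 + 3) + (4 + (5 + (1 + 1 + (S + 3)))))) ≡ 33 + 11 * l + 11 * x + S
      lem = solve-∀

-- The space-improved algorithm

quot≡ : ∀ x n .{{_ : NonZero n}} → x / n ≡ quot x n
quot≡ x (suc n) = refl

cdiv : ℕ → ℕ → ℕ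
cdiv d n = quot (d + n ∸ 1) n

cdiv-* : ∀ d {n} → 1 ≤ n → d ≤ cdiv d n * n
cdiv-* d {suc n} _ = +-cancelʳ-≤ n d (cdiv d (suc n) * suc n) (begin
  d + n                                                  ≡⟨ cong (_∸ 1) (+-suc d n) ⟨
  d + suc n ∸ 1                                          ≡⟨ m≡m%n+[m/n]*n (d + suc n ∸ 1) (suc n) ⟩
  (d + suc n ∸ 1) % suc n + (d + suc n ∸ 1) / suc n * suc n ≤⟨ +-monoˡ-≤ _ (≤-pred (m%n<n (d + suc n ∸ 1) (suc n))) ⟩
  n + cdiv d (suc n) * suc n                             ≡⟨ +-comm n _ ⟩
  cdiv d (suc n) * suc n + n                             ∎)

cdiv-≤ : ∀ {d n k} → 1 ≤ n → d ≤ k * n → cdiv d n ≤ k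
cdiv-≤ {d} {suc n} {k} _ le = ≤-pred (m<n*o⇒m/o<n {d + suc n ∸ 1} {suc k} {suc n} (begin-strict
  d + suc n ∸ 1    ≡⟨ cong (_∸ 1) (+-suc d n) ⟩
  d + n            <⟨ +-mono-≤-< le (n<1+n n) ⟩
  k * suc n + suc n ≡⟨ +-comm (k * suc n) (suc n) ⟩
  suc k * suc n    ∎))

cdiv-mono : ∀ {d d′ n} → 1 ≤ n → d ≤ d′ → cdiv d n ≤ cdiv d′ n
cdiv-mono {d′ = d′} 1≤n d≤ = cdiv-≤ 1≤n (≤-trans d≤ (cdiv-* d′ 1≤n))

-- Positions of the running blocks

module Blocks (H ℓ hh : ℕ) (1≤ℓ : 1 ≤ ℓ) (H≡ : H ≡ ℓ * hh) (L≤H : 2 * ℓ ≤ H) where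

  L : ℕ
  L = 2 * ℓ

  ℓ≤H : ℓ ≤ H
  ℓ≤H = ≤-trans (m≤m+n ℓ (1 * ℓ)) L≤H

  1≤H : 1 ≤ H
  1≤H = ≤-trans 1≤ℓ ℓ≤H

  -- H_j / ℓ when the main loop has reached h, for an initialized block

  quota : ℕ → ℕ → ℕ
  quota j h = hh ⊔ cdiv h (j * ℓ)

  Top : ℕ → ℕ → ℕ
  Top j h = ℓ * quota j h

  module _ {j : ℕ} (1≤j : 1 ≤ j) where

    1≤jℓ : 1 ≤ j * ℓ
    1≤jℓ = *-mono-≤ 1≤j 1≤ℓ

    jH≡ : j * H ≡ hh * (j * ℓ)
    jH≡ = trans (cong (j *_) H≡) (lem j ℓ hh)
      where
      lem : ∀ j l h → j * (l * h) ≡ h * (j * l)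
      lem = solve-∀

    active⇒hh< : ∀ {h} → j * H < h → hh < cdiv h (j * ℓ)
    active⇒hh< {h} jH<h = ≰⇒> λ c≤hh → <⇒≱ jH<h (≤-trans (cdiv-* h 1≤jℓ) (≤-trans (*-monoˡ-≤ (j * ℓ) c≤hh) (≤-reflexive (sym jH≡))))

    active-quota : ∀ {h} → j * H < h → quota j h ≡ cdiv h (j * ℓ)
    active-quota jH<h = m≤n⇒m⊔n≡n (<⇒≤ (active⇒hh< jH<h))

    inactive-Top : ∀ {h} → h ≤ j * H → Top j h ≡ H
    inactive-Top h≤ = trans (cong (ℓ *_) (m≥n⇒m⊔n≡m (cdiv-≤ 1≤jℓ (≤-trans h≤ (≤-reflexive jH≡))))) (sym H≡)

    quota-mono : ∀ {h h′} → h ≤ h′ → quota j h ≤ quota j h′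
    quota-mono h≤ = ⊔-monoʳ-≤ hh (cdiv-mono 1≤jℓ h≤)

    -- When h grows by ℓ, h / (jℓ) grows by 1 / j ≤ 1. So a single shift by ℓ brings the block up to
    -- date.
    quota-step : ∀ h → quota j (h + ℓ) ≤ suc (quota j h)
    quota-step h = ⊔-lub (m≤n⇒m≤1+n (m≤m⊔n hh _)) (≤-trans (cdiv-≤ 1≤jℓ (begin
      h + ℓ                          ≤⟨ +-mono-≤ (cdiv-* h 1≤jℓ) (m≤n*m ℓ j {{>-nonZero 1≤j}}) ⟩
      cdiv h (j * ℓ) * (j * ℓ) + j * ℓ ≡⟨ +-comm _ (j * ℓ) ⟩
      suc (cdiv h (j * ℓ)) * (j * ℓ) ∎)) (s≤s (m≤n⊔m hh _)))

    H≤Top : ∀ h → H ≤ Top j h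
    H≤Top h = ≤-trans (≤-reflexive H≡) (*-monoʳ-≤ ℓ (m≤m⊔n hh _))

    L≤Top : ∀ h → L ≤ Top j h
    L≤Top h = ≤-trans L≤H (H≤Top h)

    Top≤ : ∀ {h x} → hh ≤ x → h ≤ ℓ * x → Top j h ≤ ℓ * x
    Top≤ {h} {x} hh≤x h≤ = *-monoʳ-≤ ℓ (⊔-lub hh≤x (cdiv-≤ 1≤jℓ (≤-trans h≤ (≤-trans (≤-reflexive (*-comm ℓ x)) (*-monoʳ-≤ x (m≤n*m ℓ j {{>-nonZero 1≤j}}))))))

    -- The numbers needed from B_{aj} when the products for B_j are formed

    module _ {a b h : ℕ} (2≤a : 2 ≤ a) (jH<h : j * H < h)
      (H<q : ¬ a * H ≥ Top j h) (ab≤ : a * b ≤ Top j h) (Top<ab : Top j h < a * b + ℓ) where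

      private
        c C : ℕ
        c = cdiv h (j * ℓ)
        C = cdiv h (a * j * ℓ)
        1≤a : 1 ≤ a
        1≤a = <⇒≤ 2≤a
        1≤ajℓ : 1 ≤ a * j * ℓ
        1≤ajℓ = *-mono-≤ (*-mono-≤ 1≤a 1≤j) 1≤ℓ
        Top≡ : Top j h ≡ ℓ * c
        Top≡ = cong (ℓ *_) (active-quota jH<h)

      -- If h ≤ ajH, then ⌈h/(jℓ)⌉ ≤ aH/ℓ and H_j ≤ aH, against `H<q`.
      multiple-active : a * j * H < h
      multiple-active = ≰⇒> λ h≤ → H<q (begin
        Top j h    ≡⟨ Top≡ ⟩
        ℓ * c      ≤⟨ *-monoʳ-≤ ℓ (cdiv-≤ 1≤jℓ (≤-trans h≤ (≤-reflexive (trans (cong (a * j *_) H≡) (lem a j ℓ hh))))) ⟩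
        ℓ * (a * hh) ≡⟨ lem′ ℓ a hh ⟩
        a * (ℓ * hh) ≡⟨ cong (a *_) H≡ ⟨
        a * H      ∎)
        where
        lem : ∀ a j l h → a * j * (l * h) ≡ a * h * (j * l)
        lem = solve-∀
        lem′ : ∀ l a h → l * (a * h) ≡ a * (l * h)
        lem′ = solve-∀

      private
        TopA : quota (a * j) h ≡ C
        TopA = m≤n⇒m⊔n≡n (<⇒≤ (≰⇒> λ C≤hh → <⇒≱ multiple-active
          (≤-trans (cdiv-* h 1≤ajℓ) (≤-trans (*-monoˡ-≤ (a * j * ℓ) C≤hh) (≤-reflexive (trans (lem hh a j ℓ) (cong (a * j *_) (sym H≡))))))))
          where
          lem : ∀ h a j l → h * (a * j * l) ≡ a * j * (l * h)
          lem = solve-∀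

      -- ⌈h/(jℓ)⌉ ≤ a ⌈h/(ajℓ)⌉, so ab ≤ H_j ≤ a H_(aj).
      multiple-≤ : b ≤ Top (a * j) h
      multiple-≤ = *-cancelˡ-≤ a {{>-nonZero 1≤a}} (begin
        a * b         ≤⟨ ab≤ ⟩
        Top j h       ≡⟨ Top≡ ⟩
        ℓ * c         ≤⟨ *-monoʳ-≤ ℓ (cdiv-≤ {k = a * C} 1≤jℓ (≤-trans (cdiv-* h 1≤ajℓ) (≤-reflexive (lem C a j ℓ)))) ⟩
        ℓ * (a * C)   ≡⟨ lem′ ℓ a C ⟩
        a * (ℓ * C)   ≡⟨ cong (λ x → a * (ℓ * x)) TopA ⟨
        a * Top (a * j) h ∎)
        where
        lem : ∀ C a j l → C * (a * j * l) ≡ a * C * (j * l)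
        lem = solve-∀
        lem′ : ∀ l a h → l * (a * h) ≡ a * (l * h)
        lem′ = solve-∀

      -- If D + 1 is the quota of B_(aj), minimality of the rounding gives ⌈h/(jℓ)⌉ > aD. Hence ab >
      -- H_j - ℓ ≥ aℓD, and b > H_(aj) - ℓ.
      multiple-> : Top (a * j) h < b + L
      multiple-> = <-≤-trans (subst (λ x → ℓ * x < b + ℓ) (sym TopA) (bound C refl)) (+-monoʳ-≤ b (m≤m+n ℓ (1 * ℓ)))
        where
        bound : ∀ D → D ≡ C → ℓ * D < b + ℓ
        bound zero    _  = ≤-trans (s≤s (≤-reflexive (*-zeroʳ ℓ))) (≤-trans 1≤ℓ (m≤n+m ℓ b))
        bound (suc D) eq = subst (_< b + ℓ) (trans (+-comm (ℓ * D) ℓ) (sym (*-suc ℓ D))) (+-monoˡ-< ℓ (*-cancelˡ-< a (ℓ * D) b (+-cancelʳ-< ℓ _ _ (begin-strict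
          a * (ℓ * D) + ℓ ≡⟨ lem a ℓ D ⟩
          ℓ * suc (a * D) ≤⟨ *-monoʳ-≤ ℓ (≰⇒> λ c≤ → <⇒≱ (≤-reflexive eq) (cdiv-≤ 1≤ajℓ (≤-trans (cdiv-* h 1≤jℓ)
            (≤-trans (*-monoˡ-≤ (j * ℓ) c≤) (≤-reflexive (lem″ a D j ℓ)))))) ⟩
          ℓ * c           ≡⟨ Top≡ ⟨
          Top j h         <⟨ Top<ab ⟩
          a * b + ℓ       ∎))))
          where
          lem : ∀ a l D → a * (l * D) + l ≡ l * suc (a * D)
          lem = solve-∀
          lem″ : ∀ a D j l → a * D * (j * l) ≡ D * (a * j * l)
          lem″ = solve-∀

  -- B_1 keeps pace with the main loop; the loop condition and the reported results rely on this.
  Top-1 : ∀ {x} → hh ≤ x → Top 1 (ℓ * x) ≡ ℓ * x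
  Top-1 {x} hh≤x = ≤-antisym (Top≤ ≤-refl hh≤x ≤-refl) (*-monoʳ-≤ ℓ (≤-trans (*-cancelˡ-≤ ℓ {{>-nonZero 1≤ℓ}} (begin
    ℓ * x                       ≤⟨ cdiv-* (ℓ * x) (1≤jℓ ≤-refl) ⟩
    cdiv (ℓ * x) (1 * ℓ) * (1 * ℓ) ≡⟨ lem (cdiv (ℓ * x) (1 * ℓ)) ℓ ⟩
    ℓ * cdiv (ℓ * x) (1 * ℓ)    ∎)) (m≤n⊔m hh _)))
    where
    lem : ∀ c l → c * (1 * l) ≡ l * c
    lem = solve-∀

Σ<-reverse : ∀ n (f : ℕ → ℕ) → Σ< n (λ i → f (n ∸ i)) ≡ Σ< n (f ∘ suc)
Σ<-reverse zero    f = refl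
Σ<-reverse (suc n) f = trans (Σ<-head n (λ i → f (suc n ∸ i))) (trans (+-comm (f (suc n)) _) (cong (_+ f (suc n)) (Σ<-reverse n f)))

m<[1+m/n]*n : ∀ m n .{{_ : NonZero n}} → m < suc (m / n) * n
m<[1+m/n]*n m n = begin-strict
  m                 ≡⟨ m≡m%n+[m/n]*n m n ⟩
  m % n + m / n * n <⟨ +-monoˡ-< (m / n * n) (m%n<n m n) ⟩
  suc (m / n) * n   ∎

-- Weaker than `Only`: also H_j, the size of block j and the amount of allocated storage may change.
record Touch (j : ℕ) (s s′ : Memory) : Set where
  constructor touch
  field
    blocksᵗ : ∀ k i → k ≢ j → cells s′ block k i ≡ cells s block k i
    topsᵗ   : ∀ k → k ≢ j → cells s′ top 0 k ≡ cells s top 0 k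
    sizesᵗ  : ∀ k → k ≢ j → sizes s′ block k ≡ sizes s block k
    topSize : sizes s′ top 0 ≡ sizes s top 0

open Touch

Only⇒Touch : ∀ {j s s′} → Only j s s′ → Touch j s s′
Only⇒Touch o = touch (blocks≡ o) (λ k _ → tops≡ o k) (λ k _ → sizes≡ o block k) (sizes≡ o top 0)

Touch-refl : ∀ {j s} → Touch j s s
Touch-refl = Only⇒Touch Only-refl

Touch-trans : ∀ {j s s′ s″} → Touch j s s′ → Touch j s′ s″ → Touch j s s″
Touch-trans (touch b t z y) (touch b′ t′ z′ y′) = touch (λ k i ne → trans (b′ k i ne) (b k i ne))
  (λ k ne → trans (t′ k ne) (t k ne)) (λ k ne → trans (z′ k ne) (z k ne)) (trans y′ y)

Arr-Touch : ∀ {j k s s′ base len A} → k ≢ j → Touch j s s′ → Arr s k base len A → Arr s′ k base len A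
Arr-Touch {k = k} k≢j t (arr l g) = arr (trans (sizesᵗ t k k≢j) l) λ i lo hi → trans (blocksᵗ t k i k≢j) (g i lo hi)

put-top : ∀ j v s → Touch j s (put top 0 j v s)
put-top j v s = touch (λ _ _ _ → refl) other (λ _ _ → refl) refl
  where
  other : ∀ k → k ≢ j → cells (put top 0 j v s) top 0 k ≡ cells s top 0 k
  other k k≢j rewrite ≢⇒≡ᵇ {j} {k} (k≢j ∘ sym) = refl

put-top-same : ∀ j v s → cells (put top 0 j v s) top 0 j ≡ just v
put-top-same j v s rewrite ≡ᵇ-refl j = refl

new-touch : ∀ μ j len s → Touch j s (new μ block j len s)
new-touch μ j len s = touch (λ _ _ _ → refl) (λ _ _ → refl) other refl
  where
  other : ∀ k → k ≢ j → sizes (new μ block j len s) block k ≡ sizes s block k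
  other k k≢j rewrite ≢⇒≡ᵇ {j} {k} (k≢j ∘ sym) = refl

new-size : ∀ μ j len s → sizes (new μ block j len s) block j ≡ len
new-size μ j len s rewrite ≡ᵇ-refl j = refl

-- For the account of the storage: the creation of a block changes a single size, from 0.
Σ<-bump : ∀ {n k f g} → k < n → (∀ i → i ≢ k → g i ≡ f i) → f k ≡ 0 → Σ< n g ≡ Σ< n f + g k
Σ<-bump {suc n} {k} {f} {g} k<1+n same zero′ with k ≟ n
... | yes refl = trans (cong₂ _+_ (Σ<-below n ≤-refl) (cong (_+ g n) (sym zero′))) (sym (+-assoc (Σ< n f) (f n) (g n)))
  where
  Σ<-below : ∀ m → m ≤ n → Σ< m g ≡ Σ< m f
  Σ<-below zero    _ = refl
  Σ<-below (suc m) m<n = cong₂ _+_ (Σ<-below m (<⇒≤ m<n)) (same m (<⇒≢ m<n))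
... | no k≢n = begin-equality
  Σ< n g + g n        ≡⟨ cong₂ _+_ (Σ<-bump (≤∧≢⇒< (≤-pred k<1+n) k≢n) same zero′) (same n (k≢n ∘ sym)) ⟩
  Σ< n f + g k + f n  ≡⟨ lem (Σ< n f) (g k) (f n) ⟩
  Σ< n f + f n + g k  ∎
  where
  lem : ∀ a b c → a + b + c ≡ a + c + b
  lem = solve-∀

-- Updates of the running blocks

-- By `N≤ℓ²`, a factor a with a² ≤ H_j is at most ℓ; so it is stored in B_0, and the number of
-- passes over a is bounded by ℓ. By `κ<ℓ`, the integer n - k stays within the block of n.
module SpaceImproved (w e N H ℓ hh nn : ℕ) (1≤ℓ : 1 ≤ ℓ) (H≡ : H ≡ ℓ * hh) (N≡ : N ≡ ℓ * nn) (L≤H : 2 * ℓ ≤ H) (H≤N : H ≤ N)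
  (N≤ℓ² : N ≤ ℓ * ℓ) (κ<ℓ : ∀ n → 2 ≤ n → n ≤ N → κ n < ℓ)
  (fits : ∀ {v} → v ≤ N * N * N → v < 2 ^ w)
  (bound< : suc (lg³ N) < 2 ^ e) (2bound< : suc (lg³ N) + suc (lg³ N) < 2 ^ w) where

  open Execution w e
  open Arithmetic w e
  open Tables w e
  open Blocks H ℓ hh 1≤ℓ H≡ L≤H

  2≤H : 2 ≤ H
  2≤H = ≤-trans (*-monoʳ-≤ 2 1≤ℓ) L≤H

  open TimeImproved w e N (≤-trans 2≤H H≤N) fits bound< 2bound< using (Bd; comp≤Bd; comp+comp<; X*X≤)
    renaming (1≤X to 1≤N; X<2^w to N<2^w; 1+X<2^w to 1+N<2^w)

  record Params (ρ : Env) : Set where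
    field
      N-reg : ρ R.N ≡ N
      H-reg : ρ R.H ≡ H
      ℓ-reg : ρ R.ℓ ≡ ℓ
      L-reg : ρ R.L ≡ L

  open Params

  params-frame : ∀ {rs ρ ρ′} → Frame rs ρ ρ′ → R.N ∈ᵇ rs ≡ false → R.H ∈ᵇ rs ≡ false → R.ℓ ∈ᵇ rs ≡ false → R.L ∈ᵇ rs ≡ false →
    Params ρ → Params ρ′
  params-frame fr N∉ H∉ ℓ∉ L∉ p = record
    { N-reg = trans (kept fr R.N N∉) (N-reg p) ; H-reg = trans (kept fr R.H H∉) (H-reg p)
    ; ℓ-reg = trans (kept fr R.ℓ ℓ∉) (ℓ-reg p) ; L-reg = trans (kept fr R.L L∉) (L-reg p) }

  record Ready (s : Memory) (j X : ℕ) : Set where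
    constructor ready
    field
      topEntry : cells s top 0 j ≡ just X
      contents : Arr s j (X ∸ L) L comp

  open Ready

  Ready-Touch : ∀ {j k s s′ X} → k ≢ j → Touch j s s′ → Ready s k X → Ready s′ k X
  Ready-Touch {k = k} k≢j t r = ready (trans (topsᵗ t k k≢j) (topEntry r)) (Arr-Touch k≢j t (contents r))

  L≤N : L ≤ N
  L≤N = ≤-trans L≤H H≤N

  ev-top : ∀ {ρ s x k X} → (ρ , s) ⊢ x ⇒ k → cells s top 0 k ≡ just X → (ρ , s) ⊢ topOf x ⇒ X
  ev-top = ev-[] ev-lit

  ev-position : ∀ {ρ s x n k X v} → ρ R.L ≡ L → (ρ , s) ⊢ x ⇒ k → (ρ , s) ⊢ n ⇒ v → cells s top 0 k ≡ just X →
    (ρ , s) ⊢ position x n ⇒ L + v ∸ X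
  ev-position ρL ex en top≡ = ev-⊖ (ev-⊕ (ev-! ρL) en) (ev-top ex top≡)

  position-≡ : ∀ {X v} → L ≤ X → X < v + L → X ∸ L + (L + v ∸ X) ≡ v
  position-≡ {X} {v} L≤X X<v+L = begin-equality
    X ∸ L + (L + v ∸ X) ≡⟨ cong (λ x → X ∸ L + (L + v ∸ x)) (m+[n∸m]≡n L≤X) ⟨
    X ∸ L + (L + v ∸ (L + (X ∸ L))) ≡⟨ cong (X ∸ L +_) ([m+n]∸[m+o]≡n∸o L v (X ∸ L)) ⟩
    X ∸ L + (v ∸ (X ∸ L)) ≡⟨ m+[n∸m]≡n (m≤n+o⇒m∸n≤o X L (≤-trans (<⇒≤ X<v+L) (≤-reflexive (+-comm v L)))) ⟩
    v ∎

  position-≥1 : ∀ {X v} → X < v + L → 1 ≤ L + v ∸ X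
  position-≥1 {X} {v} X<v+L = m<n⇒0<n∸m (subst (X <_) (+-comm v L) X<v+L)

  position-≤L : ∀ {X v} → v ≤ X → L + v ∸ X ≤ L
  position-≤L {X} {v} v≤X = ≤-trans (∸-monoʳ-≤ (L + v) v≤X) (≤-reflexive (m+n∸n≡m L v))

  initialize-run : ∀ {ρ s j} → Params ρ → ρ R.j ≡ j → 1 ≤ j → j ≤ sizes s top 0 → sizes s block j ≡ 0 → Arr s 0 0 H comp →
    Runs initialize ρ s (12 + 17 * L)
      (λ ρ′ s′ → Frame (R.i ∷ []) ρ ρ′ × Touch j s s′ × out s′ ≡ out s × alloc s′ ≡ alloc s + L * e × sizes s′ block j ≡ L × Ready s′ j H)
  initialize-run {ρ} {s} {j} p ρj 1≤j j≤ size₀ B₀ = weaken (≤-reflexive (lem L))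
    (allocate-run {Ψ = λ ρ′ s′ → ρ′ ≡ ρ × s′ ≡ s₁} (ev-! ρj) (ev-! (L-reg p)) size₀ (refl , refl)
    then λ { (refl , refl) →
    write {Ψ = λ ρ′ s′ → ρ′ ≡ ρ × s′ ≡ s₂} ev-lit (ev-! ρj) (ev-! (H-reg p)) 1≤j j≤ (≤-<-trans H≤N N<2^w) (refl , refl)
    then λ { (refl , refl) →
    conseq (λ { _ s′ (fr , f) → fr , Touch-trans t₂ (Only⇒Touch (only-j f)) , reported f , alloc≡ (only-j f) , trans (sizes≡ (only-j f) block j) (new-size m j L s) ,
        ready (trans (tops≡ (only-j f) j) (put-top-same j H s₁)) (arr (trans (sizes≡ (only-j f) block j) (new-size m j L s)) (inside f)) })
    (fill-run (λ k → comp (H ∸ L + k)) ev-lit (s≤s z≤n) (≤-<-trans (s≤s L≤N) 1+N<2^w) ≤-refl (≤-reflexive (sym (new-size m j L s)))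
      (λ k 1≤k k≤L → ≤-<-trans (comp≤Bd (≤-trans 1≤k (m≤n+m k (H ∸ L))) (≤-trans (H∸L+k≤H k≤L) H≤N)) bound<)
      (λ fr → ev-! (trans (kept fr R.L refl) (L-reg p))) (λ fr → ev-! (trans (kept fr R.j refl) ρj))
      (λ {k} 1≤k k≤L fr ρi o _ → ev-[] ev-lit (ev-⊕ (ev-⊖ (ev-! (trans (kept fr R.H refl) (H-reg p))) (ev-! (trans (kept fr R.L refl) (L-reg p)))) (ev-! ρi))
        (get (Arr-Only 0≢j o (Arr-Touch 0≢j t₂ B₀)) (H ∸ L + k) (≤-trans 1≤k (m≤n+m k (H ∸ L))) (H∸L+k≤H k≤L)))) } })
    where
    s₁ s₂ : Memory
    s₁ = new m block j L s
    s₂ = put top 0 j H s₁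
    t₂ : Touch j s s₂
    t₂ = Touch-trans (new-touch m j L s) (put-top j H s₁)
    0≢j : 0 ≢ j
    0≢j refl = contradiction 1≤j λ ()
    H∸L+k≤H : ∀ {k} → k ≤ L → H ∸ L + k ≤ H
    H∸L+k≤H k≤L = ≤-trans (+-monoʳ-≤ (H ∸ L) k≤L) (≤-reflexive (m∸n+n≡m L≤H))
    lem : ∀ L → 3 + (4 + (1 + 1 + (L * 17 + 3))) ≡ 12 + 17 * L
    lem = solve-∀

  shift-run : ∀ {ρ s j X} → Params ρ → ρ R.j ≡ j → 1 ≤ j → j ≤ sizes s top 0 → H ≤ X → X + ℓ ≤ N → Ready s j X →
    Runs shift ρ s (31 + 26 * ℓ + 11 * lg³ N)
      (λ ρ′ s′ → Frame (R.i ∷ R.y ∷ R.bound ∷ []) ρ ρ′ × Touch j s s′ × out s′ ≡ out s × alloc s′ ≡ alloc s × sizes s′ block j ≡ sizes s block j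
        × cells s′ top 0 j ≡ just (X + ℓ) × ∃ λ A → Arr s′ j (X + ℓ ∸ L) L A × (∀ m → m ≤ X → A m ≡ comp m) × (∀ m → X < m → A m ≡ Bd))
  shift-run {ρ} {s} {j} {X} p ρj 1≤j j≤ H≤X X+ℓ≤N r = weaken (≤-reflexive cost≡)
    (write {Ψ = λ ρ′ s′ → ρ′ ≡ ρ × s′ ≡ s₁} ev-lit (ev-! ρj) (ev-⊕ (ev-top (ev-! ρj) (topEntry r)) (ev-! (ℓ-reg p))) 1≤j j≤ (≤-<-trans X+ℓ≤N N<2^w) (refl , refl)
    then λ { (refl , refl) →
    fill-run (λ k → comp (X ∸ L + (ℓ + k))) ev-lit (s≤s z≤n) (≤-<-trans (s≤s ℓ≤N) 1+N<2^w) ≤-refl (≤-trans ℓ≤L (≤-reflexive (sym sizeⱼ)))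
      (λ k 1≤k k≤ℓ → ≤-<-trans (comp≤Bd (≤-trans 1≤k (≤-trans (m≤n+m k ℓ) (m≤n+m (ℓ + k) (X ∸ L)))) (≤-trans (copied≤ k≤ℓ) X≤N)) bound<)
      (λ fr → ev-! (trans (kept fr R.ℓ refl) (ℓ-reg p))) (λ fr → ev-! (trans (kept fr R.j refl) ρj))
      (λ {k} 1≤k k≤ℓ fr ρi o same → ev-[] (ev-! (trans (kept fr R.j refl) ρj)) (ev-⊕ (ev-! (trans (kept fr R.ℓ refl) (ℓ-reg p))) (ev-! ρi))
        (trans (same (ℓ + k) (m≤n+m k ℓ)) (get (contents r) (ℓ + k) (≤-trans 1≤k (m≤n+m k ℓ)) (ℓ+k≤L k≤ℓ))))
    then λ { {ρ₁} {s₂} (fr₁ , f₁) →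
    computeBound-run R.N (trans (kept fr₁ R.N refl) (N-reg p)) (fits ≤-refl) (≤-<-trans (m≤m+n _ _) 2bound<)
    then λ { {ρ₂} (fr₂ , ρbound , refl) →
    let fr₂′ : Frame (R.i ∷ R.y ∷ R.bound ∷ []) ρ ρ₂
        fr₂′ = frame-trans (frame-trans frame-refl refl fr₁) refl fr₂
        size₂ : sizes s₂ block j ≡ L
        size₂ = trans (sizes≡ (only-j f₁) block j) sizeⱼ
    in
    conseq (λ { _ s₃ (fr₃ , f₃) → frame-trans fr₂′ refl fr₃ ,
        Touch-trans (put-top j (X + ℓ) s) (Touch-trans (Only⇒Touch (only-j f₁)) (Only⇒Touch (only-j f₃))) ,
        trans (reported f₃) (reported f₁) , trans (alloc≡ (only-j f₃)) (alloc≡ (only-j f₁)) ,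
        trans (sizes≡ (only-j f₃) block j) (sizes≡ (only-j f₁) block j) ,
        trans (tops≡ (only-j f₃) j) (trans (tops≡ (only-j f₁) j) (put-top-same j (X + ℓ) s)) ,
        A , arr (trans (sizes≡ (only-j f₃) block j) size₂) (entries f₁ f₃) , A-old , A-new })
    (fill-run (λ _ → Bd) (ev-⊕ (ev-! (trans (kept fr₂′ R.ℓ refl) (ℓ-reg p))) ev-lit) (s≤s′ ℓ≤L) (≤-<-trans (s≤s L≤N) 1+N<2^w)
      (m≤n+m 1 ℓ) (≤-reflexive (sym size₂)) (λ _ _ _ → bound<)
      (λ fr → ev-! (trans (kept fr R.L refl) (trans (kept fr₂′ R.L refl) (L-reg p))))
      (λ fr → ev-! (trans (kept fr R.j refl) (trans (kept fr₂′ R.j refl) ρj)))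
      (λ _ _ fr _ _ _ → ev-! (trans (kept fr R.bound refl) ρbound))) } } })
    where
    s₁ : Memory
    s₁ = put top 0 j (X + ℓ) s
    sizeⱼ : sizes s block j ≡ L
    sizeⱼ = length≡ (contents r)
    X≤N : X ≤ N
    X≤N = ≤-trans (m≤m+n X ℓ) X+ℓ≤N
    L≤X : L ≤ X
    L≤X = ≤-trans L≤H H≤X
    ℓ≤N : ℓ ≤ N
    ℓ≤N = ≤-trans ℓ≤H H≤N
    ℓ≤L : ℓ ≤ L
    ℓ≤L = m≤m+n ℓ (1 * ℓ)
    s≤s′ : ∀ {x} → ℓ ≤ x → ℓ + 1 ≤ suc x
    s≤s′ ℓ≤x = ≤-trans (≤-reflexive (+-comm ℓ 1)) (s≤s ℓ≤x)
    ℓ+ℓ≡L : ℓ + ℓ ≡ L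
    ℓ+ℓ≡L = cong (ℓ +_) (sym (+-identityʳ ℓ))
    ℓ+k≤L : ∀ {k} → k ≤ ℓ → ℓ + k ≤ L
    ℓ+k≤L k≤ℓ = ≤-trans (+-monoʳ-≤ ℓ k≤ℓ) (≤-reflexive ℓ+ℓ≡L)
    base≡ : ∀ k → X + ℓ ∸ L + k ≡ X ∸ L + (ℓ + k)
    base≡ k = begin-equality
      X + ℓ ∸ L + k       ≡⟨ cong (λ x → x ∸ L + k) (+-comm X ℓ) ⟩
      ℓ + X ∸ L + k       ≡⟨ cong (_+ k) (+-∸-assoc ℓ L≤X) ⟩
      ℓ + (X ∸ L) + k     ≡⟨ cong (_+ k) (+-comm ℓ (X ∸ L)) ⟩
      X ∸ L + ℓ + k       ≡⟨ +-assoc (X ∸ L) ℓ k ⟩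
      X ∸ L + (ℓ + k)     ∎
    copied≤ : ∀ {k} → k ≤ ℓ → X ∸ L + (ℓ + k) ≤ X
    copied≤ k≤ℓ = ≤-trans (+-monoʳ-≤ (X ∸ L) (ℓ+k≤L k≤ℓ)) (≤-reflexive (m∸n+n≡m L≤X))
    fresh> : ∀ {k} → ℓ < k → X < X ∸ L + (ℓ + k)
    fresh> ℓ<k = ≤-<-trans (≤-reflexive (trans (sym (m∸n+n≡m L≤X)) (cong (X ∸ L +_) (sym ℓ+ℓ≡L)))) (+-monoʳ-< (X ∸ L) (+-monoʳ-< ℓ ℓ<k))
    A : ℕ → ℕ
    A n = if n ≤ᵇ X then comp n else Bd
    A-old : ∀ n → n ≤ X → A n ≡ comp n
    A-old n n≤X with n ≤ᵇ X in eq
    ... | true  = refl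
    ... | false = contradiction n≤X (<⇒≱ (≤ᵇ-false {n} {X} eq))
    A-new : ∀ n → X < n → A n ≡ Bd
    A-new n X<n with n ≤ᵇ X in eq
    ... | false = refl
    ... | true  = contradiction (≤ᵇ-true {n} {X} eq) (<⇒≱ X<n)
    entries : ∀ {s₂ s₃} → Filled j 1 ℓ (λ k → comp (X ∸ L + (ℓ + k))) s₁ s₂ → Filled j (ℓ + 1) L (λ _ → Bd) s₂ s₃ →
      ∀ i → 1 ≤ i → i ≤ L → cells s₃ block j i ≡ just (A (X + ℓ ∸ L + i))
    entries f₁ f₃ i 1≤i i≤L with i ≤? ℓ
    ... | yes i≤ℓ = trans (outside f₃ i (inj₁ (subst (i <_) (+-comm 1 ℓ) (s≤s i≤ℓ)))) (trans (inside f₁ i 1≤i i≤ℓ)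
      (cong just (sym (trans (cong A (base≡ i)) (A-old _ (copied≤ i≤ℓ))))))
    ... | no i≰ℓ = trans (inside f₃ i (subst (_≤ i) (+-comm 1 ℓ) (≰⇒> i≰ℓ)) i≤L)
      (cong just (sym (trans (cong A (base≡ i)) (A-new _ (fresh> (≰⇒> i≰ℓ))))))
    cost≡ : 8 + (1 + 1 + (ℓ * 15 + 3) + (11 + 11 * lg³ N + (1 + 3 + ((suc L ∸ (ℓ + 1)) * 11 + 3)))) ≡ 31 + 26 * ℓ + 11 * lg³ N
    cost≡ = trans (cong (λ x → 8 + (1 + 1 + (ℓ * 15 + 3) + (11 + 11 * lg³ N + (1 + 3 + (x * 11 + 3)))))
      (trans (cong₂ (λ x y → suc x ∸ y) (sym ℓ+ℓ≡L) (+-comm ℓ 1)) (m+n∸n≡m ℓ ℓ))) (lem ℓ (lg³ N))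
      where
      lem : ∀ l g → 8 + (1 + 1 + (l * 15 + 3) + (11 + 11 * g + (1 + 3 + (l * 11 + 3)))) ≡ 31 + 26 * l + 11 * g
      lem = solve-∀

  -- X is the new value of H_j: the updated block holds ‖n‖ for X − L < n ≤ X.

  quotCost : ℕ → ℕ
  quotCost a = 84 + 55 * quot ℓ a

  productsCost : ℕ
  productsCost = 7 + Σ< ℓ (λ i → quotCost (suc i))

  sumsCost : ℕ → ℕ
  sumsCost X = 9 + Σ< ℓ (λ i → 47 + kMaxCost Bd + 26 * κ (suc (X ∸ ℓ) + i))

  module Update (j X : ℕ) (1≤j : 1 ≤ j) (H≤X : H ≤ X) (X≤N : X ≤ N) where

    B : ℕ
    B = X ∸ L

    L≤X : L ≤ X
    L≤X = ≤-trans L≤H H≤X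

    0≢j : 0 ≢ j
    0≢j refl = contradiction 1≤j λ ()

    X<m+L : ∀ {m} → B < m → X < m + L
    X<m+L B<m = ≤-trans (s≤s (≤-reflexive (sym (m∸n+n≡m L≤X)))) (+-monoˡ-≤ L B<m)

    B+ℓ≡ : B + ℓ ≡ X ∸ ℓ
    B+ℓ≡ = begin-equality
      X ∸ L + ℓ       ≡⟨ cong (λ x → X ∸ (ℓ + x) + ℓ) (+-identityʳ ℓ) ⟩
      X ∸ (ℓ + ℓ) + ℓ ≡⟨ cong (_+ ℓ) (∸-+-assoc X ℓ ℓ) ⟨
      X ∸ ℓ ∸ ℓ + ℓ   ≡⟨ m∸n+n≡m (m+n≤o⇒m≤o∸n ℓ (≤-trans (≤-reflexive (cong (ℓ +_) (sym (+-identityʳ ℓ)))) L≤X)) ⟩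
      X ∸ ℓ           ∎

    B≤X∸ℓ : B ≤ X ∸ ℓ
    B≤X∸ℓ = ≤-trans (m≤m+n B ℓ) (≤-reflexive B+ℓ≡)

    Bounded : (ℕ → ℕ) → Set
    Bounded A = ∀ n → B < n → n ≤ X → comp n ≤ A n × A n ≤ Bd

    Treated : ℕ → (ℕ → ℕ) → Set
    Treated a₀ A = ∀ a b → 2 ≤ a → a < a₀ → a ≤ b → X ∸ ℓ < a * b → a * b ≤ X → A (a * b) ≤ comp a + comp b

    productRegs : List Register
    productRegs = R.a ∷ R.q ∷ R.b ∷ R.y ∷ R.v ∷ []

    -- `multiples` is what the blocks B_(aj) must provide. It is required whenever X > aH, which
    -- includes the program's case ⌊X/a⌋ > H.
    module Products {ρ₀ : Env} {s₀ : Memory} (p : Params ρ₀) (ρj : ρ₀ R.j ≡ j) (ρH : ρ₀ R.Hⱼ ≡ X)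
      (topX : cells s₀ top 0 j ≡ just X) (B₀ : Arr s₀ 0 0 H comp)
      (multiples : ∀ a b → 2 ≤ a → ¬ a * H ≥ X → a * b ≤ X → X ∸ ℓ < a * b →
        ∃ λ Y → Ready s₀ (a * j) Y × L ≤ Y × b ≤ Y × Y < b + L)
      {A₀ : ℕ → ℕ} (ar₀ : Arr s₀ j B L A₀) (bounded : Bounded A₀) where

      Good : Env → Memory → (ℕ → ℕ) → Set
      Good ρ s A = Frame productRegs ρ₀ ρ × Only j s₀ s × out s ≡ out s₀ × Arr s j B L A × Better A₀ A

      inner : Program
      inner =
        branch (! R.q ≼ ! R.H)
          ( R.y ≔ block [ lit 0 ][ ! R.b ] )
          ( R.y ≔ block [ ! R.a ⊗ ! R.j ][ position (! R.a ⊗ ! R.j) (! R.b) ] ) ⨟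
        lower (! R.j) (position (! R.j) (! R.a ⊗ ! R.b)) (block [ lit 0 ][ ! R.a ] ⊕ ! R.y) ⨟
        R.b ≔ ! R.b ⊕ lit 1

      inner-run : ∀ {ρ s A a b} → Good ρ s A → ρ R.a ≡ a → ρ R.b ≡ b → 2 ≤ a → a ≤ b → a ≤ H → .{{_ : NonZero a}} → ρ R.q ≡ X / a →
        X ∸ ℓ < a * b → a * b ≤ X →
        Runs inner ρ s 52 (λ ρ′ s′ → ρ′ R.a ≡ a × ρ′ R.b ≡ suc b × ρ′ R.q ≡ X / a × ∃ λ A′ → Good ρ′ s′ A′ × Better A A′ × A′ (a * b) ≤ comp a + comp b)
      inner-run {ρ} {s} {A} {a} {b} (fr , o , out≡ , ar , better₀) ρa ρb 2≤a a≤b a≤H ρq X∸ℓ< ab≤ =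
        branch-run {c = 14} {Ψ = λ ρ′ s′ → ρ′ ≡ upd R.y (comp b) ρ × s′ ≡ s}
          (tst-≼ (ev-! ρq) (ev-! (trans (kept fr R.H refl) (H-reg p))))
          (λ q≤H → weaken (from-yes (4 ≤? 14)) (assign (ev-[] ev-lit (ev-! ρb)
            (get (Arr-Only 0≢j o B₀) b 1≤b (≤-trans b≤q (≤ᵇ-true {X / a} q≤H)))) comp< (refl , refl)))
          (λ q≰H → assign (from-multiple (≤ᵇ-false {X / a} q≰H)) comp< (refl , refl))
        then λ { (refl , refl) →
        lower-run {Ψ = Post} ar (position-≥1 {X} {a * b} X<ab+L) (position-≤L {X} ab≤)
          (ev-⊕ (ev-[] ev-lit (ev-! ρa) (get (Arr-Only 0≢j o B₀) a 1≤a a≤H)) (ev-! refl))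
          (ev-! ρj′) (ev-position ρL (ev-! ρj′) (ev-⊗ (ev-! ρa) (ev-! ρb)) top≡)
          (comp+comp< 1≤a (≤-trans a≤H H≤N) 1≤b b≤N)
          (subst (λ n → A n < 2 ^ e) (sym n≡) (≤-<-trans (≤-trans (lower≤ better₀ (a * b)) (proj₂ (bounded (a * b) B< ab≤))) bound<))
          (λ ar′ o′ out′ → ρa , ρb , ρq , frame-upd R.v refl (frame-upd R.y refl fr) , Only-trans o o′ , trans out′ out≡ , _ , ar′ , step ,
            subst (λ n → lowerAt (B + (L + a * b ∸ X)) (comp a + comp b) A n ≤ comp a + comp b) n≡ (lowerAt-≤x (B + (L + a * b ∸ X)) _ A))
        then λ { (ρa , ρb , ρq , fr′ , o′ , out′ , A′ , ar′ , st′ , ≤x) →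
        assign (ev-⊕ (ev-! ρb) ev-lit) (≤-<-trans (≤-trans (≤-reflexive (+-comm b 1)) (s≤s b≤N)) 1+N<2^w)
          (ρa , +-comm b 1 , ρq , A′ , (frame-upd R.b refl fr′ , o′ , out′ , ar′ , Better-trans better₀ st′) , st′ , ≤x) } }
        where
        1≤a : 1 ≤ a
        1≤a = <⇒≤ 2≤a
        1≤b : 1 ≤ b
        1≤b = ≤-trans 1≤a a≤b
        b≤q : b ≤ X / a
        b≤q = subst (_≤ X / a) (trans (cong (_/ a) (*-comm a b)) (m*n/n≡m b a)) (/-monoˡ-≤ a ab≤)
        b≤N : b ≤ N
        b≤N = ≤-trans (m≤n*m b a) (≤-trans ab≤ X≤N)
        comp< : comp b < 2 ^ w
        comp< = ≤-<-trans (m≤m+n _ _) (comp+comp< 1≤b b≤N 1≤b b≤N)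
        B< : B < a * b
        B< = ≤-<-trans B≤X∸ℓ X∸ℓ<
        X<ab+L : X < a * b + L
        X<ab+L = X<m+L B<
        n≡ : B + (L + a * b ∸ X) ≡ a * b
        n≡ = position-≡ L≤X X<ab+L
        ρj′ : ρ R.j ≡ j
        ρj′ = trans (kept fr R.j refl) ρj
        ρL : ρ R.L ≡ L
        ρL = trans (kept fr R.L refl) (L-reg p)
        top≡ : cells s top 0 j ≡ just X
        top≡ = trans (tops≡ o j) topX
        step : Better A (lowerAt (B + (L + a * b ∸ X)) (comp a + comp b) A)
        step = lowerAt-better (subst (λ n → comp n ≤ comp a + comp b) (sym n≡) (comp-* 1≤a 1≤b))
        from-multiple : H < X / a → (ρ , s) ⊢ block [ ! R.a ⊗ ! R.j ][ position (! R.a ⊗ ! R.j) (! R.b) ] ⇒ comp b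
        from-multiple H<q with multiples a b 2≤a (λ X≤aH → <⇒≱ H<q (≤-trans (/-monoˡ-≤ a X≤aH) (≤-reflexive (trans (cong (_/ a) (*-comm a H)) (m*n/n≡m H a))))) ab≤ X∸ℓ<
        ... | Y , r , L≤Y , b≤Y , Y<b+L = ev-[] aj (ev-position ρL aj (ev-! ρb) (trans (tops≡ o (a * j)) (topEntry r)))
          (trans (get (Arr-Only aj≢j o (contents r)) (L + b ∸ Y) (position-≥1 {Y} Y<b+L) (position-≤L {Y} b≤Y)) (cong (just ∘ comp) (position-≡ L≤Y Y<b+L)))
          where
          aj : (ρ , s) ⊢ ! R.a ⊗ ! R.j ⇒ a * j
          aj = ev-⊗ (ev-! ρa) (ev-! ρj′)
          aj≢j : a * j ≢ j
          aj≢j eq = <⇒≢ (m<m*n j a {{>-nonZero 1≤j}} 2≤a) (trans (sym eq) (*-comm a j))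
        Post : Env → Memory → Set
        Post ρ′ s′ = ρ′ R.a ≡ a × ρ′ R.b ≡ b × ρ′ R.q ≡ X / a × Frame productRegs ρ₀ ρ′ × Only j s₀ s′ × out s′ ≡ out s₀ ×
          ∃ λ A′ → Arr s′ j B L A′ × Better A A′ × A′ (a * b) ≤ comp a + comp b

      step : Program
      step =
        R.q ≔ ! R.Hⱼ ⊘ ! R.a ⨟
        R.b ≔ (! R.Hⱼ ⊖ ! R.ℓ) ⊘ ! R.a ⊕ lit 1 ⨟
        when (! R.b ≺ ! R.a) (R.b ≔ ! R.a) ⨟
        while (! R.b ≼ ! R.q) inner ⨟
        R.a ≔ ! R.a ⊕ lit 1

      step-run : ∀ {ρ s A a} → Good ρ s A → Treated a A → ρ R.a ≡ a → 2 ≤ a → a * a ≤ X → a ≤ ℓ →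
        Runs step ρ s (79 + 55 * quot ℓ a) (λ ρ′ s′ → ρ′ R.a ≡ suc a × ∃ λ A′ → Good ρ′ s′ A′ × Treated (suc a) A′)
      step-run {ρ} {s} {A} {a} (fr , o , out≡ , ar , bt) treated ρa 2≤a aa≤X a≤ℓ = weaken cost≤
        (assign⨟ (ev-⊘ (ev-! ρX) (ev-! ρa)) q<
        (assign⨟ (ev-⊕ (ev-⊘ (ev-⊖ (ev-! ρX) (ev-! (trans (kept fr R.ℓ refl) (ℓ-reg p)))) (ev-! ρa)) ev-lit)
          (≤-<-trans (≤-trans (≤-reflexive (+-comm lo 1)) (s≤s (≤-trans lo≤q (≤-trans (m/n≤m X a) X≤N)))) 1+N<2^w)
        (branch-run {c = 2} {Ψ = Start}
          (tst-≺ (ev-! refl) (ev-! ρa))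
          (λ b<a → assign (ev-! ρa) (≤-<-trans (≤-trans a≤ℓ (≤-trans ℓ≤H H≤N)) N<2^w)
            (a , refl , ρa , refl , ≤-refl , ≤-trans (≤-reflexive (+-comm 1 lo)) (<⇒≤ (<ᵇ-true b<a)) , (λ x _ a≤x → a≤x) , frame-upd R.b refl (frame-upd R.b refl (frame-upd R.q refl fr)) , refl))
          (λ a≤b → skip-run (lo + 1 , refl , ρa , refl , <ᵇ-false a≤b , ≤-reflexive (+-comm 1 lo) , (λ x lo<x _ → ≤-trans (≤-reflexive (+-comm lo 1)) lo<x) ,
            frame-upd R.b refl (frame-upd R.q refl fr) , refl) (s≤s z≤n))
        then λ { (b₀ , ρb , ρa , ρq , a≤b₀ , lo<b₀ , least , fr₁ , refl) →
        weaken (+-monoˡ-≤ 3 (≤-trans (≤-reflexive (Σ<-const (suc (X / a) ∸ b₀) 55)) (*-monoˡ-≤ 55 (count b₀ lo<b₀))))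
        (while-run {Ψ = End b₀} (λ _ → 52) (I b₀) (step′ b₀ a≤b₀ lo<b₀) (suc (X / a) ∸ b₀)
          (b₀ , refl , ≤-refl , ρa , ρb , ρq , A , (fr₁ , o , out≡ , ar , bt) , Better-refl , λ b b₀≤b b<b₀ → contradiction b₀≤b (<⇒≱ b<b₀)))
        then λ { (ρa , b₁ , q<b₁ , A′ , (fr′ , o′ , out′ , ar′ , bt′) , b′ , done) →
        assign (ev-⊕ (ev-! ρa) ev-lit) (≤-<-trans (≤-trans (≤-reflexive (+-comm a 1)) (s≤s (≤-trans a≤ℓ (≤-trans ℓ≤H H≤N)))) 1+N<2^w)
          (+-comm a 1 , A′ , (frame-upd R.a refl fr′ , o′ , out′ , ar′ , bt′) , λ x y 2≤x x<1+a x≤y lo<xy xy≤X → case m<1+n⇒m<n∨m≡n x<1+a of λ where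
            (inj₁ x<a)  → ≤-trans (lower≤ b′ (x * y)) (treated x y 2≤x x<a x≤y lo<xy xy≤X)
            (inj₂ refl) → done y (least y (m<n*o⇒m/o<n {X ∸ ℓ} {y} {a} (subst (X ∸ ℓ <_) (*-comm a y) lo<xy)) x≤y) (≤-<-trans
              (subst (_≤ X / a) (trans (cong (_/ a) (*-comm a y)) (m*n/n≡m y a)) (/-monoˡ-≤ a xy≤X)) q<b₁)) } })))
        where
        instance
          a≢0 : NonZero a
          a≢0 = >-nonZero (<⇒≤ 2≤a)
        lo : ℕ
        lo = (X ∸ ℓ) / a
        lo≤q : lo ≤ X / a
        lo≤q = /-monoˡ-≤ a (m∸n≤m X ℓ)
        ρX : ρ R.Hⱼ ≡ X
        ρX = trans (kept fr R.Hⱼ refl) ρH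
        q< : X / a < 2 ^ w
        q< = ≤-<-trans (≤-trans (m/n≤m X a) X≤N) N<2^w
        Start : Env → Memory → Set
        Start ρ′ s′ = ∃ λ b₀ → ρ′ R.b ≡ b₀ × ρ′ R.a ≡ a × ρ′ R.q ≡ X / a × a ≤ b₀ × lo < b₀ × (∀ x → lo < x → a ≤ x → b₀ ≤ x) × Frame productRegs ρ₀ ρ′ × s′ ≡ s
        Done : ℕ → ℕ → (ℕ → ℕ) → Set
        Done b₀ b A′ = ∀ x → b₀ ≤ x → x < b → A′ (a * x) ≤ comp a + comp x
        End : ℕ → Env → Memory → Set
        End b₀ ρ′ s′ = ρ′ R.a ≡ a × ∃ λ b₁ → X / a < b₁ × ∃ λ A′ → Good ρ′ s′ A′ × Better A A′ × Done b₀ b₁ A′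
        I : ℕ → ℕ → Env → Memory → Set
        I b₀ k ρ′ s′ = ∃ λ b → k ≡ suc (X / a) ∸ b × b₀ ≤ b × ρ′ R.a ≡ a × ρ′ R.b ≡ b × ρ′ R.q ≡ X / a × ∃ λ A′ → Good ρ′ s′ A′ × Better A A′ × Done b₀ b A′
        step′ : ∀ b₀ → a ≤ b₀ → lo < b₀ → ∀ k ρ s → I b₀ k ρ s → (Tests ρ s (! R.b ≼ ! R.q) false × End b₀ ρ s) ⊎
          (Tests ρ s (! R.b ≼ ! R.q) true × ∃ λ k′ → k ≡ suc k′ × Runs inner ρ s 52 (I b₀ k′))
        step′ b₀ a≤b₀ lo<b₀ k ρ s (b , k≡ , b₀≤b , ρa , ρb , ρq , A′ , good , b′ , done) with b ≤ᵇ X / a in eq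
        ... | false = inj₁ (retest eq (tst-≼ (ev-! ρb) (ev-! ρq)) , ρa , b , ≤ᵇ-false {b} eq , A′ , good , b′ , done)
        ... | true  = inj₂ (retest eq (tst-≼ (ev-! ρb) (ev-! ρq)) , X / a ∸ b , trans k≡ (+-∸-assoc 1 b≤q) ,
          conseq (λ { _ _ (ρa , ρb , ρq , A″ , good″ , b″ , ≤x) → suc b , refl , m≤n⇒m≤1+n b₀≤b , ρa , ρb , ρq , A″ , good″ , Better-trans b′ b″ ,
              λ x b₀≤x x<1+b → case m<1+n⇒m<n∨m≡n x<1+b of λ where
                (inj₁ x<b)  → ≤-trans (lower≤ b″ (a * x)) (done x b₀≤x x<b)
                (inj₂ refl) → ≤x })
            (inner-run good ρa ρb 2≤a (≤-trans a≤b₀ b₀≤b) (≤-trans a≤ℓ ℓ≤H) ρq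
              (<-≤-trans (m<[1+m/n]*n (X ∸ ℓ) a) (≤-trans (*-monoˡ-≤ a (≤-trans lo<b₀ b₀≤b)) (≤-reflexive (*-comm b a))))
              (≤-trans (≤-trans (≤-reflexive (*-comm a b)) (*-monoˡ-≤ a b≤q)) (m/n*n≤m X a))))
          where
          b≤q : b ≤ X / a
          b≤q = ≤ᵇ-true {b} eq
        -- An interval of length ℓ contains at most ⌊ℓ/a⌋ + 1 multiples of a.
        count : ∀ b₀ → lo < b₀ → suc (X / a) ∸ b₀ ≤ suc (quot ℓ a)
        count b₀ lo<b₀ = m≤n+o⇒m∸n≤o (suc (X / a)) b₀ (≤-trans q<′ (+-monoˡ-≤ (suc (quot ℓ a)) lo<b₀))
          where
          q<′ : X / a < suc lo + suc (quot ℓ a)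
          q<′ = m<n*o⇒m/o<n {X} {suc lo + suc (quot ℓ a)} {a} (begin-strict
            X                                   ≡⟨ m∸n+n≡m (≤-trans (≤-trans (m≤m+n ℓ (1 * ℓ)) L≤X) ≤-refl) ⟨
            X ∸ ℓ + ℓ                           <⟨ +-mono-< (m<[1+m/n]*n (X ∸ ℓ) a) (m<[1+m/n]*n ℓ a) ⟩
            suc lo * a + suc (ℓ / a) * a        ≡⟨ *-distribʳ-+ a (suc lo) (suc (ℓ / a)) ⟨
            (suc lo + suc (ℓ / a)) * a          ≡⟨ cong (λ x → (suc lo + suc x) * a) (quot≡ ℓ a) ⟩
            (suc lo + suc (quot ℓ a)) * a       ∎)
        cost≤ : 4 + (8 + (3 + 2 + (suc (quot ℓ a) * 55 + 3 + 4))) ≤ 79 + 55 * quot ℓ a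
        cost≤ = ≤-reflexive (lem (quot ℓ a))
          where
          lem : ∀ x → 4 + (8 + (3 + 2 + (suc x * 55 + 3 + 4))) ≡ 79 + 55 * x
          lem = solve-∀

      products-run : Runs products ρ₀ s₀ productsCost (λ ρ′ s′ → ∃ λ A′ → Good ρ′ s′ A′ × Treated (suc X) A′)
      products-run = weaken cost≤ (assign⨟ ev-lit (≤-<-trans 2≤H (≤-<-trans H≤N N<2^w))
        (while-run {Ψ = λ ρ′ s′ → ∃ λ A′ → Good ρ′ s′ A′ × Treated (suc X) A′} (λ k → 79 + 55 * quot ℓ (ℓ ∸ k)) I loop (ℓ ∸ 1)
          (2 , ≤-refl , cong suc (m+[n∸m]≡n 1≤ℓ) , refl , A₀ , (frame-upd R.a refl frame-refl , Only-refl , refl , ar₀ , Better-refl) ,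
            λ a b 2≤a a<2 → contradiction 2≤a (<⇒≱ a<2))))
        where
        I : ℕ → Env → Memory → Set
        I k ρ s = ∃ λ a → 2 ≤ a × a + k ≡ suc ℓ × ρ R.a ≡ a × ∃ λ A → Good ρ s A × Treated a A
        loop : ∀ k ρ s → I k ρ s → (Tests ρ s (! R.a ⊗ ! R.a ≼ ! R.Hⱼ) false × ∃ λ A′ → Good ρ s A′ × Treated (suc X) A′) ⊎
          (Tests ρ s (! R.a ⊗ ! R.a ≼ ! R.Hⱼ) true × ∃ λ k′ → k ≡ suc k′ × Runs step ρ s (79 + 55 * quot ℓ (ℓ ∸ k′)) (I k′))
        loop k ρ s (a , 2≤a , a+k , ρa , A , good , treated) with a * a ≤ᵇ X in eq
        ... | false = inj₁ (retest eq (tst-≼ (ev-⊗ (ev-! ρa) (ev-! ρa)) (ev-! (trans (kept (proj₁ good) R.Hⱼ refl) ρH))) , A , good ,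
          λ x y 2≤x _ x≤y lo hi → treated x y 2≤x (≰⇒> λ a≤x → <⇒≱ (≤ᵇ-false {a * a} eq) (≤-trans (*-mono-≤ a≤x (≤-trans a≤x x≤y)) hi)) x≤y lo hi)
        ... | true with k
        -- The index is ℓ + 1 - a. It cannot be used up while the test succeeds, since a = ℓ + 1
        -- contradicts a² ≤ X ≤ N ≤ ℓ².
        ...   | zero  = contradiction (≤-trans (≤ᵇ-true {a * a} eq) (≤-trans X≤N N≤ℓ²)) (<⇒≱ (*-mono-< ℓ<a ℓ<a))
          where
          ℓ<a : ℓ < a
          ℓ<a = ≤-reflexive (trans (sym a+k) (+-identityʳ a))
        ...   | suc k′ = inj₂ (retest eq (tst-≼ (ev-⊗ (ev-! ρa) (ev-! ρa)) (ev-! (trans (kept (proj₁ good) R.Hⱼ refl) ρH))) , k′ , refl ,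
          subst (λ x → Runs step ρ s (79 + 55 * quot ℓ x) (I k′)) a≡
            (conseq (λ { _ _ (ρa′ , A′ , good′ , treated′) → suc a , m≤n⇒m≤1+n 2≤a , trans (sym (+-suc a k′)) a+k , ρa′ , A′ , good′ , treated′ })
              (step-run good treated ρa 2≤a (≤ᵇ-true {a * a} eq) (≤-trans (m≤m+n a k′) (≤-reflexive a+k′)))))
          where
          a+k′ : a + k′ ≡ ℓ
          a+k′ = suc-injective (trans (sym (+-suc a k′)) a+k)
          a≡ : a ≡ ℓ ∸ k′
          a≡ = trans (sym (m+n∸n≡m a k′)) (cong (_∸ k′) a+k′)
        cost≤ : 2 + (Σ< (ℓ ∸ 1) (λ k → quotCost (ℓ ∸ k)) + 5) ≤ productsCost
        cost≤ = begin
          2 + (Σ< (ℓ ∸ 1) (λ k → quotCost (ℓ ∸ k)) + 5) ≤⟨ +-monoʳ-≤ 2 (+-monoˡ-≤ 5 (Σ<-monoˡ (λ k → quotCost (ℓ ∸ k)) (m∸n≤m ℓ 1))) ⟩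
          2 + (Σ< ℓ (λ k → quotCost (ℓ ∸ k)) + 5)       ≡⟨ cong (λ S → 2 + (S + 5)) (Σ<-reverse ℓ quotCost) ⟩
          2 + (Σ< ℓ (quotCost ∘ suc) + 5)               ≡⟨ cong (2 +_) (+-comm _ 5) ⟩
          productsCost ∎

    sumRegs : List Register
    sumRegs = R.n ∷ R.i ∷ R.T ∷ R.k ∷ R.v ∷ kMaxRegs

    module Sums {ρ₀ : Env} {s₀ : Memory} (p : Params ρ₀) (ρj : ρ₀ R.j ≡ j) (ρH : ρ₀ R.Hⱼ ≡ X)
      (topX : cells s₀ top 0 j ≡ just X) (B₀ : Arr s₀ 0 0 H comp)
      {A₀ : ℕ → ℕ} (ar₀ : Arr s₀ j B L A₀) (bounded : Bounded A₀) (old : ∀ n → B < n → n ≤ X ∸ ℓ → A₀ n ≡ comp n)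
      (treated : Treated (suc X) A₀) where

      -- Only B_1 reports, and its results continue the list that ended at X - ℓ.
      Reported : ℕ → Memory → Set
      Reported r s = (j ≡ 1 → out s₀ ≡ results (X ∸ ℓ) → out s ≡ results r) × (j ≢ 1 → out s ≡ out s₀)

      Good : ℕ → ℕ → Env → Memory → Set
      Good n r ρ s = ρ R.n ≡ n × Frame sumRegs ρ₀ ρ × Only j s₀ s × Reported r s × ∃ λ A → Arr s j B L A × Better A₀ A × (∀ m → B < m → m < n → A m ≡ comp m)

      body : Program
      body =
        R.i ≔ position (! R.j) (! R.n) ⨟
        R.T ≔ block [ ! R.j ][ ! R.i ⊖ lit 1 ] ⨟
        lower (! R.j) (! R.i) (! R.T ⊕ lit 1) ⨟
        computeKMax ⨟
        forUp R.k (lit 6) (! R.κ)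
          ( lower (! R.j) (! R.i) (block [ lit 0 ][ ! R.k ] ⊕ block [ ! R.j ][ ! R.i ⊖ ! R.k ]) ) ⨟
        when (! R.j ≐ lit 1)
          ( emit (! R.n) (block [ ! R.j ][ ! R.i ]) )

      -- The new integers lie at positions ℓ + 1 to 2ℓ. As k < ℓ, the integer n - k is still in the
      -- block, and its entry is exact because it is either old or already treated.
      body-run : ∀ {n ρ s} → X ∸ ℓ < suc n → suc n ≤ X → Good (suc n) n ρ s →
        Runs body ρ s (40 + kMaxCost Bd + 26 * κ (suc n)) (λ ρ′ s′ → ρ′ R.n ≡ suc n × Good (suc (suc n)) (suc n) (upd R.n (suc (suc n)) ρ′) s′)
      body-run {n} {ρ} {s} lo n≤X (ρn , fr , o , (rep₁ , rep₂) , A , ar , bt , exact) = weaken cost≤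
        (assign⨟ (ev-position (trans (kept fr R.L refl) (L-reg p)) (ev-! ρj′) (ev-! ρn) (trans (tops≡ o j) topX)) (≤-<-trans i≤L (≤-<-trans L≤N N<2^w))
        (assign⨟ (ev-[] (ev-! ρj′) (ev-⊖ (ev-! refl) ev-lit) (entry≡ ar (m<n⇒0<n∸m 1<i) (≤-trans (m∸n≤m i 1) i≤L) n′≡ (exact n B<n ≤-refl))) comp<
        (lower-run {Ψ = Ψ₁} ar 1≤i i≤L (ev-⊕ (ev-! refl) ev-lit) (ev-! ρj′) (ev-! refl)
          (≤-<-trans (+-monoʳ-≤ (comp n) (1≤comp n)) (comp+comp< 1≤n n≤N 1≤n n≤N)) (subst (λ x → A x < 2 ^ e) (sym i≡) (A< A bt))
          (λ ar₁ o₁ out₁ → ρn , refl , refl , frame-upd R.v refl (frame-upd R.T refl (frame-upd R.i refl fr)) , Only-trans o o₁ , out₁ , _ , ar₁ , Better-trans bt step₁ ,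
            (λ m B<m m<n → Better-exact step₁ (exact m B<m m<n)) , subst (λ x → lowerAt (B + i) (comp n + 1) A x ≤ comp n + 1) i≡ (lowerAt-≤x (B + i) _ A))
        then λ { {ρ₁} {s₁} (ρn , ρi , ρT , fr , o , out₁ , A₁ , ar₁ , bt₁ , exact₁ , A₁≤) →
        weaken (kMaxCost-mono (comp≤Bd 1≤n n≤N)) (computeKMax-run ρn ρT comp< E<)
        then λ { {ρ₂} (fr₂ , ρκ , refl) →
        let ρ₂j = trans (kept fr₂ R.j refl) (trans (kept fr R.j refl) ρj)
            ρ₂i = trans (kept fr₂ R.i refl) ρi
        in
        sumsLoop-run {z = block [ ! R.j ][ ! R.i ⊖ ! R.k ]} i≡ 1≤i i≤L 1≤n ar₁ ρκ κ<2^w 6<2^w (A< A₁ bt₁)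
          (λ k 6≤k k≤ → comp+comp< (≤-trans (s≤s z≤n) 6≤k) (≤-trans (k≤n k≤) n≤N) (m<n⇒0<n∸m (s≤s (k≤n k≤))) (≤-trans (m∸n≤m (suc n) k) (≤-trans n≤X X≤N)))
          (λ fr′ → ev-! (trans (kept fr′ R.j refl) ρ₂j)) (λ fr′ → ev-! (trans (kept fr′ R.i refl) ρ₂i))
          (λ {k} 6≤k k≤ fr′ ρk ar′ b′ o′ → ev-⊕
            (ev-[] ev-lit (ev-! ρk) (get (Arr-Only 0≢j (Only-trans o o′) B₀) k (≤-trans (s≤s z≤n) 6≤k) (≤-trans (<⇒≤ (k<ℓ k≤)) ℓ≤H)))
            (ev-[] (ev-! (trans (kept fr′ R.j refl) ρ₂j)) (ev-⊖ (ev-! (trans (kept fr′ R.i refl) ρ₂i)) (ev-! ρk))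
              (entry≡ ar′ (m<n⇒0<n∸m (k<i k≤)) (≤-trans (m∸n≤m i k) i≤L) (n∸k≡ k≤)
                (Better-exact b′ (exact₁ (suc n ∸ k) (B<n∸k k≤) (∸-monoʳ-< (≤-trans (s≤s z≤n) 6≤k) (≤-trans (k≤n k≤) (n≤1+n n))))))))
        then λ { {ρ₃} {s₃} (fr₃ , o₃ , out₃ , A₂ , ar₂ , b₂ , done) →
        let A₂n : A₂ (suc n) ≡ comp (suc n)
            A₂n = comp-characterised (s≤s 1≤n) (sound b₂ (suc n) (sound bt₁ (suc n) (proj₁ (bounded (suc n) B<1+n n≤X))))
                    (≤-trans (lower≤ b₂ (suc n)) (≤-trans A₁≤ (≤-reflexive (+-comm (comp n) 1))))
                    (λ x y 2≤x x≤y xy≡ → ≤-trans (lower≤ b₂ (suc n)) (≤-trans (lower≤ bt₁ (suc n))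
                      (subst (λ z → A₀ z ≤ comp x + comp y) xy≡ (treated x y 2≤x
                        (s≤s (≤-trans x≤y (≤-trans (m≤n*m y x {{>-nonZero (<⇒≤ 2≤x)}}) (≤-trans (≤-reflexive xy≡) n≤X))))
                        x≤y (subst (X ∸ ℓ <_) (sym xy≡) lo) (subst (_≤ X) (sym xy≡) n≤X)))))
                    done
            ρ₃j = trans (kept fr₃ R.j refl) ρ₂j
            ρ₃n = trans (kept fr₃ R.n refl) (trans (kept fr₂ R.n refl) ρn)
            fr₃′ : Frame sumRegs ρ₀ ρ₃
            fr₃′ = frame-trans (frame-trans fr refl fr₂) refl fr₃
            exact₂ : ∀ m → B < m → m < suc (suc n) → A₂ m ≡ comp m
            exact₂ = λ m B<m m<2+n → case m<1+n⇒m<n∨m≡n m<2+n of λ where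
              (inj₁ m<1+n) → Better-exact b₂ (exact₁ m B<m m<1+n)
              (inj₂ refl)  → A₂n
            final : ∀ {s′} → Arr s′ j B L A₂ → Only j s₃ s′ → Reported (suc n) s′ → ρ₃ R.n ≡ suc n × Good (suc (suc n)) (suc n) (upd R.n (suc (suc n)) ρ₃) s′
            final = λ ar′ o′ rep → ρ₃n , refl , frame-upd R.n refl fr₃′ , Only-trans (Only-trans o o₃) o′ , rep , A₂ , ar′ ,
              Better-trans bt₁ b₂ , exact₂
            out₃≡ : out s₃ ≡ out s
            out₃≡ = trans out₃ out₁
        in
        branch-run (tst-≐ (ev-! ρ₃j) ev-lit)
          (λ j≡1 → emit-run (ev-! ρ₃n) (ev-[] (ev-! ρ₃j) (ev-! (trans (kept fr₃ R.i refl) ρ₂i)) (entry≡ ar₂ 1≤i i≤L i≡ A₂n))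
            (final (arr (length≡ ar₂) (get ar₂)) (only (λ _ _ _ → refl) (λ _ → refl) (λ _ _ → refl) refl)
              ((λ j≡1 start → cong (_∷ʳ (suc n , comp (suc n))) (trans out₃≡ (rep₁ j≡1 start))) , λ j≢1 → contradiction (≡ᵇ-true {j} j≡1) j≢1)))
          (λ j≢1 → skip-run (final ar₂ Only-refl ((λ j≡1 _ → contradiction j≡1 (≡ᵇ-false {j} j≢1)) , λ j≢1 → trans out₃≡ (rep₂ j≢1))) (s≤s z≤n)) } } })))
        where
        i : ℕ
        i = L + suc n ∸ X
        ρj′ : ρ R.j ≡ j
        ρj′ = trans (kept fr R.j refl) ρj
        B+ℓ≤n : B + ℓ ≤ n
        B+ℓ≤n = ≤-trans (≤-reflexive B+ℓ≡) (≤-pred lo)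
        B<n : B < n
        B<n = ≤-trans (≤-trans (≤-reflexive (+-comm 1 B)) (+-monoʳ-≤ B 1≤ℓ)) B+ℓ≤n
        B<1+n : B < suc n
        B<1+n = m≤n⇒m≤1+n B<n
        1≤n : 1 ≤ n
        1≤n = ≤-trans (s≤s z≤n) B<n
        n≤N : n ≤ N
        n≤N = ≤-trans (<⇒≤ n≤X) X≤N
        i≡ : B + i ≡ suc n
        i≡ = position-≡ L≤X (X<m+L B<1+n)
        1≤i : 1 ≤ i
        1≤i = position-≥1 {X} {suc n} (X<m+L B<1+n)
        i≤L : i ≤ L
        i≤L = position-≤L {X} {suc n} n≤X
        ℓ<i : ℓ < i
        ℓ<i = +-cancelˡ-< B ℓ i (≤-trans (s≤s B+ℓ≤n) (≤-reflexive (sym i≡)))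
        1<i : 1 < i
        1<i = ≤-<-trans 1≤ℓ ℓ<i
        n′≡ : B + (i ∸ 1) ≡ n
        n′≡ = trans (sym (+-∸-assoc B 1≤i)) (cong (_∸ 1) i≡)
        entry≡ : ∀ {s A i m} → Arr s j B L A → 1 ≤ i → i ≤ L → B + i ≡ m → A m ≡ comp m → cells s block j i ≡ just (comp m)
        entry≡ {i = i} ar 1≤i i≤L refl eq = trans (get ar i 1≤i i≤L) (cong just eq)
        comp< : comp n < 2 ^ w
        comp< = ≤-<-trans (m≤m+n _ _) (comp+comp< 1≤n n≤N 1≤n n≤N)
        E< : E (comp n) < 2 ^ w
        E< = fits (≤-trans (E[comp]≤n² 1≤n) (≤-trans (*-mono-≤ n≤N n≤N) X*X≤))
        A< : ∀ A′ → Better A₀ A′ → A′ (suc n) < 2 ^ e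
        A< A′ b = ≤-<-trans (≤-trans (lower≤ b (suc n)) (proj₂ (bounded (suc n) B<1+n n≤X))) bound<
        κ≤ℓ : κ (suc n) < ℓ
        κ≤ℓ = κ<ℓ (suc n) (s≤s 1≤n) (≤-trans n≤X X≤N)
        k<ℓ : ∀ {k} → k ≤ κ (suc n) → k < ℓ
        k<ℓ k≤ = ≤-<-trans k≤ κ≤ℓ
        k<i : ∀ {k} → k ≤ κ (suc n) → k < i
        k<i k≤ = <-trans (k<ℓ k≤) ℓ<i
        k≤n : ∀ {k} → k ≤ κ (suc n) → k ≤ n
        k≤n k≤ = ≤-trans (<⇒≤ (k<ℓ k≤)) (≤-trans (m≤n+m ℓ B) B+ℓ≤n)
        n∸k≡ : ∀ {k} → k ≤ κ (suc n) → B + (i ∸ k) ≡ suc n ∸ k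
        n∸k≡ {k} k≤ = trans (sym (+-∸-assoc B (<⇒≤ (k<i k≤)))) (cong (_∸ k) i≡)
        B<n∸k : ∀ {k} → k ≤ κ (suc n) → B < suc n ∸ k
        B<n∸k {k} k≤ = m+n≤o⇒m≤o∸n (suc B) (≤-trans (+-monoʳ-≤ (suc B) (<⇒≤ (k<ℓ k≤))) (s≤s B+ℓ≤n))
        κ<2^w : suc (κ (suc n)) < 2 ^ w
        κ<2^w = ≤-<-trans κ≤ℓ (≤-<-trans (≤-trans ℓ≤H H≤N) N<2^w)
        6<2^w : 6 < 2 ^ w
        6<2^w = ≤-<-trans (≤-trans (from-yes (6 ≤? 8)) (*-mono-≤ (*-mono-≤ 2≤N 2≤N) 2≤N)) (fits ≤-refl)
          where
          2≤N : 2 ≤ N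
          2≤N = ≤-trans 2≤H H≤N
        step₁ : Better A (lowerAt (B + i) (comp n + 1) A)
        step₁ = lowerAt-better (subst (λ x → comp x ≤ comp n + 1) (sym i≡) (≤-trans (comp-suc 1≤n) (≤-reflexive (+-comm 1 (comp n)))))
        Ψ₁ : Env → Memory → Set
        Ψ₁ ρ′ s′ = ρ′ R.n ≡ suc n × ρ′ R.i ≡ i × ρ′ R.T ≡ comp n × Frame sumRegs ρ₀ ρ′ × Only j s₀ s′ × out s′ ≡ out s × ∃ λ A′ → Arr s′ j B L A′ × Better A₀ A′
          × (∀ m → B < m → m < suc n → A′ m ≡ comp m) × A′ (suc n) ≤ comp n + 1
        cost≤ : 8 + (6 + (13 + (kMaxCost Bd + (5 + κ (suc n) * 26 + (3 + 5))))) ≤ 40 + kMaxCost Bd + 26 * κ (suc n)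
        cost≤ = ≤-reflexive (lem (kMaxCost Bd) (κ (suc n)))
          where
          lem : ∀ kc k → 8 + (6 + (13 + (kc + (5 + k * 26 + (3 + 5))))) ≡ 40 + kc + 26 * k
          lem = solve-∀

      sums-run : Runs sums ρ₀ s₀ (sumsCost X) (λ ρ′ s′ → Frame sumRegs ρ₀ ρ′ × Only j s₀ s′ × Reported X s′ × Arr s′ j B L comp)
      sums-run = weaken cost≤ (conseq (λ { _ s′ (n , _ , final , _ , fr , o , rep , A , ar , _ , exact) → let n≡ = final lo≤ in
          fr , o , subst (λ r → Reported (pred r) s′) n≡ rep ,
          Arr-cong (λ i 1≤i i≤L → exact (B + i) (subst (_≤ B + i) (+-comm B 1) (+-monoʳ-≤ B 1≤i))
            (subst (B + i <_) (sym n≡) (s≤s (≤-trans (+-monoʳ-≤ B i≤L) (≤-reflexive (m∸n+n≡m L≤X)))))) ar })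
        (forUp-run {hi = X} (λ n → 40 + kMaxCost Bd + 26 * κ n) (λ n → Good n (pred n))
          (ev-⊕ (ev-⊖ (ev-! ρH) (ev-! (ℓ-reg p))) ev-lit) (≤-<-trans lo≤ 1+X<) 1+X<
          (λ (ρn , fr , _) → ρn , ev-! (trans (kept fr R.Hⱼ refl) ρH))
          (λ { {zero} lo _ _ → contradiction (≤-trans (m≤n+m 1 (X ∸ ℓ)) lo) λ () ; {suc n} lo n≤X good → body-run (≤-trans (≤-reflexive (+-comm 1 (X ∸ ℓ))) lo) n≤X good })
          (refl , frame-upd R.n refl frame-refl , Only-refl , ((λ _ start → trans start (cong results (cong pred (+-comm 1 (X ∸ ℓ))))) , λ _ → refl) , A₀ , ar₀ , Better-refl ,
            λ m B<m m< → old m B<m (≤-pred (≤-trans m< (≤-reflexive (+-comm (X ∸ ℓ) 1)))))))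
        where
        ℓ≤X : ℓ ≤ X
        ℓ≤X = ≤-trans ℓ≤H H≤X
        lo≤ : X ∸ ℓ + 1 ≤ suc X
        lo≤ = ≤-trans (≤-reflexive (+-comm (X ∸ ℓ) 1)) (s≤s (m∸n≤m X ℓ))
        1+X< : suc X < 2 ^ w
        1+X< = ≤-<-trans (s≤s X≤N) 1+N<2^w
        len≡ : suc X ∸ (X ∸ ℓ + 1) ≡ ℓ
        len≡ = trans (cong (suc X ∸_) (+-comm (X ∸ ℓ) 1)) (m∸[m∸n]≡n ℓ≤X)
        cost≤ : 1 + 5 + (Σ< (suc X ∸ (X ∸ ℓ + 1)) (λ i → 6 + 1 + (40 + kMaxCost Bd + 26 * κ (X ∸ ℓ + 1 + i))) + (2 + 1)) ≤ sumsCost X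
        cost≤ = ≤-reflexive (trans (cong (6 +_) (+-comm _ 3)) (cong (9 +_) (trans (cong (λ k → Σ< k (λ i → 6 + 1 + (40 + kMaxCost Bd + 26 * κ (X ∸ ℓ + 1 + i)))) len≡)
          (Σ<-cong ℓ (λ i → cong (λ x → 47 + kMaxCost Bd + 26 * κ (x + i)) (+-comm (X ∸ ℓ) 1))))))

  -- The potential and the invariants of a pass

  Jmax : ℕ
  Jmax = cdiv N H

  -- B_1 exists from the beginning, when h = H; every other B_j is created when h first exceeds jH.
  Initialized : ℕ → ℕ → Set
  Initialized j h = j ≡ 1 ⊎ j * H < h

  initialized? : ∀ j h → Dec (Initialized j h)
  initialized? j h = (j ≟ 1) ⊎-dec (j * H <? h)

  record Status (s : Memory) (j h : ℕ) : Set where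
    constructor status
    field
      on  : Initialized j h → Ready s j (Top j h)
      off : ¬ Initialized j h → cells s top 0 j ≡ just 0 × sizes s block j ≡ 0

  open Status

  Status-Touch : ∀ {j k s s′ h} → k ≢ j → Touch j s s′ → Status s k h → Status s′ k h
  Status-Touch {k = k} k≢j t st = status (Ready-Touch k≢j t ∘ on st)
    (λ ¬i → trans (topsᵗ t k k≢j) (proj₁ (off st ¬i)) , trans (sizesᵗ t k k≢j) (proj₂ (off st ¬i)))

  -- The situation within a pass, before B_j is considered: the blocks above j already belong to h +
  -- ℓ, the others still to h. `a₀` is the storage outside the running blocks.
  record World (a₀ h j : ℕ) (s : Memory) : Set where
    field
      B₀      : Arr s 0 0 H comp
      treated : ∀ k → j < k → k ≤ Jmax → Status s k (h + ℓ)
      waiting : ∀ k → 1 ≤ k → k ≤ j → Status s k h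
      tops    : sizes s top 0 ≡ Jmax
      account : alloc s ≡ a₀ + e * Σ< Jmax (λ k → sizes s block (suc k))

  open World

  -- What an update costs apart from its loops over k ≤ kMax(n). Every update is also charged 12 +
  -- 17 L for an initialization that may precede it.
  fixedCost : ℕ
  fixedCost = 56 + 17 * L + 26 * ℓ + 11 * lg³ N + productsCost + ℓ * (47 + kMaxCost Bd)

  Potential : ℕ → ℕ → ℕ
  Potential j h = fixedCost * quota j h + 26 * U (Top j h)

  updateCost : ℕ → ℕ
  updateCost X = 12 + 17 * L + (31 + 26 * ℓ + 11 * lg³ N) + 4 + (productsCost + sumsCost X)

  -- An update raises the quota by 1 and H_j by ℓ, so that exactly the kMax of the new integers
  -- enter `U`. An equality is aimed at, so that the charges of successive passes telescope.
  potential-step : ∀ j h h′ → quota j h′ ≡ suc (quota j h) → updateCost (Top j h′) ≡ Potential j h′ ∸ Potential j h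
  potential-step j h h′ eq = begin-equality
    updateCost (Top j h′)                               ≡⟨ cong updateCost Top≡ ⟩
    updateCost (X + ℓ)                                  ≡⟨ m+n∸n≡m (updateCost (X + ℓ)) (Potential j h) ⟨
    updateCost (X + ℓ) + Potential j h ∸ Potential j h  ≡⟨ cong (_∸ Potential j h) total ⟩
    Potential j h′ ∸ Potential j h                      ∎
    where
    X : ℕ
    X = Top j h
    D : ℕ
    D = Σ< ℓ (λ i → κ (suc X + i))
    Top≡ : Top j h′ ≡ X + ℓ
    Top≡ = trans (cong (ℓ *_) eq) (trans (*-suc ℓ (quota j h)) (+-comm ℓ X))
    sums≡ : sumsCost (X + ℓ) ≡ 9 + (ℓ * (47 + kMaxCost Bd) + 26 * D)
    sums≡ = cong (9 +_) (begin-equality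
      Σ< ℓ (λ i → 47 + kMaxCost Bd + 26 * κ (suc (X + ℓ ∸ ℓ) + i)) ≡⟨ cong (λ x → Σ< ℓ (λ i → 47 + kMaxCost Bd + 26 * κ (suc x + i))) {X + ℓ ∸ ℓ} {X} (m+n∸n≡m X ℓ) ⟩
      Σ< ℓ (λ i → 47 + kMaxCost Bd + 26 * κ (suc X + i)) ≡⟨ Σ<-+ ℓ (λ _ → 47 + kMaxCost Bd) (λ i → 26 * κ (suc X + i)) ⟩
      Σ< ℓ (λ _ → 47 + kMaxCost Bd) + Σ< ℓ (λ i → 26 * κ (suc X + i)) ≡⟨ cong₂ _+_ (Σ<-const ℓ (47 + kMaxCost Bd)) (sym (Σ<-* 26 ℓ (λ i → κ (suc X + i)))) ⟩
      ℓ * (47 + kMaxCost Bd) + 26 * D ∎)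
    U≡ : U (X + ℓ) ≡ U X + D
    U≡ = Σ<-append (suc X) ℓ κ
    total : updateCost (X + ℓ) + Potential j h ≡ Potential j h′
    total = begin-equality
      updateCost (X + ℓ) + Potential j h
        ≡⟨ cong (λ S → 12 + 17 * L + (31 + 26 * ℓ + 11 * lg³ N) + 4 + (productsCost + S) + Potential j h) sums≡ ⟩
      12 + 17 * L + (31 + 26 * ℓ + 11 * lg³ N) + 4 + (productsCost + (9 + (ℓ * (47 + kMaxCost Bd) + 26 * D))) + Potential j h
        ≡⟨ lem (17 * L) (26 * ℓ) (11 * lg³ N) productsCost (ℓ * (47 + kMaxCost Bd)) D fixedCost (quota j h) (U X) refl ⟩
      fixedCost * suc (quota j h) + 26 * (U X + D)
        ≡⟨ cong₂ (λ q u → fixedCost * q + 26 * u) (sym eq) (trans (sym U≡) (cong U (sym Top≡))) ⟩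
      Potential j h′ ∎
      where
      lem : ∀ a b c p k D F q u → F ≡ 56 + a + b + c + p + k →
        12 + a + (31 + b + c) + 4 + (p + (9 + (k + 26 * D))) + (F * q + 26 * u) ≡ F * suc q + 26 * (u + D)
      lem a b c p k D F q u refl = lem′ a b c p k D q u
        where
        lem′ : ∀ a b c p k D q u → 12 + a + (31 + b + c) + 4 + (p + (9 + (k + 26 * D))) + ((56 + a + b + c + p + k) * q + 26 * u)
          ≡ (56 + a + b + c + p + k) * suc q + 26 * (u + D)
        lem′ = solve-∀

  updateBlock blockBody : Program
  updateBlock = shift ⨟ R.Hⱼ ≔ topOf (! R.j) ⨟ products ⨟ sums
  blockBody =
    R.newH ≔ ! R.ℓ ⊗ ceilDiv (! R.h) (! R.j ⊗ ! R.ℓ) ⨟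
    when (topOf (! R.j) ≐ lit 0)
      ( when (! R.H ≺ ! R.newH) initialize ) ⨟
    when (lit 1 ≼ topOf (! R.j))
      ( when (topOf (! R.j) ≺ ! R.newH) updateBlock )

  blockRegs : List Register
  blockRegs = R.newH ∷ R.Hⱼ ∷ R.i ∷ R.y ∷ R.bound ∷ R.a ∷ R.q ∷ R.b ∷ R.v ∷ R.n ∷ R.T ∷ R.k ∷ kMaxRegs

  module BlockStep (a₀ h x j : ℕ) (h≡ : h ≡ ℓ * x) (hh≤x : hh ≤ x) (h′≤N : h + ℓ ≤ N) (1≤j : 1 ≤ j) (active : j * H < h + ℓ) where

    X X′ : ℕ
    X  = Top j h
    X′ = Top j (h + ℓ)

    X′≤N : X′ ≤ N
    X′≤N = ≤-trans (Top≤ 1≤j (m≤n⇒m≤1+n hh≤x) (≤-reflexive h′≡)) (≤-trans (≤-reflexive (sym h′≡)) h′≤N)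
      where
      h′≡ : h + ℓ ≡ ℓ * suc x
      h′≡ = trans (cong (_+ ℓ) h≡) (trans (+-comm (ℓ * x) ℓ) (sym (*-suc ℓ x)))

    j≤J : ∀ {k} → k * H < h + ℓ → k ≤ Jmax
    j≤J {k} kH< = ≮⇒≥ λ Jmax<k → <⇒≱ kH< (≤-trans h′≤N (≤-trans (cdiv-* N 1≤H) (*-monoˡ-≤ H (<⇒≤ Jmax<k))))

    newH≡ : ∀ {ρ s} → Params ρ → ρ R.h ≡ h + ℓ → ρ R.j ≡ j → (ρ , s) ⊢ ! R.ℓ ⊗ ceilDiv (! R.h) (! R.j ⊗ ! R.ℓ) ⇒ X′
    newH≡ {ρ} {s} p ρh ρj = subst (λ q → (ρ , s) ⊢ ! R.ℓ ⊗ ceilDiv (! R.h) (! R.j ⊗ ! R.ℓ) ⇒ ℓ * q)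
      (trans (quot≡ (h + ℓ + j * ℓ ∸ 1) (j * ℓ)) (sym (active-quota 1≤j active)))
      (ev-⊗ (ev-! (ℓ-reg p)) (ev-⊘ (ev-⊖ (ev-⊕ (ev-! ρh) jℓ) ev-lit) jℓ))
      where
      instance
        jℓ≢0 : NonZero (j * ℓ)
        jℓ≢0 = >-nonZero (1≤jℓ 1≤j)
      jℓ : (ρ , s) ⊢ ! R.j ⊗ ! R.ℓ ⇒ j * ℓ
      jℓ = ev-⊗ (ev-! ρj) (ev-! (ℓ-reg p))

    record Prepared (s : Memory) : Set where
      field
        atH     : Ready s j X
        zero-ok : Arr s 0 0 H comp
        higher  : ∀ k → j < k → k ≤ Jmax → Status s k (h + ℓ)
        lower′  : ∀ k → 1 ≤ k → k < j → Status s k h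
        topsOK  : sizes s top 0 ≡ Jmax
        money   : alloc s ≡ a₀ + e * Σ< Jmax (λ k → sizes s block (suc k))

    open Prepared

    Prepared-Touch : ∀ {s s′} → Touch j s s′ → alloc s′ ≡ a₀ + e * Σ< Jmax (λ k → sizes s′ block (suc k)) → Ready s′ j X → World a₀ h j s → Prepared s′
    Prepared-Touch t acc r wd = record
      { atH     = r
      ; zero-ok = Arr-Touch (λ { refl → contradiction 1≤j λ () }) t (B₀ wd)
      ; higher  = λ k j<k k≤J → Status-Touch (>⇒≢ j<k) t (treated wd k j<k k≤J)
      ; lower′  = λ k 1≤k k<j → Status-Touch (<⇒≢ k<j) t (waiting wd k 1≤k (<⇒≤ k<j))
      ; topsOK  = trans (topSize t) (tops wd)
      ; money   = acc }

    Finished : ℕ → Memory → Memory → Set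
    Finished j₀ s s′ = World a₀ h j₀ s′ × (j ≡ 1 → out s ≡ results h → out s′ ≡ results (h + ℓ)) × (j ≢ 1 → out s′ ≡ out s)

    finish : ∀ {s s′ j₀} → j ≡ suc j₀ → Prepared s → Touch j s s′ → alloc s′ ≡ alloc s → (∀ k → sizes s′ block k ≡ sizes s block k) → Ready s′ j X′ → World a₀ h j₀ s′
    finish {s} {s′} refl pr t alloc≡ sz r = record
      { B₀      = Arr-Touch (λ ()) t (zero-ok pr)
      ; treated = λ k j₀<k k≤J → case k ≟ j of λ where
          (yes refl) → status (λ _ → r) (λ ¬i → contradiction (inj₂ active) ¬i)
          (no k≢j)   → Status-Touch k≢j t (higher pr k (≤∧≢⇒< j₀<k (k≢j ∘ sym)) k≤J)
      ; waiting = λ k 1≤k k≤j₀ → Status-Touch (<⇒≢ (s≤s k≤j₀)) t (lower′ pr k 1≤k (s≤s k≤j₀))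
      ; tops    = trans (topSize t) (topsOK pr)
      ; account = trans alloc≡ (trans (money pr) (cong (λ S → a₀ + e * S) (Σ<-cong Jmax (λ k → sym (sz (suc k)))))) }

    prepared-run : ∀ {ρ s p} → Initialized j h → ρ R.j ≡ j → World a₀ h j s →
      Runs (when (topOf (! R.j) ≐ lit 0) p) ρ s (5 + 1) (λ ρ′ s′ → Frame (R.i ∷ []) ρ ρ′ × Prepared s′ × out s′ ≡ out s)
    prepared-run i ρj wd = branch-run
      (retest (≢⇒≡ᵇ (λ X≡0 → <⇒≱ 1≤H (≤-trans (H≤Top 1≤j h) (≤-reflexive X≡0)))) (tst-≐ (ev-top (ev-! ρj) (topEntry (on (waiting wd j 1≤j ≤-refl) i))) ev-lit))
      (λ ()) (λ _ → skip-run (frame-refl , Prepared-Touch Touch-refl (account wd) (on (waiting wd j 1≤j ≤-refl) i) wd , refl) (s≤s z≤n))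

    H<X′ : H < X′
    H<X′ = ≤-<-trans (≤-reflexive H≡) (*-monoʳ-< ℓ {{>-nonZero 1≤ℓ}} (<-≤-trans (active⇒hh< 1≤j active) (m≤n⊔m hh _)))

    -- For a block that does not exist yet the formula for H_j gives H, which is the value set by
    -- the initialization; so afterwards the two cases need no distinction.
    prepare-run : ∀ {ρ s} → Params ρ → ρ R.j ≡ j → ρ R.newH ≡ X′ → World a₀ h j s →
      Runs (when (topOf (! R.j) ≐ lit 0) (when (! R.H ≺ ! R.newH) initialize)) ρ s (5 + (3 + (12 + 17 * L)))
        (λ ρ′ s′ → Frame (R.i ∷ []) ρ ρ′ × Prepared s′ × out s′ ≡ out s)
    prepare-run {ρ} {s} p ρj ρnew wd with initialized? j h
    ... | yes i = weaken (s≤s (s≤s (s≤s (s≤s (s≤s (s≤s z≤n)))))) (prepared-run i ρj wd)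
    ... | no ¬i with off (waiting wd j 1≤j ≤-refl) ¬i
    ...   | top≡0 , size≡0 = branch-run (tst-≐ (ev-top (ev-! ρj) top≡0) ev-lit)
      (λ _ → branch-run (retest (<ᵇ-true′ (H<X′)) (tst-≺ (ev-! (H-reg p)) (ev-! ρnew)))
        (λ _ → conseq (λ { _ s′ (fr , t , out≡ , alloc≡ , size≡ , r) → fr , Prepared-Touch t (acc t alloc≡ size≡) (subst (Ready s′ j) (sym X≡H) r) wd , out≡ })
          (initialize-run p ρj 1≤j (subst (j ≤_) (sym (tops wd)) (j≤J active)) size≡0 (B₀ wd)))
        (λ ()))
      (λ ())
      where
      X≡H : X ≡ H
      X≡H = inactive-Top 1≤j (≮⇒≥ (¬i ∘ inj₂))
      acc : ∀ {s′} → Touch j s s′ → alloc s′ ≡ alloc s + L * e → sizes s′ block j ≡ L → alloc s′ ≡ a₀ + e * Σ< Jmax (λ k → sizes s′ block (suc k))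
      acc {s′} t alloc≡ size≡ = begin-equality
        alloc s′                                                        ≡⟨ alloc≡ ⟩
        alloc s + L * e                                                 ≡⟨ cong (_+ L * e) (account wd) ⟩
        a₀ + e * Σ< Jmax (λ k → sizes s block (suc k)) + L * e             ≡⟨ lem a₀ e _ L ⟩
        a₀ + e * (Σ< Jmax (λ k → sizes s block (suc k)) + L)               ≡⟨ cong (λ S → a₀ + e * S) (trans (cong (Σ< Jmax (λ k → sizes s block (suc k)) +_) (sym (trans (cong (sizes s′ block) j≡) size≡)))
                                                                             (sym (Σ<-bump j′<Jmax other (trans (cong (sizes s block) j≡) size≡0)))) ⟩
        a₀ + e * Σ< Jmax (λ k → sizes s′ block (suc k))                    ∎
        where
        lem : ∀ a e S L → a + e * S + L * e ≡ a + e * (S + L)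
        lem = solve-∀
        j≡ : suc (pred j) ≡ j
        j≡ = suc-pred j {{>-nonZero 1≤j}}
        j′<Jmax : pred j < Jmax
        j′<Jmax = subst (_≤ Jmax) (sym j≡) (j≤J active)
        other : ∀ k → k ≢ pred j → sizes s′ block (suc k) ≡ sizes s block (suc k)
        other k k≢ = sizesᵗ t (suc k) (λ eq → k≢ (cong pred eq))

    update-run : ∀ {ρ s} → Params ρ → ρ R.j ≡ j → X′ ≡ X + ℓ → Prepared s →
      Runs updateBlock ρ s (31 + 26 * ℓ + 11 * lg³ N + (4 + (productsCost + sumsCost X′)))
        (λ ρ′ s′ → Frame blockRegs ρ ρ′ × Touch j s s′ × alloc s′ ≡ alloc s × (∀ k → sizes s′ block k ≡ sizes s block k) × Ready s′ j X′
          × (j ≡ 1 → out s ≡ results X → out s′ ≡ results X′) × (j ≢ 1 → out s′ ≡ out s))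
    update-run {ρ} {s} p ρj X′≡ pr =
      shift-run p ρj 1≤j (subst (j ≤_) (sym (topsOK pr)) (j≤J active)) (H≤Top 1≤j h) (≤-trans (≤-reflexive (sym X′≡)) X′≤N) (atH pr)
      then λ { {ρ₁} {s₁} (fr₁ , t₁ , out₁ , alloc₁ , size₁ , top₁ , A , ar₁ , old , fresh) →
      let ρ₁j   = trans (kept fr₁ R.j refl) ρj
          top₁′ = trans top₁ (cong just (sym X′≡))
          p₁    = params-frame fr₁ refl refl refl refl p
          B₁    = Arr-Touch (λ { refl → contradiction 1≤j λ () }) t₁ (zero-ok pr)
      in
      assign⨟ (ev-top (ev-! ρ₁j) top₁′) (≤-<-trans X′≤N N<2^w)
      (Products.products-run {upd R.Hⱼ X′ ρ₁} {s₁} (params-frame (frame-upd {R.Hⱼ ∷ []} R.Hⱼ refl frame-refl) refl refl refl refl p₁) ρ₁j refl top₁′ B₁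
        -- The block B_(aj) has an index above j, so the descending pass has already moved it to h +
        -- ℓ.
        (λ a b 2≤a H<q ab≤ X′< → let act = multiple-active 1≤j 2≤a active H<q ab≤ (lt {a * b} X′<) in
          Top (a * j) (h + ℓ) , Ready-Touch (aj≢j 2≤a) t₁ (on (higher pr (a * j) (subst (j <_) (*-comm j a) (m<m*n j a {{>-nonZero 1≤j}} 2≤a)) (j≤J act)) (inj₂ act)) ,
          L≤Top (*-mono-≤ (<⇒≤ 2≤a) 1≤j) (h + ℓ) , multiple-≤ 1≤j 2≤a active H<q ab≤ (lt {a * b} X′<) , multiple-> 1≤j 2≤a active H<q ab≤ (lt {a * b} X′<))
        (subst (λ Y → Arr s₁ j (Y ∸ L) L A) (sym X′≡) ar₁) (bounded A old fresh)
      then λ { {ρ₂} {s₂} (A₂ , (fr₂ , o₂ , out₂ , ar₂ , b₂) , treated₂) →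
      conseq (λ { _ s₃ (fr₃ , o₃ , (rep₁ , rep₂) , ar₃) →
          frame-trans (frame-trans (frame-upd R.Hⱼ refl (frame-trans frame-refl refl fr₁)) refl fr₂) refl fr₃ ,
          Touch-trans t₁ (Touch-trans (Only⇒Touch o₂) (Only⇒Touch o₃)) ,
          trans (alloc≡ o₃) (trans (alloc≡ o₂) alloc₁) ,
          (λ k → trans (sizes≡ o₃ block k) (trans (sizes≡ o₂ block k) (sizes₁ {s₁} t₁ size₁ k))) ,
          ready (trans (tops≡ o₃ j) (trans (tops≡ o₂ j) top₁′)) ar₃ ,
          (λ j≡1 start → rep₁ j≡1 (trans out₂ (trans out₁ (trans start (cong results (sym X′∸ℓ)))))) ,
          (λ j≢1 → trans (rep₂ j≢1) (trans out₂ out₁)) })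
        (Sums.sums-run {ρ₂} {s₂} (params-frame fr₂ refl refl refl refl (params-frame (frame-upd {R.Hⱼ ∷ []} R.Hⱼ refl frame-refl) refl refl refl refl p₁))
          (trans (kept fr₂ R.j refl) ρ₁j) (kept fr₂ R.Hⱼ refl) (trans (tops≡ o₂ j) top₁′) (Arr-Only (λ { refl → contradiction 1≤j λ () }) o₂ B₁)
          ar₂ (λ n B<n n≤ → sound b₂ n (proj₁ (bounded A old fresh n B<n n≤)) , ≤-trans (lower≤ b₂ n) (proj₂ (bounded A old fresh n B<n n≤)))
          (λ n B<n n≤ → Better-exact b₂ (old n (≤-trans n≤ (≤-reflexive X′∸ℓ)))) treated₂) }) }
      where
      open Update j X′ 1≤j (H≤Top 1≤j (h + ℓ)) X′≤N
      X′∸ℓ : X′ ∸ ℓ ≡ X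
      X′∸ℓ = trans (cong (_∸ ℓ) X′≡) (m+n∸n≡m X ℓ)
      lt : ∀ {n} → X′ ∸ ℓ < n → X′ < n + ℓ
      lt {n} X′∸ℓ<n = subst (_< n + ℓ) (trans (cong (_+ ℓ) X′∸ℓ) (sym X′≡)) (+-monoˡ-< ℓ X′∸ℓ<n)
      aj≢j : ∀ {a} → 2 ≤ a → a * j ≢ j
      aj≢j {a} 2≤a eq = <⇒≢ (m<m*n j a {{>-nonZero 1≤j}} 2≤a) (trans (sym eq) (*-comm a j))
      bounded : ∀ A (old : ∀ n → n ≤ X → A n ≡ comp n) (fresh : ∀ n → X < n → A n ≡ Bd) → Bounded A
      bounded A old fresh n B<n n≤X′ with n ≤? X
      ... | yes n≤X = ≤-reflexive (sym (old n n≤X)) , ≤-trans (≤-reflexive (old n n≤X)) (comp≤Bd (≤-trans (s≤s z≤n) B<n) (≤-trans n≤X′ X′≤N))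
      ... | no n≰X  = ≤-trans (comp≤Bd (≤-trans (s≤s z≤n) B<n) (≤-trans n≤X′ X′≤N)) (≤-reflexive (sym (fresh n (≰⇒> n≰X)))) , ≤-reflexive (fresh n (≰⇒> n≰X))
      sizes₁ : ∀ {s₁} → Touch j s s₁ → sizes s₁ block j ≡ sizes s block j → ∀ k → sizes s₁ block k ≡ sizes s block k
      sizes₁ t eq k with k ≟ j
      ... | yes refl = eq
      ... | no k≢j   = sizesᵗ t k k≢j

    X≡h : j ≡ 1 → X ≡ h
    X≡h refl = trans (cong (Top 1) h≡) (trans (Top-1 hh≤x) (sym h≡))

    X′≡h′ : j ≡ 1 → X′ ≡ h + ℓ
    X′≡h′ refl = trans (cong (Top 1) h′≡) (trans (Top-1 (m≤n⇒m≤1+n hh≤x)) (sym h′≡))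
      where
      h′≡ : h + ℓ ≡ ℓ * suc x
      h′≡ = trans (cong (_+ ℓ) h≡) (trans (+-comm (ℓ * x) ℓ) (sym (*-suc ℓ x)))

    1≤X : 1 ≤ X
    1≤X = ≤-trans 1≤H (H≤Top 1≤j h)

    -- If the quota is unchanged, the block already exists, because newH > H, and no update takes
    -- place. This cannot happen for j = 1, where H_1 = h grows in every pass.
    blockBody-run : ∀ {ρ s j₀} → j ≡ suc j₀ → Params ρ → ρ R.j ≡ j → ρ R.h ≡ h + ℓ → World a₀ h j s →
      Runs blockBody ρ s (32 + (Potential j (h + ℓ) ∸ Potential j h)) (λ ρ′ s′ → Frame blockRegs ρ ρ′ × Finished j₀ s s′)
    blockBody-run {ρ} {s} {j₀} j≡ p ρj ρh wd with quota j (h + ℓ) ≟ quota j h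
    ... | yes same = weaken (≤-trans (from-yes (31 ≤? 32)) (m≤m+n 32 _))
      (assign⨟ (newH≡ p ρh ρj) X′<
      (prepared-run init ρj wd
      then λ { {ρ₁} {s₁} (fr₁ , pr , out₁) →
      conseq (λ { _ _ (refl , refl) → frame-trans (frame-upd R.newH refl frame-refl) refl fr₁ ,
          finish j≡ pr Touch-refl refl (λ _ → refl) (subst (Ready s₁ j) (sym X′≡X) (atH pr)) ,
          (λ j≡1 _ → contradiction (trans (sym (X′≡h′ j≡1)) (trans X′≡X (X≡h j≡1))) (>⇒≢ (m<m+n h 1≤ℓ))) , λ _ → out₁ })
      (branch-run {c = 6} (retest (≤ᵇ-true′ 1≤X) (tst-≼ ev-lit (ev-top (ev-! (trans (kept fr₁ R.j refl) ρj)) (topEntry (atH pr)))))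
        (λ _ → branch-run {c = 1} (retest (<ᵇ-false′ (≤-reflexive X′≡X)) (tst-≺ (ev-top (ev-! (trans (kept fr₁ R.j refl) ρj)) (topEntry (atH pr))) (ev-! (kept fr₁ R.newH refl))))
          (λ ()) (λ _ → skip-run {Ψ = λ ρ′ s′ → ρ′ ≡ ρ₁ × s′ ≡ s₁} (refl , refl) ≤-refl))
        (λ ())) }))
      where
      X′≡X : X′ ≡ X
      X′≡X = cong (ℓ *_) same
      X′< : X′ < 2 ^ w
      X′< = ≤-<-trans X′≤N N<2^w
      init : Initialized j h
      init with initialized? j h
      ... | yes i = i
      ... | no ¬i = contradiction (trans X′≡X (inactive-Top 1≤j (≮⇒≥ (¬i ∘ inj₂)))) (>⇒≢ H<X′)
    ... | no differs = weaken (≤-reflexive cost≡)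
      (assign⨟ (newH≡ p ρh ρj) (≤-<-trans X′≤N N<2^w)
      (prepare-run (params-frame (frame-upd {R.newH ∷ []} R.newH refl frame-refl) refl refl refl refl p) ρj refl wd
      then λ { {ρ₁} {s₁} (fr₁ , pr , out₁) →
      branch-run (retest (≤ᵇ-true′ 1≤X) (tst-≼ ev-lit (ev-top (ev-! (trans (kept fr₁ R.j refl) ρj)) (topEntry (atH pr)))))
        (λ _ → branch-run (retest (<ᵇ-true′ X<X′) (tst-≺ (ev-top (ev-! (trans (kept fr₁ R.j refl) ρj)) (topEntry (atH pr))) (ev-! (kept fr₁ R.newH refl))))
          (λ _ → conseq (λ { _ s₂ (fr₂ , t₂ , alloc₂ , sizes₂ , r₂ , rep₁ , rep₂) →
              frame-trans (frame-trans (frame-upd R.newH refl frame-refl) refl fr₁) refl fr₂ ,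
              finish j≡ pr t₂ alloc₂ sizes₂ r₂ ,
              (λ j≡1 start → trans (rep₁ j≡1 (trans out₁ (trans start (cong results (sym (X≡h j≡1)))))) (cong results (X′≡h′ j≡1))) ,
              λ j≢1 → trans (rep₂ j≢1) out₁ })
            (update-run (params-frame fr₁ refl refl refl refl (params-frame (frame-upd {R.newH ∷ []} R.newH refl frame-refl) refl refl refl refl p))
              (trans (kept fr₁ R.j refl) ρj) X′≡ pr))
          (λ ()))
        (λ ()) }))
      where
      quota≡ : quota j (h + ℓ) ≡ suc (quota j h)
      quota≡ = ≤-antisym (quota-step 1≤j h) (≤∧≢⇒< (quota-mono 1≤j (m≤m+n h ℓ)) (differs ∘ sym))
      X′≡ : X′ ≡ X + ℓ
      X′≡ = trans (cong (ℓ *_) quota≡) (trans (*-suc ℓ (quota j h)) (+-comm ℓ X))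
      X<X′ : X < X′
      X<X′ = subst (X <_) (sym X′≡) (m<m+n X 1≤ℓ)
      cost≡ : 14 + (5 + (3 + (12 + 17 * L)) + (5 + (5 + (31 + 26 * ℓ + 11 * lg³ N + (4 + (productsCost + sumsCost X′)))))) ≡ 32 + (Potential j (h + ℓ) ∸ Potential j h)
      cost≡ = trans (lem (17 * L) (31 + 26 * ℓ + 11 * lg³ N) (productsCost + sumsCost X′)) (cong (32 +_) (potential-step j h (h + ℓ) quota≡))
        where
        lem : ∀ a b c → 14 + (5 + (3 + (12 + a)) + (5 + (5 + (b + (4 + c))))) ≡ 32 + (12 + a + b + 4 + c)
        lem = solve-∀

  -- The main loop

  record Level (a₀ h : ℕ) (s : Memory) : Set where
    field
      level-B₀ : Arr s 0 0 H comp
      blocks   : ∀ k → 1 ≤ k → k ≤ Jmax → Status s k h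
      level-tops    : sizes s top 0 ≡ Jmax
      level-account : alloc s ≡ a₀ + e * Σ< Jmax (λ k → sizes s block (suc k))

  open Level

  mainRegs : List Register
  mainRegs = R.h ∷ R.j ∷ blockRegs

  -- Summed over all indices up to `Jmax`, also those that the pass does not reach, so that the
  -- potentials telescope over a fixed range.
  iterationCost : ℕ → ℕ
  iterationCost h = 24 + Σ< Jmax (λ i → 39 + (Potential (suc i) (h + ℓ) ∸ Potential (suc i) h))

  iteration : Program
  iteration =
    R.h ≔ topOf (lit 1) ⊕ ! R.ℓ ⨟
    when (! R.N ≺ ! R.h) (R.h ≔ ! R.N) ⨟
    forDown R.j (ceilDiv (! R.h) (! R.H) ⊖ lit 1) (lit 1) blockBody

  1≤Jmax : 1 ≤ Jmax
  1≤Jmax = ≰⇒> λ J≤0 → <⇒≱ 1≤N (≤-trans (cdiv-* N 1≤H) (≤-trans (*-monoˡ-≤ H J≤0) z≤n))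

  top₁ : ∀ {a₀ x s} → hh ≤ x → Level a₀ (ℓ * x) s → cells s top 0 1 ≡ just (ℓ * x)
  top₁ hh≤x lv = trans (topEntry (on (blocks lv 1 ≤-refl 1≤Jmax) (inj₁ refl))) (cong just (Top-1 hh≤x))

  iteration-run : ∀ {ρ s a₀ x} → Params ρ → hh ≤ x → x < nn → Level a₀ (ℓ * x) s → out s ≡ results (ℓ * x) →
    Runs iteration ρ s (iterationCost (ℓ * x)) (λ ρ′ s′ → Frame mainRegs ρ ρ′ × Level a₀ (ℓ * suc x) s′ × out s′ ≡ results (ℓ * suc x))
  iteration-run {ρ} {s} {a₀} {x} p hh≤x x<nn lv out≡ = weaken cost≤
    (assign⨟ (ev-⊕ (ev-top ev-lit (top₁ hh≤x lv)) (ev-! (ℓ-reg p))) (≤-<-trans h′≤N N<2^w)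
    (branch-run {c = 2} {Ψ = λ ρ′ s′ → ρ′ ≡ upd R.h h′ ρ × s′ ≡ s} (retest (<ᵇ-false′ h′≤N) (tst-≺ (ev-! (N-reg p)) (ev-! refl)))
      (λ ()) (λ _ → skip-run (refl , refl) (s≤s z≤n))
    then λ { (refl , refl) →
    assign⨟ (subst (λ q → (upd R.h h′ ρ , s) ⊢ ceilDiv (! R.h) (! R.H) ⊖ lit 1 ⇒ q ∸ 1) (quot≡ (h′ + H ∸ 1) H)
        (ev-⊖ (ev-⊘ (ev-⊖ (ev-⊕ (ev-! refl) (ev-! (H-reg p))) ev-lit) (ev-! (H-reg p))) ev-lit)) n<
    (conseq (λ { _ s′ (_ , _ , fr , _ , wd , _ , out′) → fr , record
        { level-B₀ = B₀ wd ; blocks = λ k 1≤k k≤J → subst (Status s′ k) h′≡ (treated wd k 1≤k k≤J) ; level-tops = tops wd ; level-account = account wd } ,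
        trans (out′ refl) (cong results h′≡) })
      (loop-down (λ i → 32 + (Potential (suc i) h′ ∸ Potential (suc i) h)) I proj₁ body n
        (refl , refl , frame-upd R.j refl (frame-upd R.h refl frame-refl) , ≤-refl , begun , (λ _ → out≡) , λ n≡0 → contradiction 1≤n (<⇒≱ (s≤s (≤-reflexive n≡0)))))) }))
    where
    instance
      H≢0 : NonZero H
      H≢0 = >-nonZero 1≤H
    h h′ n : ℕ
    h  = ℓ * x
    h′ = h + ℓ
    n  = cdiv h′ H ∸ 1
    h′≡ : h′ ≡ ℓ * suc x
    h′≡ = trans (+-comm (ℓ * x) ℓ) (sym (*-suc ℓ x))
    h′≤N : h′ ≤ N
    h′≤N = ≤-trans (≤-reflexive h′≡) (≤-trans (*-monoʳ-≤ ℓ x<nn) (≤-reflexive (sym N≡)))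
    H<h′ : H < h′
    H<h′ = ≤-<-trans (≤-trans (≤-reflexive H≡) (*-monoʳ-≤ ℓ hh≤x)) (m<m+n h 1≤ℓ)
    2≤c : 2 ≤ cdiv h′ H
    2≤c = ≰⇒> λ c≤1 → <⇒≱ H<h′ (≤-trans (cdiv-* h′ 1≤H) (≤-trans (*-monoˡ-≤ H c≤1) (≤-reflexive (*-identityˡ H))))
    1≤n : 1 ≤ n
    1≤n = ∸-monoˡ-≤ 1 2≤c
    n≡ : suc n ≡ cdiv h′ H
    n≡ = m+[n∸m]≡n (<⇒≤ 2≤c)
    active : ∀ {j} → j ≤ n → j * H < h′
    active {j} j≤n = ≰⇒> λ h′≤ → <⇒≱ (≤-trans (s≤s j≤n) (≤-reflexive n≡)) (cdiv-≤ 1≤H h′≤)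
    idle : ∀ {j} → n < j → h′ ≤ j * H
    idle n<j = ≤-trans (cdiv-* h′ 1≤H) (*-monoˡ-≤ H (≤-trans (≤-reflexive (sym n≡)) n<j))
    n≤J : n ≤ Jmax
    n≤J = ≤-trans (m∸n≤m (cdiv h′ H) 1) (cdiv-mono 1≤H h′≤N)
    n< : n < 2 ^ w
    n< = ≤-<-trans (≤-trans (m≤m*n n H) (≤-trans (<⇒≤ (active ≤-refl)) h′≤N)) N<2^w
    begun : World a₀ h n s
    begun = record
      { B₀ = level-B₀ lv
      -- Blocks beyond the range of the pass satisfy kH ≥ h + ℓ; they are not due yet, so the status
      -- for h is also the one for h + ℓ.
      ; treated = λ k n<k k≤J → let st = blocks lv k (≤-trans (s≤s z≤n) n<k) k≤J
                                    ¬i : ¬ Initialized k h′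
                                    ¬i = λ { (inj₁ refl) → <⇒≱ n<k 1≤n ; (inj₂ kH<h′) → <⇒≱ kH<h′ (idle n<k) }
          in status (λ i → contradiction i ¬i)
            (λ _ → off st λ { (inj₁ k≡1) → ¬i (inj₁ k≡1) ; (inj₂ kH<h) → ¬i (inj₂ (<-≤-trans kH<h (m≤m+n h ℓ))) })
      ; waiting = λ k 1≤k k≤n → blocks lv k 1≤k (≤-trans k≤n n≤J)
      ; tops = level-tops lv
      ; account = level-account lv }
    I : ℕ → Env → Memory → Set
    I j ρ′ s′ = ρ′ R.j ≡ j × ρ′ R.h ≡ h′ × Frame mainRegs ρ ρ′ × j ≤ n × World a₀ h j s′ × (1 ≤ j → out s′ ≡ results h) × (j ≡ 0 → out s′ ≡ results h′)
    body : ∀ {i ρ′ s′} → I (suc i) ρ′ s′ → Runs blockBody ρ′ s′ (32 + (Potential (suc i) h′ ∸ Potential (suc i) h))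
      (λ ρ″ s″ → ρ″ R.j ≡ suc i × i < 2 ^ w × I i (upd R.j i ρ″) s″)
    body {i} {ρ′} {s′} (ρj , ρh , fr , i<n , wd , out₁ , _) =
      conseq (λ { _ _ (fr′ , wd′ , rep₁ , rep₂) → trans (kept fr′ R.j refl) ρj , <-trans i<n n< , refl , trans (kept fr′ R.h refl) ρh ,
          frame-upd R.j refl (frame-trans fr refl fr′) , <⇒≤ i<n , wd′ ,
          (λ 1≤i → trans (rep₂ (λ 1+i≡1 → contradiction 1≤i (<⇒≱ (≤-reflexive 1+i≡1)))) (out₁ (s≤s z≤n))) ,
          (λ i≡0 → rep₁ (cong suc i≡0) (out₁ (s≤s z≤n))) })
        (BlockStep.blockBody-run a₀ h x (suc i) refl hh≤x h′≤N (s≤s z≤n) (active i<n) refl (params-frame fr refl refl refl refl p) ρj ρh wd)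
    cost≤ : 6 + (5 + (10 + (Σ< n (λ i → 7 + (32 + (Potential (suc i) h′ ∸ Potential (suc i) h))) + 3))) ≤ iterationCost h
    cost≤ = ≤-trans (≤-reflexive (lem _)) (+-monoʳ-≤ 24 (Σ<-monoˡ (λ i → 39 + (Potential (suc i) h′ ∸ Potential (suc i) h)) n≤J))
      where
      lem : ∀ S → 6 + (5 + (10 + (S + 3))) ≡ 24 + S
      lem = solve-∀

  potentialSum : ℕ → ℕ
  potentialSum h = Σ< Jmax (λ i → Potential (suc i) h)

  mainCost : ℕ
  mainCost = nn * (29 + Jmax * 39) + potentialSum N + 5

  Potential-mono : ∀ i {h h′} → h ≤ h′ → Potential (suc i) h ≤ Potential (suc i) h′
  Potential-mono i h≤ = +-mono-≤ (*-monoʳ-≤ fixedCost q≤) (*-monoʳ-≤ 26 (Σ<-monoˡ κ (s≤s (*-monoʳ-≤ ℓ q≤))))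
    where
    q≤ = quota-mono {suc i} (s≤s z≤n) h≤

  -- Summation from the last pass backwards: the differences of potential telescope, and besides the
  -- constant costs only the potentials at N remain.
  iterations-cost : ∀ k → k ≤ nn → Σ< k (λ i → 5 + iterationCost (ℓ * (nn ∸ suc i))) + potentialSum (ℓ * (nn ∸ k)) ≡ k * (29 + Jmax * 39) + potentialSum N
  iterations-cost zero    _    = cong potentialSum (sym N≡)
  iterations-cost (suc k) k<nn = begin-equality
    S + (5 + iterationCost h) + potentialSum h
      ≡⟨ cong (λ x → S + (5 + (24 + x)) + potentialSum h) (trans (Σ<-+ Jmax (λ _ → 39) Δ) (cong (_+ Σ< Jmax Δ) (Σ<-const Jmax 39))) ⟩
    S + (5 + (24 + (Jmax * 39 + Σ< Jmax Δ))) + potentialSum h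
      ≡⟨ lem S (Jmax * 39) (Σ< Jmax Δ) (potentialSum h) ⟩
    29 + Jmax * 39 + (S + (Σ< Jmax Δ + potentialSum h))
      ≡⟨ cong (λ x → 29 + Jmax * 39 + (S + x)) (trans (sym (Σ<-+ Jmax Δ (λ i → Potential (suc i) h)))
           (Σ<-cong Jmax (λ i → trans (m∸n+n≡m (Potential-mono i (m≤m+n h ℓ))) (cong (Potential (suc i)) h+ℓ≡)))) ⟩
    29 + Jmax * 39 + (S + potentialSum (ℓ * (nn ∸ k)))
      ≡⟨ cong (29 + Jmax * 39 +_) (iterations-cost k (<⇒≤ k<nn)) ⟩
    29 + Jmax * 39 + (k * (29 + Jmax * 39) + potentialSum N)
      ≡⟨ +-assoc (29 + Jmax * 39) (k * (29 + Jmax * 39)) (potentialSum N) ⟨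
    suc k * (29 + Jmax * 39) + potentialSum N ∎
    where
    h S : ℕ
    h = ℓ * (nn ∸ suc k)
    S = Σ< k (λ i → 5 + iterationCost (ℓ * (nn ∸ suc i)))
    Δ : ℕ → ℕ
    Δ i = Potential (suc i) (h + ℓ) ∸ Potential (suc i) h
    h+ℓ≡ : h + ℓ ≡ ℓ * (nn ∸ k)
    h+ℓ≡ = trans (+-comm h ℓ) (trans (sym (*-suc ℓ (nn ∸ suc k))) (cong (ℓ *_) (sym (+-∸-assoc 1 k<nn))))
    lem : ∀ S a b p → S + (5 + (24 + (a + b))) + p ≡ 29 + a + (S + (b + p))
    lem = solve-∀

  mainLoop-run : ∀ {ρ s a₀} → Params ρ → hh ≤ nn → Level a₀ H s → out s ≡ results H →
    Runs mainLoop ρ s mainCost (λ ρ′ s′ → Level a₀ N s′ × out s′ ≡ results N)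
  mainLoop-run {ρ} {s} {a₀} p hh≤nn lv out≡ = weaken cost≤
    (while-run {Ψ = λ ρ′ s′ → Level a₀ N s′ × out s′ ≡ results N} (λ k → iterationCost (ℓ * (nn ∸ suc k))) I step (nn ∸ hh)
      (hh , ≤-refl , m+[n∸m]≡n hh≤nn , frame-refl , subst (λ h → Level a₀ h s) H≡ lv , trans out≡ (cong results H≡)))
    where
    I : ℕ → Env → Memory → Set
    I k ρ′ s′ = ∃ λ x → hh ≤ x × x + k ≡ nn × Frame mainRegs ρ ρ′ × Level a₀ (ℓ * x) s′ × out s′ ≡ results (ℓ * x)
    step : ∀ k ρ′ s′ → I k ρ′ s′ → (Tests ρ′ s′ (topOf (lit 1) ≺ ! R.N) false × (Level a₀ N s′ × out s′ ≡ results N)) ⊎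
      (Tests ρ′ s′ (topOf (lit 1) ≺ ! R.N) true × ∃ λ k′ → k ≡ suc k′ × Runs iteration ρ′ s′ (iterationCost (ℓ * (nn ∸ suc k′))) (I k′))
    step zero ρ′ s′ (x , hh≤x , x≡ , fr , lv , out≡) = inj₁ (retest (<ᵇ-false′ (≤-reflexive (sym h≡N))) (tst-≺ (ev-top ev-lit (top₁ hh≤x lv))
        (ev-! (trans (kept fr R.N refl) (N-reg p)))) , subst (λ h → Level a₀ h s′) h≡N lv , trans out≡ (cong results h≡N))
      where
      h≡N : ℓ * x ≡ N
      h≡N = trans (cong (ℓ *_) (trans (sym (+-identityʳ x)) x≡)) (sym N≡)
    step (suc k) ρ′ s′ (x , hh≤x , x≡ , fr , lv , out≡) = inj₂ (retest (<ᵇ-true′ h<N) (tst-≺ (ev-top ev-lit (top₁ hh≤x lv))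
        (ev-! (trans (kept fr R.N refl) (N-reg p)))) , k , refl ,
        subst (λ y → Runs iteration ρ′ s′ (iterationCost (ℓ * y)) (I k)) x≡′
          (conseq (λ { _ _ (fr′ , lv′ , out′) → suc x , m≤n⇒m≤1+n hh≤x , trans (sym (+-suc x k)) x≡ , frame-trans fr refl fr′ , lv′ , out′ })
            (iteration-run (params-frame fr refl refl refl refl p) hh≤x x<nn lv out≡)))
      where
      x<nn : x < nn
      x<nn = ≤-trans (m≤m+n (suc x) k) (≤-reflexive (trans (sym (+-suc x k)) x≡))
      h<N : ℓ * x < N
      h<N = subst (ℓ * x <_) (sym N≡) (*-monoʳ-< ℓ {{>-nonZero 1≤ℓ}} x<nn)
      x≡′ : x ≡ nn ∸ suc k
      x≡′ = trans (sym (m+n∸n≡m x (suc k))) (cong (_∸ suc k) x≡)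
    cost≤ : Σ< (nn ∸ hh) (λ k → 5 + iterationCost (ℓ * (nn ∸ suc k))) + 5 ≤ mainCost
    cost≤ = +-monoˡ-≤ 5 (≤-trans (m≤m+n _ (potentialSum (ℓ * (nn ∸ (nn ∸ hh))))) (≤-trans (≤-reflexive (iterations-cost (nn ∸ hh) (m∸n≤m nn hh)))
      (+-monoˡ-≤ (potentialSum N) (*-monoˡ-≤ (29 + Jmax * 39) (m∸n≤m nn hh)))))

  -- The complete run

  H³≤N³ : H * H * H ≤ N * N * N
  H³≤N³ = *-mono-≤ (*-mono-≤ H≤N H≤N) H≤N

  lgH≤lgN : suc (lg³ H) ≤ suc (lg³ N)
  lgH≤lgN = s≤s (⌊log₂⌋-mono-≤ H³≤N³)

  module B₀ = TimeImproved w e H 2≤H (λ v≤ → fits (≤-trans v≤ H³≤N³)) (≤-<-trans lgH≤lgN bound<) (≤-<-trans (+-mono-≤ lgH≤lgN lgH≤lgN) 2bound<)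

  totalCost : ℕ
  totalCost = 46 + B₀.timeImprovedCost + Jmax * 17 + 17 * L + mainCost

  emptyMemory : Memory
  emptyMemory = memory (λ _ _ _ → nothing) (λ _ _ → 0) 0 []

  spaceImproved-run : e ≤ w → hh ≤ nn →
    Runs (spaceImproved N H ℓ) (λ _ → 0) emptyMemory totalCost
      (λ _ s → out s ≡ results N × alloc s ≤ H * e + Jmax * w + e * (Jmax * L))
  spaceImproved-run e≤w hh≤nn = weaken (≤-reflexive cost≡)
    (assign⨟ ev-lit N<2^w
    (assign⨟ ev-lit H<2^w
    (assign⨟ ev-lit (≤-<-trans ℓ≤H H<2^w)
    (assign⨟ (ev-⊗ ev-lit (ev-! refl)) (≤-<-trans L≤H H<2^w)
    (assign⨟ (ev-! refl) H<2^w
    (B₀.timeImproved-run refl refl refl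
    then λ { {ρ₁} {s₁} (fr₁ , o₁ , out₁ , B₁) →
    let p₁ : Params ρ₁
        p₁ = record { N-reg = kept fr₁ R.N refl ; H-reg = kept fr₁ R.H refl ; ℓ-reg = kept fr₁ R.ℓ refl ; L-reg = kept fr₁ R.L refl }
    in
    allocate-run {Ψ = λ ρ′ s′ → ρ′ ≡ ρ₁ × s′ ≡ new m top 0 Jmax s₁} ev-lit (ev-J p₁) (sizes≡ o₁ top 0) (refl , refl)
    then λ { (refl , refl) →
    forUp-run {hi = Jmax} (λ _ → 4) (Zeroed ρ₁ s₁) ev-lit (≤-<-trans (≤-trans (s≤s z≤n) 2≤H) H<2^w) J<
      (λ (ρi , fr , _) → ρi , ev-J (params-frame fr refl refl refl refl p₁))
      (λ {i} {ρ′} {s′} 1≤i i≤J (ρi , fr , zeros , blocks′ , sizes′ , alloc′ , out′) →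
        write ev-lit (ev-! ρi) ev-lit 1≤i (≤-trans i≤J (≤-reflexive (sym (sizes′ top 0)))) (≤-<-trans z≤n N<2^w)
          (ρi , refl , frame-upd R.i refl fr , (λ k 1≤k k<1+i → zero-entry {s′} 1≤k (m<1+n⇒m<n∨m≡n k<1+i) zeros) ,
            blocks′ , sizes′ , alloc′ , out′))
      (refl , frame-upd R.i refl frame-refl , (λ k 1≤k k<1 → contradiction 1≤k (<⇒≱ k<1)) , (λ _ _ → refl) , (λ _ _ → refl) , refl , refl)
    then λ { {ρ₂} {s₂} (n , J<n , _ , _ , fr₂ , zeros , blocks₂ , sizes₂ , alloc₂ , out₂) →
    let p₂ : Params ρ₂
        p₂ = params-frame fr₂ refl refl refl refl p₁
        size-top : sizes s₂ top 0 ≡ Jmax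
        size-top = sizes₂ top 0
        size-block : ∀ k → sizes s₂ block (suc k) ≡ 0
        size-block k = trans (sizes₂ block (suc k)) (sizes≡ o₁ block (suc k))
        B₂ : Arr s₂ 0 0 H comp
        B₂ = arr (trans (sizes₂ block 0) (length≡ B₁)) (λ i lo hi → trans (blocks₂ 0 i) (get B₁ i lo hi))
    in
    assign⨟ ev-lit (≤-<-trans (≤-trans (s≤s z≤n) 2≤H) H<2^w)
    (initialize-run (params-frame (frame-upd {R.j ∷ []} R.j refl frame-refl) refl refl refl refl p₂) refl ≤-refl
      (subst (1 ≤_) (sym size-top) 1≤Jmax) (size-block 0) B₂
    then λ { {ρ₃} {s₃} (fr₃ , t₃ , out₃ , alloc₃ , size₃ , r₃) →
    conseq (λ { _ s₄ (lv , out₄) → out₄ , final-alloc lv })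
      (mainLoop-run {a₀ = H * e + Jmax * w} (params-frame fr₃ refl refl refl refl (params-frame (frame-upd {R.j ∷ []} R.j refl frame-refl) refl refl refl refl p₂)) hh≤nn
        (record
          { level-B₀ = Arr-Touch (λ ()) t₃ B₂
          ; blocks = λ where
              (suc zero)    _ _    → status (λ _ → subst (Ready s₃ 1) (sym (trans (cong (Top 1) H≡) (trans (Top-1 ≤-refl) (sym H≡)))) r₃) (λ ¬i → contradiction (inj₁ refl) ¬i)
              (suc (suc k)) _ k≤J → status
                (λ { (inj₁ ()) ; (inj₂ kH<H) → contradiction kH<H (≤⇒≯ (m≤m+n H (suc k * H))) })
                (λ _ → trans (topsᵗ t₃ (2+ k) (λ ())) (zeros (2+ k) (s≤s z≤n) (≤-<-trans k≤J J<n)) , trans (sizesᵗ t₃ (2+ k) (λ ())) (size-block (suc k)))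
          ; level-tops = trans (topSize t₃) size-top
          ; level-account = account₃ {s₂} {s₃} (trans alloc₂ (cong (_+ Jmax * w) (alloc≡ o₁))) alloc₃ size-block size₃ t₃ })
        (trans out₃ (trans out₂ out₁))) }) } } })))))
    )
    where
    H<2^w : H < 2 ^ w
    H<2^w = ≤-<-trans H≤N N<2^w
    J≤N : Jmax ≤ N
    J≤N = cdiv-≤ 1≤H (≤-trans (≤-reflexive (sym (*-identityʳ N))) (*-monoʳ-≤ N 1≤H))
    J< : suc Jmax < 2 ^ w
    J< = ≤-<-trans (s≤s J≤N) 1+N<2^w
    ev-J : ∀ {ρ s} → Params ρ → (ρ , s) ⊢ ceilDiv (! R.N) (! R.H) ⇒ Jmax
    ev-J {ρ} {s} p = subst (λ q → (ρ , s) ⊢ ceilDiv (! R.N) (! R.H) ⇒ q) (quot≡ (N + H ∸ 1) H)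
      (ev-⊘ (ev-⊖ (ev-⊕ (ev-! (N-reg p)) (ev-! (H-reg p))) ev-lit) (ev-! (H-reg p)))
      where
      instance
        H≢0 : NonZero H
        H≢0 = >-nonZero 1≤H
    Zeroed : Env → Memory → ℕ → Env → Memory → Set
    Zeroed ρ₁ s₁ n ρ s = ρ R.i ≡ n × Frame (R.i ∷ []) ρ₁ ρ × (∀ k → 1 ≤ k → k < n → cells s top 0 k ≡ just 0)
      × (∀ k i → cells s block k i ≡ cells s₁ block k i) × (∀ f k → sizes s f k ≡ sizes (new m top 0 Jmax s₁) f k)
      × alloc s ≡ alloc s₁ + Jmax * w × out s ≡ out s₁
    zero-entry : ∀ {s i k} → 1 ≤ k → k < i ⊎ k ≡ i → (∀ k → 1 ≤ k → k < i → cells s top 0 k ≡ just 0) → cells (put top 0 i 0 s) top 0 k ≡ just 0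
    zero-entry {s} {i} 1≤k (inj₁ k<i)  zeros = trans (topsᵗ (put-top i 0 s) _ (<⇒≢ k<i)) (zeros _ 1≤k k<i)
    zero-entry {s} {i} 1≤k (inj₂ refl) zeros = put-top-same i 0 s
    account₃ : ∀ {s₂ s₃} → alloc s₂ ≡ H * e + Jmax * w → alloc s₃ ≡ alloc s₂ + L * e → (∀ k → sizes s₂ block (suc k) ≡ 0) → sizes s₃ block 1 ≡ L →
      Touch 1 s₂ s₃ → alloc s₃ ≡ H * e + Jmax * w + e * Σ< Jmax (λ k → sizes s₃ block (suc k))
    account₃ {s₂} {s₃} eq₂ eq₃ zero₂ size₃ t₃ = trans eq₃ (cong₂ _+_ eq₂ (trans (*-comm L e) (cong (e *_) (sym total))))
      where
      total : Σ< Jmax (λ k → sizes s₃ block (suc k)) ≡ L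
      total = trans (Σ<-bump {Jmax} {0} {λ k → sizes s₂ block (suc k)} 1≤Jmax (λ k k≢0 → sizesᵗ t₃ (suc k) (k≢0 ∘ suc-injective)) (zero₂ 0))
        (trans (cong (_+ sizes s₃ block 1) (trans (Σ<-cong Jmax zero₂) (trans (Σ<-const Jmax 0) (*-zeroʳ Jmax)))) size₃)
    final-alloc : ∀ {s} → Level (H * e + Jmax * w) N s → alloc s ≤ H * e + Jmax * w + e * (Jmax * L)
    final-alloc {s} lv = ≤-trans (≤-reflexive (level-account lv)) (+-monoʳ-≤ (H * e + Jmax * w) (*-monoʳ-≤ e
      (≤-trans (Σ<-mono Jmax (λ k k<J → size≤ (suc k) (blocks lv (suc k) (s≤s z≤n) k<J))) (≤-reflexive (Σ<-const Jmax L)))))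
      where
      size≤ : ∀ k → Status s k N → sizes s block k ≤ L
      size≤ k st with initialized? k N
      ... | yes i = ≤-reflexive (length≡ (contents (on st i)))
      ... | no ¬i = ≤-trans (≤-reflexive (proj₂ (off st ¬i))) z≤n
    cost≡ : 2 + (2 + (2 + (4 + (2 + (B₀.timeImprovedCost + (9 + (1 + 1 + (Σ< (suc Jmax ∸ 1) (λ i → 6 + 7 + 4) + (2 + 7)) + (2 + (12 + 17 * L + mainCost))))))))) ≡ totalCost
    cost≡ = trans (cong (λ S → 2 + (2 + (2 + (4 + (2 + (B₀.timeImprovedCost + (9 + (1 + 1 + (S + (2 + 7)) + (2 + (12 + 17 * L + mainCost)))))))))) (Σ<-const Jmax 17))
      (lem B₀.timeImprovedCost Jmax (17 * L) mainCost)
      where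
      lem : ∀ t J a c → 2 + (2 + (2 + (4 + (2 + (t + (9 + (1 + 1 + (J * 17 + (2 + 7)) + (2 + (12 + a + c))))))))) ≡ 46 + t + J * 17 + a + c
      lem = solve-∀

-- Logarithms and harmonic sums

lg-unique : ∀ k {n} → 2 ^ k ≤ n → n < 2 ^ suc k → ⌊log₂ n ⌋ ≡ k
lg-unique zero    {suc zero}    _ _ = refl
lg-unique zero    {suc (suc n)} _ (s≤s (s≤s ()))
lg-unique (suc k) {n} lo hi = trans (lg-half (≤-trans (*-monoʳ-≤ 2 (m^n>0 2 k)) lo)) (cong suc (lg-unique k
  (subst (_≤ n / 2) (trans (cong (_/ 2) (*-comm 2 (2 ^ k))) (m*n/n≡m (2 ^ k) 2)) (/-monoˡ-≤ 2 lo))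
  (m<n*o⇒m/o<n (<-≤-trans hi (≤-reflexive (*-comm 2 (2 ^ suc k)))))))

quot-≤ : ∀ A {i j} → 1 ≤ i → i ≤ j → quot A j ≤ quot A i
quot-≤ A {suc i} {suc j} _ i≤j = /-monoʳ-≤ A i≤j

quot-* : ∀ A n → quot A n * n ≤ A
quot-* A zero    = z≤n
quot-* A (suc n) = m/n*n≤m A (suc n)

*-≤-quot : ∀ {A n x} → 1 ≤ n → x * n ≤ A → x ≤ quot A n
*-≤-quot {A} {suc n} {x} _ le = subst (_≤ A / suc n) (m*n/n≡m x (suc n)) (/-monoˡ-≤ (suc n) le)

-- The terms with 2^m ≤ i < 2^(m+1) add up to at most A.

harmonic-2^ : ∀ m A → Σ< (2 ^ m) (quot A) ≤ m * A
harmonic-2^ zero    A = ≤-refl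
harmonic-2^ (suc m) A = begin
  Σ< (2 ^ suc m) (quot A)                                    ≡⟨ cong (λ x → Σ< (2 ^ m + x) (quot A)) (+-identityʳ (2 ^ m)) ⟩
  Σ< (2 ^ m + 2 ^ m) (quot A)                                ≡⟨ Σ<-append (2 ^ m) (2 ^ m) (quot A) ⟩
  Σ< (2 ^ m) (quot A) + Σ< (2 ^ m) (λ i → quot A (2 ^ m + i)) ≤⟨ +-mono-≤ (harmonic-2^ m A) (Σ<-mono (2 ^ m) (λ i _ → quot-≤ A (m^n>0 2 m) (m≤m+n (2 ^ m) i))) ⟩
  m * A + Σ< (2 ^ m) (λ _ → quot A (2 ^ m))                  ≡⟨ cong (m * A +_) (trans (Σ<-const (2 ^ m) _) (*-comm (2 ^ m) _)) ⟩
  m * A + quot A (2 ^ m) * 2 ^ m                             ≤⟨ +-monoʳ-≤ (m * A) (quot-* A (2 ^ m)) ⟩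
  m * A + A                                                  ≡⟨ +-comm (m * A) A ⟩
  suc m * A                                                  ∎

harmonic : ∀ {n} m A → n < 2 ^ m → Σ< n (λ i → quot A (suc i)) ≤ m * A
harmonic {n} m A n< = begin
  Σ< n (λ i → quot A (suc i)) ≡⟨ Σ<-head n (quot A) ⟨
  Σ< (suc n) (quot A)         ≤⟨ Σ<-monoˡ (quot A) n< ⟩
  Σ< (2 ^ m) (quot A)         ≤⟨ harmonic-2^ m A ⟩
  m * A                       ∎

-- Comparisons of powers

square-cancel-≤ : ∀ {x y} → x * x ≤ y * y → x ≤ y
square-cancel-≤ le = ≮⇒≥ λ y<x → <⇒≱ (*-mono-< y<x y<x) le

power-product : ∀ k a b → a ^ k * b ^ k ≡ (a * b) ^ k
power-product k a b = sym (^-distribʳ-* k a b)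

3^k≤4^k : ∀ k → 3 ^ k ≤ 2 ^ k * 2 ^ k
3^k≤4^k k = ≤-trans (^-monoˡ-≤ k (from-yes (3 ≤? 4))) (≤-reflexive (sym (power-product k 2 2)))

8^k≤9^k : ∀ k → 2 ^ k * 2 ^ k * 2 ^ k ≤ 3 ^ k * 3 ^ k
8^k≤9^k k = begin
  2 ^ k * 2 ^ k * 2 ^ k ≡⟨ cong (_* 2 ^ k) (power-product k 2 2) ⟩
  4 ^ k * 2 ^ k         ≡⟨ power-product k 4 2 ⟩
  8 ^ k                 ≤⟨ ^-monoˡ-≤ k (from-yes (8 ≤? 9)) ⟩
  9 ^ k                 ≡⟨ power-product k 3 3 ⟨
  3 ^ k * 3 ^ k         ∎

16^k≤27^k : ∀ k → 2 ^ k * 2 ^ k * (2 ^ k * 2 ^ k) ≤ 3 ^ k * 3 ^ k * 3 ^ k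
16^k≤27^k k = begin
  2 ^ k * 2 ^ k * (2 ^ k * 2 ^ k) ≡⟨ cong₂ _*_ (power-product k 2 2) (power-product k 2 2) ⟩
  4 ^ k * 4 ^ k                   ≡⟨ power-product k 4 4 ⟩
  16 ^ k                          ≤⟨ ^-monoˡ-≤ k (from-yes (16 ≤? 27)) ⟩
  27 ^ k                          ≡⟨ power-product k 9 3 ⟨
  9 ^ k * 3 ^ k                   ≡⟨ cong (_* 3 ^ k) (power-product k 3 3) ⟨
  3 ^ k * 3 ^ k * 3 ^ k           ∎

power-eventually : ∀ c a b k₀ {k} → c * a ^ k₀ ≤ b ^ k₀ → a ≤ b → k₀ ≤ k → c * a ^ k ≤ b ^ k
power-eventually c a b k₀ {k} le a≤b k₀≤k = begin
  c * a ^ k             ≡⟨ cong (λ x → c * a ^ x) (m+[n∸m]≡n k₀≤k) ⟨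
  c * a ^ (k₀ + d)      ≡⟨ cong (c *_) (^-distribˡ-+-* a k₀ d) ⟩
  c * (a ^ k₀ * a ^ d)  ≡⟨ *-assoc c (a ^ k₀) (a ^ d) ⟨
  c * a ^ k₀ * a ^ d    ≤⟨ *-mono-≤ le (^-monoˡ-≤ d a≤b) ⟩
  b ^ k₀ * b ^ d        ≡⟨ ^-distribˡ-+-* b k₀ d ⟨
  b ^ (k₀ + d)          ≡⟨ cong (b ^_) (m+[n∸m]≡n k₀≤k) ⟩
  b ^ k                 ∎
  where
  d : ℕ
  d = k ∸ k₀

-- 288 = 2 · 12²: with H ≤ 12 S and S² ≤ 2 · 3^k this yields H ≤ 2^k. The exponent 20 is the least
-- one with (4/3)^k ≥ 288, and it is the reason for the threshold 2^20 in the theorem.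
288*3^k≤4^k : ∀ {k} → 20 ≤ k → 288 * 3 ^ k ≤ 2 ^ k * 2 ^ k
288*3^k≤4^k {k} 20≤k = ≤-trans (power-eventually 288 3 4 20 (from-yes (288 * 3 ^ 20 ≤? 4 ^ 20)) (from-yes (3 ≤? 4)) 20≤k)
  (≤-reflexive (sym (power-product k 2 2)))

k*2^k≤3^k : ∀ k → k * 2 ^ k ≤ 3 ^ k
k*2^k≤3^k 0 = z≤n
k*2^k≤3^k 1 = from-yes (2 ≤? 3)
k*2^k≤3^k 2 = from-yes (8 ≤? 9)
k*2^k≤3^k (suc k@(suc (suc j))) = begin
  suc k * (2 * 2 ^ k)         ≡⟨ lem k (2 ^ k) ⟩
  2 * (k * 2 ^ k) + 2 * 2 ^ k ≤⟨ +-monoʳ-≤ (2 * (k * 2 ^ k)) (*-monoˡ-≤ (2 ^ k) (s≤s (s≤s (z≤n {j})))) ⟩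
  2 * (k * 2 ^ k) + k * 2 ^ k ≡⟨ +-comm (2 * (k * 2 ^ k)) (k * 2 ^ k) ⟩
  3 * (k * 2 ^ k)             ≤⟨ *-monoʳ-≤ 3 (k*2^k≤3^k k) ⟩
  3 * 3 ^ k                   ∎
  where
  lem : ∀ k q → suc k * (2 * q) ≡ 2 * (k * q) + 2 * q
  lem = solve-∀

n<2^n : ∀ n → n < 2 ^ n
n<2^n zero    = ≤-refl
n<2^n (suc n) = ≤-trans (+-mono-≤ (m^n>0 2 n) (n<2^n n)) (≤-reflexive (cong (2 ^ n +_) (sym (+-identityʳ (2 ^ n)))))

2n<2^n : ∀ {n} → 3 ≤ n → n + n < 2 ^ n
2n<2^n {1} (s≤s ())
2n<2^n {2} (s≤s (s≤s ()))
2n<2^n {3} _ = from-yes (6 <? 8)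
2n<2^n {suc n@(suc (suc (suc j)))} _ = begin-strict
  suc n + suc n       ≡⟨ lem n ⟩
  n + n + 2           <⟨ +-mono-<-≤ (2n<2^n {n} (s≤s (s≤s (s≤s z≤n)))) (*-mono-≤ (≤-refl {2}) (m^n>0 2 (2 + j))) ⟩
  2 ^ n + 2 ^ n       ≡⟨ cong (2 ^ n +_) (+-identityʳ (2 ^ n)) ⟨
  2 ^ suc n           ∎
  where
  lem : ∀ n → suc n + suc n ≡ n + n + 2
  lem = solve-∀

-- An integer between 3^(k/2) and √2 · 3^(k/2), which replaces the square root.
root3 : ℕ → ℕ
root3 0             = 1
root3 1             = 2
root3 (suc (suc k)) = 3 * root3 k

root3-≥ : ∀ k → 3 ^ k ≤ root3 k * root3 k
root3-≥ 0 = ≤-refl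
root3-≥ 1 = from-yes (3 ≤? 4)
root3-≥ (suc (suc k)) = ≤-trans (≤-reflexive (lem₁ (3 ^ k))) (≤-trans (*-monoʳ-≤ 9 (root3-≥ k)) (≤-reflexive (lem₂ (root3 k))))
  where
  lem₁ : ∀ x → 3 * (3 * x) ≡ 9 * x
  lem₁ = solve-∀
  lem₂ : ∀ x → 9 * (x * x) ≡ 3 * x * (3 * x)
  lem₂ = solve-∀

root3-≤ : ∀ k → root3 k * root3 k ≤ 2 * 3 ^ k
root3-≤ 0 = from-yes (1 ≤? 2)
root3-≤ 1 = from-yes (4 ≤? 6)
root3-≤ (suc (suc k)) = ≤-trans (≤-reflexive (lem₂ (root3 k))) (≤-trans (*-monoʳ-≤ 9 (root3-≤ k)) (≤-reflexive (lem₁ (3 ^ k))))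
  where
  lem₁ : ∀ x → 9 * (2 * x) ≡ 2 * (3 * (3 * x))
  lem₁ = solve-∀
  lem₂ : ∀ x → 3 * x * (3 * x) ≡ 9 * (x * x)
  lem₂ = solve-∀

-- The parameters: with 2^k ≤ N < 2^(k+1), ℓ is about 3 (3/2)^k and H about 8 · 3^(k/2).
-- They are the fields of a record, so that they are never evaluated.

record Parameters (N₀ k : ℕ) : Set where
  field
    P Q S ℓ hh nn w j : ℕ
    P≡      : P ≡ 3 ^ k
    Q≡      : Q ≡ 2 ^ k
    1≤Q     : 1 ≤ Q
    Q≤P     : Q ≤ P
    P≤Q²    : P ≤ Q * Q
    Q³≤P²   : Q * Q * Q ≤ P * P
    Q⁴≤P³   : Q * Q * (Q * Q) ≤ P * P * P
    288P≤Q² : 288 * P ≤ Q * Q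
    kQ≤P    : k * Q ≤ P
    P≤S²    : P ≤ S * S
    S²≤2P   : S * S ≤ 2 * P
    1≤ℓ     : 1 ≤ ℓ
    3P<ℓQ   : 3 * P < ℓ * Q
    ℓQ≤3P+Q : ℓ * Q ≤ Q + 3 * P
    8S≤H    : 8 * S ≤ ℓ * hh
    H≤ℓ+8S  : ℓ * hh ≤ ℓ + 8 * S
    Q≤N₀    : Q ≤ N₀
    N₀<2Q   : N₀ < 2 * Q
    N₀≤N    : N₀ ≤ ℓ * nn
    N<N₀+ℓ  : ℓ * nn < N₀ + ℓ
    w≡      : w ≡ 7 + 3 * k
    j≡      : j ≡ ⌊log₂ w ⌋
    2^j≤w   : 2 ^ j ≤ w
    w<2^1+j : w < 2 ^ suc j

parameters : ∀ {N₀ k} → 20 ≤ k → 2 ^ k ≤ N₀ → N₀ < 2 ^ suc k → Parameters N₀ k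
parameters {N₀} {k} 20≤k lo hi = record
  { P = 3 ^ k ; Q = 2 ^ k ; S = root3 k ; P≡ = refl ; Q≡ = refl
  ; 1≤Q = m^n>0 2 k ; Q≤P = ^-monoˡ-≤ k (from-yes (2 ≤? 3)) ; P≤Q² = 3^k≤4^k k ; Q³≤P² = 8^k≤9^k k ; Q⁴≤P³ = 16^k≤27^k k
  ; 288P≤Q² = 288*3^k≤4^k 20≤k ; kQ≤P = k*2^k≤3^k k ; P≤S² = root3-≥ k ; S²≤2P = root3-≤ k
  ; ℓ = ℓ ; hh = suc (8 * root3 k / ℓ) ; nn = cdiv N₀ ℓ
  ; 1≤ℓ = s≤s z≤n
  ; 3P<ℓQ = m<[1+m/n]*n (3 * 3 ^ k) (2 ^ k)
  ; ℓQ≤3P+Q = +-monoʳ-≤ (2 ^ k) (m/n*n≤m (3 * 3 ^ k) (2 ^ k))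
  ; 8S≤H = ≤-trans (<⇒≤ (m<[1+m/n]*n (8 * root3 k) ℓ)) (≤-reflexive (*-comm (suc (8 * root3 k / ℓ)) ℓ))
  ; H≤ℓ+8S = ≤-trans (≤-reflexive (*-comm ℓ (suc (8 * root3 k / ℓ)))) (+-monoʳ-≤ ℓ (m/n*n≤m (8 * root3 k) ℓ))
  ; Q≤N₀ = lo ; N₀<2Q = hi
  ; N₀≤N = ≤-trans (cdiv-* N₀ {ℓ} (s≤s z≤n)) (≤-reflexive (*-comm (cdiv N₀ ℓ) ℓ))
  ; N<N₀+ℓ = ≤-<-trans (≤-trans (≤-reflexive (*-comm ℓ (cdiv N₀ ℓ))) (≤-trans (m/n*n≤m (N₀ + ℓ ∸ 1) ℓ) (≤-reflexive (cong (_∸ 1) (+-suc N₀ d)))))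
      (+-monoʳ-< N₀ (n<1+n d))
  ; w = 7 + 3 * k ; j = proj₁ fl ; w≡ = refl ; j≡ = sym (lg-unique (proj₁ fl) (proj₁ (proj₂ fl)) (proj₂ (proj₂ fl)))
  ; 2^j≤w = proj₁ (proj₂ fl) ; w<2^1+j = proj₂ (proj₂ fl) }
  where
  instance
    2^k≢0 : NonZero (2 ^ k)
    2^k≢0 = m^n≢0 2 k
  d ℓ : ℕ
  d = 3 * 3 ^ k / 2 ^ k
  ℓ = suc d
  fl : ∃ λ j → 2 ^ j ≤ 7 + 3 * k × 7 + 3 * k < 2 ^ suc j
  fl = floor-log (7 + 3 * k) (s≤s z≤n)

module Choice {N₀ k : ℕ} (choice : Parameters N₀ k) where

  open Parameters choice public

  instance
    Q≢0 : NonZero Q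
    Q≢0 = >-nonZero 1≤Q
    ℓ≢0 : NonZero ℓ
    ℓ≢0 = >-nonZero 1≤ℓ

  H N L e : ℕ
  H = ℓ * hh
  N = ℓ * nn
  L = 2 * ℓ
  e = suc j

  1≤S : 1 ≤ S
  1≤S = square-cancel-≤ (≤-trans (≤-trans 1≤Q Q≤P) P≤S²)

  ℓQ≤4P : ℓ * Q ≤ 4 * P
  ℓQ≤4P = ≤-trans ℓQ≤3P+Q (+-monoˡ-≤ (3 * P) Q≤P)

  ℓ≤Q : ℓ ≤ Q
  ℓ≤Q = *-cancelʳ-≤ ℓ Q Q (≤-trans ℓQ≤4P (≤-trans (*-monoˡ-≤ P (from-yes (4 ≤? 288))) 288P≤Q²))

  P≤SQ : P ≤ S * Q
  P≤SQ = square-cancel-≤ (≤-trans (*-mono-≤ P≤S² P≤Q²) (≤-reflexive (lem S Q)))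
    where
    lem : ∀ s q → s * s * (q * q) ≡ s * q * (s * q)
    lem = solve-∀

  ℓ≤4S : ℓ ≤ 4 * S
  ℓ≤4S = *-cancelʳ-≤ ℓ (4 * S) Q (≤-trans ℓQ≤4P (≤-trans (*-monoʳ-≤ 4 P≤SQ) (≤-reflexive (sym (*-assoc 4 S Q)))))

  H≤12S : H ≤ 12 * S
  H≤12S = ≤-trans H≤ℓ+8S (≤-trans (+-monoˡ-≤ (8 * S) ℓ≤4S) (≤-reflexive (sym (*-distribʳ-+ S 4 8))))

  L≤H : L ≤ H
  L≤H = ≤-trans (*-monoʳ-≤ 2 ℓ≤4S) (≤-trans (≤-reflexive (sym (*-assoc 2 4 S))) 8S≤H)

  N≤4Q : N ≤ 4 * Q
  N≤4Q = begin
    N              ≤⟨ <⇒≤ N<N₀+ℓ ⟩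
    N₀ + ℓ         ≤⟨ +-mono-≤ (<⇒≤ N₀<2Q) (≤-trans ℓ≤Q (m≤n*m Q 2)) ⟩
    2 * Q + 2 * Q  ≡⟨ *-distribʳ-+ Q 2 2 ⟨
    4 * Q          ∎

  H≤N : H ≤ N
  H≤N = ≤-trans H≤12S (≤-trans (square-cancel-≤ (begin
    12 * S * (12 * S) ≡⟨ lem S ⟩
    144 * (S * S)     ≤⟨ *-monoʳ-≤ 144 S²≤2P ⟩
    144 * (2 * P)     ≡⟨ *-assoc 144 2 P ⟨
    288 * P           ≤⟨ 288P≤Q² ⟩
    Q * Q             ∎)) (≤-trans Q≤N₀ N₀≤N))
    where
    lem : ∀ s → 12 * s * (12 * s) ≡ 144 * (s * s)
    lem = solve-∀

  -- The factor 8 in H serves this: LN ≤ 2ℓ · 4Q ≤ 32 P, while H² ≥ 64 S² ≥ 64 P.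
  LN≤H² : L * N ≤ H * H
  LN≤H² = begin
    2 * ℓ * N             ≤⟨ *-monoʳ-≤ (2 * ℓ) N≤4Q ⟩
    2 * ℓ * (4 * Q)       ≡⟨ lem₁ ℓ Q ⟩
    8 * (ℓ * Q)           ≤⟨ *-monoʳ-≤ 8 ℓQ≤4P ⟩
    8 * (4 * P)           ≤⟨ *-monoʳ-≤ 8 (*-mono-≤ (from-yes (4 ≤? 8)) P≤S²) ⟩
    8 * (8 * (S * S))     ≡⟨ lem₂ S ⟩
    8 * S * (8 * S)       ≤⟨ *-mono-≤ 8S≤H 8S≤H ⟩
    H * H                 ∎
    where
    lem₁ : ∀ l q → 2 * l * (4 * q) ≡ 8 * (l * q)
    lem₁ = solve-∀
    lem₂ : ∀ s → 8 * (8 * (s * s)) ≡ 8 * s * (8 * s)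
    lem₂ = solve-∀

  -- Comes down to 16 ≤ 27: from Q⁴ ≤ P³ follows Q² ≤ PS, and P ≤ ℓQ.
  N≤ℓH : N ≤ ℓ * H
  N≤ℓH = begin
    N             ≤⟨ N≤4Q ⟩
    4 * Q         ≤⟨ *-mono-≤ (from-yes (4 ≤? 8)) Q≤ℓS ⟩
    8 * (ℓ * S)   ≡⟨ lem₁ ℓ S ⟩
    ℓ * (8 * S)   ≤⟨ *-monoʳ-≤ ℓ 8S≤H ⟩
    ℓ * H         ∎
    where
    lem₁ : ∀ l s → 8 * (l * s) ≡ l * (8 * s)
    lem₁ = solve-∀
    lem₂ : ∀ p s → p * p * (s * s) ≡ p * s * (p * s)
    lem₂ = solve-∀
    lem₃ : ∀ l q s → l * q * s ≡ l * s * q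
    lem₃ = solve-∀
    Q²≤PS : Q * Q ≤ P * S
    Q²≤PS = square-cancel-≤ (≤-trans Q⁴≤P³ (≤-trans (*-monoʳ-≤ (P * P) P≤S²) (≤-reflexive (lem₂ P S))))
    Q≤ℓS : Q ≤ ℓ * S
    Q≤ℓS = *-cancelʳ-≤ Q (ℓ * S) Q (≤-trans Q²≤PS (≤-trans (*-monoˡ-≤ S (≤-trans (m≤n*m P 3) (<⇒≤ 3P<ℓQ))) (≤-reflexive (lem₃ ℓ Q S))))

  -- Comes down to 8 ≤ 9, since ℓ exceeds 3 (3/2)^k.
  N≤ℓ² : N ≤ ℓ * ℓ
  N≤ℓ² = ≤-trans N≤4Q (*-cancelʳ-≤ (4 * Q) (ℓ * ℓ) (Q * Q) {{m*n≢0 Q Q}} (begin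
    4 * Q * (Q * Q)       ≡⟨ lem₁ Q ⟩
    4 * (Q * Q * Q)       ≤⟨ *-mono-≤ (from-yes (4 ≤? 9)) Q³≤P² ⟩
    9 * (P * P)           ≡⟨ lem₂ P ⟩
    3 * P * (3 * P)       ≤⟨ *-mono-≤ (<⇒≤ 3P<ℓQ) (<⇒≤ 3P<ℓQ) ⟩
    ℓ * Q * (ℓ * Q)       ≡⟨ lem₃ ℓ Q ⟩
    ℓ * ℓ * (Q * Q)       ∎))
    where
    lem₁ : ∀ q → 4 * q * (q * q) ≡ 4 * (q * q * q)
    lem₁ = solve-∀
    lem₂ : ∀ p → 9 * (p * p) ≡ 3 * p * (3 * p)
    lem₂ = solve-∀
    lem₃ : ∀ l q → l * q * (l * q) ≡ l * l * (q * q)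
    lem₃ = solve-∀

  N≤2^[2+k] : N ≤ 2 ^ (2 + k)
  N≤2^[2+k] = ≤-trans N≤4Q (≤-reflexive (trans (*-assoc 2 2 Q) (cong (λ q → 2 * (2 * q)) Q≡)))

  -- N may be as large as 2^(k+2), so `κ-bound` is used with K = k + 1 and gives κ(n) ≤ 3 (3/2)^k.
  -- This is the origin of the factor 3 in ℓ.
  κ<ℓ : ∀ n → 2 ≤ n → n ≤ N → κ n < ℓ
  κ<ℓ n 2≤n n≤N = *-cancelʳ-< Q (κ n) ℓ (≤-<-trans (*-cancelˡ-≤ 2 (begin
    2 * (κ n * Q)       ≡⟨ lem (κ n) Q ⟩
    κ n * (2 * Q)       ≡⟨ cong (λ q → κ n * (2 * q)) Q≡ ⟩
    κ n * 2 ^ suc k     ≤⟨ κ-bound (suc k) 2≤n (≤-trans n≤N N≤2^[2+k]) ⟩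
    2 * 3 ^ suc k       ≡⟨ cong (λ p → 2 * (3 * p)) P≡ ⟨
    2 * (3 * P)         ∎)) 3P<ℓQ)
    where
    lem : ∀ x q → 2 * (x * q) ≡ x * (2 * q)
    lem = solve-∀

  admissible : Admissible N H ℓ
  admissible = record
    { N-positive = ≤-trans (≤-trans 1≤Q Q≤N₀) N₀≤N
    ; H-positive = ≤-trans (s≤s z≤n) (≤-trans (*-mono-≤ (from-yes (1 ≤? 8)) 1≤S) 8S≤H)
    ; ℓ-positive = 1≤ℓ
    ; kMax<ℓ     = λ { (suc n) T 2≤n n≤N T≡ → subst (λ T → kMax (suc n) T < ℓ) (sym (comp-unique (≤-pred 2≤n) T≡)) (κ<ℓ (suc n) 2≤n n≤N) }
    ; N≤ℓH       = N≤ℓH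
    ; ℓ∣H        = divides hh (*-comm ℓ hh)
    ; ℓ∣N        = divides nn (*-comm ℓ nn)
    ; LN≤H²      = LN≤H² }

  hh≤nn : hh ≤ nn
  hh≤nn = *-cancelˡ-≤ ℓ H≤N

  e≤w : e ≤ w
  e≤w = ≤-trans (n<2^n j) 2^j≤w

  N³≤ : N * N * N ≤ 2 ^ (6 + 3 * k)
  N³≤ = begin
    N * N * N                                  ≤⟨ *-mono-≤ (*-mono-≤ N≤2^[2+k] N≤2^[2+k]) N≤2^[2+k] ⟩
    2 ^ (2 + k) * 2 ^ (2 + k) * 2 ^ (2 + k)    ≡⟨ cong (_* 2 ^ (2 + k)) (^-distribˡ-+-* 2 (2 + k) (2 + k)) ⟨
    2 ^ (2 + k + (2 + k)) * 2 ^ (2 + k)        ≡⟨ ^-distribˡ-+-* 2 (2 + k + (2 + k)) (2 + k) ⟨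
    2 ^ (2 + k + (2 + k) + (2 + k))            ≡⟨ cong (2 ^_) (lem k) ⟩
    2 ^ (6 + 3 * k)                            ∎
    where
    lem : ∀ k → 2 + k + (2 + k) + (2 + k) ≡ 6 + 3 * k
    lem = solve-∀

  fits : ∀ {v} → v ≤ N * N * N → v < 2 ^ w
  fits v≤ = ≤-<-trans (≤-trans v≤ N³≤) (^-monoʳ-< 2 (s≤s (s≤s z≤n)) (≤-reflexive (sym w≡)))

  Bd≤w : suc (lg³ N) ≤ w
  Bd≤w = ≤-trans (s≤s (≤-trans (⌊log₂⌋-mono-≤ N³≤) (≤-reflexive (⌊log₂[2^n]⌋≡n (6 + 3 * k))))) (≤-reflexive (sym w≡))

  -- The block entries never exceed the initial bound, which is at most w; so 1 + ⌊log₂ w⌋ bits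
  -- suffice for them. This is where log log N originates.
  bound< : suc (lg³ N) < 2 ^ e
  bound< = ≤-<-trans Bd≤w w<2^1+j

  2bound< : suc (lg³ N) + suc (lg³ N) < 2 ^ w
  2bound< = ≤-<-trans (+-mono-≤ Bd≤w Bd≤w) (2n<2^n (≤-trans (s≤s (s≤s (s≤s z≤n))) (≤-reflexive (sym w≡))))

-- Estimates for storage and time

cdiv-*-≤ : ∀ d n → cdiv d n * n ≤ d + n
cdiv-*-≤ d n = ≤-trans (quot-* (d + n ∸ 1) n) (m∸n≤m (d + n) 1)

module Bounds {N₀ k : ℕ} (20≤k : 20 ≤ k) (choice : Parameters N₀ k) where

  open Choice choice
  open SpaceImproved w e N H ℓ hh nn 1≤ℓ refl refl L≤H H≤N N≤ℓ² κ<ℓ fits bound< 2bound< using (productsCost; quotCost; 2≤H)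
  open SpaceImproved w e N H ℓ hh nn 1≤ℓ refl refl L≤H H≤N N≤ℓ² κ<ℓ fits bound< 2bound<
    using (Jmax; fixedCost; Potential; potentialSum; mainCost; totalCost; module B₀; lgH≤lgN)
  open Blocks H ℓ hh 1≤ℓ refl L≤H using (quota; Top; H≤Top; 1≤H)
  open Arithmetic w e using (kMaxCost; kMaxCost-mono)

  instance
    H≢0 : NonZero H
    H≢0 = >-nonZero 1≤H
    S≢0 : NonZero S
    S≢0 = >-nonZero 1≤S
    N≢0 : NonZero N
    N≢0 = >-nonZero (≤-trans 1≤H H≤N)

  1≤k : 1 ≤ k
  1≤k = ≤-trans (from-yes (1 ≤? 20)) 20≤k

  N+H≤2N : N + H ≤ 2 * N
  N+H≤2N = +-monoʳ-≤ N (≤-trans H≤N (m≤m+n N 0))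

  JH≤2N : Jmax * H ≤ 2 * N
  JH≤2N = ≤-trans (cdiv-*-≤ N H) N+H≤2N

  -- The purpose of the condition LN ≤ H²: about N/H blocks of length L together take no more than
  -- twice the length of B_0.
  JL≤2H : Jmax * L ≤ 2 * H
  JL≤2H = *-cancelʳ-≤ (Jmax * L) (2 * H) H (begin
    Jmax * L * H       ≡⟨ lem₁ Jmax L H ⟩
    L * (Jmax * H)     ≤⟨ *-monoʳ-≤ L (cdiv-*-≤ N H) ⟩
    L * (N + H)        ≡⟨ *-distribˡ-+ L N H ⟩
    L * N + L * H      ≤⟨ +-mono-≤ LN≤H² (*-monoˡ-≤ H L≤H) ⟩
    H * H + H * H      ≡⟨ lem₂ H ⟩
    2 * H * H          ∎)
    where
    lem₁ : ∀ j l h → j * l * h ≡ l * (j * h)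
    lem₁ = solve-∀
    lem₂ : ∀ h → h * h + h * h ≡ 2 * h * h
    lem₂ = solve-∀

  JS≤Q : Jmax * S ≤ Q
  JS≤Q = *-cancelˡ-≤ 8 (begin
    8 * (Jmax * S)   ≡⟨ lem Jmax S ⟩
    Jmax * (8 * S)   ≤⟨ *-monoʳ-≤ Jmax 8S≤H ⟩
    Jmax * H         ≤⟨ JH≤2N ⟩
    2 * N            ≤⟨ *-monoʳ-≤ 2 N≤4Q ⟩
    2 * (4 * Q)      ≡⟨ *-assoc 2 4 Q ⟨
    8 * Q            ∎)
    where
    lem : ∀ j s → 8 * (j * s) ≡ j * (8 * s)
    lem = solve-∀

  -- Among the arrays only that of the H_j has words of order k bits. Its length is at most Q / S,
  -- and k 2^k ≤ 3^k absorbs the factor k.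
  kJ≤S : k * Jmax ≤ S
  kJ≤S = *-cancelʳ-≤ (k * Jmax) S S (begin
    k * Jmax * S    ≡⟨ *-assoc k Jmax S ⟩
    k * (Jmax * S)  ≤⟨ *-monoʳ-≤ k JS≤Q ⟩
    k * Q           ≤⟨ kQ≤P ⟩
    P               ≤⟨ P≤S² ⟩
    S * S           ∎)

  k≤S : k ≤ S
  k≤S = square-cancel-≤ (≤-trans (*-monoʳ-≤ k (≤-trans (<⇒≤ (n<2^n k)) (≤-reflexive (sym Q≡)))) (≤-trans kQ≤P P≤S²))

  w≤10k : w ≤ 10 * k
  w≤10k = ≤-trans (≤-reflexive w≡) (≤-trans (+-monoˡ-≤ (3 * k) (m≤m*n 7 k {{>-nonZero 1≤k}})) (≤-reflexive (sym (*-distribʳ-+ k 7 3))))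

  λλ : ℕ
  λλ = ⌊log₂ k ⌋

  1≤λ : 1 ≤ λλ
  1≤λ = ⌊log₂⌋-mono-≤ (≤-trans (from-yes (2 ≤? 20)) 20≤k)

  e≤5λ : e ≤ 5 * λλ
  e≤5λ = begin
    suc j                      ≡⟨ cong suc j≡ ⟩
    suc ⌊log₂ w ⌋              ≤⟨ s≤s (⌊log₂⌋-mono-≤ w≤8k) ⟩
    suc ⌊log₂ (2 * (2 * (2 * k))) ⌋ ≡⟨ cong suc (trans (doubled (2 * (2 * k)) 1≤4k) (cong suc (trans (doubled (2 * k) 1≤2k) (cong suc (doubled k 1≤k))))) ⟩
    4 + λλ                     ≤⟨ +-monoˡ-≤ λλ (*-monoʳ-≤ 4 1≤λ) ⟩
    4 * λλ + λλ                ≡⟨ +-comm (4 * λλ) λλ ⟩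
    5 * λλ                     ∎
    where
    doubled : ∀ n → 1 ≤ n → ⌊log₂ (2 * n) ⌋ ≡ suc ⌊log₂ n ⌋
    doubled n 1≤n = ⌊log₂[2*b]⌋≡1+⌊log₂b⌋ n {{>-nonZero 1≤n}}
    1≤2k : 1 ≤ 2 * k
    1≤2k = ≤-trans 1≤k (m≤n*m k 2)
    1≤4k : 1 ≤ 2 * (2 * k)
    1≤4k = ≤-trans 1≤2k (m≤n*m (2 * k) 2)
    lem : ∀ k → 5 * k + 3 * k ≡ 2 * (2 * (2 * k))
    lem = solve-∀
    w≤8k : w ≤ 2 * (2 * (2 * k))
    w≤8k = ≤-trans (≤-reflexive w≡) (≤-trans (+-monoˡ-≤ (3 * k) (≤-trans (from-yes (7 ≤? 20)) (≤-trans 20≤k (m≤n*m k 5)))) (≤-reflexive (lem k)))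

  storage≤ : 25 * w + (H * e + Jmax * w + e * (Jmax * L)) ≤ 440 * λλ * S
  storage≤ = begin
    25 * w + (H * e + Jmax * w + e * (Jmax * L))
      ≤⟨ +-mono-≤ (*-monoʳ-≤ 25 (≤-trans w≤10k (*-monoʳ-≤ 10 k≤S))) (+-mono-≤ (+-mono-≤ (*-mono-≤ H≤12S e≤5λ) Jw≤) (*-mono-≤ e≤5λ (≤-trans JL≤2H (*-monoʳ-≤ 2 H≤12S)))) ⟩
    25 * (10 * S) + (12 * S * (5 * λλ) + 10 * S + 5 * λλ * (2 * (12 * S)))
      ≡⟨ lem₁ S λλ ⟩
    260 * S + 180 * λλ * S
      ≤⟨ +-monoˡ-≤ (180 * λλ * S) (*-monoˡ-≤ S (*-monoʳ-≤ 260 1≤λ)) ⟩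
    260 * λλ * S + 180 * λλ * S
      ≡⟨ lem₂ S λλ ⟩
    440 * λλ * S ∎
    where
    Jw≤ : Jmax * w ≤ 10 * S
    Jw≤ = ≤-trans (*-monoʳ-≤ Jmax w≤10k) (≤-trans (≤-reflexive (lem Jmax k)) (*-monoʳ-≤ 10 kJ≤S))
      where
      lem : ∀ j k → j * (10 * k) ≡ 10 * (k * j)
      lem = solve-∀
    lem₁ : ∀ s l → 25 * (10 * s) + (12 * s * (5 * l) + 10 * s + 5 * l * (2 * (12 * s))) ≡ 260 * s + 180 * l * s
    lem₁ = solve-∀
    lem₂ : ∀ s l → 260 * l * s + 180 * l * s ≡ 440 * l * s
    lem₂ = solve-∀

  -- The number G is at least K₀ (16 · 2^k)^(11/9).

  z : ℕ
  z = k + 4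

  1≤z : 1 ≤ z
  1≤z = ≤-trans 1≤k (m≤m+n k 4)

  w+1≤3z : suc w ≤ 3 * z
  w+1≤3z = ≤-trans (≤-reflexive (cong suc w≡)) (≤-trans (m≤m+n _ 4) (≤-reflexive (lem k)))
    where
    lem : ∀ k → suc (7 + 3 * k) + 4 ≡ 3 * (k + 4)
    lem = solve-∀

  lg≤3z : lg³ N ≤ 3 * z
  lg≤3z = ≤-trans (≤-trans (n≤1+n _) Bd≤w) (≤-trans (n≤1+n w) w+1≤3z)

  kMaxCost≤ : ∀ {B} → B ≤ w → kMaxCost B ≤ 540 * (z * z)
  kMaxCost≤ {B} B≤w = ≤-trans (*-monoʳ-≤ 60 (*-mono-≤ (≤-trans (s≤s B≤w) w+1≤3z) (≤-trans (s≤s B≤w) w+1≤3z))) (≤-reflexive (lem z))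
    where
    lem : ∀ z → 60 * (3 * z * (3 * z)) ≡ 540 * (z * z)
    lem = solve-∀

  4N≤2^z : 2 * (2 * N) ≤ 2 ^ z
  4N≤2^z = begin
    2 * (2 * N)              ≤⟨ *-monoʳ-≤ 2 (*-monoʳ-≤ 2 N≤2^[2+k]) ⟩
    2 ^ (4 + k)              ≡⟨ cong (2 ^_) (+-comm 4 k) ⟩
    2 ^ z                    ∎

  N<2^z : N < 2 ^ z
  N<2^z = <-≤-trans (m<m+n N (≤-trans (≤-trans 1≤H H≤N) (m≤m+n N 0))) (≤-trans (m≤n*m (2 * N) 2) 4N≤2^z)

  harmonic-z : ∀ {n} A → n ≤ N → Σ< n (λ i → quot A (suc i)) ≤ z * A
  harmonic-z A n≤N = harmonic z A (≤-<-trans n≤N N<2^z)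

  ℓ≤N : ℓ ≤ N
  ℓ≤N = ≤-trans (m≤n*m ℓ 2) (≤-trans L≤H H≤N)

  z≤zz : z ≤ z * z
  z≤zz = m≤m*n z z {{>-nonZero 1≤z}}

  1≤zz : 1 ≤ z * z
  1≤zz = ≤-trans 1≤z z≤zz

  -- The products contribute a harmonic sum over a ≤ ℓ, of order zℓ. The leading term z²ℓ comes from
  -- computing kMax, whose cost is quadratic in the complexity.
  fixedCost≤ : fixedCost ≤ 882 * (z * z) * ℓ
  fixedCost≤ = begin
    56 + 17 * (2 * ℓ) + 26 * ℓ + 11 * lg³ N + productsCost + ℓ * (47 + kMaxCost (suc (lg³ N)))
      ≤⟨ +-mono-≤ (+-mono-≤ (+-monoʳ-≤ (56 + 17 * (2 * ℓ) + 26 * ℓ) (*-monoʳ-≤ 11 lg≤3z)) products≤) (*-monoʳ-≤ ℓ (+-monoʳ-≤ 47 (kMaxCost≤ Bd≤w))) ⟩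
    56 + 17 * (2 * ℓ) + 26 * ℓ + 11 * (3 * z) + (7 + (ℓ * 84 + 55 * (z * ℓ))) + ℓ * (47 + 540 * (z * z))
      ≡⟨ lem₁ ℓ z ⟩
    63 + 191 * ℓ + 33 * z + 55 * (z * ℓ) + 540 * (z * z) * ℓ
      ≤⟨ +-monoˡ-≤ (540 * (z * z) * ℓ) (+-mono-≤ (+-mono-≤ (+-mono-≤ (*-monoʳ-≤ 63 1≤X) (*-monoʳ-≤ 191 ℓ≤X)) (*-monoʳ-≤ 33 z≤X)) (*-monoʳ-≤ 55 (*-monoˡ-≤ ℓ z≤zz))) ⟩
    63 * (z * z * ℓ) + 191 * (z * z * ℓ) + 33 * (z * z * ℓ) + 55 * (z * z * ℓ) + 540 * (z * z) * ℓ
      ≡⟨ lem₂ (z * z) ℓ ⟩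
    882 * (z * z) * ℓ ∎
    where
    ℓ≤X : ℓ ≤ z * z * ℓ
    ℓ≤X = m≤n*m ℓ (z * z) {{>-nonZero 1≤zz}}
    1≤X : 1 ≤ z * z * ℓ
    1≤X = ≤-trans 1≤ℓ ℓ≤X
    z≤X : z ≤ z * z * ℓ
    z≤X = ≤-trans z≤zz (m≤m*n (z * z) ℓ)
    products≤ : productsCost ≤ 7 + (ℓ * 84 + 55 * (z * ℓ))
    products≤ = +-monoʳ-≤ 7 (≤-trans (≤-reflexive (trans (Σ<-+ ℓ (λ _ → 84) (λ i → 55 * quot ℓ (suc i))) (cong₂ _+_ (Σ<-const ℓ 84) (sym (Σ<-* 55 ℓ (λ i → quot ℓ (suc i)))))))
      (+-monoʳ-≤ (ℓ * 84) (*-monoʳ-≤ 55 (harmonic-z ℓ ℓ≤N))))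
    lem₁ : ∀ l z → 56 + 17 * (2 * l) + 26 * l + 11 * (3 * z) + (7 + (l * 84 + 55 * (z * l))) + l * (47 + 540 * (z * z)) ≡ 63 + 191 * l + 33 * z + 55 * (z * l) + 540 * (z * z) * l
    lem₁ = solve-∀
    lem₂ : ∀ y l → 63 * (y * l) + 191 * (y * l) + 33 * (y * l) + 55 * (y * l) + 540 * y * l ≡ 882 * y * l
    lem₂ = solve-∀

  -- If H_j is still H, then j ≤ ⌈N/H⌉ suffices; otherwise rounding up adds at most jℓ ≤ N to j H_j.
  Top*j≤2N : ∀ i → i < Jmax → Top (suc i) N * suc i ≤ 2 * N
  Top*j≤2N i i<J with ⊔-sel hh (cdiv N (suc i * ℓ))
  ... | inj₁ eq = begin
    ℓ * quota (suc i) N * suc i ≡⟨ cong (λ x → ℓ * x * suc i) eq ⟩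
    H * suc i                   ≤⟨ *-monoʳ-≤ H i<J ⟩
    H * Jmax                    ≡⟨ *-comm H Jmax ⟩
    Jmax * H                    ≤⟨ JH≤2N ⟩
    2 * N                       ∎
  ... | inj₂ eq = begin
    ℓ * quota (suc i) N * suc i ≡⟨ cong (λ x → ℓ * x * suc i) eq ⟩
    ℓ * cdiv N (suc i * ℓ) * suc i ≡⟨ lem ℓ (cdiv N (suc i * ℓ)) (suc i) ⟩
    cdiv N (suc i * ℓ) * (suc i * ℓ) ≤⟨ cdiv-*-≤ N (suc i * ℓ) ⟩
    N + suc i * ℓ               ≤⟨ +-monoʳ-≤ N (≤-trans (*-monoˡ-≤ ℓ i<J) (≤-trans Jℓ≤N (m≤m+n N 0))) ⟩
    2 * N                       ∎
    where
    lem : ∀ l c j → l * c * j ≡ c * (j * l)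
    lem = solve-∀
    lem′ : ∀ j l → 2 * (j * l) ≡ j * (2 * l)
    lem′ = solve-∀
    Jℓ≤N : Jmax * ℓ ≤ N
    Jℓ≤N = *-cancelˡ-≤ 2 (≤-trans (≤-reflexive (lem′ Jmax ℓ)) (≤-trans (*-monoʳ-≤ Jmax L≤H) JH≤2N))

  J≤N : Jmax ≤ N
  J≤N = *-cancelˡ-≤ 2 (≤-trans (≤-reflexive (*-comm 2 Jmax)) (≤-trans (*-monoʳ-≤ Jmax 2≤H) JH≤2N))

  -- The purpose of N ≤ ℓH: with N/ℓ passes and at most 2N/H blocks in each, the constant cost per
  -- block and pass adds up to O(N).
  nnJ≤2N : nn * Jmax ≤ 2 * N
  nnJ≤2N = *-cancelʳ-≤ (nn * Jmax) (2 * N) N (begin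
    nn * Jmax * N          ≤⟨ *-monoʳ-≤ (nn * Jmax) N≤ℓH ⟩
    nn * Jmax * (ℓ * H)    ≡⟨ lem nn Jmax ℓ H ⟩
    Jmax * H * N           ≤⟨ *-monoˡ-≤ N JH≤2N ⟩
    2 * N * N              ∎)
    where
    lem : ∀ n j l h → n * j * (l * h) ≡ j * h * (l * n)
    lem = solve-∀

  -- G stays abstract, with only the two properties used. Ω is the common majorant z³ (W + 1) G of
  -- all costs.
  module Time (G : ℕ) (G-large : K₀ ^ 9 * (2 ^ z) ^ 11 ≤ G ^ 9) (N≤G : N ≤ G) where

    W V Ω : ℕ
    W = totalWeight
    V = suc W * G
    Ω = z * (z * z) * V

    instance
      2^z≢0 : NonZero (2 ^ z)
      2^z≢0 = m^n≢0 2 z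

    -- Because `U-bound` is linear in X, the condition Xj ≤ 2N turns it into a bound proportional to
    -- 1 / j.
    U*j≤ : ∀ X j → 1 ≤ X → X ≤ 2 * N → X * j ≤ 2 * N → U X * j ≤ 32 * W * G
    U*j≤ X j 1≤X X≤ Xj≤ = *-cancelˡ-≤ (2 ^ z) (begin
      2 ^ z * (U X * j)       ≡⟨ *-assoc (2 ^ z) (U X) j ⟨
      2 ^ z * U X * j         ≤⟨ *-monoˡ-≤ j (U-bound X (2 ^ z) G 1≤X (≤-trans (*-monoʳ-≤ 2 X≤) 4N≤2^z) G-large) ⟩
      32 * W * G * X * j      ≡⟨ *-assoc (32 * W * G) X j ⟩
      32 * W * G * (X * j)    ≤⟨ *-monoʳ-≤ (32 * W * G) (≤-trans Xj≤ (≤-trans (m≤n*m (2 * N) 2) 4N≤2^z)) ⟩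
      32 * W * G * 2 ^ z      ≡⟨ *-comm (32 * W * G) (2 ^ z) ⟩
      2 ^ z * (32 * W * G)    ∎)

    V≤Ω : V ≤ Ω
    V≤Ω = m≤n*m V (z * (z * z)) {{>-nonZero (*-mono-≤ 1≤z 1≤zz)}}

    G≤V : G ≤ V
    G≤V = m≤m+n G (W * G)

    N≤V : N ≤ V
    N≤V = ≤-trans N≤G G≤V

    N≤Ω : N ≤ Ω
    N≤Ω = ≤-trans N≤V V≤Ω

    1≤Ω : 1 ≤ Ω
    1≤Ω = ≤-trans (≤-trans 1≤H H≤N) N≤Ω

    z≤Ω : z ≤ Ω
    z≤Ω = ≤-trans (≤-trans (m≤m*n z (z * z) {{>-nonZero 1≤zz}}) (m≤m*n (z * (z * z)) N)) (*-monoʳ-≤ (z * (z * z)) N≤V)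

    zN≤Ω : z * N ≤ Ω
    zN≤Ω = *-mono-≤ (m≤m*n z (z * z) {{>-nonZero 1≤zz}}) N≤V

    zzN≤Ω : z * z * N ≤ Ω
    zzN≤Ω = *-mono-≤ (m≤n*m (z * z) z {{>-nonZero 1≤z}}) N≤V

    z³N≤Ω : z * (z * z) * N ≤ Ω
    z³N≤Ω = *-monoʳ-≤ (z * (z * z)) N≤V

    WG≤V : W * G ≤ V
    WG≤V = m≤n+m (W * G) G

    zWG≤Ω : z * (W * G) ≤ Ω
    zWG≤Ω = *-mono-≤ (m≤m*n z (z * z) {{>-nonZero 1≤zz}}) WG≤V

    potential≤ : potentialSum N ≤ 2596 * Ω
    potential≤ = begin
      Σ< Jmax (λ i → Potential (suc i) N)
        ≤⟨ Σ<-mono Jmax each ⟩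
      Σ< Jmax (λ i → 882 * (z * z) * quot (2 * N) (suc i) + 26 * quot (32 * W * G) (suc i))
        ≡⟨ trans (Σ<-+ Jmax (λ i → 882 * (z * z) * quot (2 * N) (suc i)) (λ i → 26 * quot (32 * W * G) (suc i)))
             (cong₂ _+_ (sym (Σ<-* (882 * (z * z)) Jmax (λ i → quot (2 * N) (suc i)))) (sym (Σ<-* 26 Jmax (λ i → quot (32 * W * G) (suc i))))) ⟩
      882 * (z * z) * Σ< Jmax (λ i → quot (2 * N) (suc i)) + 26 * Σ< Jmax (λ i → quot (32 * W * G) (suc i))
        ≤⟨ +-mono-≤ (*-monoʳ-≤ (882 * (z * z)) (harmonic-z (2 * N) J≤N)) (*-monoʳ-≤ 26 (harmonic-z (32 * W * G) J≤N)) ⟩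
      882 * (z * z) * (z * (2 * N)) + 26 * (z * (32 * W * G))
        ≡⟨ lem z N W G ⟩
      1764 * (z * (z * z) * N) + 832 * (z * (W * G))
        ≤⟨ +-mono-≤ (*-monoʳ-≤ 1764 z³N≤Ω) (*-monoʳ-≤ 832 zWG≤Ω) ⟩
      1764 * Ω + 832 * Ω
        ≡⟨ *-distribʳ-+ Ω 1764 832 ⟨
      2596 * Ω ∎
      where
      lem : ∀ z n w g → 882 * (z * z) * (z * (2 * n)) + 26 * (z * (32 * w * g)) ≡ 1764 * (z * (z * z) * n) + 832 * (z * (w * g))
      lem = solve-∀
      each : ∀ i → i < Jmax → Potential (suc i) N ≤ 882 * (z * z) * quot (2 * N) (suc i) + 26 * quot (32 * W * G) (suc i)
      each i i<J = +-mono-≤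
        (≤-trans (*-monoˡ-≤ (quota (suc i) N) fixedCost≤) (≤-trans (≤-reflexive (*-assoc (882 * (z * z)) ℓ (quota (suc i) N)))
          (*-monoʳ-≤ (882 * (z * z)) (*-≤-quot (s≤s z≤n) (Top*j≤2N i i<J)))))
        (*-monoʳ-≤ 26 (*-≤-quot {x = U (Top (suc i) N)} (s≤s z≤n) (U*j≤ (Top (suc i) N) (suc i) (≤-trans 1≤H (H≤Top {suc i} (s≤s z≤n) N))
          (≤-trans (m≤m*n (Top (suc i) N) (suc i)) (Top*j≤2N i i<J)) (Top*j≤2N i i<J))))

    mainCost≤ : mainCost ≤ 2708 * Ω
    mainCost≤ = begin
      nn * (29 + Jmax * 39) + potentialSum N + 5
        ≡⟨ cong (λ x → x + potentialSum N + 5) (lem₁ nn Jmax) ⟩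
      29 * nn + 39 * (nn * Jmax) + potentialSum N + 5
        ≤⟨ +-mono-≤ (+-mono-≤ (+-mono-≤ (*-monoʳ-≤ 29 (≤-trans (m≤n*m nn ℓ) N≤Ω)) (*-monoʳ-≤ 39 (≤-trans nnJ≤2N (*-monoʳ-≤ 2 N≤Ω)))) potential≤) (*-monoʳ-≤ 5 1≤Ω) ⟩
      29 * Ω + 39 * (2 * Ω) + 2596 * Ω + 5 * Ω
        ≡⟨ lem₂ Ω ⟩
      2708 * Ω ∎
      where
      lem₁ : ∀ n j → n * (29 + j * 39) ≡ 29 * n + 39 * (n * j)
      lem₁ = solve-∀
      lem₂ : ∀ x → 29 * x + 39 * (2 * x) + 2596 * x + 5 * x ≡ 2708 * x
      lem₂ = solve-∀

    timeImprovedCost≤ : B₀.timeImprovedCost ≤ 1531 * Ω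
    timeImprovedCost≤ = begin
      33 + 11 * lg³ H + 11 * H + Σ< (H ∸ 1) (λ i → 7 + B₀.bodyCost (2 + i))
        ≤⟨ +-mono-≤ (+-mono-≤ (+-mono-≤ (*-monoʳ-≤ 33 1≤Ω) (*-monoʳ-≤ 11 (≤-trans (≤-pred lgH≤lgN) (≤-trans lg≤3z (*-monoʳ-≤ 3 z≤Ω))))) (*-monoʳ-≤ 11 H≤Ω)) body≤ ⟩
      33 * Ω + 11 * (3 * Ω) + 11 * Ω + (54 * Ω + 540 * Ω + 26 * (32 * Ω) + 28 * Ω)
        ≡⟨ lem Ω ⟩
      1531 * Ω ∎
      where
      lem : ∀ x → 33 * x + 11 * (3 * x) + 11 * x + (54 * x + 540 * x + 26 * (32 * x) + 28 * x) ≡ 1531 * x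
      lem = solve-∀
      H≤Ω : H ≤ Ω
      H≤Ω = ≤-trans H≤N N≤Ω
      H′ : ℕ
      H′ = H ∸ 1
      suc-H′ : suc H′ ≡ H
      suc-H′ = m+[n∸m]≡n 1≤H
      κs : Σ< H′ (λ i → κ (2 + i)) ≤ 32 * Ω
      κs = begin
        Σ< H′ (λ i → κ (2 + i))              ≤⟨ m≤n+m _ (Σ< 2 κ) ⟩
        Σ< 2 κ + Σ< H′ (λ i → κ (2 + i))     ≡⟨ Σ<-append 2 H′ κ ⟨
        Σ< (2 + H′) κ                        ≡⟨ cong (λ x → Σ< (suc x) κ) suc-H′ ⟩
        U H                                  ≡⟨ *-identityʳ (U H) ⟨
        U H * 1                              ≤⟨ U*j≤ H 1 1≤H (≤-trans H≤N (m≤m+n N (1 * N))) (≤-trans (≤-reflexive (*-identityʳ H)) (≤-trans H≤N (m≤m+n N (1 * N)))) ⟩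
        32 * W * G                           ≡⟨ *-assoc 32 W G ⟩
        32 * (W * G)                         ≤⟨ *-monoʳ-≤ 32 (≤-trans WG≤V V≤Ω) ⟩
        32 * Ω                               ∎
      quots : Σ< H′ (λ i → quot H (2 + i)) ≤ Ω
      quots = begin
        Σ< H′ (λ i → quot H (2 + i))         ≤⟨ m≤n+m _ (quot H 1) ⟩
        quot H 1 + Σ< H′ (λ i → quot H (2 + i)) ≡⟨ Σ<-head H′ (λ i → quot H (suc i)) ⟨
        Σ< (suc H′) (λ i → quot H (suc i))   ≡⟨ cong (λ x → Σ< x (λ i → quot H (suc i))) suc-H′ ⟩
        Σ< H (λ i → quot H (suc i))          ≤⟨ harmonic-z H H≤N ⟩
        z * H                                ≤⟨ ≤-trans (*-monoʳ-≤ z H≤N) zN≤Ω ⟩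
        Ω                                    ∎
      C : ℕ
      C = kMaxCost (suc (lg³ H))
      body≤ : Σ< H′ (λ i → 7 + (47 + C + 26 * κ (2 + i) + 28 * quot H (2 + i))) ≤ 54 * Ω + 540 * Ω + 26 * (32 * Ω) + 28 * Ω
      body≤ = begin
        Σ< H′ (λ i → 7 + (47 + C + 26 * κ (2 + i) + 28 * quot H (2 + i)))
          ≡⟨ trans (Σ<-+ H′ (λ i → 54 + C + 26 * κ (2 + i)) (λ i → 28 * quot H (2 + i)))
               (cong₂ _+_ (trans (Σ<-+ H′ (λ _ → 54 + C) (λ i → 26 * κ (2 + i))) (cong₂ _+_ (Σ<-const H′ (54 + C)) (sym (Σ<-* 26 H′ (λ i → κ (2 + i))))))
                 (sym (Σ<-* 28 H′ (λ i → quot H (2 + i))))) ⟩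
        H′ * (54 + C) + 26 * Σ< H′ (λ i → κ (2 + i)) + 28 * Σ< H′ (λ i → quot H (2 + i))
          ≤⟨ +-mono-≤ (+-mono-≤ H′*≤ (*-monoʳ-≤ 26 κs)) (*-monoʳ-≤ 28 quots) ⟩
        54 * Ω + 540 * Ω + 26 * (32 * Ω) + 28 * Ω ∎
        where
        lem′ : ∀ n y → n * (54 + 540 * y) ≡ 54 * n + 540 * (y * n)
        lem′ = solve-∀
        H′*≤ : H′ * (54 + C) ≤ 54 * Ω + 540 * Ω
        H′*≤ = begin
          H′ * (54 + C)                ≤⟨ *-mono-≤ (≤-trans (m∸n≤m H 1) H≤N) (+-monoʳ-≤ 54 (kMaxCost≤ (≤-trans lgH≤lgN Bd≤w))) ⟩
          N * (54 + 540 * (z * z))     ≡⟨ lem′ N (z * z) ⟩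
          54 * N + 540 * (z * z * N)   ≤⟨ +-mono-≤ (*-monoʳ-≤ 54 N≤Ω) (*-monoʳ-≤ 540 zzN≤Ω) ⟩
          54 * Ω + 540 * Ω             ∎

    totalCost≤ : totalCost ≤ 4319 * Ω
    totalCost≤ = begin
      46 + B₀.timeImprovedCost + Jmax * 17 + 17 * L + mainCost
        ≤⟨ +-mono-≤ (+-mono-≤ (+-mono-≤ (+-mono-≤ (*-monoʳ-≤ 46 1≤Ω) timeImprovedCost≤) (*-monoˡ-≤ 17 (≤-trans J≤N N≤Ω))) (*-monoʳ-≤ 17 (≤-trans L≤H (≤-trans H≤N N≤Ω)))) mainCost≤ ⟩
      46 * Ω + 1531 * Ω + Ω * 17 + 17 * Ω + 2708 * Ω
        ≡⟨ lem Ω ⟩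
      4319 * Ω ∎
      where
      lem : ∀ x → 46 * x + 1531 * x + x * 17 + 17 * x + 2708 * x ≡ 4319 * x
      lem = solve-∀

-- Real exponents

-- Transitivity for fractions: c / d ≤ a / b ≤ p / q.
swap-sides : ∀ {p q} a b c d → 1 ≤ b → q * a ≤ p * b → c * b ≤ d * a → c * q ≤ d * p
swap-sides {p} {q} a b c d 1≤b qa≤pb cb≤da = *-cancelˡ-≤ b {{>-nonZero 1≤b}} (begin
  b * (c * q)   ≡⟨ lem₁ b c q ⟩
  c * b * q     ≤⟨ *-monoˡ-≤ q cb≤da ⟩
  d * a * q     ≡⟨ lem₂ d a q ⟩
  d * (q * a)   ≤⟨ *-monoʳ-≤ d qa≤pb ⟩
  d * (p * b)   ≡⟨ lem₃ d p b ⟩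
  b * (d * p)   ∎)
  where
  lem₁ : ∀ b c q → b * (c * q) ≡ c * b * q
  lem₁ = solve-∀
  lem₂ : ∀ d a q → d * a * q ≡ d * (q * a)
  lem₂ = solve-∀
  lem₃ : ∀ d p b → d * (p * b) ≡ b * (d * p)
  lem₃ = solve-∀

-- If s x ≤ c k + s r then 2^x is O(2^(θ k)) for θ ≥ c / s.

exponent-bound : ∀ s c r {x k p q} → 1 ≤ s → s * x ≤ c * k + s * r → c * q ≤ s * p → x * q ≤ k * p + r * q
exponent-bound s c r {x} {k} {p} {q} 1≤s sx≤ cq≤sp = *-cancelˡ-≤ s {{>-nonZero 1≤s}} (begin
  s * (x * q)                ≡⟨ *-assoc s x q ⟨
  s * x * q                  ≤⟨ *-monoˡ-≤ q sx≤ ⟩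
  (c * k + s * r) * q        ≡⟨ lem₁ s c r k q ⟩
  k * (c * q) + s * (r * q)  ≤⟨ +-monoˡ-≤ (s * (r * q)) (*-monoʳ-≤ k cq≤sp) ⟩
  k * (s * p) + s * (r * q)  ≡⟨ lem₂ s k p (r * q) ⟩
  s * (k * p + r * q)        ∎)
  where
  lem₁ : ∀ s c r k q → (c * k + s * r) * q ≡ k * (c * q) + s * (r * q)
  lem₁ = solve-∀
  lem₂ : ∀ s k p y → k * (s * p) + s * y ≡ s * (k * p + y)
  lem₂ = solve-∀

-- The additive term r of the exponent moves into the constant as 2^r.
power-bound : ∀ c r {x k p q N t} → x * q ≤ k * p + r * q → 2 ^ k ≤ N → t ≤ c * 2 ^ x → t ^ q ≤ (c * 2 ^ r) ^ q * N ^ p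
power-bound c r {x} {k} {p} {q} {N} {t} xq≤ 2^k≤N t≤ = begin
  t ^ q                                  ≤⟨ ^-monoˡ-≤ q t≤ ⟩
  (c * 2 ^ x) ^ q                        ≡⟨ ^-distribʳ-* q c (2 ^ x) ⟩
  c ^ q * (2 ^ x) ^ q                    ≡⟨ cong (c ^ q *_) (^-*-assoc 2 x q) ⟩
  c ^ q * 2 ^ (x * q)                    ≤⟨ *-monoʳ-≤ (c ^ q) (^-monoʳ-≤ 2 xq≤) ⟩
  c ^ q * 2 ^ (k * p + r * q)            ≡⟨ cong (c ^ q *_) (^-distribˡ-+-* 2 (k * p) (r * q)) ⟩
  c ^ q * (2 ^ (k * p) * 2 ^ (r * q))    ≡⟨ cong₂ (λ a b → c ^ q * (a * b)) (^-*-assoc 2 k p) (^-*-assoc 2 r q) ⟨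
  c ^ q * ((2 ^ k) ^ p * (2 ^ r) ^ q)    ≤⟨ *-monoʳ-≤ (c ^ q) (*-monoˡ-≤ ((2 ^ r) ^ q) (^-monoˡ-≤ p 2^k≤N)) ⟩
  c ^ q * (N ^ p * (2 ^ r) ^ q)          ≡⟨ lem (c ^ q) (N ^ p) ((2 ^ r) ^ q) ⟩
  c ^ q * (2 ^ r) ^ q * N ^ p            ≡⟨ cong (_* N ^ p) (^-distribʳ-* q c (2 ^ r)) ⟨
  (c * 2 ^ r) ^ q * N ^ p                ∎
  where
  lem : ∀ a b c → a * (b * c) ≡ a * c * b
  lem = solve-∀

-- The condition on the exponent amounts to 3^q ≤ 2^(2p), so (3^k)^q ≤ (2^k)^(2p) ≤ N^(2p). Square
-- roots are then taken by comparing squares, and the factor √2 in `root3` is rounded up to 2.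
root3-power : ∀ {N} k p q → 2 ^ k ≤ N → q ≤ 2 * p → 3 ^ q ≤ 2 ^ (2 * p ∸ q + q) → root3 k ^ q ≤ 2 ^ q * N ^ p
root3-power {N} k p q 2^k≤N q≤2p 3^q≤ = square-cancel-≤ (begin
  root3 k ^ q * root3 k ^ q      ≡⟨ ^-distribʳ-* q (root3 k) (root3 k) ⟨
  (root3 k * root3 k) ^ q        ≤⟨ ^-monoˡ-≤ q (root3-≤ k) ⟩
  (2 * 3 ^ k) ^ q                ≡⟨ ^-distribʳ-* q 2 (3 ^ k) ⟩
  2 ^ q * (3 ^ k) ^ q            ≡⟨ cong (2 ^ q *_) (trans (^-*-assoc 3 k q) (trans (cong (3 ^_) (*-comm k q)) (sym (^-*-assoc 3 q k)))) ⟩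
  2 ^ q * (3 ^ q) ^ k            ≤⟨ *-monoʳ-≤ (2 ^ q) (^-monoˡ-≤ k 3^q≤) ⟩
  2 ^ q * (2 ^ (2 * p ∸ q + q)) ^ k ≡⟨ cong (λ x → 2 ^ q * (2 ^ x) ^ k) (m∸n+n≡m q≤2p) ⟩
  2 ^ q * (2 ^ (2 * p)) ^ k      ≡⟨ cong (2 ^ q *_) (trans (^-*-assoc 2 (2 * p) k) (trans (cong (2 ^_) (lem p k)) (sym (^-*-assoc 2 k (p + p))))) ⟩
  2 ^ q * (2 ^ k) ^ (p + p)      ≤⟨ *-mono-≤ (m≤m*n (2 ^ q) (2 ^ q) {{m^n≢0 2 q}}) (^-monoˡ-≤ (p + p) 2^k≤N) ⟩
  2 ^ q * 2 ^ q * N ^ (p + p)    ≡⟨ cong (2 ^ q * 2 ^ q *_) (^-distribˡ-+-* N p p) ⟩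
  2 ^ q * 2 ^ q * (N ^ p * N ^ p) ≡⟨ lem′ (2 ^ q) (N ^ p) ⟩
  2 ^ q * N ^ p * (2 ^ q * N ^ p) ∎)
  where
  lem : ∀ p k → 2 * p * k ≡ k * (p + p)
  lem = solve-∀
  lem′ : ∀ a b → a * a * (b * b) ≡ a * b * (a * b)
  lem′ = solve-∀

n<b*2^[n/b] : ∀ n b .{{_ : NonZero b}} → n < b * 2 ^ (n / b)
n<b*2^[n/b] n b = begin-strict
  n                   <⟨ m<[1+m/n]*n n b ⟩
  suc (n / b) * b     ≤⟨ *-monoˡ-≤ b (n<2^n (n / b)) ⟩
  2 ^ (n / b) * b     ≡⟨ *-comm (2 ^ (n / b)) b ⟩
  b * 2 ^ (n / b)     ∎

≤[]-mono : ∀ {x C C′ N θ} → C ≤ C′ → x ≤[ C · N ↑ θ ] → x ≤[ C′ · N ↑ θ ]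
≤[]-mono {N = N} C≤ bound p q 1≤q θpq = ≤-trans (bound p q 1≤q θpq) (*-monoˡ-≤ (N ^ p) (^-monoˡ-≤ q C≤))

results-correct : ∀ N → ComputesComplexities N (results N)
results-correct N = (N , ≤-refl , first N) , second N
  where
  first : ∀ n → List.map proj₁ (results n) ≡ List.map suc (upTo n)
  first zero    = refl
  first (suc n) = trans (map-++ proj₁ (results n) _) (trans (cong (_∷ʳ suc n) (first n))
    (trans (sym (map-++ suc (upTo n) _)) (cong (List.map suc) (upTo-∷ʳ n))))
  second : ∀ n → All (uncurry ‖_‖≡_) (results n)
  second zero    = []
  second (suc n) = ∷ʳ⁺ (second n) (comp-correct (s≤s z≤n))

-- The running time is O(z³ 2^g) with z = k + 4 and g close to 11 z / 9; the factor z³ is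
-- absorbed since z < b 2^(z/b) for b = 400.

opaque
  timeConstant : ℕ → ℕ
  timeConstant b = 4319 * (b * (b * b) * (suc totalWeight * K₀))

  time-constant-bound : ∀ b .{{_ : NonZero b}} z g t → t ≤ 4319 * (z * (z * z) * (suc totalWeight * (K₀ * 2 ^ g))) →
    t ≤ timeConstant b * 2 ^ (g + 3 * (z / b))
  time-constant-bound b z g t t≤ = begin
    t ≤⟨ t≤ ⟩
    4319 * (z * (z * z) * (W * (K₀ * 2 ^ g)))
      ≤⟨ *-monoʳ-≤ 4319 (*-monoˡ-≤ (W * (K₀ * 2 ^ g)) (*-mono-≤ z≤ (*-mono-≤ z≤ z≤))) ⟩
    4319 * (b * B * (b * B * (b * B)) * (W * (K₀ * 2 ^ g)))
      ≡⟨ lem 4319 b B W K₀ (2 ^ g) ⟩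
    timeConstant b * (2 ^ g * (B * (B * (B * 1))))
      ≡⟨ cong (λ x → timeConstant b * (2 ^ g * x)) (trans (^-*-assoc 2 (z / b) 3) (cong (2 ^_) (*-comm (z / b) 3))) ⟩
    timeConstant b * (2 ^ g * 2 ^ (3 * (z / b)))
      ≡⟨ cong (timeConstant b *_) (^-distribˡ-+-* 2 g (3 * (z / b))) ⟨
    timeConstant b * 2 ^ (g + 3 * (z / b)) ∎
    where
    B W : ℕ
    B = 2 ^ (z / b)
    W = suc totalWeight
    z≤ : z ≤ b * B
    z≤ = <⇒≤ (n<b*2^[n/b] z b)
    lem : ∀ c b B W K y → c * (b * B * (b * B * (b * B)) * (W * (K * y))) ≡ c * (b * (b * b) * (W * K)) * (y * (B * (B * (B * 1))))
    lem = solve-∀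

time-exponent : ∀ k g → g * 9 ≤ 11 * (k + 4) + 9 → 3600 * (g + 3 * ((k + 4) / 400)) ≤ 4427 * k + 3600 * 6
time-exponent k g 9g≤ = begin
  3600 * (g + 3 * m)                     ≡⟨ lem₁ g m ⟩
  400 * (g * 9) + 27 * (m * 400)         ≤⟨ +-mono-≤ (*-monoʳ-≤ 400 9g≤) (*-monoʳ-≤ 27 (m/n*n≤m (k + 4) 400)) ⟩
  -- The constant terms add up to 21308, and 292 fills them up to 21600 = 3600 · 6.
  400 * (11 * (k + 4) + 9) + 27 * (k + 4) ≤⟨ m≤m+n _ 292 ⟩
  400 * (11 * (k + 4) + 9) + 27 * (k + 4) + 292 ≡⟨ lem₂ k ⟩
  4427 * k + 3600 * 6                    ∎
  where
  m : ℕ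
  m = (k + 4) / 400
  lem₁ : ∀ g m → 3600 * (g + 3 * m) ≡ 400 * (g * 9) + 27 * (m * 400)
  lem₁ = solve-∀
  lem₂ : ∀ k → 400 * (11 * (k + 4) + 9) + 27 * (k + 4) + 292 ≡ 4427 * k + 3600 * 6
  lem₂ = solve-∀

-- 4427/3600 = 11/9 + 3/400. The three factors z cost 3/b in the exponent, which must not exceed
-- 1.230175 - 11/9, about 0.00795; b = 400 is a round number that achieves this.
α-exponent : ∀ k g p q → α p q → g * 9 ≤ 11 * (k + 4) + 9 → (g + 3 * ((k + 4) / 400)) * q ≤ k * p + 6 * q
α-exponent k g p q α≤ 9g≤ = exponent-bound 3600 4427 6 {g + 3 * ((k + 4) / 400)} {k} {p} {q} (s≤s z≤n) (time-exponent k g 9g≤)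
  (swap-sides {p} {q} 1230175 1000000 4427 3600 (s≤s z≤n) α≤ (from-yes (4427 * 1000000 ≤? 3600 * 1230175)))

-- The asymptotic bounds

module Conclusion {N₀ k : ℕ} (20≤k : 20 ≤ k) (2^k≤N₀ : 2 ^ k ≤ N₀) (k≡ : ⌊log₂ N₀ ⌋ ≡ k) (choice : Parameters N₀ k) (S≡ : Parameters.S choice ≡ root3 k) where

  open Choice choice public
  open Bounds 20≤k choice
  open SpaceImproved w e N H ℓ hh nn 1≤ℓ refl refl L≤H H≤N N≤ℓ² κ<ℓ fits bound< 2bound< using (totalCost; spaceImproved-run; emptyMemory; Jmax)
  open Execution w e using (Runs; runs; m)

  -- 11z/9 is rounded up to an integer, so that G is an integer multiple of K₀ without any ninth
  -- root; the rounding costs a constant factor.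
  g G : ℕ
  g = cdiv (11 * z) 9
  G = K₀ * 2 ^ g

  11z≤9g : 11 * z ≤ g * 9
  11z≤9g = cdiv-* (11 * z) {9} (s≤s z≤n)

  G-large : K₀ ^ 9 * (2 ^ z) ^ 11 ≤ G ^ 9
  G-large = begin
    K₀ ^ 9 * (2 ^ z) ^ 11  ≡⟨ cong (K₀ ^ 9 *_) (trans (^-*-assoc 2 z 11) (cong (2 ^_) (*-comm z 11))) ⟩
    K₀ ^ 9 * 2 ^ (11 * z)  ≤⟨ *-monoʳ-≤ (K₀ ^ 9) (^-monoʳ-≤ 2 11z≤9g) ⟩
    K₀ ^ 9 * 2 ^ (g * 9)   ≡⟨ cong (K₀ ^ 9 *_) (^-*-assoc 2 g 9) ⟨
    K₀ ^ 9 * (2 ^ g) ^ 9   ≡⟨ ^-distribʳ-* 9 K₀ (2 ^ g) ⟨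
    G ^ 9                  ∎

  N≤G : N ≤ G
  N≤G = ≤-trans (<⇒≤ N<2^z) (≤-trans (^-monoʳ-≤ 2 z≤g) (m≤n*m (2 ^ g) K₀ {{>-nonZero 1≤K₀}}))
    where
    z≤g : z ≤ g
    z≤g = *-cancelʳ-≤ z g 9 (≤-trans (≤-trans (≤-reflexive (*-comm z 9)) (*-monoˡ-≤ z (from-yes (9 ≤? 11)))) 11z≤9g)

  time-bound : totalCost ≤[ timeConstant 400 * 2 ^ 6 · N₀ ↑ α ]
  time-bound p q 1≤q α≤ = power-bound (timeConstant 400) 6 {g + 3 * (z / 400)} {k} {p} {q} {N₀} {totalCost}
    (α-exponent k g p q α≤ (cdiv-*-≤ (11 * z) 9))
    2^k≤N₀ (time-constant-bound 400 z g totalCost (Time.totalCost≤ G G-large N≤G))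

  -- 880 = 2 · 440, where the factor 2 stems from `root3-power`.
  storage-bound : ∀ a → a ≤ H * e + Jmax * w + e * (Jmax * L) → (25 * w + a) ≤[ 880 * ⌊log₂ ⌊log₂ N₀ ⌋ ⌋ · N₀ ↑ [1+ β ]/2 ]
  storage-bound a a≤ p q 1≤q (q≤2p , 3^q≤) = begin
    (25 * w + a) ^ q                     ≤⟨ ^-monoˡ-≤ q (≤-trans (+-monoʳ-≤ (25 * w) a≤) storage≤) ⟩
    (440 * λλ * S) ^ q                   ≡⟨ cong (λ s → (440 * λλ * s) ^ q) S≡ ⟩
    (440 * λλ * root3 k) ^ q             ≡⟨ ^-distribʳ-* q (440 * λλ) (root3 k) ⟩
    (440 * λλ) ^ q * root3 k ^ q         ≤⟨ *-monoʳ-≤ ((440 * λλ) ^ q) (root3-power k p q 2^k≤N₀ q≤2p 3^q≤) ⟩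
    (440 * λλ) ^ q * (2 ^ q * N₀ ^ p)    ≡⟨ *-assoc ((440 * λλ) ^ q) (2 ^ q) (N₀ ^ p) ⟨
    (440 * λλ) ^ q * 2 ^ q * N₀ ^ p      ≡⟨ cong (_* N₀ ^ p) (trans (sym (^-distribʳ-* q (440 * λλ) 2)) (cong (_^ q) (trans (lem λλ) (cong (λ x → 880 * ⌊log₂ x ⌋) (sym k≡))))) ⟩
    (880 * ⌊log₂ ⌊log₂ N₀ ⌋ ⌋) ^ q * N₀ ^ p ∎
    where
    lem : ∀ l → 440 * l * 2 ≡ 880 * l
    lem = solve-∀

  C : ℕ
  C = timeConstant 400 * 2 ^ 6 + 880

  Claim : Set
  Claim = ∃[ N′ ] ∃[ H ] ∃[ ℓ ] N₀ ≤ N′ × N′ < N₀ + ℓ × Admissible N′ H ℓ ×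
    ∃[ m ] ∃[ σ ] ∃[ t ]
    m ⊢⟨ spaceImproved N′ H ℓ , initial ⟩⇓⟨ σ , t ⟩ ×
    ComputesComplexities N′ (emitted σ) ×
    t ≤[ C · N₀ ↑ α ] ×
    storage m σ ≤[ C * ⌊log₂ ⌊log₂ N₀ ⌋ ⌋ · N₀ ↑ [1+ β ]/2 ]

  conclude : Runs (spaceImproved N H ℓ) (λ _ → 0) emptyMemory totalCost (λ _ s → Memory.out s ≡ results N × Memory.alloc s ≤ H * e + Jmax * w + e * (Jmax * L)) → Claim
  conclude (runs {env} {mem} {t} run t≤ (out≡ , alloc≤)) = N , H , ℓ , N₀≤N , N<N₀+ℓ , admissible , m , st env mem , t , run ,
    subst (ComputesComplexities N) (sym out≡) (results-correct N) ,
    (λ p q 1≤q α≤ → ≤-trans (^-monoˡ-≤ q t≤)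
      (≤[]-mono {totalCost} {timeConstant 400 * 2 ^ 6} {C} {N₀} {α} (m≤m+n (timeConstant 400 * 2 ^ 6) 880) time-bound p q 1≤q α≤)) ,
    ≤[]-mono {25 * w + Memory.alloc mem} {880 * ⌊log₂ ⌊log₂ N₀ ⌋ ⌋} {C * ⌊log₂ ⌊log₂ N₀ ⌋ ⌋} {N₀} {[1+ β ]/2}
      (*-monoˡ-≤ ⌊log₂ ⌊log₂ N₀ ⌋ ⌋ (m≤n+m 880 (timeConstant 400 * 2 ^ 6))) (storage-bound (Memory.alloc mem) alloc≤)

  conclusion : Claim
  conclusion = conclude (spaceImproved-run e≤w hh≤nn)

proposition14 : ∃[ C ] ∃[ N₀ ] ∀ N → N₀ ≤ N →
    ∃[ N′ ] ∃[ H ] ∃[ ℓ ] N ≤ N′ × N′ < N + ℓ × Admissible N′ H ℓ ×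
    ∃[ m ] ∃[ σ ] ∃[ t ]
    m ⊢⟨ spaceImproved N′ H ℓ , initial ⟩⇓⟨ σ , t ⟩ ×
    ComputesComplexities N′ (emitted σ) ×
    t ≤[ C · N ↑ α ] ×
    storage m σ ≤[ C * ⌊log₂ ⌊log₂ N ⌋ ⌋ · N ↑ [1+ β ]/2 ]
proposition14 = timeConstant 400 * 2 ^ 6 + 880 , 2 ^ 20 , λ N 2^20≤N →
  let k , lo , hi = floor-log N (≤-trans (m^n>0 2 20) 2^20≤N)
      20≤k        = ≮⇒≥ λ k<20 → <⇒≱ hi (≤-trans (^-monoʳ-≤ 2 k<20) 2^20≤N)
  in Conclusion.conclusion 20≤k lo (lg-unique k lo hi) (parameters 20≤k lo hi) refl
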